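{- Let $n\ge 1$, let $\lambda$ be a partition of $n$, and let $\lambda'$ be its conjugate. Write the coefficient of the Schur function $s_\lambda$ in $\tilde J_{(n)}^{(\alpha)}(X)$ as $$\langle \tilde{J}_{(n)}^{(\alpha)}(X), s_\lambda\rangle = \sum_{k=0}^{n-1} a_k((n),\lambda) \binom{\alpha + k}{n}.$$ Then $a_k((n),\lambda) = n!\,\mathrm{QYT}_{=k+1}(\lambda')$ for all $0\le k\le n-1$.
   Context: Jack polynomials: over $\mathbb{Q}(\alpha)$, with $\alpha$ an indeterminate, let $\langle p_\lambda,p_\nu\rangle_\alpha=\delta_{\lambda\nu}z_\lambda\alpha^{\ell(\lambda)}$, where $z_\lambda=\prod_i i^{m_i}m_i!$ and $m_i$ is the number of parts of $\lambda$ equal to $i$. The integral form Jack symmetric functions $J_\mu^{(\alpha)}(X)$ are the unique family, indexed by partitions $\mu$, of symmetric functions that are pairwise orthogonal for $\langle\cdot,\cdot\rangle_\alpha$, are triangular (only monomial symmetric functions $m_\lambda$ with $\lambda\le\mu$ in dominance order appear in $J_\mu^{(\alpha)}$), and are normalized so that the coefficient of $m_{1^n}$ in $J_\mu^{(\alpha)}$ is $n!$ where $n=|\mu|$. For $\mu$ a partition of $n$, define $\tilde J_\mu^{(\alpha)}(X)=\alpha^nJ_\mu^{(1/\alpha)}(X)$. The bracket $\langle\cdot,\cdot\rangle$ (without subscript) is the Hall scalar product, for which Schur functions are orthonormal (extended linearly over $\mathbb{Q}(\alpha)$). $\binom{\alpha+k}{n}=(\alpha+k)(\alpha+k-1)\cdots(\alpha+k-n+1)/n!$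 is a polynomial in $\alpha$; the coefficients of $\tilde J_\mu^{(\alpha)}$ in the Schur basis are polynomials in $\alpha$, and the polynomials $\binom{\alpha+k}{n}$, $0\le k\le n-1$, are linearly independent. Quasi-Yamanouchi tableaux: partition diagrams are drawn in French notation (rows left-justified, first row at the bottom). A semistandard Young tableau is a filling of the diagram by positive integers weakly increasing to the right along rows and strictly increasing upwards in columns. An entry $i$ is weakly left of an entry $j$ when $i$ is above, or above and to the left of, $j$. A semistandard Young tableau is quasi-Yamanouchi if, for every $i>1$ that appears in it, the leftmost instance of $i$ is weakly left of some entry equal to $i-1$. $\mathrm{QYT}_{=m}(\mu)$ denotes (the number of) quasi-Yamanouchi tableaux of shape $\mu$ with maximum entry exactly $m$. Equivalently, this is the number of standard Young tableaux of shape $\mu$ with exactly $m-1$ descents, where $i$ is a descent of $T$ if $i+1$ is weakly left of $i$ in $T$. -}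

module Defs where

open import Algebra.Bundles.Raw using (RawRing)
import Algebra.Definitions.RawSemiring as RawSemiringDefinitions
open import Data.Bool.Base using (if_then_else_; true; false)
open import Data.Empty using (⊥-elim)
open import Data.Fin.Base as Fin using (Fin; toℕ)
import Data.Fin.Properties as Fin
open import Data.Integer.Base as ℤ using (ℤ; _⊖_)
open import Data.List.Base as List
  using (List; []; _∷_; _++_; length; map; filter; foldr; take; applyUpTo;
         allFin; cartesianProductWith)
import Data.List.Properties as List
open import Data.List.Relation.Unary.All as All using (All; []; _∷_; all?)
import Data.List.Relation.Unary.All.Properties as All
open import Data.List.Relation.Unary.Any using (Any; here; there; any?)
open import Data.List.Relation.Unary.Linked using (Linked; []; [-]; _∷_)
import Data.List.Relation.Unary.Linked.Properties as Linked
open import Data.Nat.Base as ℕ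
  using (ℕ; zero; suc; _≤_; _<_; _≥_; _⊔_; z≤n; s≤s; NonZero; _!)
open import Data.Nat.ListAction using (sum; product)
import Data.Nat.Properties as ℕ
open import Algebra.Properties.CommutativeSemigroup ℕ.+-commutativeSemigroup using (interchange)
open import Data.Product.Base using (_×_; _,_; ∃)
open import Data.Rational.Base as ℚ using (ℚ; 0ℚ; 1ℚ)
import Data.Rational.Properties as ℚ
open import Data.Sum.Base using (inj₁; inj₂)
open import Data.Vec.Base as Vec using (Vec)
import Data.Vec.Properties as Vec
open import Function.Base using (_∘_)
open import Level using (0ℓ)
open import Relation.Binary.PropositionalEquality
  using (_≡_; _≢_; refl; sym; trans; cong; cong₂; subst; module ≡-Reasoning)
open import Relation.Nullary using (¬_; Dec; yes; no; does; ¬?; contradiction)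
open import Relation.Nullary.Decidable using (_×-dec_; _→-dec_)
open import Relation.Unary using (Pred; Decidable)

count : ∀ {A : Set} {P : Pred A 0ℓ} → Decidable P → List A → ℕ
count P? xs = length (filter P? xs)

-- Coefficient lists, constant term first; trailing zeros are allowed.
Poly : Set
Poly = List ℚ

coeffₚ : Poly → ℕ → ℚ
coeffₚ []      _       = 0ℚ
coeffₚ (a ∷ p) zero    = a
coeffₚ (a ∷ p) (suc i) = coeffₚ p i

infix  4 _≈ₚ_
infixl 6 _+ₚ_
infixl 7 _*ₚ_

_≈ₚ_ : Poly → Poly → Set
p ≈ₚ q = ∀ i → coeffₚ p i ≡ coeffₚ q i

_+ₚ_ : Poly → Poly → Poly
[]      +ₚ q       = q
(a ∷ p) +ₚ []      = a ∷ p
(a ∷ p) +ₚ (b ∷ q) = a ℚ.+ b ∷ p +ₚ q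

-ₚ_ : Poly → Poly
-ₚ_ = map (λ a → ℚ.- a)

_*ₚ_ : Poly → Poly → Poly
[]      *ₚ q = []
(a ∷ p) *ₚ q = map (a ℚ.*_) q +ₚ (0ℚ ∷ p *ₚ q)

NonZeroₚ : Poly → Set
NonZeroₚ = Any (_≢ 0ℚ)

nonZeroₚ? : Decidable NonZeroₚ
nonZeroₚ? = any? (λ a → ¬? (a ℚ.≟ 0ℚ))

coeff-+ : ∀ p q i → coeffₚ (p +ₚ q) i ≡ coeffₚ p i ℚ.+ coeffₚ q i
coeff-+ []      q       i       = sym (ℚ.+-identityˡ _)
coeff-+ (a ∷ p) []      i       = sym (ℚ.+-identityʳ _)
coeff-+ (a ∷ p) (b ∷ q) zero    = refl
coeff-+ (a ∷ p) (b ∷ q) (suc i) = coeff-+ p q i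

coeff-scale : ∀ a q i → coeffₚ (map (a ℚ.*_) q) i ≡ a ℚ.* coeffₚ q i
coeff-scale a []      i       = sym (ℚ.*-zeroʳ a)
coeff-scale a (b ∷ q) zero    = refl
coeff-scale a (b ∷ q) (suc i) = coeff-scale a q i

coeff-∷* : ∀ a p q i →
           coeffₚ ((a ∷ p) *ₚ q) i ≡ a ℚ.* coeffₚ q i ℚ.+ coeffₚ (0ℚ ∷ p *ₚ q) i
coeff-∷* a p q i = trans (coeff-+ (map (a ℚ.*_) q) (0ℚ ∷ p *ₚ q) i)
                         (cong (ℚ._+ coeffₚ (0ℚ ∷ p *ₚ q) i) (coeff-scale a q i))

ZeroBelow : ℕ → Poly → Set
ZeroBelow j q = ∀ {i} → i < j → coeffₚ q i ≡ 0ℚ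

*-zeroBelow : ∀ p q {j} → ZeroBelow j q → ZeroBelow j (p *ₚ q)
0∷*-zeroBelow : ∀ p q {j} → ZeroBelow j q → ∀ {i} → i ≤ j → coeffₚ (0ℚ ∷ p *ₚ q) i ≡ 0ℚ
*-zeroBelow []      q z i<j = refl
*-zeroBelow (a ∷ p) q z {i} i<j = trans (coeff-∷* a p q i)
  (trans (cong₂ ℚ._+_ (trans (cong (a ℚ.*_) (z i<j)) (ℚ.*-zeroʳ a))
                      (0∷*-zeroBelow p q z (ℕ.<⇒≤ i<j)))
         (ℚ.+-identityˡ 0ℚ))
0∷*-zeroBelow p q z {zero}  i≤j = refl
0∷*-zeroBelow p q z {suc i} i≤j = *-zeroBelow p q z i≤j

lowest : ∀ {q} → NonZeroₚ q → ∃ λ j → coeffₚ q j ≢ 0ℚ × ZeroBelow j q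
lowest (here b≢0) = 0 , b≢0 , λ ()
lowest {b ∷ q} (there q≢0) with b ℚ.≟ 0ℚ
... | no  b≢0 = 0 , b≢0 , λ ()
... | yes b≡0 with j , c≢0 , z ← lowest q≢0 =
  suc j , c≢0 , λ { {zero} _ → b≡0 ; {suc i} (s≤s i<j) → z i<j }

nonZero-at : ∀ p i → coeffₚ p i ≢ 0ℚ → NonZeroₚ p
nonZero-at []      i       c≢0 = ⊥-elim (c≢0 refl)
nonZero-at (a ∷ p) zero    c≢0 = here c≢0
nonZero-at (a ∷ p) (suc i) c≢0 = there (nonZero-at p i c≢0)

ℚ-noZeroDivisors : ∀ a b → a ≢ 0ℚ → b ≢ 0ℚ → a ℚ.* b ≢ 0ℚ
ℚ-noZeroDivisors a b a≢0 b≢0 ab≡0 = b≢0 (begin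
  b                        ≡⟨ ℚ.*-identityˡ b ⟨
  1ℚ ℚ.* b                 ≡⟨ cong (ℚ._* b) (ℚ.*-inverseˡ a) ⟨
  ((ℚ.1/ a) ℚ.* a) ℚ.* b   ≡⟨ ℚ.*-assoc (ℚ.1/ a) a b ⟩
  (ℚ.1/ a) ℚ.* (a ℚ.* b)   ≡⟨ cong ((ℚ.1/ a) ℚ.*_) ab≡0 ⟩
  (ℚ.1/ a) ℚ.* 0ℚ          ≡⟨ ℚ.*-zeroʳ (ℚ.1/ a) ⟩
  0ℚ                       ∎)
  where
    open ≡-Reasoning
    instance
      _ : ℚ.NonZero a
      _ = ℚ.≢-nonZero a≢0

*-nonZeroₚ : ∀ {p q} → NonZeroₚ p → NonZeroₚ q → NonZeroₚ (p *ₚ q)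
*-nonZeroₚ {p} {q} p≢0 q≢0 with j , c≢0 , z ← lowest q≢0 = go p p≢0
  where
  go : ∀ p → NonZeroₚ p → NonZeroₚ (p *ₚ q)
  go (a ∷ p) ap≢0 with a ℚ.≟ 0ℚ
  ... | no a≢0 = nonZero-at ((a ∷ p) *ₚ q) j λ e →
    ℚ-noZeroDivisors a (coeffₚ q j) a≢0 c≢0
      (trans (sym (trans (coeff-∷* a p q j)
                  (trans (cong (a ℚ.* coeffₚ q j ℚ.+_) (0∷*-zeroBelow p q z ℕ.≤-refl))
                         (ℚ.+-identityʳ _))))
             e)
  go (a ∷ p) (here a≢0) | yes a≡0 = contradiction a≡0 a≢0
  go (a ∷ p) (there p≢0) | yes a≡0 with i , d≢0 , _ ← lowest (go p p≢0) =
    nonZero-at ((a ∷ p) *ₚ q) (suc i) λ e → d≢0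
      (trans (sym (trans (coeff-∷* a p q (suc i))
                  (trans (cong (ℚ._+ coeffₚ (p *ₚ q) i)
                               (trans (cong (ℚ._* coeffₚ q (suc i)) a≡0) (ℚ.*-zeroˡ (coeffₚ q (suc i)))))
                         (ℚ.+-identityˡ _))))
             e)

-- Fractions need not be in lowest terms.
record ℚ⟨α⟩ : Set where
  constructor frac
  field
    num   : Poly
    den   : Poly
    den≢0 : NonZeroₚ den

open ℚ⟨α⟩ public

1≢0 : NonZeroₚ (1ℚ ∷ [])
1≢0 = here λ ()

const : ℚ → ℚ⟨α⟩
const c = frac (c ∷ []) (1ℚ ∷ []) 1≢0

α : ℚ⟨α⟩
α = frac (0ℚ ∷ 1ℚ ∷ []) (1ℚ ∷ []) 1≢0

ℚ⟨α⟩-rawRing : RawRing 0ℓ 0ℓ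
ℚ⟨α⟩-rawRing = record
  { Carrier = ℚ⟨α⟩
  ; _≈_ = λ f g → num f *ₚ den g ≈ₚ num g *ₚ den f
  ; _+_ = λ f g → frac (num f *ₚ den g +ₚ num g *ₚ den f) (den f *ₚ den g)
                         (*-nonZeroₚ (den≢0 f) (den≢0 g))
  ; _*_ = λ f g → frac (num f *ₚ num g) (den f *ₚ den g) (*-nonZeroₚ (den≢0 f) (den≢0 g))
  ; -_  = λ f → frac (-ₚ num f) (den f) (den≢0 f)
  ; 0#  = const 0ℚ
  ; 1#  = const 1ℚ
  }

open RawRing ℚ⟨α⟩-rawRing public
  using (_≈_; _+_; _*_; -_; 0#; 1#)
open RawSemiringDefinitions (RawRing.rawSemiring ℚ⟨α⟩-rawRing) public
  using (_^_) renaming (sum to ∑; product to ∏)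

-- Total, with 0⁻¹ = 0.
infix 9 _⁻¹
_⁻¹ : ℚ⟨α⟩ → ℚ⟨α⟩
f ⁻¹ with nonZeroₚ? (num f)
... | yes num≢0 = frac (den f) (num f) num≢0
... | no  _     = 0#

fromℤ : ℤ → ℚ⟨α⟩
fromℤ i = const (i ℚ./ 1)

fromℕ : ℕ → ℚ⟨α⟩
fromℕ k = fromℤ (ℤ.+ k)

evalₚ : Poly → ℚ⟨α⟩ → ℚ⟨α⟩
evalₚ []      β = 0#
evalₚ (a ∷ p) β = const a + β * evalₚ p β

-- The automorphism α ↦ 1/α. A nonzero denominator stays nonzero at 1/α, so the
-- outer ⁻¹ is a genuine inverse.
infix 9 _[1/α]
_[1/α] : ℚ⟨α⟩ → ℚ⟨α⟩
f [1/α] = evalₚ (num f) (α ⁻¹) * evalₚ (den f) (α ⁻¹) ⁻¹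

-- (α + k)(α + k − 1) ⋯ (α + k − n + 1) / n!
binomial : ℕ → ℕ → ℚ⟨α⟩
binomial k n = ∏ {n} (λ i → α + fromℤ (k ⊖ toℕ i)) * fromℕ (n !) ⁻¹

record Partition (n : ℕ) : Set where
  field
    parts    : List ℕ
    positive : All (0 <_) parts
    sorted   : Linked _≥_ parts
    sum≡n    : sum parts ≡ n

open Partition public

ℓ : ∀ {n} → Partition n → ℕ
ℓ μ = length (parts μ)

-- Partitions of possibly different sizes are compared through their parts.
sameParts? : ∀ {m n} (μ : Partition m) (ν : Partition n) → Dec (parts μ ≡ parts ν)
sameParts? μ ν = List.≡-dec ℕ._≟_ (parts μ) (parts ν)

δ : ∀ {m n} → Partition m → Partition n → ℚ⟨α⟩
δ μ ν = if does (sameParts? μ ν) then 1# else 0#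

_⊴_ : ∀ {n} → Partition n → Partition n → Set
μ ⊴ ν = ∀ k → sum (take k (parts μ)) ≤ sum (take k (parts ν))

row : ∀ n → .{{NonZero n}} → Partition n
row n = record
  { parts    = n ∷ []
  ; positive = ℕ.>-nonZero⁻¹ n ∷ []
  ; sorted   = [-]
  ; sum≡n    = ℕ.+-identityʳ n
  }

sum-ones : ∀ n → sum (applyUpTo (λ _ → 1) n) ≡ n
sum-ones zero    = refl
sum-ones (suc n) = cong suc (sum-ones n)

ones : ∀ n → Partition n
ones n = record
  { parts    = applyUpTo (λ _ → 1) n
  ; positive = All.applyUpTo⁺₂ _ n (λ _ → s≤s z≤n)
  ; sorted   = Linked.applyUpTo⁺₂ _ n (λ _ → ℕ.≤-refl)
  ; sum≡n    = sum-ones n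
  }

multiplicity : ∀ {n} → ℕ → Partition n → ℕ
multiplicity i μ = count (ℕ._≟ i) (parts μ)

z : ∀ {n} → Partition n → ℕ
z {n} μ = product (applyUpTo (λ i → suc i ℕ.^ multiplicity (suc i) μ ℕ.* multiplicity (suc i) μ !) n)

-- Length of the column with index j (counted from 0) of the diagram with row lengths xs.
column : List ℕ → ℕ → ℕ
column xs j = count (j ℕ.<?_) xs

largest : List ℕ → ℕ
largest = foldr _⊔_ 0

column-cons : ∀ x xs j → column (x ∷ xs) j ≡ column (x ∷ []) j ℕ.+ column xs j
column-cons x xs j with does (j ℕ.<? x)
... | true  = refl
... | false = refl

column-suc : ∀ x j → column (suc x ∷ []) (suc j) ≡ column (x ∷ []) j
column-suc x j with j ℕ.<ᵇ x
... | true  = refl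
... | false = refl

column-[]≤ : ∀ x j → column (x ∷ []) (suc j) ≤ column (x ∷ []) j
column-[]≤ zero    j       = z≤n
column-[]≤ (suc x) zero    = List.length-filter (1 ℕ.<?_) (suc x ∷ [])
column-[]≤ (suc x) (suc j) rewrite column-suc x (suc j) | column-suc x j = column-[]≤ x j

column-antitone : ∀ xs j → column xs (suc j) ≤ column xs j
column-antitone []       j = z≤n
column-antitone (x ∷ xs) j
  rewrite column-cons x xs (suc j) | column-cons x xs j =
  ℕ.+-mono-≤ (column-[]≤ x j) (column-antitone xs j)

<largest⇒Any : ∀ xs {j} → j < largest xs → Any (j <_) xs
<largest⇒Any (x ∷ xs) {j} j<m with ℕ.⊔-sel x (largest xs)
... | inj₁ e = here (subst (j <_) e j<m)
... | inj₂ e = there (<largest⇒Any xs (subst (j <_) e j<m))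

≤largest : ∀ xs → All (_≤ largest xs) xs
≤largest []       = []
≤largest (x ∷ xs) = ℕ.m≤m⊔n x _ ∷ All.map (λ y≤m → ℕ.≤-trans y≤m (ℕ.m≤n⊔m x _)) (≤largest xs)

sum-applyUpTo-+ : ∀ (f g h : ℕ → ℕ) → (∀ j → f j ≡ g j ℕ.+ h j) → ∀ N →
                  sum (applyUpTo f N) ≡ sum (applyUpTo g N) ℕ.+ sum (applyUpTo h N)
sum-applyUpTo-+ f g h e zero    = refl
sum-applyUpTo-+ f g h e (suc N) = trans
  (cong₂ ℕ._+_ (e 0) (sum-applyUpTo-+ (f ∘ suc) (g ∘ suc) (h ∘ suc) (e ∘ suc) N))
  (interchange (g 0) (h 0) _ _)

sum-applyUpTo-cong : ∀ (f g : ℕ → ℕ) → (∀ j → f j ≡ g j) → ∀ N →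
                     sum (applyUpTo f N) ≡ sum (applyUpTo g N)
sum-applyUpTo-cong f g e zero    = refl
sum-applyUpTo-cong f g e (suc N) = cong₂ ℕ._+_ (e 0) (sum-applyUpTo-cong _ _ (e ∘ suc) N)

sum-zeros : ∀ N → sum (applyUpTo (λ _ → 0) N) ≡ 0
sum-zeros zero    = refl
sum-zeros (suc N) = sum-zeros N

sum-column-single : ∀ x N → x ≤ N → sum (applyUpTo (column (x ∷ [])) N) ≡ x
sum-column-single zero    N       _         = sum-zeros N
sum-column-single (suc x) (suc N) (s≤s x≤N) = cong suc
  (trans (sum-applyUpTo-cong _ _ (column-suc x) N) (sum-column-single x N x≤N))

sum-column : ∀ xs N → All (_≤ N) xs → sum (applyUpTo (column xs) N) ≡ sum xs
sum-column []       N []        = sum-zeros N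
sum-column (x ∷ xs) N (p ∷ ps) = trans (sum-applyUpTo-+ _ _ _ (column-cons x xs) N)
  (cong₂ ℕ._+_ (sum-column-single x N p) (sum-column xs N ps))

conjugate : ∀ {n} → Partition n → Partition n
conjugate μ = record
  { parts    = applyUpTo (column (parts μ)) (largest (parts μ))
  ; positive = All.applyUpTo⁺₁ _ _ (λ j<m → List.filter-some (_ ℕ.<?_) (<largest⇒Any (parts μ) j<m))
  ; sorted   = Linked.applyUpTo⁺₂ _ _ (column-antitone (parts μ))
  ; sum≡n    = trans (sum-column (parts μ) _ (≤largest (parts μ))) (sum≡n μ)
  }

-- The list of rows, bottom row first (French notation).
Filling : Set
Filling = List (List ℕ)

rowFillings : ℕ → ℕ → List (List ℕ)
rowFillings m zero    = [] ∷ []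
rowFillings m (suc k) = cartesianProductWith _∷_ (applyUpTo suc m) (rowFillings m k)

-- All fillings of the diagram with the given row lengths by entries in {1, …, m}.
fillings : ℕ → List ℕ → List Filling
fillings m []       = [] ∷ []
fillings m (k ∷ ks) = cartesianProductWith _∷_ (rowFillings m k) (fillings m ks)

record Cell : Set where
  constructor cell
  field
    height : ℕ
    col    : ℕ
    entry  : ℕ

open Cell public

rowCells : ℕ → ℕ → List ℕ → List Cell
rowCells r c []       = []
rowCells r c (x ∷ xs) = cell r c x ∷ rowCells r (suc c) xs

cellsFrom : ℕ → Filling → List Cell
cellsFrom r []       = []
cellsFrom r (xs ∷ T) = rowCells r 0 xs ++ cellsFrom (suc r) T

cells : Filling → List Cell
cells = cellsFrom 0

Semistandard : Filling → Set
Semistandard T = All (λ x → All (λ y →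
    (height x ≡ height y → col x < col y → entry x ≤ entry y)
  × (col x ≡ col y → height x < height y → entry x < entry y)) (cells T)) (cells T)

semistandard? : Decidable Semistandard
semistandard? T = all? (λ x → all? (λ y →
    (height x ℕ.≟ height y →-dec (col x ℕ.<? col y →-dec entry x ℕ.≤? entry y))
  ×-dec (col x ℕ.≟ col y →-dec (height x ℕ.<? height y →-dec entry x ℕ.<? entry y))) (cells T)) (cells T)

ssyt : ∀ {n} → ℕ → Partition n → List Filling
ssyt m μ = filter semistandard? (fillings m (parts μ))

_WeaklyLeftOf_ : Cell → Cell → Set
x WeaklyLeftOf y = height y < height x × col x ≤ col y

-- x is the leftmost instance of its entry; in a semistandard filling it is
-- unique, since no entry occurs twice in a column.
Leftmost : Filling → Cell → Set
Leftmost T x = All (λ y → entry y ≡ entry x → col x ≤ col y) (cells T)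

QuasiYamanouchi : Filling → Set
QuasiYamanouchi T = All (λ x → 1 < entry x → Leftmost T x →
  Any (λ y → suc (entry y) ≡ entry x × x WeaklyLeftOf y) (cells T)) (cells T)

quasiYamanouchi? : Decidable QuasiYamanouchi
quasiYamanouchi? T = all? (λ x → 1 ℕ.<? entry x →-dec
  (all? (λ y → entry y ℕ.≟ entry x →-dec col x ℕ.≤? col y) (cells T) →-dec
   any? (λ y → suc (entry y) ℕ.≟ entry x ×-dec
               (height y ℕ.<? height x ×-dec col x ℕ.≤? col y)) (cells T))) (cells T)

HasMaximum : ℕ → Filling → Set
HasMaximum m T = All (λ x → entry x ≤ m) (cells T) × Any (λ x → entry x ≡ m) (cells T)

hasMaximum? : ∀ m → Decidable (HasMaximum m)
hasMaximum? m T = all? (λ x → entry x ℕ.≤? m) (cells T) ×-dec any? (λ x → entry x ℕ.≟ m) (cells T)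

QYT₌ : ∀ {n} → ℕ → Partition n → ℕ
QYT₌ m μ = count (λ T → quasiYamanouchi? T ×-dec hasMaximum? m T) (ssyt m μ)

-- Λ = ⨁ₙ Λ n, where f : Λ n stands for Σ f μ · m_μ over the partitions μ of n.
Λ : ℕ → Set
Λ n = Partition n → ℚ⟨α⟩

_≋_ : ∀ {n} → Λ n → Λ n → Set
f ≋ g = ∀ μ → f μ ≈ g μ

_⊕_ : ∀ {n} → Λ n → Λ n → Λ n
(f ⊕ g) μ = f μ + g μ

_•_ : ∀ {n} → ℚ⟨α⟩ → Λ n → Λ n
(c • f) μ = c * f μ

-- A polynomial in x₁, …, x_N with coefficients in ℕ, as a list of monomials
-- (exponent vectors) with repetitions.
Monomials : ℕ → Set
Monomials N = List (Vec ℕ N)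

coefficient : ∀ {N} → Vec ℕ N → Monomials N → ℕ
coefficient a = count (λ b → Vec.≡-dec ℕ._≟_ b a)

-- The symmetric function F, given by its specialisations F N = F(x₁, …, x_N).
-- The coefficient of m_μ is that of x₁^{μ₁} ⋯ x_ℓ^{μ_ℓ}, for which ℓ = ℓ(μ)
-- variables suffice.
fromMonomials : ∀ {n} → (∀ N → Monomials N) → Λ n
fromMonomials F μ = fromℕ (coefficient (Vec.fromList (parts μ)) (F (ℓ μ)))

-- x₁^r + ⋯ + x_N^r
powerSum : ℕ → ∀ N → Monomials N
powerSum r N = map (λ i → Vec.tabulate (λ j → if does (i Fin.≟ j) then r else 0)) (allFin N)

infixl 7 _⊛_
_⊛_ : ∀ {N} → Monomials N → Monomials N → Monomials N
_⊛_ = cartesianProductWith (Vec.zipWith ℕ._+_)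

p : ∀ {n} → Partition n → Λ n
p μ = fromMonomials λ N → foldr (λ r F → powerSum r N ⊛ F) (Vec.replicate N 0 ∷ []) (parts μ)

weight : ∀ N → Filling → Vec ℕ N
weight N T = Vec.tabulate (λ i → count (λ x → entry x ℕ.≟ suc (toℕ i)) (cells T))

s : ∀ {n} → Partition n → Λ n
s μ = fromMonomials λ N → map (weight N) (ssyt N μ)

-- A bilinear form on ⨁ₙ Λ n is a family of bilinear maps Λ m × Λ n → ℚ(α).
record BilinearForm : Set where
  field
    form    : ∀ {m n} → Λ m → Λ n → ℚ⟨α⟩
    congr   : ∀ {m n} {f f′ : Λ m} {g g′ : Λ n} → f ≋ f′ → g ≋ g′ → form f g ≈ form f′ g′
    ⊕-left  : ∀ {m n} (f f′ : Λ m) (g : Λ n) → form (f ⊕ f′) g ≈ form f g + form f′ g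
    ⊕-right : ∀ {m n} (f : Λ m) (g g′ : Λ n) → form f (g ⊕ g′) ≈ form f g + form f g′
    •-left  : ∀ {m n} (c : ℚ⟨α⟩) (f : Λ m) (g : Λ n) → form (c • f) g ≈ c * form f g
    •-right : ∀ {m n} (c : ℚ⟨α⟩) (f : Λ m) (g : Λ n) → form f (c • g) ≈ c * form f g

open BilinearForm public using (form)

-- The p_μ and the s_μ each form a basis of Λ, so each of the next two
-- conditions determines the form.
IsJackProduct : BilinearForm → Set
IsJackProduct B = ∀ {m n} (μ : Partition m) (ν : Partition n) →
  form B (p μ) (p ν) ≈ δ μ ν * (fromℕ (z μ) * α ^ ℓ μ)

IsHallProduct : BilinearForm → Set
IsHallProduct B = ∀ {m n} (μ : Partition m) (ν : Partition n) → form B (s μ) (s ν) ≈ δ μ ν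

-- When B is ⟨·,·⟩_α, the only such family is J_μ = J_μ^{(α)}. Homogeneity of J_μ,
-- built into its type, is part of triangularity: ⊴ compares partitions of one size.
record IsJackFamily (B : BilinearForm) (J : ∀ {n} → Partition n → Λ n) : Set where
  field
    orthogonal : ∀ {m n} (μ : Partition m) (ν : Partition n) → parts μ ≢ parts ν →
                 form B (J μ) (J ν) ≈ 0#
    triangular : ∀ {n} (μ ν : Partition n) → ¬ (ν ⊴ μ) → J μ ν ≈ 0#
    normalized : ∀ {n} (μ : Partition n) → J μ (ones n) ≈ fromℕ (n !)

-- αⁿ J_μ^{(1/α)}, obtained from J_μ = J_μ^{(α)} by substituting 1/α for α in
-- its coefficients.
tilde : (∀ {n} → Partition n → Λ n) → ∀ {n} → Partition n → Λ n
tilde J {n} μ = (α ^ n) • (λ ν → J μ ν [1/α])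

-- The form ⟨·,·⟩_α is positive definite for the order on ℚ(α) in which α is infinitesimal, so,
-- by induction along the dominance order, every m_μ with μ ≠ (n) is orthogonal to J_(n).
-- Expanding in power sums gives J_(n) = n! αⁿ h_n[X/α], and by Newton's identity the coefficient
-- of m_μ in J̃_(n) is n! ∏ᵢ C(α + μᵢ − 1, μᵢ). This and the coefficient of m_μ in
-- Σ_λ (Σ_k n! QYT_{=k+1}(λ′) C(α + k, n)) s_λ are polynomials in α; at α = −N their equality is
-- the dual Cauchy identity Σ_λ K_{λμ} s_{λ′}(1^N) = ∏ᵢ C(N, μᵢ), where
-- s_{λ′}(1^N) = Σ_m QYT_{=m}(λ′) C(N + n − m, n). The former follows from the commutation of
-- adding horizontal strips with removing vertical strips, the latter by adding the cells of a
-- tableau one at a time.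

module Submission where

-- Only the coefficient of m_{1ⁿ} in J_μ is normalised, while the induction on dominance divides by
-- the coefficient of m_μ. Definiteness makes that coefficient nonzero: if it vanished, J_μ would be
-- orthogonal to itself and hence zero. At α = -N the polynomials C(α + k, n) and ∏ᵢ C(α + μᵢ - 1,
-- μᵢ) become (-1)ⁿ C(N + n - k - 1, n) and (-1)ⁿ ∏ᵢ C(N, μᵢ). The signs cancel, and an identity of
-- natural numbers remains. Taking N ≥ n leaves infinitely many points and keeps every upper
-- argument nonnegative. Adding and removing strips commute up to a factor, with x marking each
-- added cell. Passing one row moves this factor up by one row: it is 1 + x below the bottom row and
-- 1 above an empty top row. Diagrams with n cells are therefore padded to n + 1 rows. No
-- standardisation map is built. Descents and quasi-Yamanouchi tableaux are matched because removing
-- the last cell leads to the same recursion for both, and the lists built by that recursion are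
-- shown to have the right members.

-- Adding horizontal strips and removing vertical strips

module Strips where

  open import Data.Bool.Base using (Bool; true; false; if_then_else_)
  open import Data.Bool.Properties using (T-≡)
  open import Data.Empty using (⊥-elim)
  open import Data.List.Base using (List; []; _∷_; length)
  open import Data.Nat.Base
  open import Data.Nat.Combinatorics using (_C_; nCk+nC[k+1]≡[n+1]C[k+1])
  open import Data.Nat.ListAction using (sum)
  open import Data.Nat.Properties
  open import Data.Nat.Tactic.RingSolver using (solve-∀)
  open import Data.Product.Base using (_×_; _,_; proj₁; proj₂)
  open import Function.Base using (_∘_)
  open import Function.Bundles using (Equivalence)
  open import Relation.Binary.PropositionalEquality
  open import Relation.Nullary using (yes; no; contradiction)

  infixl 9 _‼_
  -- Rows past the end have length 0, so comparisons with the next row make sense for every row.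
  _‼_ : List ℕ → ℕ → ℕ
  []       ‼ i     = 0
  (x ∷ xs) ‼ zero  = x
  (x ∷ xs) ‼ suc i = xs ‼ i

  inc dec : ℕ → List ℕ → List ℕ
  inc r       []       = []
  inc zero    (x ∷ xs) = suc x ∷ xs
  inc (suc r) (x ∷ xs) = x ∷ inc r xs
  dec r       []       = []
  dec zero    (x ∷ xs) = pred x ∷ xs
  dec (suc r) (x ∷ xs) = x ∷ dec r xs

  ‼-inc : ∀ r xs → r < length xs → inc r xs ‼ r ≡ suc (xs ‼ r)
  ‼-inc zero    (x ∷ xs) _         = refl
  ‼-inc (suc r) (x ∷ xs) (s≤s r<l) = ‼-inc r xs r<l

  ‼-inc-≢ : ∀ r i xs → i ≢ r → inc r xs ‼ i ≡ xs ‼ i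
  ‼-inc-≢ r       i       []       _   = refl
  ‼-inc-≢ zero    zero    (x ∷ xs) i≢r = ⊥-elim (i≢r refl)
  ‼-inc-≢ zero    (suc i) (x ∷ xs) _   = refl
  ‼-inc-≢ (suc r) zero    (x ∷ xs) _   = refl
  ‼-inc-≢ (suc r) (suc i) (x ∷ xs) i≢r = ‼-inc-≢ r i xs (i≢r ∘ cong suc)

  ‼-dec : ∀ r xs → dec r xs ‼ r ≡ pred (xs ‼ r)
  ‼-dec r       []       = refl
  ‼-dec zero    (x ∷ xs) = refl
  ‼-dec (suc r) (x ∷ xs) = ‼-dec r xs

  ‼-dec-≢ : ∀ r i xs → i ≢ r → dec r xs ‼ i ≡ xs ‼ i
  ‼-dec-≢ r       i       []       _   = refl
  ‼-dec-≢ zero    zero    (x ∷ xs) i≢r = ⊥-elim (i≢r refl)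
  ‼-dec-≢ zero    (suc i) (x ∷ xs) _   = refl
  ‼-dec-≢ (suc r) zero    (x ∷ xs) _   = refl
  ‼-dec-≢ (suc r) (suc i) (x ∷ xs) i≢r = ‼-dec-≢ r i xs (i≢r ∘ cong suc)

  inc-dec-comm : ∀ r s xs → r ≢ s → inc r (dec s xs) ≡ dec s (inc r xs)
  inc-dec-comm r       s       []       _   = refl
  inc-dec-comm zero    zero    (x ∷ xs) r≢s = ⊥-elim (r≢s refl)
  inc-dec-comm zero    (suc s) (x ∷ xs) _   = refl
  inc-dec-comm (suc r) zero    (x ∷ xs) _   = refl
  inc-dec-comm (suc r) (suc s) (x ∷ xs) r≢s = cong (x ∷_) (inc-dec-comm r s xs (r≢s ∘ cong suc))

  dec-inc : ∀ r xs → dec r (inc r xs) ≡ xs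
  dec-inc r       []       = refl
  dec-inc zero    (x ∷ xs) = refl
  dec-inc (suc r) (x ∷ xs) = cong (x ∷_) (dec-inc r xs)

  inc-dec : ∀ r xs → 0 < xs ‼ r → inc r (dec r xs) ≡ xs
  inc-dec zero    (suc x ∷ xs) _ = refl
  inc-dec (suc r) (x ∷ xs)     p = cong (x ∷_) (inc-dec r xs p)

  length-inc : ∀ r xs → length (inc r xs) ≡ length xs
  length-inc r       []       = refl
  length-inc zero    (x ∷ xs) = refl
  length-inc (suc r) (x ∷ xs) = cong suc (length-inc r xs)

  length-dec : ∀ r xs → length (dec r xs) ≡ length xs
  length-dec r       []       = refl
  length-dec zero    (x ∷ xs) = refl
  length-dec (suc r) (x ∷ xs) = cong suc (length-dec r xs)

  sum-inc : ∀ r xs → r < length xs → sum (inc r xs) ≡ suc (sum xs)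
  sum-inc zero    (x ∷ xs) _         = refl
  sum-inc (suc r) (x ∷ xs) (s≤s r<l) =
    trans (cong (x +_) (sum-inc r xs r<l)) (+-suc x (sum xs))

  sum-dec : ∀ r xs → 0 < xs ‼ r → suc (sum (dec r xs)) ≡ sum xs
  sum-dec zero    (suc x ∷ xs) _ = refl
  sum-dec (suc r) (x ∷ xs)     p =
    trans (sym (+-suc x (sum (dec r xs)))) (cong (x +_) (sum-dec r xs p))

  ‼-beyond : ∀ xs i → length xs ≤ i → xs ‼ i ≡ 0
  ‼-beyond []       i       _         = refl
  ‼-beyond (x ∷ xs) (suc i) (s≤s l≤i) = ‼-beyond xs i l≤i

  ‼-pos⇒< : ∀ xs i → 0 < xs ‼ i → i < length xs
  ‼-pos⇒< xs i p with i <? length xs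
  ... | yes i<l = i<l
  ... | no  i≮l = contradiction (subst (0 <_) (‼-beyond xs i (≮⇒≥ i≮l)) p) λ ()

  -- Row lengths of a diagram, padded by zeros.
  Shape : ℕ → List ℕ → Set
  Shape L xs = length xs ≡ L × (∀ i → xs ‼ suc i ≤ xs ‼ i)

  -- A cell can be added in row `suc r` exactly when one can be removed from row `r`: both say that
  -- row `suc r` is the shorter one. This coincidence lets the correction term of the commutation
  -- move up one row at a time.
  removable addable : ℕ → List ℕ → Bool
  removable r xs = xs ‼ suc r <ᵇ xs ‼ r
  addable zero    xs = true
  addable (suc r) xs = removable r xs

  <⇒<ᵇ≡ : ∀ {m n} → m < n → (m <ᵇ n) ≡ true
  <⇒<ᵇ≡ p = Equivalence.to T-≡ (<⇒<ᵇ p)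

  <ᵇ≡⇒< : ∀ {m n} → (m <ᵇ n) ≡ true → m < n
  <ᵇ≡⇒< {m} e = <ᵇ⇒< m _ (Equivalence.from T-≡ e)

  ≥⇒<ᵇ≡ : ∀ {m n} → n ≤ m → (m <ᵇ n) ≡ false
  ≥⇒<ᵇ≡ {m} {n} p with m <ᵇ n in e
  ... | true  = contradiction (<ᵇ≡⇒< {m} {n} e) (≤⇒≯ p)
  ... | false = refl

  removable⇒pos : ∀ r xs → removable r xs ≡ true → 0 < xs ‼ r
  removable⇒pos r xs e = ≤-<-trans z≤n (<ᵇ≡⇒< {xs ‼ suc r} {xs ‼ r} e)

  Shape-inc : ∀ {L} r xs → r < L → addable r xs ≡ true → Shape L xs → Shape L (inc r xs)
  Shape-inc {L} r xs r<L add (refl , mono) = length-inc r xs , mono′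
    where
    mono′ : ∀ i → inc r xs ‼ suc i ≤ inc r xs ‼ i
    mono′ i with suc i ≟ r | i ≟ r
    ... | yes refl | _ rewrite ‼-inc (suc i) xs r<L | ‼-inc-≢ (suc i) i xs (<⇒≢ ≤-refl) =
      <ᵇ≡⇒< {xs ‼ suc i} {xs ‼ i} add
    ... | no p | yes refl rewrite ‼-inc i xs r<L | ‼-inc-≢ i (suc i) xs p = m≤n⇒m≤1+n (mono i)
    ... | no p | no q rewrite ‼-inc-≢ r i xs q | ‼-inc-≢ r (suc i) xs p = mono i

  Shape-dec : ∀ {L} r xs → removable r xs ≡ true → Shape L xs → Shape L (dec r xs)
  Shape-dec {L} r xs rem (refl , mono) = length-dec r xs , mono′
    where
    mono′ : ∀ i → dec r xs ‼ suc i ≤ dec r xs ‼ i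
    mono′ i with suc i ≟ r | i ≟ r
    ... | yes refl | _ rewrite ‼-dec (suc i) xs | ‼-dec-≢ (suc i) i xs (<⇒≢ ≤-refl) =
      ≤-trans pred[n]≤n (mono i)
    ... | no p | yes refl rewrite ‼-dec i xs | ‼-dec-≢ i (suc i) xs p =
      pred-mono-≤ (<ᵇ≡⇒< {xs ‼ suc i} {xs ‼ i} rem)
    ... | no p | no q rewrite ‼-dec-≢ r i xs q | ‼-dec-≢ r (suc i) xs p = mono i

  -- Functions of a diagram with values in the power series ℕ⟦x⟧.
  Fn : Set
  Fn = List ℕ → ℕ → ℕ

  infixl 6 _⊞_
  _⊞_ : Fn → Fn → Fn
  (G ⊞ H) xs k = G xs k + H xs k

  -- Multiplication by the variable x of the power series.
  X : Fn → Fn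
  X G xs zero    = 0
  X G xs (suc k) = G xs k

  when : Bool → ℕ → ℕ
  when b n = if b then n else 0

  -- As operators, `E r` is the geometric series Σ xʲ (`u r`)ʲ, any number of cells added in row `r`
  -- and each marked by x; `F r` is 1 + `d r`, at most one cell removed; `A r` is the projection to
  -- the diagrams that admit a new cell in row `r`.
  u d A E F : ℕ → Fn → Fn
  u r G xs k = when (addable r xs) (G (inc r xs) k)
  d r G xs k = when (removable r xs) (G (dec r xs) k)
  A r G xs k = when (addable r xs) (G xs k)
  E r G xs zero    = G xs zero
  E r G xs (suc k) = G xs (suc k) + when (addable r xs) (E r G (inc r xs) k)
  F r G = G ⊞ d r G

  1+xA : ℕ → Fn → Fn
  1+xA r G = G ⊞ X (A r G)

  -- The outermost operator acts on the diagram first, so rows are changed from the top down. Row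
  -- `suc r` is extended while row `r` still has its old length, hence the added cells form a
  -- horizontal strip. A row loses a cell only after the row above it is settled, hence the removed
  -- cells form a vertical strip.
  U D : ℕ → Fn → Fn
  U zero    G = G
  U (suc r) G = E r (U r G)
  D zero    G = G
  D (suc r) G = F r (D r G)

  when-+ : ∀ b m n → when b (m + n) ≡ when b m + when b n
  when-+ true  m n = refl
  when-+ false m n = refl

  when-cong : ∀ b {m n} → (b ≡ true → m ≡ n) → when b m ≡ when b n
  when-cong true  e = e refl
  when-cong false e = refl

  when-0 : ∀ b → when b 0 ≡ 0
  when-0 true  = refl
  when-0 false = refl

  interchange : ∀ a b c d → (a + b) + (c + d) ≡ (a + c) + (b + d)
  interchange = solve-∀

  E-⊞ : ∀ r G H xs k → E r (G ⊞ H) xs k ≡ E r G xs k + E r H xs k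
  E-⊞ r G H xs zero    = refl
  E-⊞ r G H xs (suc k) = begin
    G xs (suc k) + H xs (suc k) + when b (E r (G ⊞ H) ys k)
      ≡⟨ cong (λ t → G xs (suc k) + H xs (suc k) + t)
              (trans (when-cong b (λ _ → E-⊞ r G H ys k)) (when-+ b _ _)) ⟩
    G xs (suc k) + H xs (suc k) + (when b (E r G ys k) + when b (E r H ys k))
      ≡⟨ interchange (G xs (suc k)) (H xs (suc k)) _ _ ⟩
    E r G xs (suc k) + E r H xs (suc k) ∎
    where
    open ≡-Reasoning
    b = addable r xs
    ys = inc r xs

  E-X : ∀ r G xs k → E r (X G) xs k ≡ X (E r G) xs k
  E-X r G xs zero          = refl
  E-X r G xs (suc zero)    = trans (cong (G xs 0 +_) (when-0 (addable r xs))) (+-identityʳ _)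
  E-X r G xs (suc (suc k)) = cong (G xs (suc k) +_)
    (when-cong (addable r xs) λ _ → E-X r G (inc r xs) (suc k))

  -- The geometric series commutes with `u r`, so a factor can be split off on the inside as well as
  -- on the outside.
  E-unfoldʳ : ∀ r G xs k → E r G xs (suc k) ≡ G xs (suc k) + E r (u r G) xs k
  E-unfoldʳ r G xs zero    = refl
  E-unfoldʳ r G xs (suc k) = cong (G xs (suc (suc k)) +_)
    (trans (when-cong (addable r xs) λ _ → E-unfoldʳ r G (inc r xs) k)
           (when-+ (addable r xs) _ _))

  d-⊞ : ∀ r G H xs k → d r (G ⊞ H) xs k ≡ d r G xs k + d r H xs k
  d-⊞ r G H xs k = when-+ (removable r xs) _ _

  when-comm : ∀ a b a′ b′ {m m′} → (a ≡ true → b ≡ true → a′ ≡ true × b′ ≡ true) →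
              (a′ ≡ true → b′ ≡ true → a ≡ true × b ≡ true) → m ≡ m′ →
              when a (when b m) ≡ when a′ (when b′ m′)
  when-comm true  true  a′    b′    f g refl with refl , refl ← f refl refl = refl
  when-comm true  false true  true  f g e with () ← proj₂ (g refl refl)
  when-comm true  false true  false f g e = refl
  when-comm true  false false b′    f g e = refl
  when-comm false b     true  true  f g e with () ← proj₁ (g refl refl)
  when-comm false b     true  false f g e = refl
  when-comm false b     false b′    f g e = refl

  module _ (L : ℕ) where

    infix 4 _≐_
    _≐_ : Fn → Fn → Set
    G ≐ H = ∀ xs → Shape L xs → ∀ k → G xs k ≡ H xs k

    ≐-sym : ∀ {G H} → G ≐ H → H ≐ G
    ≐-sym e xs sh k = sym (e xs sh k)

    ≐-trans : ∀ {G H K} → G ≐ H → H ≐ K → G ≐ K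
    ≐-trans e f xs sh k = trans (e xs sh k) (f xs sh k)

    ⊞-cong : ∀ {G G′ H H′} → G ≐ G′ → H ≐ H′ → (G ⊞ H) ≐ (G′ ⊞ H′)
    ⊞-cong e f xs sh k = cong₂ _+_ (e xs sh k) (f xs sh k)

    X-cong : ∀ {G H} → G ≐ H → X G ≐ X H
    X-cong e xs sh zero    = refl
    X-cong e xs sh (suc k) = e xs sh k

    d-cong : ∀ {r G H} → G ≐ H → d r G ≐ d r H
    d-cong {r} e xs sh k = when-cong (removable r xs) λ a →
      e (dec r xs) (Shape-dec r xs a sh) k

    A-cong : ∀ {r G H} → G ≐ H → A r G ≐ A r H
    A-cong {r} e xs sh k = when-cong (addable r xs) λ a → e xs sh k

    E-cong : ∀ {r G H} → r < L → G ≐ H → E r G ≐ E r H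
    E-cong r<L e xs sh zero = e xs sh zero
    E-cong {r} r<L e xs sh (suc k) = cong₂ _+_ (e xs sh (suc k))
      (when-cong (addable r xs) λ a → E-cong r<L e (inc r xs) (Shape-inc r xs r<L a sh) k)

    F-cong : ∀ {r G H} → G ≐ H → F r G ≐ F r H
    F-cong {r} {G} {H} e = ⊞-cong {G} {H} e (d-cong {r} e)

    1+xA-cong : ∀ {r G H} → G ≐ H → 1+xA r G ≐ 1+xA r H
    1+xA-cong {r} {G} {H} e = ⊞-cong {G} {H} e (X-cong (A-cong {r} e))

    -- The conditions interact only for `r = suc s`, where both compare the same two rows. In either
    -- order the moves are then allowed exactly when the two lengths differ by at least 2.
    ud-comm : ∀ r s G → r < L → r ≢ s → u r (d s G) ≐ d s (u r G)
    ud-comm r s G r<L r≢s xs (refl , mono) k =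
      when-comm (addable r xs) (removable s (inc r xs)) (removable s xs) (addable r (dec s xs))
        (to r r<L r≢s) (from r r<L r≢s) (cong (λ ys → G ys k) (sym (inc-dec-comm r s xs r≢s)))
      where
      unaffected : ∀ r → suc s ≢ r → r ≢ s → removable s (inc r xs) ≡ removable s xs
      unaffected r p q = cong₂ _<ᵇ_ (‼-inc-≢ r (suc s) xs p) (‼-inc-≢ r s xs (q ∘ sym))
      unaffected′ : ∀ r → suc s ≢ suc r → suc r ≢ s → addable (suc r) (dec s xs) ≡ addable (suc r) xs
      unaffected′ r p q = cong₂ _<ᵇ_ (‼-dec-≢ s (suc r) xs q) (‼-dec-≢ s r xs (p ∘ cong suc ∘ sym))
      to : ∀ r → r < length xs → r ≢ s → addable r xs ≡ true → removable s (inc r xs) ≡ true →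
           removable s xs ≡ true × addable r (dec s xs) ≡ true
      to zero _ r≢s a b = trans (sym (unaffected zero (λ ()) r≢s)) b , refl
      to (suc r) r<L r≢s a b with suc s ≟ suc r
      ... | no  p = trans (sym (unaffected (suc r) p r≢s)) b , trans (unaffected′ r p r≢s) a
      ... | yes refl rewrite ‼-inc (suc s) xs r<L | ‼-inc-≢ (suc s) s xs (<⇒≢ ≤-refl)
                           | ‼-dec s xs | ‼-dec-≢ s (suc s) xs (r≢s) =
        a , <⇒<ᵇ≡ (pred-mono-≤ {suc (suc (xs ‼ suc s))} {xs ‼ s} (<ᵇ≡⇒< {suc (xs ‼ suc s)} {xs ‼ s} b))
      from : ∀ r → r < length xs → r ≢ s → removable s xs ≡ true → addable r (dec s xs) ≡ true →
             addable r xs ≡ true × removable s (inc r xs) ≡ true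
      from zero _ r≢s a b = refl , trans (unaffected zero (λ ()) r≢s) a
      from (suc r) r<L r≢s a b with suc s ≟ suc r
      ... | no  p = trans (sym (unaffected′ r p r≢s)) b , trans (unaffected (suc r) p r≢s) a
      ... | yes refl rewrite ‼-inc (suc s) xs r<L | ‼-inc-≢ (suc s) s xs (<⇒≢ ≤-refl)
                           | ‼-dec s xs | ‼-dec-≢ s (suc s) xs (r≢s) =
        a , <⇒<ᵇ≡ (step {n = xs ‼ s} (<ᵇ≡⇒< {xs ‼ suc s} {pred (xs ‼ s)} b))
        where
        step : ∀ {m n} → m < pred n → suc m < n
        step {n = suc n} p = s≤s p

    -- A cell just added at the end of a row can always be removed, so only the condition for adding
    -- it survives.
    ud-same : ∀ r G → r < L → u r (d r G) ≐ A r G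
    ud-same r G r<L xs (refl , mono) k = when-cong (addable r xs) λ a →
      cong₂ when
        (<⇒<ᵇ≡ (subst₂ _<_ (sym (‼-inc-≢ r (suc r) xs (<⇒≢ ≤-refl ∘ sym))) (sym (‼-inc r xs r<L)) (s≤s (mono r))))
        (cong (λ ys → G ys k) (dec-inc r xs))

    addable-dec : ∀ r xs → removable r xs ≡ true → Shape L xs → addable r (dec r xs) ≡ true
    addable-dec zero    xs rem sh = refl
    addable-dec (suc r) xs rem (_ , mono) = <⇒<ᵇ≡ (subst₂ _<_ (sym (‼-dec (suc r) xs))
      (sym (‼-dec-≢ (suc r) r xs (<⇒≢ ≤-refl))) (pred< (removable⇒pos (suc r) xs rem) (mono r)))
      where
      pred< : ∀ {m n} → 0 < m → m ≤ n → pred m < n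
      pred< {suc m} _ p = p

    -- A cell just removed can be put back, so only removability in row `r` survives, and this is
    -- `addable (suc r)`.
    du-same : ∀ r G → d r (u r G) ≐ A (suc r) G
    du-same r G xs sh k = when-cong (removable r xs) λ rem →
      trans (cong₂ when (addable-dec r xs rem sh)
               (cong (λ ys → G ys k) (inc-dec r xs (removable⇒pos r xs rem)))) refl

    dA : ∀ r G → d r (A r G) ≐ A (suc r) (d r G)
    dA r G xs sh k = when-cong (removable r xs) λ rem →
      trans (cong (λ b → when b (G (dec r xs) k)) (addable-dec r xs rem sh))
            (sym (cong (λ b → when b (G (dec r xs) k)) rem))

    dE : ∀ r G → r < L → d r (E r G) ≐ (d r G ⊞ X (A (suc r) (E r G)))
    dE r G r<L xs sh zero    = sym (+-identityʳ _)
    dE r G r<L xs sh (suc k) = trans (when-+ (removable r xs) _ _)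
      (cong (d r G xs (suc k) +_) (du-same r (E r G) xs sh k))

    Ed : ∀ r G → r < L → E r (d r G) ≐ (d r G ⊞ X (E r (A r G)))
    Ed r G r<L xs sh zero    = sym (+-identityʳ _)
    Ed r G r<L xs sh (suc k) = trans (E-unfoldʳ r (d r G) xs k)
      (cong (d r G xs (suc k) +_) (E-cong r<L (ud-same r G r<L) xs sh k))

    -- Both sides expand to E + d + x(π′E + Eπ + π′d) + x²π′Eπ, where π = A r and π′ = A (suc r).
    FE-EF : ∀ r G → r < L → F r (E r (1+xA r G)) ≐ 1+xA (suc r) (E r (F r G))
    FE-EF r G r<L xs sh zero =
      trans (cong₂ _+_ (+-identityʳ _) (when-cong (removable r xs) λ _ → +-identityʳ _))
            (sym (+-identityʳ _))
    FE-EF r G r<L xs sh (suc k) = begin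
      E r H xs (suc k) + d r (E r H) xs (suc k)
        ≡⟨ cong (E r H xs (suc k) +_) (dE r H r<L xs sh (suc k)) ⟩
      E r H xs (suc k) + (d r H xs (suc k) + A (suc r) (E r H) xs k)
        ≡⟨ cong₂ _+_ (trans (E-⊞ r G (X (A r G)) xs (suc k)) (cong (E r G xs (suc k) +_) (E-X r (A r G) xs (suc k))))
                     (cong₂ _+_ (trans (d-⊞ r G (X (A r G)) xs (suc k)) (cong (d r G xs (suc k) +_) (dA r G xs sh k)))
                                (when-cong (removable r xs) λ _ → EH)) ⟩
      e + f + (g + h + when b (e′ + f′))
        ≡⟨ cong (λ t → e + f + (g + h + t)) (when-+ b _ _) ⟩
      e + f + (g + h + (when b e′ + when b f′))
        ≡⟨ lemma e f g h (when b e′) (when b f′) ⟩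
      e + (g + f) + (when b e′ + (h + when b f′))
        ≡⟨ cong (e + (g + f) +_) (trans (cong (when b e′ +_) (sym (when-+ b _ _))) (sym (when-+ b _ _))) ⟩
      e + (g + f) + when b (e′ + (d r G xs k + f′))
        ≡⟨ cong₂ _+_ (sym (EF (suc k))) (when-cong (removable r xs) λ _ → sym (EF k)) ⟩
      E r (F r G) xs (suc k) + A (suc r) (E r (F r G)) xs k ∎
      where
      open ≡-Reasoning
      H = 1+xA r G
      b = removable r xs
      e = E r G xs (suc k)
      e′ = E r G xs k
      f = E r (A r G) xs k
      f′ = X (E r (A r G)) xs k
      g = d r G xs (suc k)
      h = A (suc r) (d r G) xs k
      EH : E r H xs k ≡ e′ + f′
      EH = trans (E-⊞ r G (X (A r G)) xs k) (cong (e′ +_) (E-X r (A r G) xs k))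
      EF : ∀ k → E r (F r G) xs k ≡ E r G xs k + (d r G xs k + X (E r (A r G)) xs k)
      EF k = trans (E-⊞ r G (d r G) xs k) (cong (E r G xs k +_) (Ed r G r<L xs sh k))
      lemma : ∀ e f g h i j → e + f + (g + h + (i + j)) ≡ e + (g + f) + (i + (h + j))
      lemma = solve-∀

    Ed-comm : ∀ r s G → r < L → r ≢ s → E r (d s G) ≐ d s (E r G)
    Ed-comm r s G r<L r≢s xs sh zero    = refl
    Ed-comm r s G r<L r≢s xs sh (suc k) = trans
      (cong (d s G xs (suc k) +_) (trans
        (when-cong (addable r xs) λ a → Ed-comm r s G r<L r≢s (inc r xs) (Shape-inc r xs r<L a sh) k)
        (ud-comm r s (E r G) r<L r≢s xs sh k)))
      (sym (when-+ (removable s xs) _ _))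

    EF-comm : ∀ r s G → r < L → r ≢ s → E r (F s G) ≐ F s (E r G)
    EF-comm r s G r<L r≢s xs sh k =
      trans (E-⊞ r G (d s G) xs k) (cong (E r G xs k +_) (Ed-comm r s G r<L r≢s xs sh k))

    UF-comm : ∀ r s G → r ≤ L → r ≤ s → U r (F s G) ≐ F s (U r G)
    UF-comm zero    s G r≤L r≤s = λ _ _ _ → refl
    UF-comm (suc r) s G r<L r<s =
      ≐-trans {H = E r (F s (U r G))} (E-cong r<L (UF-comm r s G (<⇒≤ r<L) (<⇒≤ r<s)))
              (EF-comm r s (U r G) r<L (<⇒≢ r<s))

    DE-comm : ∀ r s G → s < L → r ≤ s → D r (E s G) ≐ E s (D r G)
    DE-comm zero    s G s<L r≤s = λ _ _ _ → refl
    DE-comm (suc r) s G s<L r<s =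
      ≐-trans {H = F r (E s (D r G))} (F-cong (DE-comm r s G s<L (<⇒≤ r<s)))
              (≐-sym {G = E s (F r (D r G))} (EF-comm s r (D r G) s<L (<⇒≢ r<s ∘ sym)))

    -- Each use of `FE-EF` lifts the factor `1+xA` by one row. It starts as 1 + x at row 0, where a
    -- cell can always be added, and arrives at row `r`.
    UD-DU : ∀ r G → r ≤ L → 1+xA r (U r (D r G)) ≐ D r (U r (1+xA 0 G))
    UD-DU zero    G r≤L = λ _ _ _ → refl
    UD-DU (suc r) G r<L =
      ≐-trans {H = 1+xA (suc r) (E r (F r (U r (D r G))))}
        (1+xA-cong {suc r} (E-cong r<L (UF-comm r r (D r G) (<⇒≤ r<L) ≤-refl)))
      (≐-trans {H = F r (E r (1+xA r (U r (D r G))))}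
        (≐-sym {G = F r (E r (1+xA r (U r (D r G))))} (FE-EF r (U r (D r G)) r<L))
      (≐-trans {H = F r (E r (D r (U r (1+xA 0 G))))}
        (F-cong (E-cong r<L (UD-DU r G (<⇒≤ r<L))))
        (F-cong (≐-sym {G = D r (E r (U r (1+xA 0 G)))} (DE-comm r r (U r (1+xA 0 G)) r<L ≤-refl)))))

    -- `S 0` is the constant series 1 at the empty diagram and 0 elsewhere: both the number of cells
    -- and the exponent of x have to vanish.
    empty : List ℕ → ℕ → Bool
    empty xs k = sum xs + k ≡ᵇ 0

    -- S N λ counts the chains of N vertical strips from ∅ to λ.
    S : ℕ → Fn
    S zero    xs k = when (empty xs k) 1
    S (suc N) = D L (S N)

    -- A diagram to which a cell has been added is not empty, so only the term without new cells
    -- survives.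
    E-S₀ : ∀ r → r < L → E r (S 0) ≐ S 0
    E-S₀ r r<L xs sh zero = refl
    E-S₀ r r<L xs sh (suc k)
      rewrite +-suc (sum xs) k = trans (when-cong (addable r xs) λ a →
        trans (E-S₀ r r<L (inc r xs) (Shape-inc r xs r<L a sh) k)
          (cong (λ t → when (t + k ≡ᵇ 0) 1) (sum-inc r xs (subst (r <_) (sym (proj₁ sh)) r<L))))
        (when-0 (addable r xs))

    U-S₀ : ∀ r → r ≤ L → U r (S 0) ≐ S 0
    U-S₀ zero    r≤L = λ _ _ _ → refl
    U-S₀ (suc r) r<L = ≐-trans {H = E r (S 0)} (E-cong r<L (U-S₀ r (<⇒≤ r<L))) (E-S₀ r r<L)

    D-X : ∀ r G xs k → D r (X G) xs k ≡ X (D r G) xs k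
    D-X zero    G xs k = refl
    D-X (suc r) G xs zero    = cong₂ _+_ (D-X r G xs 0)
      (trans (when-cong (removable r xs) λ _ → D-X r G (dec r xs) 0) (when-0 (removable r xs)))
    D-X (suc r) G xs (suc k) = cong₂ _+_ (D-X r G xs (suc k))
      (when-cong (removable r xs) λ _ → D-X r G (dec r xs) (suc k))

    D-⊞ : ∀ r G H xs k → D r (G ⊞ H) xs k ≡ D r G xs k + D r H xs k
    D-⊞ zero    G H xs k = refl
    D-⊞ (suc r) G H xs k = trans
      (cong₂ _+_ (D-⊞ r G H xs k)
        (trans (when-cong (removable r xs) λ _ → D-⊞ r G H (dec r xs) k) (when-+ (removable r xs) _ _)))
      (interchange (D r G xs k) (D r H xs k) _ _)

    U-X : ∀ r G → r ≤ L → U r (X G) ≐ X (U r G)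
    U-X zero    G r≤L xs sh k = refl
    U-X (suc r) G r<L xs sh k =
      trans (E-cong r<L (U-X r G (<⇒≤ r<L)) xs sh k) (E-X r (U r G) xs k)

    U-⊞ : ∀ r G H → r ≤ L → U r (G ⊞ H) ≐ (U r G ⊞ U r H)
    U-⊞ zero    G H r≤L xs sh k = refl
    U-⊞ (suc r) G H r<L xs sh k =
      trans (E-cong r<L (U-⊞ r G H (<⇒≤ r<L)) xs sh k) (E-⊞ r (U r G) (U r H) xs k)

    1+x : Fn → Fn
    1+x = 1+xA 0

    pow : ℕ → Fn → Fn
    pow zero    G = G
    pow (suc N) G = 1+x (pow N G)

    D-1+x : ∀ r G xs k → D r (1+x G) xs k ≡ 1+x (D r G) xs k
    D-1+x r G xs k = trans (D-⊞ r G (X G) xs k) (cong (D r G xs k +_) (D-X r G xs k))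

    U-1+x : ∀ r G → r ≤ L → U r (1+x G) ≐ 1+x (U r G)
    U-1+x r G r≤L xs sh k = trans (U-⊞ r G (X G) r≤L xs sh k) (cong (U r G xs k +_) (U-X r G r≤L xs sh k))

    D-pow : ∀ r N G xs k → D r (pow N G) xs k ≡ pow N (D r G) xs k
    D-pow r zero    G xs k = refl
    D-pow r (suc N) G xs k = trans (D-1+x r (pow N G) xs k)
      (cong₂ _+_ (D-pow r N G xs k) (X-cong′ k))
      where
      X-cong′ : ∀ k → X (D r (pow N G)) xs k ≡ X (pow N (D r G)) xs k
      X-cong′ zero    = refl
      X-cong′ (suc k) = D-pow r N G xs k

    -- With the last row empty no cell fits on top of it, which kills the correction term at row
    -- `L`. Removing cells preserves the condition.
    Small : List ℕ → Set
    Small xs = Shape L xs × xs ‼ pred L ≡ 0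

    Small-dec : ∀ r xs → removable r xs ≡ true → Small xs → Small (dec r xs)
    Small-dec r xs rem (sh , e) = Shape-dec r xs rem sh , e′
      where
      e′ : dec r xs ‼ pred L ≡ 0
      e′ with pred L ≟ r
      ... | yes refl = trans (‼-dec r xs) (cong pred e)
      ... | no  p    = trans (‼-dec-≢ r (pred L) xs p) e

    D-cong : ∀ r {G H} → (∀ xs → Small xs → ∀ k → G xs k ≡ H xs k) →
             ∀ xs → Small xs → ∀ k → D r G xs k ≡ D r H xs k
    D-cong zero    e xs sm k = e xs sm k
    D-cong (suc r) e xs sm k = cong₂ _+_ (D-cong r e xs sm k)
      (when-cong (removable r xs) λ rem → D-cong r e (dec r xs) (Small-dec r xs rem sm) k)

    module _ (0<L : 0 < L) where

      A-Small : ∀ xs → Small xs → addable L xs ≡ false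
      A-Small xs (sh , e) = helper L 0<L e
        where
        helper : ∀ L → 0 < L → xs ‼ pred L ≡ 0 → addable L xs ≡ false
        helper (suc L) _ e = ≥⇒<ᵇ≡ (subst (_≤ xs ‼ suc L) (sym e) z≤n)

      -- Here `1+xA L` acts as the identity, and the commutation costs only the scalar factor 1 + x.
      UD-Small : ∀ G xs → Small xs → ∀ k → U L (D L G) xs k ≡ D L (U L (1+x G)) xs k
      UD-Small G xs sm k = trans (sym (drop k)) (UD-DU L G ≤-refl xs (proj₁ sm) k)
        where
        drop : ∀ k → 1+xA L (U L (D L G)) xs k ≡ U L (D L G) xs k
        drop zero    = +-identityʳ _
        drop (suc k) rewrite A-Small xs sm = +-identityʳ _

      -- Dual Pieri rule at x₁ = ⋯ = x_N = 1: summing s_{μ′}(1^N) over the horizontal strips μ/λ of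
      -- size k gives e_k(1^N) s_{λ′}(1^N). Moving `U L` past each of the N vertical strips
      -- contributes one factor 1 + x.
      US : ∀ N xs → Small xs → ∀ k → U L (S N) xs k ≡ pow N (S N) xs k
      US zero    xs sm k = U-S₀ L ≤-refl xs (proj₁ sm) k
      US (suc N) xs sm k = begin
        U L (D L (S N)) xs k            ≡⟨ UD-Small (S N) xs sm k ⟩
        D L (U L (1+x (S N))) xs k      ≡⟨ D-cong L (λ ys sm′ → U-1+x L (S N) ≤-refl ys (proj₁ sm′)) xs sm k ⟩
        D L (1+x (U L (S N))) xs k      ≡⟨ D-cong L (λ ys sm′ k → cong₂ _+_ (US N ys sm′ k) (X-US ys sm′ k)) xs sm k ⟩
        D L (pow (suc N) (S N)) xs k    ≡⟨ D-pow L (suc N) (S N) xs k ⟩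
        pow (suc N) (S (suc N)) xs k    ∎
        where
        open ≡-Reasoning
        X-US : ∀ ys → Small ys → ∀ k → X (U L (S N)) ys k ≡ X (pow N (S N)) ys k
        X-US ys sm zero    = refl
        X-US ys sm (suc k) = US N ys sm k

      S-const : ∀ N xs k → S N xs (suc k) ≡ 0
      S-const zero    xs k rewrite +-suc (sum xs) k = refl
      S-const (suc N) = go L
        where
        go : ∀ r xs k → D r (S N) xs (suc k) ≡ 0
        go zero    xs k = S-const N xs k
        go (suc r) xs k = cong₂ _+_ (go r xs k)
          (trans (when-cong (removable r xs) λ _ → go r (dec r xs) k) (when-0 (removable r xs)))

      pow-const : ∀ N G xs → (∀ k → G xs (suc k) ≡ 0) → ∀ k → pow N G xs k ≡ (N C k) * G xs 0
      pow-const zero    G xs e zero    = sym (+-identityʳ _)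
      pow-const zero    G xs e (suc k) = e k
      pow-const (suc N) G xs e zero    = trans (+-identityʳ _) (pow-const N G xs e 0)
      pow-const (suc N) G xs e (suc k) = begin
        pow N G xs (suc k) + pow N G xs k
          ≡⟨ cong₂ _+_ (pow-const N G xs e (suc k)) (pow-const N G xs e k) ⟩
        (N C suc k) * G xs 0 + (N C k) * G xs 0
          ≡⟨ *-distribʳ-+ (G xs 0) (N C suc k) (N C k) ⟨
        (N C suc k + N C k) * G xs 0
          ≡⟨ cong (_* G xs 0) (trans (+-comm (N C suc k) (N C k)) (nCk+nC[k+1]≡[n+1]C[k+1] N k)) ⟩
        (suc N C suc k) * G xs 0 ∎
        where open ≡-Reasoning

      US-C : ∀ N xs → Small xs → ∀ k → U L (S N) xs k ≡ (N C k) * S N xs 0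
      US-C N xs sm k = trans (US N xs sm k) (pow-const N (S N) xs (S-const N xs) k)

-- Chains of vertical strips counted by descents

module Descents where

  open import Data.Bool.Base using (Bool; true; false; if_then_else_)
  open import Data.List.Base using (List; []; _∷_; length)
  open import Data.Nat.Base
  open import Data.Nat.Combinatorics using (_C_; nCk+nC[k+1]≡[n+1]C[k+1]; k>n⇒nCk≡0)
  open import Data.Nat.ListAction using (sum)
  open import Data.Nat.Properties
  open import Data.Product.Base using (proj₁)
  open import Data.Sum.Base using (inj₁; inj₂)
  open import Function.Base using (_∘_)
  open import Relation.Binary.PropositionalEquality
  open import Relation.Nullary using (contradiction)
  open Strips

  Σ< : ℕ → (ℕ → ℕ) → ℕ
  Σ< zero    f = 0
  Σ< (suc n) f = Σ< n f + f n

  Σ<-cong : ∀ n {f g : ℕ → ℕ} → (∀ i → i < n → f i ≡ g i) → Σ< n f ≡ Σ< n g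
  Σ<-cong zero    e = refl
  Σ<-cong (suc n) e = cong₂ _+_ (Σ<-cong n λ i i<n → e i (m≤n⇒m≤1+n i<n)) (e n ≤-refl)

  Σ<-0 : ∀ n → Σ< n (λ _ → 0) ≡ 0
  Σ<-0 zero    = refl
  Σ<-0 (suc n) = trans (+-identityʳ _) (Σ<-0 n)

  Σ<-+ : ∀ n (f g : ℕ → ℕ) → Σ< n (λ i → f i + g i) ≡ Σ< n f + Σ< n g
  Σ<-+ zero    f g = refl
  Σ<-+ (suc n) f g = trans (cong (_+ (f n + g n)) (Σ<-+ n f g)) (interchange (Σ< n f) (Σ< n g) (f n) (g n))

  Σ<-*ʳ : ∀ n (f : ℕ → ℕ) c → Σ< n (λ i → f i * c) ≡ Σ< n f * c
  Σ<-*ʳ zero    f c = refl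
  Σ<-*ʳ (suc n) f c = trans (cong (_+ f n * c) (Σ<-*ʳ n f c)) (sym (*-distribʳ-+ c (Σ< n f) (f n)))

  Σ<-swap : ∀ m n (f : ℕ → ℕ → ℕ) → Σ< m (λ i → Σ< n (f i)) ≡ Σ< n (λ j → Σ< m (λ i → f i j))
  Σ<-swap zero    n f = sym (Σ<-0 n)
  Σ<-swap (suc m) n f = trans (cong (_+ Σ< n (f m)) (Σ<-swap m n f)) (sym (Σ<-+ n _ (f m)))

  Σ<-head : ∀ n (f : ℕ → ℕ) → Σ< (suc n) f ≡ f 0 + Σ< n (f ∘ suc)
  Σ<-head zero    f = sym (+-identityʳ _)
  Σ<-head (suc n) f = trans (cong (_+ f (suc n)) (Σ<-head n f)) (+-assoc (f 0) _ _)

  when-Σ : ∀ b n (f : ℕ → ℕ) → when b (Σ< n f) ≡ Σ< n (when b ∘ f)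
  when-Σ true  n f = refl
  when-Σ false n f = sym (Σ<-0 n)

  when-* : ∀ b m n → when b m * n ≡ when b (m * n)
  when-* true  m n = refl
  when-* false m n = refl

  pick : ℕ → (ℕ → ℕ) → (ℕ → ℕ) → ℕ → ℕ
  pick c f g i = if i <ᵇ c then f i else g i

  pick-cong : ∀ c i {f g f′ g′ : ℕ → ℕ} → (i < c → f i ≡ f′ i) → g i ≡ g′ i → pick c f g i ≡ pick c f′ g′ i
  pick-cong c i e e′ with i <ᵇ c in eq
  ... | true  = e (<ᵇ≡⇒< {i} {c} eq)
  ... | false = e′

  pick-*Σ : ∀ c i n (f g : ℕ → ℕ → ℕ) (w : ℕ → ℕ) →
            Σ< n (λ m → pick c (f m) (g m) i * w m) ≡
            pick c (λ i → Σ< n (λ m → f m i * w m)) (λ i → Σ< n (λ m → g m i * w m)) i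
  pick-*Σ c i n f g w with i <ᵇ c
  ... | true  = refl
  ... | false = refl

  -- The index stands for the row of the previous cell of a tableau: a cell added in row `c` creates
  -- no descent if that row is below `c` (first function) and creates one otherwise (second
  -- function).
  mix : ℕ → ℕ → (ℕ → ℕ) → (ℕ → ℕ) → ℕ
  mix n c f g = Σ< n (pick c f g)

  -- Only the term at `c` changes sides; it appears on both sides because ℕ has no subtraction.
  mix-suc : ∀ n c (f g : ℕ → ℕ) → c < n → mix n (suc c) f g + g c ≡ mix n c f g + f c
  mix-suc (suc n) c f g c<n with m≤n⇒m<n∨m≡n (s≤s⁻¹ c<n)

  ... | inj₁ c<n′ rewrite ≥⇒<ᵇ≡ {n} {c} (<⇒≤ c<n′) | ≥⇒<ᵇ≡ {n} {suc c} c<n′ =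
    trans (xy∙z≡xz∙y (mix n (suc c) f g) (g n) (g c))
      (trans (cong (_+ g n) (mix-suc n c f g c<n′)) (xy∙z≡xz∙y (mix n c f g) (f c) (g n)))
    where
    xy∙z≡xz∙y : ∀ x y z → x + y + z ≡ x + z + y
    xy∙z≡xz∙y x y z = trans (+-assoc x y z) (trans (cong (x +_) (+-comm y z)) (sym (+-assoc x z y)))
  ... | inj₂ refl rewrite <⇒<ᵇ≡ {c} {suc c} ≤-refl | ≥⇒<ᵇ≡ {c} {c} ≤-refl =
    trans (cong (λ t → t + f c + g c) (Σ<-cong c below))
      (trans (+-assoc _ (f c) (g c)) (trans (cong (mix c c f g +_) (+-comm (f c) (g c))) (sym (+-assoc _ (g c) (f c)))))
    where
    below : ∀ i → i < c → pick (suc c) f g i ≡ pick c f g i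
    below i i<c rewrite <⇒<ᵇ≡ i<c | <⇒<ᵇ≡ (m≤n⇒m≤1+n i<c) = refl

  module _ (L : ℕ) where

    -- The number of standard tableaux of shape xs (of size n) with m − 1 descents of the
    -- transposed tableau whose last cell is in row c. The empty tableau counts as m = 0, c = L.
    b : ℕ → ℕ → List ℕ → ℕ → ℕ
    b zero    zero    xs c = if c ≡ᵇ L then 1 else 0
    b zero    (suc m) xs c = 0
    b (suc n) zero    xs c = 0
    b (suc n) (suc m) xs c = when (removable c xs) (mix (suc L) c (b n (suc m) (dec c xs)) (b n m (dec c xs)))

    b-vanish : ∀ n m xs c → n < m → b n m xs c ≡ 0
    b-vanish zero    (suc m) xs c _         = refl
    b-vanish (suc n) (suc m) xs c (s≤s n<m) = trans
      (when-cong (removable c xs) λ _ → trans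
        (Σ<-cong (suc L) λ i _ → pick-cong c i
          {b n (suc m) (dec c xs)} {b n m (dec c xs)} {λ _ → 0} {λ _ → 0}
          (λ _ → b-vanish n (suc m) (dec c xs) i (m≤n⇒m≤1+n n<m)) (b-vanish n m (dec c xs) i n<m))
        (trans (Σ<-cong (suc L) λ i _ → pick-0 i) (Σ<-0 (suc L))))
      (when-0 (removable c xs))
      where
      pick-0 : ∀ i → pick c (λ _ → 0) (λ _ → 0) i ≡ 0
      pick-0 i with i <ᵇ c
      ... | true  = refl
      ... | false = refl

    -- A standard tableau with m - 1 descents has C(N + n - m, n) labellings by 1, ..., N that
    -- increase weakly along the cells and strictly at the descents. This is the number of labelled
    -- tableaux whose last cell is in row `c`.
    labelled : ℕ → ℕ → List ℕ → ℕ → ℕ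
    labelled N n xs c = Σ< (suc n) (λ m → b n m xs c * ((N + n ∸ m) C n))

    labelled-suc : ∀ N n xs c → labelled N (suc n) xs c ≡
             Σ< (suc n) (λ m → b (suc n) (suc m) xs c * ((N + n ∸ m) C suc n))
    labelled-suc N n xs c = trans (Σ<-head (suc n) _)
      (Σ<-cong (suc n) λ m _ → cong (λ t → b (suc n) (suc m) xs c * ((t ∸ suc m) C suc n)) (+-suc N n))

    pascal : ∀ N n m → m ≤ n → (suc N + n ∸ m) C suc n ≡ (N + n ∸ m) C suc n + (N + n ∸ m) C n
    pascal N n m m≤n = trans (cong (_C suc n) (+-∸-assoc 1 (≤-trans m≤n (m≤n+m n N))))
      (trans (sym (nCk+nC[k+1]≡[n+1]C[k+1] (N + n ∸ m) n)) (+-comm ((N + n ∸ m) C n) _))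

    -- Pascal's rule separates the labellings without the label `suc N` from those in which the last
    -- cell carries it. In the latter, the previous cell may carry it too if there is no descent
    -- between them, that is if its row is below `c`.
    labelled-step : ∀ N n xs c → c ≤ L → labelled (suc N) (suc n) xs c ≡
              labelled N (suc n) xs c +
              when (removable c xs) (mix (suc L) c (labelled (suc N) n (dec c xs)) (labelled N n (dec c xs)))
    labelled-step N n xs c c≤L = begin
      labelled (suc N) (suc n) xs c
        ≡⟨ labelled-suc (suc N) n xs c ⟩
      Σ< (suc n) (λ m → b (suc n) (suc m) xs c * ((suc N + n ∸ m) C suc n))
        ≡⟨ Σ<-cong (suc n) (λ m m<n → trans
             (cong (b (suc n) (suc m) xs c *_) (pascal N n m (s≤s⁻¹ m<n)))
             (*-distribˡ-+ (b (suc n) (suc m) xs c) _ _)) ⟩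
      Σ< (suc n) (λ m → b (suc n) (suc m) xs c * ((N + n ∸ m) C suc n)
                      + b (suc n) (suc m) xs c * w m)
        ≡⟨ Σ<-+ (suc n) _ _ ⟩
      Σ< (suc n) (λ m → b (suc n) (suc m) xs c * ((N + n ∸ m) C suc n))
        + Σ< (suc n) (λ m → b (suc n) (suc m) xs c * w m)
        ≡⟨ cong₂ _+_ (sym (labelled-suc N n xs c)) second ⟩
      labelled N (suc n) xs c + when r (mix (suc L) c (labelled (suc N) n ys) (labelled N n ys)) ∎
      where
      open ≡-Reasoning
      r = removable c xs
      ys = dec c xs
      w : ℕ → ℕ
      w m = (N + n ∸ m) C n
      b-zero : ∀ n i → i < c → b n 0 ys i ≡ 0
      b-zero (suc n) i i<c = refl
      b-zero zero    i i<c with i ≡ᵇ L in e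
      ... | true  = contradiction (≡ᵇ⇒≡ i L (subst Data.Bool.Base.T (sym e) _)) (<⇒≢ (<-≤-trans i<c c≤L))
      ... | false = refl
      -- Shifting `m` drops the term `suc n`, which exceeds the number of cells, and adds the term
      -- 0, which belongs to the empty tableau alone and thus to row `L`, never below `c`.
      first : ∀ i → i < c → Σ< (suc n) (λ m → b n (suc m) ys i * w m) ≡ labelled (suc N) n ys i
      first i i<c = begin
        Σ< n (λ m → b n (suc m) ys i * w m) + b n (suc n) ys i * w n
          ≡⟨ cong (λ t → Σ< n (λ m → b n (suc m) ys i * w m) + t * w n) (b-vanish n (suc n) ys i ≤-refl) ⟩
        Σ< n (λ m → b n (suc m) ys i * w m) + 0
          ≡⟨ +-identityʳ _ ⟩
        Σ< n (λ m → b n (suc m) ys i * w m)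
          ≡⟨ cong (λ t → t * ((suc N + n) C n) + Σ< n (λ m → b n (suc m) ys i * w m)) (b-zero n i i<c) ⟨
        b n 0 ys i * ((suc N + n) C n) + Σ< n (λ m → b n (suc m) ys i * w m)
          ≡⟨ Σ<-head n (λ m → b n m ys i * ((suc N + n ∸ m) C n)) ⟨
        labelled (suc N) n ys i ∎
      second : Σ< (suc n) (λ m → b (suc n) (suc m) xs c * w m) ≡
               when r (mix (suc L) c (labelled (suc N) n ys) (labelled N n ys))
      second = begin
        Σ< (suc n) (λ m → b (suc n) (suc m) xs c * w m)
          ≡⟨ Σ<-cong (suc n) (λ m _ → when-* r _ (w m)) ⟩
        Σ< (suc n) (λ m → when r (mix (suc L) c (b n (suc m) ys) (b n m ys) * w m))
          ≡⟨ when-Σ r (suc n) _ ⟨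
        when r (Σ< (suc n) (λ m → mix (suc L) c (b n (suc m) ys) (b n m ys) * w m))
          ≡⟨ cong (when r) (trans (Σ<-cong (suc n) λ m _ → sym (Σ<-*ʳ (suc L) _ (w m))) (Σ<-swap (suc n) (suc L) _)) ⟩
        when r (Σ< (suc L) (λ i → Σ< (suc n) (λ m → pick c (b n (suc m) ys) (b n m ys) i * w m)))
          ≡⟨ cong (when r) (Σ<-cong (suc L) λ i _ → trans
               (pick-*Σ c i (suc n) (λ m → b n (suc m) ys) (λ m → b n m ys) w)
               (pick-cong c i {λ i → Σ< (suc n) (λ m → b n (suc m) ys i * w m)} {labelled N n ys}
                                  {labelled (suc N) n ys} {labelled N n ys} (first i) refl)) ⟩
        when r (mix (suc L) c (labelled (suc N) n ys) (labelled N n ys)) ∎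

    removable-L : ∀ xs → length xs ≡ L → removable L xs ≡ false
    removable-L xs e = ≥⇒<ᵇ≡ (subst (_≤ xs ‼ suc L) (sym (‼-beyond xs L (≤-reflexive e))) z≤n)

    sum≡0⇒‼≡0 : ∀ xs i → sum xs ≡ 0 → xs ‼ i ≡ 0
    sum≡0⇒‼≡0 []       i       e = refl
    sum≡0⇒‼≡0 (x ∷ xs) zero    e = m+n≡0⇒m≡0 x e
    sum≡0⇒‼≡0 (x ∷ xs) (suc i) e = sum≡0⇒‼≡0 xs i (m+n≡0⇒n≡0 x e)

    ≡ᵇ-refl : ∀ n → (n ≡ᵇ n) ≡ true
    ≡ᵇ-refl zero    = refl
    ≡ᵇ-refl (suc n) = ≡ᵇ-refl n

    -- Row `L` has no cells, so only the empty tableau contributes, and it has one labelling for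
    -- every N.
    labelled-last : ∀ N N′ n xs → length xs ≡ L → labelled N n xs L ≡ labelled N′ n xs L
    labelled-last N N′ zero    xs e = refl
    labelled-last N N′ (suc n) xs e = trans (zero-sum N) (sym (zero-sum N′))
      where
      zero-sum : ∀ N → labelled N (suc n) xs L ≡ 0
      zero-sum N = trans (labelled-suc N n xs L)
        (trans (Σ<-cong (suc n) (λ m _ → cong (λ r → when r (mix (suc L) L (b n (suc m) (dec L xs)) (b n m (dec L xs))) * ((N + n ∸ m) C suc n)) (removable-L xs e)))
               (Σ<-0 (suc n)))

    -- Without labels only the empty tableau counts: for a nonempty one the upper argument of the
    -- binomial coefficient is smaller than the lower one.
    labelled-0 : ∀ xs n → sum xs ≡ n → when (empty L xs 0) 1 ≡ Σ< (suc L) (labelled 0 n xs)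
    labelled-0 xs zero e rewrite e | ≡ᵇ-refl L = sym (cong (_+ 1) (trans (Σ<-cong L λ i i<L → off i i<L) (Σ<-0 L)))
      where
      off : ∀ i → i < L → labelled 0 0 xs i ≡ 0
      off i i<L with i ≡ᵇ L in eq
      ... | true  = contradiction (≡ᵇ⇒≡ i L (subst Data.Bool.Base.T (sym eq) _)) (<⇒≢ i<L)
      ... | false = refl
    labelled-0 xs (suc n) e rewrite e = sym (trans (Σ<-cong (suc L) (λ i _ → trans (labelled-suc 0 n xs i)
      (trans (Σ<-cong (suc n) λ m _ → trans (cong (b (suc n) (suc m) xs i *_) (k>n⇒nCk≡0 (s≤s (m∸n≤m n m))))
                                            (*-zeroʳ (b (suc n) (suc m) xs i))) (Σ<-0 (suc n))))) (Σ<-0 (suc L)))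

    -- Reading the N strips of a chain as labels turns the chain into a labelled standard tableau:
    -- inside one strip the cells are numbered from the bottom row up. This is proved together with
    -- the refinement that follows.
    S-labelled : ∀ N n xs → Shape L xs → sum xs ≡ n → S L N xs 0 ≡ Σ< (suc L) (labelled N n xs)
    -- The last of `suc N` strips is confined to the rows below `c`. Hence the last cell lies below
    -- `c` if it has the label `suc N`, and in any row otherwise.
    D-S : ∀ N c n xs → c ≤ L → Shape L xs → sum xs ≡ n →
          D c (S L N) xs 0 ≡ mix (suc L) c (labelled (suc N) n xs) (labelled N n xs)
    S-labelled zero    n xs sh e = labelled-0 xs n e
    S-labelled (suc N) n xs sh e = trans (D-S N L n xs ≤-refl sh e)
      (cong₂ _+_ (Σ<-cong L λ i i<L → cong (λ t → if t then labelled (suc N) n xs i else labelled N n xs i) (<⇒<ᵇ≡ i<L))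
        (trans (cong (λ t → if t then labelled (suc N) n xs L else labelled N n xs L) (≥⇒<ᵇ≡ {L} {L} ≤-refl))
               (labelled-last N (suc N) n xs (proj₁ sh))))
    D-S N zero    n xs c≤L sh e = S-labelled N n xs sh e
    -- The term of row `c` with the smaller label bound is added to both sides, so that `mix-suc`
    -- can exchange it for the one with the larger bound.
    D-S N (suc c) n xs c<L sh e = +-cancelʳ-≡ (labelled N n xs c) _ _ (begin
      D c (S L N) xs 0 + when r (D c (S L N) (dec c xs) 0) + labelled N n xs c
        ≡⟨ cong (λ t → t + when r (D c (S L N) (dec c xs) 0) + labelled N n xs c) (D-S N c n xs (<⇒≤ c<L) sh e) ⟩
      mix (suc L) c f g + when r (D c (S L N) (dec c xs) 0) + labelled N n xs c
        ≡⟨ trans (+-assoc (mix (suc L) c f g) _ _) (cong (mix (suc L) c f g +_) (trans (+-comm _ (labelled N n xs c)) (sym (last n e)))) ⟩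
      mix (suc L) c f g + labelled (suc N) n xs c
        ≡⟨ mix-suc (suc L) c f g (m≤n⇒m≤1+n c<L) ⟨
      mix (suc L) (suc c) f g + labelled N n xs c ∎)
      where
      open ≡-Reasoning
      f = labelled (suc N) n xs
      g = labelled N n xs
      r = removable c xs
      last : ∀ n → sum xs ≡ n → labelled (suc N) n xs c ≡ labelled N n xs c + when r (D c (S L N) (dec c xs) 0)
      last zero e rewrite ≥⇒<ᵇ≡ {xs ‼ suc c} {xs ‼ c} (subst (_≤ xs ‼ suc c) (sym (sum≡0⇒‼≡0 xs c e)) z≤n) =
        sym (+-identityʳ _)
      last (suc n) e = trans (labelled-step N n xs c (<⇒≤ c<L)) (cong (labelled N (suc n) xs c +_)
        (when-cong r λ rem → sym (D-S N c n (dec c xs) (<⇒≤ c<L) (Shape-dec c xs rem sh)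
          (suc-injective (trans (sum-dec c xs (removable⇒pos c xs rem)) e)))))

-- Semistandard tableaux built entry by entry

module Tableaux where

  open import Defs using (Filling; Cell; cell; height; col; entry; rowCells; cellsFrom; cells; Semistandard; count)
  open import Data.Bool.Base using (Bool; true; false)
  import Data.Bool.Properties as Bool
  open import Data.Empty using (⊥)
  open import Data.List.Base using (List; []; _∷_; _++_; length; map; filter; replicate)
  open import Data.List.Properties using (++-assoc; length-++; length-map; filter-accept; filter-reject; filter-none; length-replicate)
  open import Data.List.Membership.Propositional using (_∈_; find)
  open import Data.List.Membership.Propositional.Properties
    using (∈-++⁻; ∈-++⁺ˡ; ∈-++⁺ʳ; ∈-map⁺; ∈-map⁻; ∈-filter⁺; ∈-filter⁻)
  open import Data.List.Membership.Propositional.Properties.WithK using (unique∧set⇒bag)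
  open import Data.List.Relation.Binary.BagAndSetEquality using (∼bag⇒↭)
  open import Data.List.Relation.Binary.Permutation.Propositional
    using (_↭_; ↭-trans; ↭-reflexive; ↭-sym)
  open import Data.List.Relation.Binary.Permutation.Propositional.Properties
    using (shift; ++⁺ˡ; ∈-resp-↭; ↭-length; filter-↭)
  open import Data.List.Relation.Unary.All as All using (All; []; _∷_)
  open import Data.List.Relation.Unary.All.Properties using (¬Any⇒All¬)
  open import Data.List.Relation.Unary.AllPairs using ([]; _∷_)
  open import Data.List.Relation.Unary.Any using (here; there; any?)
  open import Data.List.Relation.Unary.Unique.Propositional using (Unique)
  import Data.List.Relation.Unary.Unique.Propositional.Properties as Unique
  open import Data.Nat.Base
  open import Data.Nat.Combinatorics using (_C_)
  open import Data.Nat.ListAction using (sum)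
  open import Data.Nat.Properties
  open import Data.Product.Base using (_×_; _,_; proj₁; proj₂; ∃)
  open import Data.Sum.Base using (_⊎_; inj₁; inj₂)
  open import Function.Base using (_∘_; case_of_)
  open import Function.Bundles using (mk⇔)
  open import Relation.Binary.PropositionalEquality
  open import Relation.Nullary using (¬_; yes; no; contradiction)
  open import Relation.Nullary.Decidable using (_×-dec_)
  open Strips

  unique-↭ : ∀ {A : Set} {xs ys : List A} → Unique xs → Unique ys →
             (∀ {x} → x ∈ xs → x ∈ ys) → (∀ {x} → x ∈ ys → x ∈ xs) → xs ↭ ys
  unique-↭ u v f g = ∼bag⇒↭ (unique∧set⇒bag u v (mk⇔ f g))

  unique-map : ∀ {A B : Set} {f : A → B} {xs} → (∀ {x y} → x ∈ xs → y ∈ xs → f x ≡ f y → x ≡ y) →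
               Unique xs → Unique (map f xs)
  unique-map inj [] = []
  unique-map {f = f} {x ∷ xs} inj (x∉ ∷ u) =
    All.tabulate (λ {b} b∈ e → let (y , y∈ , e′) = ∈-map⁻ f b∈ in
      All.lookup x∉ y∈ (inj (here refl) (there y∈) (trans e e′)))
    ∷ unique-map (λ p q → inj (there p) (there q)) u

  shape : Filling → List ℕ
  shape = map length

  push : ℕ → ℕ → Filling → Filling
  push h       x []      = []
  push zero    x (R ∷ T) = (R ++ x ∷ []) ∷ T
  push (suc h) x (R ∷ T) = R ∷ push h x T

  initial : List ℕ → List ℕ
  initial []          = []
  initial (x ∷ [])    = []
  initial (x ∷ y ∷ R) = x ∷ initial (y ∷ R)

  pop : ℕ → Filling → Filling
  pop h       []      = []
  pop zero    (R ∷ T) = initial R ∷ T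
  pop (suc h) (R ∷ T) = R ∷ pop h T

  initial-∷ʳ : ∀ R x → initial (R ++ x ∷ []) ≡ R
  initial-∷ʳ []          x = refl
  initial-∷ʳ (y ∷ [])    x = refl
  initial-∷ʳ (y ∷ z ∷ R) x = cong (y ∷_) (initial-∷ʳ (z ∷ R) x)

  snoc-initial : ∀ x R → ∃ λ y → x ∷ R ≡ initial (x ∷ R) ++ y ∷ []
  snoc-initial x []      = x , refl
  snoc-initial x (y ∷ R) with z , e ← snoc-initial y R = z , cong (x ∷_) e

  pop-push : ∀ h x T → pop h (push h x T) ≡ T
  pop-push h       x []      = refl
  pop-push zero    x (R ∷ T) = cong (_∷ T) (initial-∷ʳ R x)
  pop-push (suc h) x (R ∷ T) = cong (R ∷_) (pop-push h x T)

  push-pop : ∀ h T → 0 < shape T ‼ h → ∃ λ x → T ≡ push h x (pop h T)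
  push-pop zero    ((x ∷ R) ∷ T) _ with y , e ← snoc-initial x R = y , cong (_∷ T) e
  push-pop (suc h) (R ∷ T)       p with y , e ← push-pop h T p = y , cong (R ∷_) e

  shape-push : ∀ h x T → shape (push h x T) ≡ inc h (shape T)
  shape-push h       x []      = refl
  shape-push zero    x (R ∷ T) = cong (_∷ shape T) (trans (length-++ R) (+-comm (length R) 1))
  shape-push (suc h) x (R ∷ T) = cong (length R ∷_) (shape-push h x T)

  rowCells-∷ʳ : ∀ r c R x → rowCells r c (R ++ x ∷ []) ≡ rowCells r c R ++ cell r (c + length R) x ∷ []
  rowCells-∷ʳ r c []      x = cong (λ t → cell r t x ∷ []) (sym (+-identityʳ c))
  rowCells-∷ʳ r c (y ∷ R) x = cong (cell r c y ∷_)
    (trans (rowCells-∷ʳ r (suc c) R x) (cong (λ t → rowCells r (suc c) R ++ cell r t x ∷ []) (sym (+-suc c (length R)))))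

  cellsFrom-push : ∀ r h x T → h < length T →
                   cellsFrom r (push h x T) ↭ cell (r + h) (shape T ‼ h) x ∷ cellsFrom r T
  cellsFrom-push r zero x (R ∷ T) _ = ↭-trans
    (↭-reflexive (trans (cong (_++ cellsFrom (suc r) T) (rowCells-∷ʳ r 0 R x)) (++-assoc (rowCells r 0 R) _ _)))
    (subst (λ r′ → rowCells r 0 R ++ cell r (length R) x ∷ cellsFrom (suc r) T ↭
                   cell r′ (length R) x ∷ rowCells r 0 R ++ cellsFrom (suc r) T)
      (sym (+-identityʳ r)) (shift _ (rowCells r 0 R) _))
  cellsFrom-push r (suc h) x (R ∷ T) (s≤s h<l) = ↭-trans
    (++⁺ˡ (rowCells r 0 R) (cellsFrom-push (suc r) h x T h<l))
    (subst (λ r′ → rowCells r 0 R ++ cell (suc r + h) (shape T ‼ h) x ∷ cellsFrom (suc r) T ↭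
                   cell r′ (shape T ‼ h) x ∷ rowCells r 0 R ++ cellsFrom (suc r) T)
      (sym (+-suc r h)) (shift _ (rowCells r 0 R) _))

  cells-push : ∀ h x T → h < length T → cells (push h x T) ↭ cell h (shape T ‼ h) x ∷ cells T
  cells-push = cellsFrom-push 0

  rowCells-bound : ∀ {y} r c R → y ∈ rowCells r c R → height y ≡ r × col y < c + length R
  rowCells-bound r c (x ∷ R) (here refl) = refl , subst (c <_) (sym (+-suc c (length R))) (s≤s (m≤m+n c (length R)))
  rowCells-bound {y} r c (x ∷ R) (there p) with e , q ← rowCells-bound r (suc c) R p =
    e , subst (col y <_) (sym (+-suc c (length R))) q

  cellsFrom-bound : ∀ {y} r T → y ∈ cellsFrom r T → ∃ λ h → height y ≡ r + h × col y < shape T ‼ h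
  cellsFrom-bound r (R ∷ T) p with ∈-++⁻ (rowCells r 0 R) p
  ... | inj₁ q with e , l ← rowCells-bound r 0 R q = 0 , trans e (sym (+-identityʳ r)) , l
  ... | inj₂ q with h , e , l ← cellsFrom-bound (suc r) T q = suc h , trans e (sym (+-suc r h)) , l

  cell-bound : ∀ {y} T → y ∈ cells T → col y < shape T ‼ height y
  cell-bound T p with h , refl , l ← cellsFrom-bound 0 T p = l

  rowCells-exists : ∀ r c R i → i < length R → ∃ λ e → cell r (c + i) e ∈ rowCells r c R
  rowCells-exists r c (x ∷ R) zero    _       = x , here (cong (λ t → cell r t x) (+-identityʳ c))
  rowCells-exists r c (x ∷ R) (suc i) (s≤s p) with e , q ← rowCells-exists r (suc c) R i p =
    e , there (subst (λ t → cell r t e ∈ rowCells r (suc c) R) (sym (+-suc c i)) q)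

  cellsFrom-exists : ∀ r T h c → c < shape T ‼ h → ∃ λ e → cell (r + h) c e ∈ cellsFrom r T
  cellsFrom-exists r (R ∷ T) zero c p with e , q ← rowCells-exists r 0 R c p =
    e , ∈-++⁺ˡ (subst (λ t → cell t c e ∈ rowCells r 0 R) (sym (+-identityʳ r)) q)
  cellsFrom-exists r (R ∷ T) (suc h) c p with e , q ← cellsFrom-exists (suc r) T h c p =
    e , ∈-++⁺ʳ (rowCells r 0 R) (subst (λ t → cell t c e ∈ cellsFrom (suc r) T) (sym (+-suc r h)) q)

  cell-exists : ∀ T h c → c < shape T ‼ h → ∃ λ e → cell h c e ∈ cells T
  cell-exists = cellsFrom-exists 0

  ‼-mono : ∀ {xs i j} → (∀ i → xs ‼ suc i ≤ xs ‼ i) → i ≤ j → xs ‼ j ≤ xs ‼ i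
  ‼-mono {xs} {i} {j} mono i≤j with m≤n⇒m<n∨m≡n i≤j
  ... | inj₂ refl = ≤-refl
  ‼-mono {xs} {i} {suc j} mono i≤j | inj₁ (s≤s i≤j′) = ≤-trans (mono j) (‼-mono {xs} mono i≤j′)

  Ordered : Cell → Cell → Set
  Ordered x y = (height x ≡ height y → col x < col y → entry x ≤ entry y)
              × (col x ≡ col y → height x < height y → entry x < entry y)

  ss-ordered : ∀ T {x y} → Semistandard T → x ∈ cells T → y ∈ cells T → Ordered x y
  ss-ordered T ss x∈ y∈ = All.lookup (All.lookup ss x∈) y∈

  ordered-ss : ∀ T → (∀ {x y} → x ∈ cells T → y ∈ cells T → Ordered x y) → Semistandard T
  ordered-ss T f = All.tabulate λ x∈ → All.tabulate λ y∈ → f x∈ y∈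

  module Push (h x : ℕ) (T : Filling) (h<l : h < length T) where

    new : Cell
    new = cell h (shape T ‼ h) x

    ∈-push⁻ : ∀ {y} → y ∈ cells (push h x T) → y ≡ new ⊎ y ∈ cells T
    ∈-push⁻ p with ∈-resp-↭ (cells-push h x T h<l) p
    ... | here e  = inj₁ e
    ... | there q = inj₂ q

    new∈ : new ∈ cells (push h x T)
    new∈ = ∈-resp-↭ (↭-sym (cells-push h x T h<l)) (here refl)

    old∈ : ∀ {y} → y ∈ cells T → y ∈ cells (push h x T)
    old∈ p = ∈-resp-↭ (↭-sym (cells-push h x T h<l)) (there p)

    pop-ss : Semistandard (push h x T) → Semistandard T
    pop-ss ss = ordered-ss T λ p q → ss-ordered (push h x T) ss (old∈ p) (old∈ q)

    -- The new cell ends its row, and no cell of a diagram lies above a free place, so only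
    -- comparisons with older cells to its left or below remain.
    push-ss : (∀ i → shape T ‼ suc i ≤ shape T ‼ i) → Semistandard T →
              (∀ {y} → y ∈ cells T → entry y ≤ x × (col y ≡ shape T ‼ h → entry y < x)) →
              Semistandard (push h x T)
    push-ss mono ss le = ordered-ss (push h x T) λ p q → order (∈-push⁻ p) (∈-push⁻ q)
      where
      order : ∀ {y z} → y ≡ new ⊎ y ∈ cells T → z ≡ new ⊎ z ∈ cells T → Ordered y z
      order (inj₁ refl) (inj₁ refl) = (λ _ p → contradiction p (<-irrefl refl)) , (λ _ p → contradiction p (<-irrefl refl))
      order (inj₁ refl) (inj₂ q) =
        (λ { refl p → contradiction (cell-bound T q) (<-asym p) }) ,
        (λ { refl p → contradiction (<-≤-trans (cell-bound T q) (‼-mono {shape T} mono (<⇒≤ p))) (<-irrefl refl) })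
      order (inj₂ p) (inj₁ refl) = (λ _ _ → proj₁ (le p)) , (λ e _ → proj₂ (le p) e)
      order (inj₂ p) (inj₂ q) = ss-ordered T ss p q

  content : Filling → ℕ → ℕ
  content T e = count (λ y → entry y ≟ e) (cells T)

  content-push : ∀ h x T → h < length T → content (push h x T) x ≡ suc (content T x)
  content-push h x T h<l = trans (↭-length (filter-↭ (λ y → entry y ≟ x) (cells-push h x T h<l)))
    (cong length (filter-accept (λ y → entry y ≟ x) {cell h (shape T ‼ h) x} refl))

  content-push-≢ : ∀ h x e T → h < length T → x ≢ e → content (push h x T) e ≡ content T e
  content-push-≢ h x e T h<l x≢e = trans (↭-length (filter-↭ (λ y → entry y ≟ e) (cells-push h x T h<l)))
    (cong length (filter-reject (λ y → entry y ≟ e) {cell h (shape T ‼ h) x} x≢e))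

  content-0 : ∀ T e → (∀ {y} → y ∈ cells T → entry y ≢ e) → content T e ≡ 0
  content-0 T e f = cong length (filter-none (λ y → entry y ≟ e) (All.tabulate f))

  module Removal {L : ℕ} (T : Filling) (sh : Shape L (shape T)) (ss : Semistandard T) where

    -- A cell above the end of row `h` would have an entry larger than the maximum `x`.
    top⇒removable : ∀ h c x → shape T ‼ h ≡ suc c → cell h c x ∈ cells T →
                    (∀ {y} → y ∈ cells T → entry y ≤ x) → removable h (shape T) ≡ true
    top⇒removable h c x e z∈ max with shape T ‼ suc h <? shape T ‼ h
    ... | yes p = <⇒<ᵇ≡ p
    ... | no  p with v , w∈ ← cell-exists T (suc h) c (subst (_≤ shape T ‼ suc h) e (≮⇒≥ p)) =
      contradiction (proj₂ (ss-ordered T ss z∈ w∈) refl ≤-refl) (≤⇒≯ (max w∈))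

  module _ (L : ℕ) (μ : ℕ → ℕ) where

    record Tab (N : ℕ) (T : Filling) : Set where
      field
        shapely  : Shape L (shape T)
        ss       : Semistandard T
        entries  : ∀ {y} → y ∈ cells T → 1 ≤ entry y × entry y ≤ N
        contents : ∀ {i} → i < N → content T (suc i) ≡ μ i

    -- An intermediate stage in placing the entries `suc N`: they are placed from the top row down,
    -- the rows `r` and above have been treated, and `k` of them are present.
    record PartialTab (N r k : ℕ) (T : Filling) : Set where
      field
        shapely  : Shape L (shape T)
        ss       : Semistandard T
        entries  : ∀ {y} → y ∈ cells T → 1 ≤ entry y × entry y ≤ suc N
        high     : ∀ {y} → y ∈ cells T → entry y ≡ suc N → r ≤ height y
        contents : ∀ {i} → i < N → content T (suc i) ≡ μ i
        top      : content T (suc N) ≡ k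

    height<L : ∀ T {y} → Shape L (shape T) → y ∈ cells T → height y < L
    height<L T {y} (e , _) y∈ = subst (height y <_) e (‼-pos⇒< (shape T) (height y) (≤-<-trans z≤n (cell-bound T y∈)))

    Tab⇒Partial : ∀ {N T} → Tab N T → PartialTab N L 0 T
    Tab⇒Partial {N} {T} t = record
      { shapely = shapely ; ss = ss
      ; entries = λ p → proj₁ (entries p) , m≤n⇒m≤1+n (proj₂ (entries p))
      ; high = λ p e → contradiction e (<⇒≢ (s≤s (proj₂ (entries p))))
      ; contents = contents
      ; top = content-0 T (suc N) λ p → <⇒≢ (s≤s (proj₂ (entries p))) }
      where open Tab t

    Partial⇒Tab : ∀ {N k T} → PartialTab N L k T → Tab N T × k ≡ 0
    Partial⇒Tab {N} {k} {T} t = record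
      { shapely = shapely ; ss = ss
      ; entries = λ p → proj₁ (entries p) , s≤s⁻¹ (≤∧≢⇒< (proj₂ (entries p)) (≢top p))
      ; contents = contents } , trans (sym top) (content-0 T (suc N) ≢top)
      where
      open PartialTab t
      ≢top : ∀ {y} → y ∈ cells T → entry y ≢ suc N
      ≢top p e = contradiction (height<L T shapely p) (≤⇒≯ (high p e))

    Partial-weaken : ∀ {N r k T} → PartialTab N (suc r) k T → PartialTab N r k T
    Partial-weaken t = record
      { shapely = shapely ; ss = ss ; entries = entries
      ; high = λ p e → <⇒≤ (high p e) ; contents = contents ; top = top }
      where open PartialTab t

    Partial-push : ∀ {N r k T} → r < L → addable r (shape T) ≡ true → PartialTab N r k T →
                   PartialTab N r (suc k) (push r (suc N) T)
    Partial-push {N} {r} {k} {T} r<L add t = record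
      { shapely = subst (Shape L) (sym (shape-push r (suc N) T)) (Shape-inc r (shape T) r<L add shapely)
      ; ss = push-ss (proj₂ shapely) ss λ {y} p → proj₂ (entries p) , λ e →
          ≤∧≢⇒< (proj₂ (entries p)) λ e′ → <-irrefl refl
            (<-≤-trans (subst (_< shape T ‼ height y) e (cell-bound T p))
                       (‼-mono {shape T} (proj₂ shapely) (high p e′)))
      ; entries = λ p → case ∈-push⁻ p of λ { (inj₁ refl) → s≤s z≤n , ≤-refl ; (inj₂ q) → entries q }
      ; high = λ p e → case ∈-push⁻ p of λ { (inj₁ refl) → ≤-refl ; (inj₂ q) → high q e }
      ; contents = λ i<N → trans (content-push-≢ r (suc N) _ T r<l (<⇒≢ (s≤s i<N) ∘ sym)) (contents i<N)
      ; top = trans (content-push r (suc N) T r<l) (cong suc top) }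
      where
      open PartialTab t
      r<l : r < length T
      r<l = subst (r <_) (sym (trans (sym (length-map length T)) (proj₁ shapely))) r<L
      open Push r (suc N) T r<l

    -- If `suc N` occurs in row `r`, it also ends that row, since rows increase weakly and no entry
    -- is larger. Nothing lies above that last cell, so it can be taken off.
    Partial-cases : ∀ {N r k T} → r < L → PartialTab N r k T → PartialTab N (suc r) k T ⊎
      (∃ λ T′ → ∃ λ k′ → T ≡ push r (suc N) T′ × k ≡ suc k′ × addable r (shape T′) ≡ true × PartialTab N r k′ T′)
    Partial-cases {N} {r} {k} {T} r<L t with any? (λ y → height y ≟ r ×-dec entry y ≟ suc N) (cells T)
    ... | no none = inj₁ record
      { shapely = shapely ; ss = ss ; entries = entries
      ; high = λ p e → ≤∧≢⇒< (high p e) λ e′ → All.lookup (¬Any⇒All¬ _ none) p (sym e′ , e)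
      ; contents = contents ; top = top }
      where open PartialTab t
    ... | yes some with y , y∈ , h≡ , e ← find some
                   with x , T≡ ← push-pop r T (subst (λ h → 0 < shape T ‼ h) h≡ (≤-<-trans z≤n (cell-bound T y∈))) =
      inj₂ (T′ , pred k , trans T≡ (cong (λ v → push r v T′) x≡) , k≡ , add , record
        { shapely = subst (Shape L) (sym shape′) (Shape-dec r (shape T) rem shapely)
        ; ss = pop-ss (subst Semistandard T≡ ss)
        ; entries = λ p → entries (old p)
        ; high = λ p → high (old p)
        ; contents = λ i<N → trans (sym (content-push-≢ r (suc N) _ T′ r<l (<⇒≢ (s≤s i<N) ∘ sym)))
                                   (trans (cong (λ T → content T _) (sym T≡′)) (contents i<N))
        ; top = suc-injective (trans (trans (sym (content-push r (suc N) T′ r<l))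
                  (cong (λ T → content T (suc N)) (sym T≡′))) (trans top k≡)) })
      where
      open PartialTab t
      T′ = pop r T
      shape≡ : shape T ≡ inc r (shape T′)
      shape≡ = trans (cong shape T≡) (shape-push r x T′)
      shape′ : shape T′ ≡ dec r (shape T)
      shape′ = trans (sym (dec-inc r (shape T′))) (cong (dec r) (sym shape≡))
      r<l : r < length T′
      r<l = subst (r <_) (trans (sym (proj₁ shapely)) (trans (cong length shape≡)
              (trans (length-inc r (shape T′)) (length-map length T′)))) r<L
      open Push r x T′ r<l
      old : ∀ {y} → y ∈ cells T′ → y ∈ cells T
      old p = subst (λ T → _ ∈ cells T) (sym T≡) (old∈ p)
      z∈ : new ∈ cells T
      z∈ = subst (λ T → new ∈ cells T) (sym T≡) new∈
      x≥ : suc N ≤ x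
      x≥ with ∈-push⁻ (subst (λ T → y ∈ cells T) T≡ y∈)
      ... | inj₁ refl = ≤-reflexive (sym e)
      ... | inj₂ q    = subst (_≤ x) e (proj₁ (ss-ordered T ss y∈ z∈) h≡ (subst (λ h → col y < shape T′ ‼ h) h≡ (cell-bound T′ q)))
      x≡ : x ≡ suc N
      x≡ = ≤-antisym (proj₂ (entries z∈)) x≥
      T≡′ : T ≡ push r (suc N) T′
      T≡′ = trans T≡ (cong (λ v → push r v T′) x≡)
      rem : removable r (shape T) ≡ true
      rem = Removal.top⇒removable T shapely ss r (shape T′ ‼ r) x
        (trans (cong (_‼ r) shape≡) (‼-inc r (shape T′) (subst (r <_) (sym (length-map length T′)) r<l)))
        z∈ (λ p → subst (_ ≤_) (sym x≡) (proj₂ (entries p)))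
      add : addable r (shape T′) ≡ true
      add = subst (λ s → addable r s ≡ true) (sym shape′) (addable-dec L r (shape T) rem shapely)
      k≡ : k ≡ suc (pred k)
      k≡ = trans (sym top) (trans (cong (λ T → content T (suc N)) T≡′) (trans (content-push r (suc N) T′ r<l)
        (cong suc (cong pred (trans (sym (content-push r (suc N) T′ r<l)) (trans (cong (λ T → content T (suc N)) (sym T≡′)) top))))))

    extend : ℕ → ℕ → List Filling → List Filling
    extend x r xs = map (push r x) (filter (λ T → addable r (shape T) Bool.≟ true) xs)

    -- The fillings with k entries suc N, all of them in the rows r, …, r + j − 1.
    partials : ℕ → List Filling → ℕ → ℕ → ℕ → List Filling
    partials N base zero    r zero    = base
    partials N base zero    r (suc k) = []
    partials N base (suc j) r zero    = partials N base j (suc r) zero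
    partials N base (suc j) r (suc k) =
      partials N base j (suc r) (suc k) ++ extend (suc N) r (partials N base (suc j) r k)

    tabs : ℕ → List Filling
    tabs zero    = replicate L [] ∷ []
    tabs (suc N) = partials N (tabs N) L 0 (μ N)

    -- An enumeration without repetitions, so that lengths of lists count tableaux.
    record Lists (P : Filling → Set) (xs : List Filling) : Set where
      field
        unique   : Unique xs
        sound    : ∀ {T} → T ∈ xs → P T
        complete : ∀ {T} → P T → T ∈ xs

    empty-rows : ∀ L r → cellsFrom r (replicate L []) ≡ []
    empty-rows zero    r = refl
    empty-rows (suc L) r = empty-rows L (suc r)

    empty-shape : ∀ L i → shape (replicate L []) ‼ i ≡ 0
    empty-shape zero    i       = refl
    empty-shape (suc L) zero    = refl
    empty-shape (suc L) (suc i) = empty-shape L i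

    no-cells⇒empty : ∀ T r → (∀ {y} → ¬ (y ∈ cellsFrom r T)) → T ≡ replicate (length T) []
    no-cells⇒empty []            r f = refl
    no-cells⇒empty ([] ∷ T)      r f = cong ([] ∷_) (no-cells⇒empty T (suc r) f)
    no-cells⇒empty ((x ∷ R) ∷ T) r f = contradiction (here refl) f

    tabs-0 : Lists (Tab 0) (tabs 0)
    tabs-0 = record
      { unique = [] ∷ []
      ; sound = λ { (here refl) → record
          { shapely = trans (length-map length (replicate L [])) (length-replicate L) ,
              λ i → ≤-trans (≤-reflexive (empty-shape L (suc i))) z≤n
          ; ss = subst (λ c → All (λ x → All (Ordered x) c) c) (sym (empty-rows L 0)) []
          ; entries = λ p → contradiction (subst (_ ∈_) (empty-rows L 0) p) λ ()
          ; contents = λ () } }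
      ; complete = λ {T} t → here (trans (no-cells⇒empty T 0 λ p → contradiction
          (≤-trans (proj₁ (Tab.entries t p)) (proj₂ (Tab.entries t p))) λ ())
          (cong (λ l → replicate l []) (trans (sym (length-map length T)) (proj₁ (Tab.shapely t))))) }

    push-injective : ∀ {r x T T′} → push r x T ≡ push r x T′ → T ≡ T′
    push-injective {r} {x} {T} {T′} e = trans (sym (pop-push r x T)) (trans (cong (pop r) e) (pop-push r x T′))

    Partial-none : ∀ {N r xs} → r < L → Lists (PartialTab N (suc r) 0) xs → Lists (PartialTab N r 0) xs
    Partial-none r<L l = record
      { unique = unique ; sound = λ p → Partial-weaken (sound p)
      ; complete = λ t → case Partial-cases r<L t of λ
          { (inj₁ t′) → complete t′ ; (inj₂ (T′ , k′ , _ , () , _)) } }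
      where open Lists l

    Partial-extend : ∀ {N r k xs ys} → r < L → Lists (PartialTab N (suc r) (suc k)) xs →
                     Lists (PartialTab N r k) ys → Lists (PartialTab N r (suc k)) (xs ++ extend (suc N) r ys)
    Partial-extend {N} {r} {k} {xs} {ys} r<L l l′ = record
      { unique = Unique.++⁺ S.unique
          (unique-map (λ _ _ → push-injective) (Unique.filter⁺ _ K.unique))
          λ (p , q) → disjoint p q
      ; sound = λ p → case ∈-++⁻ xs p of λ
          { (inj₁ q) → Partial-weaken (S.sound q)
          ; (inj₂ q) → let (T′ , q′ , e′) = ∈-map⁻ _ q
                           (q″ , a) = ∈-filter⁻ _ {xs = ys} q′
                       in subst (PartialTab N r (suc k)) (sym e′) (Partial-push r<L a (K.sound q″)) }
      ; complete = λ t → case Partial-cases r<L t of λ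
          { (inj₁ t′) → ∈-++⁺ˡ (S.complete t′)
          ; (inj₂ (T′ , k′ , refl , refl , a , t′)) →
              ∈-++⁺ʳ xs (∈-map⁺ _ (∈-filter⁺ _ (K.complete t′) a)) } }
      where
      module S = Lists l
      module K = Lists l′
      -- A member of the second list has `suc N` in row `r`, while a member of the first has it only
      -- in higher rows.
      disjoint : ∀ {T} → T ∈ xs → T ∈ extend (suc N) r ys → ⊥
      disjoint p q with T′ , q′ , refl ← ∈-map⁻ _ q
                   with q″ , _ ← ∈-filter⁻ _ {xs = ys} q′ =
        contradiction (PartialTab.high (S.sound p) (Push.new∈ r (suc N) T′
          (subst (r <_) (trans (sym (proj₁ (PartialTab.shapely (K.sound q″)))) (length-map length T′)) r<L)) refl)
          (<-irrefl refl)

    partials-lists : ∀ {N base} → Lists (Tab N) base → ∀ j r k → r + j ≡ L →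
                     Lists (PartialTab N r k) (partials N base j r k)
    partials-lists {N} {base} b zero r k e with trans (sym (+-identityʳ r)) e
    partials-lists {N} {base} b zero r zero    e | refl = record
      { unique = Lists.unique b
      ; sound = λ p → Tab⇒Partial (Lists.sound b p)
      ; complete = λ t → Lists.complete b (proj₁ (Partial⇒Tab t)) }
    partials-lists {N} {base} b zero r (suc k) e | refl = record
      { unique = [] ; sound = λ () ; complete = λ t → contradiction (proj₂ (Partial⇒Tab t)) λ () }
    partials-lists {N} {base} b (suc j) r zero e =
      Partial-none (subst (r <_) e (m<m+n r (s≤s z≤n)))
        (partials-lists b j (suc r) zero (trans (sym (+-suc r j)) e))
    partials-lists {N} {base} b (suc j) r (suc k) e =
      Partial-extend (subst (r <_) e (m<m+n r (s≤s z≤n)))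
        (partials-lists b j (suc r) (suc k) (trans (sym (+-suc r j)) e)) (partials-lists b (suc j) r k e)

    tabs-lists : ∀ N → Lists (Tab N) (tabs N)
    tabs-lists zero    = tabs-0
    tabs-lists (suc N) = record
      { unique = unique
      ; sound = λ p → let open PartialTab (sound p) in record
          { shapely = shapely ; ss = ss ; entries = entries
          ; contents = λ {i} i<1+N → case m≤n⇒m<n∨m≡n (s≤s⁻¹ i<1+N) of λ
              { (inj₁ i<N) → contents i<N ; (inj₂ refl) → top } }
      ; complete = λ t → let open Tab t in complete (record
          { shapely = shapely ; ss = ss ; entries = entries ; high = λ _ _ → z≤n
          ; contents = λ i<N → contents (m≤n⇒m≤1+n i<N) ; top = contents ≤-refl }) }
      where open Lists (partials-lists (tabs-lists N) L 0 (μ N) refl)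

    total : (List ℕ → ℕ) → List Filling → ℕ
    total G xs = sum (map (G ∘ shape) xs)

    total-++ : ∀ G xs ys → total G (xs ++ ys) ≡ total G xs + total G ys
    total-++ G []       ys = refl
    total-++ G (T ∷ xs) ys = trans (cong (G (shape T) +_) (total-++ G xs ys)) (sym (+-assoc (G (shape T)) _ _))

    total-extend : ∀ G x r xs → total G (extend x r xs) ≡ total (λ s → when (addable r s) (G (inc r s))) xs
    total-extend G x r []       = refl
    total-extend G x r (T ∷ xs) with addable r (shape T) in e
    ... | true  = cong₂ _+_ (cong G (shape-push r x T)) (total-extend G x r xs)
    ... | false = total-extend G x r xs

    total-cong : ∀ G H xs → (∀ {T} → T ∈ xs → G (shape T) ≡ H (shape T)) → total G xs ≡ total H xs
    total-cong G H []       e = refl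
    total-cong G H (T ∷ xs) e = cong₂ _+_ (e (here refl)) (total-cong G H xs (e ∘ there))

    total-+ : ∀ G H xs → total (λ s → G s + H s) xs ≡ total G xs + total H xs
    total-+ G H []       = refl
    total-+ G H (T ∷ xs) = trans (cong (G (shape T) + H (shape T) +_) (total-+ G H xs)) (interchange (G (shape T)) _ _ _)

    total-* : ∀ c G xs → total (λ s → c * G s) xs ≡ c * total G xs
    total-* c G []       = sym (*-zeroʳ c)
    total-* c G (T ∷ xs) = trans (cong (c * G (shape T) +_) (total-* c G xs)) (sym (*-distribˡ-+ c (G (shape T)) _))

    -- The coefficient of xᵏ in Σᵢ xⁱ Σ_{T ∈ f i} G(shape T): the number of new entries and the
    -- exponent in `G` add up to `k`.
    convolve : (ℕ → List Filling) → Fn → ℕ → ℕ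
    convolve f G zero    = total (λ s → G s 0) (f 0)
    convolve f G (suc k) = total (λ s → G s (suc k)) (f 0) + convolve (f ∘ suc) G k

    -- One step of the geometric series under the sum. It has the form of the recursion by which
    -- `partials` treats row `r`.
    convolve-E : ∀ f r G k → convolve f (E r G) (suc k) ≡ convolve f G (suc k) + convolve f (E r (u r G)) k
    convolve-E f r G zero = trans
      (cong (_+ total (λ s → G s 0) (f 1)) (total-+ (λ s → G s 1) (λ s → u r G s 0) (f 0)))
      (xy∙z≡xz∙y (total (λ s → G s 1) (f 0)) _ _)
      where
      xy∙z≡xz∙y : ∀ x y z → x + y + z ≡ x + z + y
      xy∙z≡xz∙y x y z = trans (+-assoc x y z) (trans (cong (x +_) (+-comm y z)) (sym (+-assoc x z y)))
    convolve-E f r G (suc k) = trans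
      (cong₂ _+_
        (trans (total-cong (λ s → E r G s (suc (suc k))) (λ s → G s (suc (suc k)) + E r (u r G) s (suc k)) (f 0) λ {T} _ → E-unfoldʳ r G (shape T) (suc k))
               (total-+ (λ s → G s (suc (suc k))) (λ s → E r (u r G) s (suc k)) (f 0)))
        (convolve-E (f ∘ suc) r G k))
      (interchange (total (λ s → G s (suc (suc k))) (f 0)) _ _ _)

    -- Adding a cell in row `r` to the tableaux is adjoint to applying `u r` to functions of the
    -- shape.
    convolve-split : ∀ f g x r G k → convolve (λ i → f i ++ extend x r (g i)) G k ≡
                     convolve f G k + convolve g (u r G) k
    convolve-split f g x r G zero = trans (total-++ (λ s → G s 0) (f 0) _) (cong (total (λ s → G s 0) (f 0) +_) (total-extend (λ s → G s 0) x r (g 0)))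
    convolve-split f g x r G (suc k) = trans
      (cong₂ _+_
        (trans (total-++ (λ s → G s (suc k)) (f 0) _) (cong (total (λ s → G s (suc k)) (f 0) +_) (total-extend (λ s → G s (suc k)) x r (g 0))))
        (convolve-split (f ∘ suc) (g ∘ suc) x r G k))
      (interchange (total (λ s → G s (suc k)) (f 0)) _ _ _)

    -- Admitting new entries in row `r` of the tableaux is dual to applying `E r` to the function;
    -- both sides obey the same recursion in `k`.
    convolve-partials : ∀ N base j r G k → convolve (partials N base (suc j) r) G k ≡
                        convolve (partials N base j (suc r)) (E r G) k
    convolve-partials N base j r G zero    = refl
    convolve-partials N base j r G (suc k) = begin
      total (λ s → G s (suc k)) (partials N base j (suc r) 0)
        + convolve (partials N base (suc j) r ∘ suc) G k
        ≡⟨ cong (total (λ s → G s (suc k)) (partials N base j (suc r) 0) +_)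
             (convolve-split (partials N base j (suc r) ∘ suc) (partials N base (suc j) r) (suc N) r G k) ⟩
      total (λ s → G s (suc k)) (partials N base j (suc r) 0)
        + (convolve (partials N base j (suc r) ∘ suc) G k + convolve (partials N base (suc j) r) (u r G) k)
        ≡⟨ +-assoc (total (λ s → G s (suc k)) (partials N base j (suc r) 0)) _ _ ⟨
      convolve (partials N base j (suc r)) G (suc k) + convolve (partials N base (suc j) r) (u r G) k
        ≡⟨ cong (convolve (partials N base j (suc r)) G (suc k) +_) (convolve-partials N base j r (u r G) k) ⟩
      convolve (partials N base j (suc r)) G (suc k) + convolve (partials N base j (suc r)) (E r (u r G)) k
        ≡⟨ convolve-E (partials N base j (suc r)) r G k ⟨
      convolve (partials N base j (suc r)) (E r G) (suc k) ∎
      where open ≡-Reasoning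

    -- Row by row the new entries are traded for operators, until all of them act on the function
    -- and only the old tableaux remain.
    convolve-U : ∀ N base j r G k → r + j ≡ L → convolve (partials N base j r) (U r G) k ≡
                 convolve (partials N base 0 L) (U L G) k
    convolve-U N base zero    r G k e with refl ← trans (sym (+-identityʳ r)) e = refl
    convolve-U N base (suc j) r G k e = trans (convolve-partials N base j r (U r G) k)
      (convolve-U N base j (suc r) G k (trans (sym (+-suc r j)) e))

    convolve-base : ∀ N base r G k → convolve (partials N base 0 r) G k ≡ total (λ s → G s k) base
    convolve-base N base r G zero    = refl
    convolve-base N base r G (suc k) = trans (cong (total (λ s → G s (suc k)) base +_) (go k (partials N base 0 r ∘ suc) λ _ → refl)) (+-identityʳ _)
      where
      go : ∀ k f → (∀ i → f i ≡ []) → convolve f G k ≡ 0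
      go zero    f e rewrite e 0 = refl
      go (suc k) f e rewrite e 0 = go k (f ∘ suc) (e ∘ suc)

    -- Since `G` has only a constant term, exactly the tableaux with `μ N` new entries contribute to
    -- the coefficient of x to the power `μ N`.
    total-tabs-suc : ∀ N G → (∀ s k → G s (suc k) ≡ 0) →
                     total (λ s → G s 0) (tabs (suc N)) ≡ total (λ s → U L G s (μ N)) (tabs N)
    total-tabs-suc N G e = begin
      total (λ s → G s 0) (partials N (tabs N) L 0 (μ N))
        ≡⟨ const-convolve (μ N) (partials N (tabs N) L 0) ⟨
      convolve (partials N (tabs N) L 0) G (μ N)
        ≡⟨ convolve-U N (tabs N) L 0 G (μ N) refl ⟩
      convolve (partials N (tabs N) 0 L) (U L G) (μ N)
        ≡⟨ convolve-base N (tabs N) L (U L G) (μ N) ⟩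
      total (λ s → U L G s (μ N)) (tabs N) ∎
      where
      open ≡-Reasoning
      total-0 : ∀ xs k → total (λ s → G s (suc k)) xs ≡ 0
      total-0 []       k = refl
      total-0 (T ∷ xs) k = cong₂ _+_ (e (shape T) k) (total-0 xs k)
      const-convolve : ∀ k f → convolve f G k ≡ total (λ s → G s 0) (f k)
      const-convolve zero    f = refl
      const-convolve (suc k) f = trans (cong (_+ convolve (f ∘ suc) G k) (total-0 (f 0) k)) (const-convolve k (f ∘ suc))

    partials-size : ∀ N base n → (∀ {T} → T ∈ base → sum (shape T) ≡ n × length T ≡ L) → ∀ j r k → r + j ≡ L →
                    ∀ {T} → T ∈ partials N base j r k → sum (shape T) ≡ n + k × length T ≡ L
    partials-size N base n b zero    r zero    e p = trans (proj₁ (b p)) (sym (+-identityʳ n)) , proj₂ (b p)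
    partials-size N base n b (suc j) r zero    e p = partials-size N base n b j (suc r) zero (trans (sym (+-suc r j)) e) p
    partials-size N base n b (suc j) r (suc k) e p with ∈-++⁻ (partials N base j (suc r) (suc k)) p
    ... | inj₁ q = partials-size N base n b j (suc r) (suc k) (trans (sym (+-suc r j)) e) q
    ... | inj₂ q with T′ , q′ , refl ← ∈-map⁻ _ q
                 with q″ , _ ← ∈-filter⁻ _ {xs = partials N base (suc j) r k} q′
                 with s , l ← partials-size N base n b (suc j) r k e q″ =
      trans (cong sum (shape-push r (suc N) T′))
        (trans (sum-inc r (shape T′) (subst (r <_) (trans (sym l) (sym (length-map length T′))) (subst (r <_) e (m<m+n r (s≤s z≤n)))))
               (trans (cong suc s) (sym (+-suc n k)))) ,
      trans (sym (length-map length (push r (suc N) T′)))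
        (trans (cong length (shape-push r (suc N) T′))
          (trans (length-inc r (shape T′)) (trans (length-map length T′) l)))

    prefix-sum : ℕ → ℕ
    prefix-sum zero    = 0
    prefix-sum (suc N) = prefix-sum N + μ N

    tabs-size : ∀ N {T} → T ∈ tabs N → sum (shape T) ≡ prefix-sum N × length T ≡ L
    tabs-size zero (here refl) = sum-empty L , length-replicate L
      where
      sum-empty : ∀ L → sum (shape (replicate L [])) ≡ 0
      sum-empty zero    = refl
      sum-empty (suc L) = sum-empty L
    tabs-size (suc N) p = partials-size N (tabs N) (prefix-sum N) (tabs-size N) L 0 (μ N) refl p

    -- If the last of L rows were nonempty, all rows would be, and there would be at least L cells.
    last-empty : ∀ {xs} → Shape L xs → sum xs < L → xs ‼ pred L ≡ 0
    last-empty {xs} (e , mono) s<L with xs ‼ pred L in eq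
    ... | zero  = refl
    ... | suc v = contradiction (go xs λ i i<l → ≤-trans (≤-trans (s≤s z≤n) (≤-reflexive (sym eq)))
                    (‼-mono {xs} mono (pred-mono-≤ (subst (suc i ≤_) e i<l))))
                    (<⇒≱ (subst (sum xs <_) (sym e) s<L))
      where
      go : ∀ xs → (∀ i → i < length xs → 1 ≤ xs ‼ i) → length xs ≤ sum xs
      go []       f = z≤n
      go (x ∷ xs) f = +-mono-≤ (f 0 (s≤s z≤n)) (go xs λ i i<l → f (suc i) (s≤s i<l))

    binomials : ℕ → ℕ → ℕ
    binomials M zero    = 1
    binomials M (suc N) = (M C μ N) * binomials M N

    module _ (0<L : 0 < L) where

      S-empty : ∀ M → S L M (shape (replicate L [])) 0 ≡ 1
      S-empty zero rewrite proj₁ (tabs-size zero (here refl)) = refl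
      S-empty (suc M) = trans (D-empty L) (S-empty M)
        where
        D-empty : ∀ r → D r (S L M) (shape (replicate L [])) 0 ≡ S L M (shape (replicate L [])) 0
        D-empty zero    = refl
        D-empty (suc r) = trans (cong₂ _+_ (D-empty r)
          (cong (λ b → when b (D r (S L M) (dec r (shape (replicate L []))) 0))
            (≥⇒<ᵇ≡ {shape (replicate L []) ‼ suc r} (subst (_≤ shape (replicate L []) ‼ suc r) (sym (empty-shape L r)) z≤n))))
          (+-identityʳ _)

      -- The cells with the largest entry form a horizontal strip of size `μ N`. Taking them off
      -- replaces `S L M` by its image under `U L`, which is (1 + x)^M times `S L M`, and so yields
      -- the factor C(M, μ N). The bound keeps the last row empty.
      dual-cauchy : ∀ M N → prefix-sum N < L → total (λ s → S L M s 0) (tabs N) ≡ binomials M N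
      dual-cauchy M zero    s<L = trans (+-identityʳ _) (S-empty M)
      dual-cauchy M (suc N) s<L = begin
        total (λ s → S L M s 0) (tabs (suc N))
          ≡⟨ total-tabs-suc N (S L M) (S-const L 0<L M) ⟩
        total (λ s → U L (S L M) s (μ N)) (tabs N)
          ≡⟨ total-cong (λ s → U L (S L M) s (μ N)) (λ s → (M C μ N) * S L M s 0) (tabs N) (λ {T} p → let sh = Tab.shapely (Lists.sound (tabs-lists N) p) in
               US-C L 0<L M (shape T) (sh , last-empty {shape T} sh
                 (≤-<-trans (≤-trans (≤-reflexive (proj₁ (tabs-size N p))) (m≤m+n (prefix-sum N) (μ N))) s<L)) (μ N)) ⟩
        total (λ s → (M C μ N) * S L M s 0) (tabs N)
          ≡⟨ total-* (M C μ N) (λ s → S L M s 0) (tabs N) ⟩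
        (M C μ N) * total (λ s → S L M s 0) (tabs N)
          ≡⟨ cong ((M C μ N) *_) (dual-cauchy M N (≤-<-trans (m≤m+n (prefix-sum N) (μ N)) s<L)) ⟩
        binomials M (suc N) ∎
        where open ≡-Reasoning

-- Quasi-Yamanouchi tableaux, one cell at a time

module QuasiYamanouchiTableaux where

  open import Defs using (Filling; Cell; cell; height; col; entry; cells; Semistandard; QuasiYamanouchi; Leftmost; _WeaklyLeftOf_; column; column-antitone)
  open import Data.Bool.Base using (true; false; if_then_else_; T)
  open import Data.List.Base using (List; []; _∷_; _++_; length; map; replicate; applyUpTo)
  open import Data.List.Properties using (length-++; length-map; length-filter; filter-accept; filter-reject; length-applyUpTo; length-replicate)
  open import Data.List.Membership.Propositional using (_∈_; find; lose)
  open import Data.List.Membership.Propositional.Properties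
    using (∈-++⁻; ∈-++⁺ˡ; ∈-++⁺ʳ; ∈-map⁺; ∈-map⁻)
  open import Data.List.Relation.Unary.All as All using (All; []; _∷_)
  open import Data.List.Relation.Unary.All.Properties using (¬Any⇒All¬)
  open import Data.List.Relation.Unary.AllPairs using ([]; _∷_)
  open import Data.List.Relation.Unary.Any using (Any; here; there; any?)
  open import Data.List.Relation.Unary.Unique.Propositional using (Unique)
  import Data.List.Relation.Unary.Unique.Propositional.Properties as Unique
  open import Data.Nat.Base
  open import Data.Nat.ListAction using (sum)
  open import Data.Nat.Properties
  open import Data.Product.Base using (_×_; _,_; proj₁; proj₂; ∃)
  open import Data.Sum.Base using (_⊎_; inj₁; inj₂)
  open import Function.Base using (_∘_; case_of_)
  open import Relation.Binary.PropositionalEquality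
  open import Relation.Nullary using (¬_; yes; no; contradiction; Dec)
  open Strips
  open Descents
  open Tableaux

  Mono : List ℕ → Set
  Mono xs = ∀ i → xs ‼ suc i ≤ xs ‼ i

  ‼-≤-head : ∀ x xs i → Mono (x ∷ xs) → xs ‼ i ≤ x
  ‼-≤-head x xs i mono = ‼-mono {x ∷ xs} {0} {suc i} mono z≤n

  column-reject : ∀ xs j → (∀ i → xs ‼ i ≤ j) → column xs j ≡ 0
  column-reject []       j le = refl
  column-reject (x ∷ xs) j le =
    trans (cong length (filter-reject (j <?_) {x} {xs} (≤⇒≯ (le 0)))) (column-reject xs j (le ∘ suc))

  -- Both inequalities say that the cell in row `i` and column `j` belongs to the diagram.
  <column⇒ : ∀ xs i j → Mono xs → i < column xs j → j < xs ‼ i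
  <column⇒ (x ∷ xs) i j mono p with j <? x
  <column⇒ (x ∷ xs) zero    j mono p | yes j<x = j<x
  <column⇒ (x ∷ xs) (suc i) j mono p | yes j<x =
    <column⇒ xs i j (mono ∘ suc) (s≤s⁻¹ (subst (suc i <_) (cong length (filter-accept (j <?_) {x} {xs} j<x)) p))
  <column⇒ (x ∷ xs) i j mono p | no j≮x = contradiction
    (subst (i <_) (trans (cong length (filter-reject (j <?_) {x} {xs} j≮x))
      (column-reject xs j λ k → ≤-trans (‼-≤-head x xs k mono) (≮⇒≥ j≮x))) p) λ ()

  ⇒<column : ∀ xs i j → Mono xs → j < xs ‼ i → i < column xs j
  ⇒<column (x ∷ xs) zero j mono p =
    subst (0 <_) (sym (cong length (filter-accept (j <?_) {x} {xs} p))) (s≤s z≤n)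
  ⇒<column (x ∷ xs) (suc i) j mono p =
    subst (suc i <_) (sym (cong length (filter-accept (j <?_) {x} {xs} (<-≤-trans p (‼-≤-head x xs i mono)))))
      (s≤s (⇒<column xs i j (mono ∘ suc) p))

  -- Only the column of the removed cell changes; its index is `pred (xs ‼ c)` because columns are
  -- counted from 0.
  column-dec-≢ : ∀ xs c j → j ≢ pred (xs ‼ c) → column (dec c xs) j ≡ column xs j
  column-dec-≢ []       c       j _ = refl
  column-dec-≢ (zero ∷ xs) zero j _ = refl
  column-dec-≢ (suc x ∷ xs) zero j j≢ with j <? x
  ... | yes p = trans (cong length (filter-accept (j <?_) {x} {xs} p))
    (sym (cong length (filter-accept (j <?_) {suc x} {xs} (m≤n⇒m≤1+n p))))
  ... | no  p = trans (cong length (filter-reject (j <?_) {x} {xs} p))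
    (sym (cong length (filter-reject (j <?_) {suc x} {xs} λ q → p (≤∧≢⇒< (s≤s⁻¹ q) j≢))))
  column-dec-≢ (x ∷ xs) (suc c) j j≢ with j <? x
  ... | yes p = trans (cong length (filter-accept (j <?_) {x} {dec c xs} p))
    (trans (cong suc (column-dec-≢ xs c j j≢)) (sym (cong length (filter-accept (j <?_) {x} {xs} p))))
  ... | no  p = trans (cong length (filter-reject (j <?_) {x} {dec c xs} p))
    (trans (column-dec-≢ xs c j j≢) (sym (cong length (filter-reject (j <?_) {x} {xs} p))))

  column-dec : ∀ xs c h → xs ‼ c ≡ suc h → column xs h ≡ suc (column (dec c xs) h)
  column-dec (x ∷ xs) zero    h refl = trans (cong length (filter-accept (h <?_) {suc h} {xs} ≤-refl))
    (cong suc (sym (cong length (filter-reject (h <?_) {h} {xs} (<-irrefl refl)))))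
  column-dec (x ∷ xs) (suc c) h e with h <? x
  ... | yes p = trans (cong length (filter-accept (h <?_) {x} {xs} p))
    (cong suc (trans (column-dec xs c h e) (sym (cong length (filter-accept (h <?_) {x} {dec c xs} p)))))
  ... | no  p = trans (cong length (filter-reject (h <?_) {x} {xs} p))
    (trans (column-dec xs c h e) (cong suc (sym (cong length (filter-reject (h <?_) {x} {dec c xs} p)))))

  applyUpTo-‼ : ∀ f L i → i < L → applyUpTo f L ‼ i ≡ f i
  applyUpTo-‼ f (suc L) zero    _         = refl
  applyUpTo-‼ f (suc L) (suc i) (s≤s i<L) = applyUpTo-‼ (f ∘ suc) L i i<L

  ‼-ext : ∀ xs ys → length xs ≡ length ys → (∀ i → i < length xs → xs ‼ i ≡ ys ‼ i) → xs ≡ ys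
  ‼-ext []       []       _ _ = refl
  ‼-ext (x ∷ xs) (y ∷ ys) l e =
    cong₂ _∷_ (e 0 (s≤s z≤n)) (‼-ext xs ys (suc-injective l) λ i p → e (suc i) (s≤s p))

  ‼≤sum : ∀ xs i → xs ‼ i ≤ sum xs
  ‼≤sum []       i       = z≤n
  ‼≤sum (x ∷ xs) zero    = m≤m+n x _
  ‼≤sum (x ∷ xs) (suc i) = ≤-trans (‼≤sum xs i) (m≤n+m _ x)

  ‼0≡0⇒sum≡0 : ∀ xs → Mono xs → xs ‼ 0 ≡ 0 → sum xs ≡ 0
  ‼0≡0⇒sum≡0 []       mono e = refl
  ‼0≡0⇒sum≡0 (x ∷ xs) mono e = cong₂ _+_ e (‼0≡0⇒sum≡0 xs (mono ∘ suc) (n≤0⇒n≡0 (subst (xs ‼ 0 ≤_) e (mono 0))))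

  -- Finds the rightmost instance of an entry, by whose column the tableaux are sorted.
  farthest : ∀ {P : Cell → Set} (P? : ∀ y → Dec (P y)) {y} ys → y ∈ ys → P y →
             ∃ λ z → z ∈ ys × P z × (∀ {w} → w ∈ ys → P w → col w ≤ col z)
  farthest P? (x ∷ ys) y∈ p with any? P? ys
  farthest {P} P? (x ∷ ys) y∈ p | no none = x , here refl , x-ok y∈ p ,
    λ { (here refl) _ → ≤-refl ; (there q) r → contradiction r (All.lookup (¬Any⇒All¬ ys none) q) }
    where
    x-ok : ∀ {y} → y ∈ x ∷ ys → P y → P x
    x-ok (here refl) p = p
    x-ok (there q)   p = contradiction p (All.lookup (¬Any⇒All¬ ys none) q)
  farthest P? (x ∷ ys) y∈ p | yes some with y′ , y′∈ , p′ ← find some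
                                       with z , z∈ , pz , max ← farthest P? ys y′∈ p′
                                       with P? x
  ... | no ¬px = z , there z∈ , pz , λ { (here refl) r → contradiction r ¬px ; (there q) r → max q r }
  ... | yes px with col x ≤? col z
  ... | yes le = z , there z∈ , pz , λ { (here refl) _ → le ; (there q) r → max q r }
  ... | no  gt = x , here refl , px , λ { (here refl) _ → ≤-refl ; (there q) r → ≤-trans (max q r) (≰⇒≥ gt) }

  concat< : {A : Set} → ℕ → (ℕ → List A) → List A
  concat< zero    f = []
  concat< (suc n) f = concat< n f ++ f n

  ∈-concat<⁺ : ∀ {A : Set} {x : A} n f i → i < n → x ∈ f i → x ∈ concat< n f
  ∈-concat<⁺ (suc n) f i i<n p with m≤n⇒m<n∨m≡n (s≤s⁻¹ i<n)
  ... | inj₁ i<n′ = ∈-++⁺ˡ (∈-concat<⁺ n f i i<n′ p)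
  ... | inj₂ refl = ∈-++⁺ʳ (concat< n f) p

  ∈-concat<⁻ : ∀ {A : Set} {x : A} n f → x ∈ concat< n f → ∃ λ i → i < n × x ∈ f i
  ∈-concat<⁻ (suc n) f p with ∈-++⁻ (concat< n f) p
  ... | inj₁ q with i , i<n , r ← ∈-concat<⁻ n f q = i , m≤n⇒m≤1+n i<n , r
  ... | inj₂ q = n , ≤-refl , q

  unique-concat< : ∀ {A : Set} n (f : ℕ → List A) → (∀ i → Unique (f i)) →
                   (∀ {x i j} → x ∈ f i → x ∈ f j → i ≡ j) → Unique (concat< n f)
  unique-concat< zero    f u d = []
  unique-concat< (suc n) f u d = Unique.++⁺ (unique-concat< n f u d) (u n)
    λ (p , q) → let (i , i<n , r) = ∈-concat<⁻ n f p in contradiction (d r q) (<⇒≢ i<n)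

  length-concat< : ∀ {A : Set} n (f : ℕ → List A) → length (concat< n f) ≡ Σ< n (length ∘ f)
  length-concat< zero    f = refl
  length-concat< (suc n) f = trans (length-++ (concat< n f)) (cong (_+ length (f n)) (length-concat< n f))

  module _ (L : ℕ) where

    -- Padded to `L` rows like the diagrams themselves; with fewer than `L` cells no column is cut
    -- off.
    conj : List ℕ → List ℕ
    conj xs = applyUpTo (column xs) L

    conj-‼ : ∀ xs i → Mono xs → sum xs < L → conj xs ‼ i ≡ column xs i
    conj-‼ xs i mono s<L with i <? L
    ... | yes i<L = applyUpTo-‼ (column xs) L i i<L
    ... | no  i≮L = trans (‼-beyond (conj xs) i (≤-trans (≤-reflexive (length-applyUpTo (column xs) L)) (≮⇒≥ i≮L)))
      (sym (column-reject xs i λ j → ≤-trans (‼≤sum xs j) (≤-trans (<⇒≤ s<L) (≮⇒≥ i≮L))))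

    conj-Shape : ∀ xs → Mono xs → sum xs < L → Shape L (conj xs)
    conj-Shape xs mono s<L = length-applyUpTo (column xs) L , λ i →
      subst₂ _≤_ (sym (conj-‼ xs (suc i) mono s<L)) (sym (conj-‼ xs i mono s<L)) (column-antitone xs i)

    -- A corner in row `c` and column `h` of the diagram is, in the conjugate diagram, the end of
    -- row `h`, in column `c`.
    module Corner {xs c} (sh : Shape L xs) (s<L : sum xs < L) (rem : removable c xs ≡ true) where

      h : ℕ
      h = pred (xs ‼ c)

      ‼≡ : xs ‼ c ≡ suc h
      ‼≡ with xs ‼ c | removable⇒pos c xs rem
      ... | suc v | _ = refl

      below : xs ‼ suc c ≤ h
      below = s≤s⁻¹ (subst (xs ‼ suc c <_) ‼≡ (<ᵇ≡⇒< {xs ‼ suc c} {xs ‼ c} rem))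

      column-h : column xs h ≡ suc c
      column-h = ≤-antisym (≮⇒≥ λ p → <⇒≱ (<column⇒ xs (suc c) h (proj₂ sh) p) below)
        (⇒<column xs c h (proj₂ sh) (≤-reflexive (sym ‼≡)))

      h<L : h < L
      h<L = ≤-<-trans pred[n]≤n (≤-<-trans (‼≤sum xs c) s<L)

      dec-Shape : Shape L (dec c xs)
      dec-Shape = Shape-dec c xs rem sh

      dec-sum : suc (sum (dec c xs)) ≡ sum xs
      dec-sum = sum-dec c xs (removable⇒pos c xs rem)

      dec-sum<L : sum (dec c xs) < L
      dec-sum<L = <-trans ≤-refl (subst (_< L) (sym dec-sum) s<L)

      conj-h : conj (dec c xs) ‼ h ≡ c
      conj-h = trans (conj-‼ (dec c xs) h (proj₂ dec-Shape) dec-sum<L)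
        (suc-injective (trans (sym (column-dec xs c h ‼≡)) column-h))

      conj-dec : conj xs ≡ inc h (conj (dec c xs))
      conj-dec = ‼-ext _ _ (trans (length-applyUpTo (column xs) L)
          (sym (trans (length-inc h (conj (dec c xs))) (length-applyUpTo (column (dec c xs)) L)))) λ i _ → go i
        where
        go : ∀ i → conj xs ‼ i ≡ inc h (conj (dec c xs)) ‼ i
        go i with i ≟ h
        ... | yes refl = trans (conj-‼ xs h (proj₂ sh) s<L) (trans column-h
          (sym (trans (‼-inc h (conj (dec c xs)) (subst (h <_) (sym (length-applyUpTo (column (dec c xs)) L)) h<L))
                      (cong suc conj-h))))
        ... | no i≢h = trans (conj-‼ xs i (proj₂ sh) s<L) (trans (sym (column-dec-≢ xs c i i≢h))
          (sym (trans (‼-inc-≢ h i (conj (dec c xs)) i≢h) (conj-‼ (dec c xs) i (proj₂ dec-Shape) dec-sum<L))))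

    -- Quasi-Yamanouchi tableaux of size n and shape conj xs with maximum m, the rightmost
    -- m in column c; the empty tableau counts as m = 0, c = L.
    record QY (n m : ℕ) (xs : List ℕ) (c : ℕ) (T : Filling) : Set where
      field
        shape≡  : shape T ≡ conj xs
        ss      : Semistandard T
        qy      : QuasiYamanouchi T
        entries : ∀ {y} → y ∈ cells T → 1 ≤ entry y × entry y ≤ m
        right   : ∀ {y} → y ∈ cells T → entry y ≡ m → col y ≤ c
        last    : (n ≡ 0 × m ≡ 0 × c ≡ L) ⊎ (∃ λ y → y ∈ cells T × entry y ≡ m × col y ≡ c)

    no-cells : ∀ T xs {y} → Shape L xs → sum xs ≡ 0 → 0 < L → shape T ≡ conj xs → ¬ (y ∈ cells T)
    no-cells T xs {y} sh e 0<L s≡ p = contradiction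
      (subst (col y <_) (trans (cong (_‼ height y) s≡) (trans (conj-‼ xs (height y) (proj₂ sh) (subst (_< L) (sym e) 0<L))
        (column-reject xs (height y) λ i → ≤-trans (≤-reflexive (sum≡0⇒‼≡0 L xs i e)) z≤n))) (cell-bound T p)) λ ()

    -- The maximum and its rightmost column can be read off the tableau, and the convention for the
    -- empty tableau applies only when there are no cells.
    QY-unique : ∀ {n m m′ xs c c′ T} → Shape L xs → sum xs ≡ n → n < L →
                QY n m xs c T → QY n m′ xs c′ T → m ≡ m′ × c ≡ c′
    QY-unique {xs = xs} {T = T} sh e n<L q q′ with QY.last q | QY.last q′
    ... | inj₁ (_ , refl , refl) | inj₁ (_ , refl , refl) = refl , refl
    ... | inj₁ (refl , _) | inj₂ (y , p , _) = contradiction p (no-cells T xs sh e n<L (QY.shape≡ q))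
    ... | inj₂ (y , p , _) | inj₁ (refl , _) = contradiction p (no-cells T xs sh e n<L (QY.shape≡ q))
    ... | inj₂ (y , p , refl , refl) | inj₂ (y′ , p′ , e₁ , refl)
      with refl ← ≤-antisym (proj₂ (QY.entries q′ p)) (subst (_≤ entry y) e₁ (proj₂ (QY.entries q p′))) =
      refl , ≤-antisym (QY.right q′ p refl) (QY.right q p′ e₁)

    module Step {xs c} (sh : Shape L xs) (s<L : sum xs < L) (rem : removable c xs ≡ true)
                (m : ℕ) (T′ : Filling) (s≡ : shape T′ ≡ conj (dec c xs)) where
      open Corner {xs} {c} sh s<L rem public

      shapely : Shape L (shape T′)
      shapely = subst (Shape L) (sym s≡) (conj-Shape (dec c xs) (proj₂ dec-Shape) dec-sum<L)

      h<l : h < length T′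
      h<l = subst (h <_) (trans (sym (proj₁ shapely)) (length-map length T′)) h<L

      end : shape T′ ‼ h ≡ c
      end = trans (cong (_‼ h) s≡) conj-h

      T⁺ : Filling
      T⁺ = push h (suc m) T′

      shape⁺ : shape T⁺ ≡ conj xs
      shape⁺ = trans (shape-push h (suc m) T′) (trans (cong (inc h) s≡) (sym conj-dec))

      open Push h (suc m) T′ h<l public

      -- Row `h` of `T′` ends just before column `c`, and the rows above it are no longer.
      low : ∀ {y} → y ∈ cells T′ → c ≤ col y → height y < h
      low {y} p c≤ = ≰⇒> λ h≤ → <⇒≱ (cell-bound T′ p)
        (≤-trans (‼-mono {shape T′} (proj₂ shapely) h≤) (≤-trans (≤-reflexive end) c≤))

      -- A cell that is leftmost after the addition was so before, and its old witness is still
      -- present; hence only the new cell needs an argument.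
      qy-push : QuasiYamanouchi T′ →
                (1 < suc m → Leftmost T⁺ new → Any (λ y → suc (entry y) ≡ suc m × new WeaklyLeftOf y) (cells T⁺)) →
                QuasiYamanouchi T⁺
      qy-push qy f = All.tabulate λ p → case ∈-push⁻ p of λ
        { (inj₁ refl) → f
        ; (inj₂ q) → λ 1< lm → let (w , w∈ , r) = find (All.lookup qy q 1< (All.tabulate λ u → All.lookup lm (old∈ u)))
                               in lose (old∈ w∈) r }

    -- The new cell is strictly to the right of an older instance of `suc m`, so it is not leftmost
    -- and imposes no condition.
    QY-push-same : ∀ {n m xs c i T′} → (sh : Shape L xs) (s<L : sum xs < L) (rem : removable c xs ≡ true) →
                   i < c → QY n (suc m) (dec c xs) i T′ → QY (suc n) (suc m) xs c (push (pred (xs ‼ c)) (suc m) T′)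
    QY-push-same {n} {m} {xs} {c} {i} {T′} sh s<L rem i<c q = record
      { shape≡ = shape⁺
      ; ss = push-ss (proj₂ shapely) ss λ p → proj₂ (entries p) , λ e →
          ≤∧≢⇒< (proj₂ (entries p)) λ e′ → <⇒≢ (≤-<-trans (right p e′) i<c) (trans e end)
      ; qy = qy-push qy λ _ lm → case last of λ
          { (inj₁ (_ , () , _))
          ; (inj₂ (y , p , e , refl)) → contradiction (subst (_≤ col y) end (All.lookup lm (old∈ p) e)) (<⇒≱ i<c) }
      ; entries = λ p → case ∈-push⁻ p of λ { (inj₁ refl) → s≤s z≤n , ≤-refl ; (inj₂ r) → entries r }
      ; right = λ p e → case ∈-push⁻ p of λ { (inj₁ refl) → ≤-reflexive end ; (inj₂ r) → ≤-trans (right r e) (<⇒≤ i<c) }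
      ; last = inj₂ (new , new∈ , refl , end) }
      where
      open QY q
      open Step {xs} {c} sh s<L rem m T′ shape≡

    -- The new cell is the only `suc m`. Its witness is the rightmost `m`, which lies in column `c`
    -- or beyond and is therefore lower; for `m = 0` nothing is required.
    QY-push-new : ∀ {n m xs c i T′} → (sh : Shape L xs) (s<L : sum xs < L) (rem : removable c xs ≡ true) →
                  c ≤ i → QY n m (dec c xs) i T′ → QY (suc n) (suc m) xs c (push (pred (xs ‼ c)) (suc m) T′)
    QY-push-new {n} {m} {xs} {c} {i} {T′} sh s<L rem c≤i q = record
      { shape≡ = shape⁺
      ; ss = push-ss (proj₂ shapely) ss λ p → m≤n⇒m≤1+n (proj₂ (entries p)) , λ _ → s≤s (proj₂ (entries p))
      ; qy = qy-push qy λ 1< lm → case last of λ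
          { (inj₁ (_ , refl , _)) → contradiction 1< (<-irrefl refl)
          ; (inj₂ (y , p , e , refl)) → lose (old∈ p) (cong suc e , low p c≤i , subst (_≤ col y) (sym end) c≤i) }
      ; entries = λ p → case ∈-push⁻ p of λ
          { (inj₁ refl) → s≤s z≤n , ≤-refl ; (inj₂ r) → proj₁ (entries r) , m≤n⇒m≤1+n (proj₂ (entries r)) }
      ; right = λ p e → case ∈-push⁻ p of λ
          { (inj₁ refl) → ≤-reflexive end ; (inj₂ r) → contradiction e (<⇒≢ (s≤s (proj₂ (entries r)))) }
      ; last = inj₂ (new , new∈ , refl , end) }
      where
      open QY q
      open Step {xs} {c} sh s<L rem m T′ shape≡

    -- The cell to be taken off is the rightmost instance of the maximum: it ends its row and has
    -- nothing above it, so it is the corner belonging to row `c` of `xs`.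
    module Last {n M xs c T} (sh : Shape L xs) (sum≡ : sum xs ≡ suc n) (n<L : suc n < L) (q : QY (suc n) M xs c T)
                {y} (y∈ : y ∈ cells T) (y-M : entry y ≡ M) (y-c : col y ≡ c) where
      open QY q

      s<L : sum xs < L
      s<L = subst (_< L) (sym sum≡) n<L

      h₀ : ℕ
      h₀ = height y

      T′ : Filling
      T′ = pop h₀ T

      popped : ∃ λ x → T ≡ push h₀ x T′
      popped = push-pop h₀ T (≤-<-trans z≤n (cell-bound T y∈))

      x : ℕ
      x = proj₁ popped

      T≡ : T ≡ push h₀ x T′
      T≡ = proj₂ popped

      shapely : Shape L (shape T)
      shapely = subst (Shape L) (sym shape≡) (conj-Shape xs (proj₂ sh) s<L)

      shape-T : shape T ≡ inc h₀ (shape T′)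
      shape-T = trans (cong shape T≡) (shape-push h₀ x T′)

      h<l : h₀ < length T′
      h<l = subst (h₀ <_) (trans (cong length shape-T) (trans (length-inc h₀ (shape T′)) (length-map length T′)))
        (‼-pos⇒< (shape T) h₀ (≤-<-trans z≤n (cell-bound T y∈)))

      open Push h₀ x T′ h<l

      to : ∀ {w} → w ∈ cells T′ → w ∈ cells T
      to p = subst (λ T → _ ∈ cells T) (sym T≡) (old∈ p)

      from : ∀ {w} → w ∈ cells T → w ≡ new ⊎ w ∈ cells T′
      from p = ∈-push⁻ (subst (λ T → _ ∈ cells T) T≡ p)

      new∈T : new ∈ cells T
      new∈T = subst (λ T → new ∈ cells T) (sym T≡) new∈

      -- An entry to the right of `y` in its row would be another instance of the maximum, beyond
      -- column `c`.
      y≡new : y ≡ new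
      y≡new with from y∈
      ... | inj₁ e = e
      ... | inj₂ p = contradiction (right new∈T x≡M) (<⇒≱ (subst (_< shape T′ ‼ h₀) y-c (cell-bound T′ p)))
        where
        x≡M : x ≡ M
        x≡M = ≤-antisym (proj₂ (entries new∈T))
          (subst (_≤ x) y-M (proj₁ (ss-ordered T ss y∈ new∈T) refl (cell-bound T′ p)))

      x≡M : x ≡ M
      x≡M = trans (sym (cong entry y≡new)) y-M

      end : shape T′ ‼ h₀ ≡ c
      end = trans (sym (cong col y≡new)) y-c

      end-T : shape T ‼ h₀ ≡ suc c
      end-T = trans (cong (_‼ h₀) shape-T)
        (trans (‼-inc h₀ (shape T′) (subst (h₀ <_) (sym (length-map length T′)) h<l)) (cong suc end))

      column-at : ∀ i → shape T ‼ i ≡ column xs i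
      column-at i = trans (cong (_‼ i) shape≡) (conj-‼ xs i (proj₂ sh) s<L)

      removable-T : removable h₀ (shape T) ≡ true
      removable-T = Removal.top⇒removable T shapely ss h₀ c x end-T
        (subst (λ c → cell h₀ c x ∈ cells T) end new∈T) λ p → subst (_ ≤_) (sym x≡M) (proj₂ (entries p))

      column≤ : column xs (suc h₀) ≤ c
      column≤ = s≤s⁻¹ (subst₂ _<_ (column-at (suc h₀)) end-T (<ᵇ≡⇒< {shape T ‼ suc h₀} {shape T ‼ h₀} removable-T))

      ‼c≡ : xs ‼ c ≡ suc h₀
      ‼c≡ = ≤-antisym
        (≮⇒≥ λ p → <⇒≱ (⇒<column xs c (suc h₀) (proj₂ sh) p) column≤)
        (<column⇒ xs c h₀ (proj₂ sh) (≤-reflexive (sym (trans (sym (column-at h₀)) end-T))))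

      rem : removable c xs ≡ true
      rem = <⇒<ᵇ≡ (subst (xs ‼ suc c <_) (sym ‼c≡) (s≤s (≮⇒≥ λ p →
        <-irrefl (trans (sym end-T) (column-at h₀)) (⇒<column xs (suc c) h₀ (proj₂ sh) p))))

      open Corner {xs} {c} sh s<L rem using (dec-Shape; dec-sum; dec-sum<L; conj-dec)

      h≡ : pred (xs ‼ c) ≡ h₀
      h≡ = cong pred ‼c≡

      shape-T′ : shape T′ ≡ conj (dec c xs)
      shape-T′ = trans (sym (dec-inc h₀ (shape T′))) (trans (cong (dec h₀) (trans (sym shape-T)
        (trans shape≡ (trans conj-dec (cong (λ h → inc h (conj (dec c xs))) h≡))))) (dec-inc h₀ (conj (dec c xs))))

      shapely′ : Shape L (shape T′)
      shapely′ = subst (Shape L) (sym shape-T′) (conj-Shape (dec c xs) (proj₂ dec-Shape) dec-sum<L)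

      ss′ : Semistandard T′
      ss′ = pop-ss (subst Semistandard T≡ ss)

      sum′ : sum (dec c xs) ≡ n
      sum′ = suc-injective (trans dec-sum sum≡)

      -- The new cell is neither a leftmost M of T′ pushed aside nor a witness, M being maximal.
      qy′ : QuasiYamanouchi T′
      qy′ = All.tabulate λ {w} p 1< lm →
        let (v , v∈ , e , left) = find (All.lookup qy (to p) 1< (All.tabulate λ {u} u∈ e → case from u∈ of λ
              { (inj₁ refl) → subst (col w ≤_) (sym end) (right (to p) (trans (sym e) x≡M))
              ; (inj₂ r) → All.lookup lm r e }))
        in case from v∈ of λ
              { (inj₁ v≡) → contradiction (proj₂ (entries (to p)))
                  (<⇒≱ (≤-reflexive (trans (cong suc (trans (sym x≡M) (sym (cong entry v≡)))) e)))
              ; (inj₂ r) → lose r (e , left) }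

      reached : ∀ {w} → w ∈ cells T′ → col w < L
      reached {w} p = <-≤-trans (subst (col w <_) (trans (cong (_‼ height w) shape-T′)
          (conj-‼ (dec c xs) (height w) (proj₂ dec-Shape) dec-sum<L)) (cell-bound T′ p))
        (≤-trans (length-filter (height w <?_) (dec c xs)) (≤-reflexive (proj₁ dec-Shape)))

      module _ (m : ℕ) (M≡ : M ≡ suc m) where

        same : ∀ {w} → w ∈ cells T′ → entry w ≡ suc m → (∀ {v} → v ∈ cells T′ → entry v ≡ suc m → col v ≤ col w) →
               col w < c × QY n (suc m) (dec c xs) (col w) T′
        same {w} p e max = ≤∧≢⇒< (right (to p) (trans e (sym M≡))) col≢ , record
          { shape≡ = shape-T′ ; ss = ss′ ; qy = qy′
          ; entries = λ r → proj₁ (entries (to r)) , subst (_ ≤_) M≡ (proj₂ (entries (to r)))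
          ; right = max ; last = inj₂ (w , p , e , refl) }
          where
          -- A second instance of the maximum in column `c` would lie below the removed cell,
          -- against strictness in columns, or else outside the remaining diagram.
          col≢ : col w ≢ c
          col≢ e′ with height w <? h₀
          ... | yes p< = <-irrefl (trans e (trans (sym M≡) (sym x≡M)))
            (proj₂ (ss-ordered T ss (to p) new∈T) (trans e′ (sym end)) p<)
          ... | no  p≮ = <⇒≱ (subst (_< shape T′ ‼ height w) e′ (cell-bound T′ p))
            (≤-trans (‼-mono {shape T′} (proj₂ shapely′) (≮⇒≥ p≮)) (≤-reflexive end))

        module _ (none : ∀ {w} → w ∈ cells T′ → entry w ≢ suc m) where

          entries′ : ∀ {w} → w ∈ cells T′ → 1 ≤ entry w × entry w ≤ m
          entries′ p = proj₁ (entries (to p)) ,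
            s≤s⁻¹ (≤∧≢⇒< (subst (_ ≤_) M≡ (proj₂ (entries (to p)))) (none p))

          -- The removed cell was the only `suc m`, hence leftmost, so the quasi-Yamanouchi
          -- condition supplies an `m` in column `c` or beyond.
          below : 1 < suc m → ∃ λ w → w ∈ cells T′ × entry w ≡ m × c ≤ col w
          below 1<
            with v , v∈ , e , (_ , c≤) ← find (All.lookup qy new∈T (subst (1 <_) (sym (trans x≡M M≡)) 1<)
                   (All.tabulate λ u∈ e → case from u∈ of λ
                     { (inj₁ refl) → ≤-refl ; (inj₂ r) → contradiction (trans e (trans x≡M M≡)) (none r) }))
            with from v∈
          ... | inj₁ refl = contradiction (sym e) (<⇒≢ ≤-refl)
          ... | inj₂ r = v , r , suc-injective (trans e (trans x≡M M≡)) , subst (_≤ col v) end c≤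

          fresh : ∀ {w} → w ∈ cells T′ → entry w ≡ m → c ≤ col w →
                  ∃ λ i → i ≤ L × c ≤ i × QY n m (dec c xs) i T′
          fresh p e c≤ with z , z∈ , e′ , max ← farthest (λ w → entry w ≟ m) (cells T′) p e =
            col z , <⇒≤ (reached z∈) , ≤-trans c≤ (max p e) , record
              { shape≡ = shape-T′ ; ss = ss′ ; qy = qy′ ; entries = entries′
              ; right = max ; last = inj₂ (z , z∈ , e′ , refl) }

      -- If the maximum is 1 and no other 1 is left, the remaining tableau is empty, which is
      -- recorded as column `L`.
      first : M ≡ 1 → (∀ {w} → w ∈ cells T′ → entry w ≢ 1) → c ≤ L × QY n 0 (dec c xs) L T′
      first M≡ none = <⇒≤ (≤-trans (‼-pos⇒< xs c (removable⇒pos c xs rem)) (≤-reflexive (proj₁ sh))) , record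
        { shape≡ = shape-T′ ; ss = ss′ ; qy = qy′ ; entries = entries′ 0 M≡ none
        ; right = λ p → contradiction p empty′
        ; last = inj₁ (n≡0 , refl , refl) }
        where
        empty′ : ∀ {w} → ¬ (w ∈ cells T′)
        empty′ p = contradiction (≤-trans (proj₁ (entries′ 0 M≡ none p)) (proj₂ (entries′ 0 M≡ none p))) λ ()
        n≡0 : n ≡ 0
        n≡0 with dec c xs ‼ 0 in e
        ... | zero  = trans (sym sum′) (‼0≡0⇒sum≡0 (dec c xs) (proj₂ dec-Shape) e)
        ... | suc v = contradiction (proj₂ (cell-exists T′ 0 0 (subst (0 <_)
          (sym (trans (cong (_‼ 0) shape-T′) (conj-‼ (dec c xs) 0 (proj₂ dec-Shape) dec-sum<L)))
          (⇒<column (dec c xs) 0 0 (proj₂ dec-Shape) (subst (0 <_) (sym e) (s≤s z≤n)))))) empty′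

    -- Converse of the two ways of adding a cell; which of them applies is decided by whether a
    -- further `suc m` remains.
    QY-cases : ∀ {n M xs c T} → Shape L xs → sum xs ≡ suc n → suc n < L → QY (suc n) M xs c T →
      ∃ λ m → ∃ λ T′ → ∃ λ i → M ≡ suc m × removable c xs ≡ true × T ≡ push (pred (xs ‼ c)) (suc m) T′ × i ≤ L ×
        ((i < c × QY n (suc m) (dec c xs) i T′) ⊎ (c ≤ i × QY n m (dec c xs) i T′))
    QY-cases sh sum≡ n<L q with QY.last q
    ... | inj₁ (() , _)
    QY-cases {n} {zero} sh sum≡ n<L q | inj₂ (y , y∈ , e , e′) =
      contradiction (≤-trans (proj₁ (QY.entries q y∈)) (proj₂ (QY.entries q y∈))) λ ()
    QY-cases {n} {suc m} {xs} {c} {T} sh sum≡ n<L q | inj₂ (y , y∈ , e , e′) = cases m refl (any? (λ w → entry w ≟ suc m) (cells T′))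
      where
      open Last {T = T} sh sum≡ n<L q y∈ e e′
      T-eq : T ≡ push (pred (xs ‼ c)) (suc m) T′
      T-eq = trans T≡ (cong₂ (λ h v → push h v T′) (sym h≡) x≡M)
      cases : ∀ m′ → m ≡ m′ → Dec (Any (λ w → entry w ≡ suc m) (cells T′)) →
        ∃ λ k → ∃ λ T′ → ∃ λ i → suc m ≡ suc k × removable c xs ≡ true × T ≡ push (pred (xs ‼ c)) (suc k) T′ × i ≤ L ×
        ((i < c × QY n (suc k) (dec c xs) i T′) ⊎ (c ≤ i × QY n k (dec c xs) i T′))
      cases _ _ (yes some) with w , w∈ , e ← find some
                           with z , z∈ , ez , max ← farthest (λ w → entry w ≟ suc m) (cells T′) w∈ e =
        m , T′ , col z , refl , rem , T-eq , <⇒≤ (reached z∈) , inj₁ (same m refl z∈ ez max)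
      cases zero refl (no none) with c≤L , q′ ← first refl (λ p e → All.lookup (¬Any⇒All¬ _ none) p e) =
        0 , T′ , L , refl , rem , T-eq , ≤-refl , inj₂ (c≤L , q′)
      cases (suc m′) refl (no none)
        with w , w∈ , e , c≤ ← below m refl (λ p e → All.lookup (¬Any⇒All¬ _ none) p e) (s≤s (s≤s z≤n))
        with i , i≤L , c≤i , q′ ← fresh m refl (λ p e → All.lookup (¬Any⇒All¬ _ none) p e) w∈ e c≤ =
        m , T′ , i , refl , rem , T-eq , i≤L , inj₂ (c≤i , q′)

    open Lists

    before : (ℕ → ℕ → List Filling) → ℕ → ℕ → ℕ → List Filling
    before f m c i = if i <ᵇ c then f (suc m) i else f m i

    -- Follows the recursion of `b` clause by clause, so that the length of the list is
    -- `b L n m xs c` by construction.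
    qys : ℕ → ℕ → List ℕ → ℕ → List Filling
    qys zero    zero    xs c = if c ≡ᵇ L then replicate L [] ∷ [] else []
    qys zero    (suc m) xs c = []
    qys (suc n) zero    xs c = []
    qys (suc n) (suc m) xs c = if removable c xs
      then map (push (pred (xs ‼ c)) (suc m)) (concat< (suc L) (before (λ m → qys n m (dec c xs)) m c))
      else []

    length-qys : ∀ n m xs c → length (qys n m xs c) ≡ b L n m xs c
    length-qys zero zero xs c with c ≡ᵇ L
    ... | true  = refl
    ... | false = refl
    length-qys zero    (suc m) xs c = refl
    length-qys (suc n) zero    xs c = refl
    length-qys (suc n) (suc m) xs c with removable c xs
    ... | false = refl
    ... | true  = trans (length-map _ (concat< (suc L) (before (λ m → qys n m (dec c xs)) m c)))
      (trans (length-concat< (suc L) _) (Σ<-cong (suc L) λ i _ → length-before i))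
      where
      length-before : ∀ i → length (before (λ m → qys n m (dec c xs)) m c i) ≡ pick c (b L n (suc m) (dec c xs)) (b L n m (dec c xs)) i
      length-before i with i <ᵇ c
      ... | true  = length-qys n (suc m) (dec c xs) i
      ... | false = length-qys n m (dec c xs) i

    qys-0 : ∀ m xs c → Shape L xs → sum xs ≡ 0 → 0 < L → Lists L (λ _ → 0) (QY 0 m xs c) (qys 0 m xs c)
    qys-0 zero xs c sh e 0<L with c ≡ᵇ L in eq
    ... | false = record { unique = [] ; sound = λ () ; complete = λ q → case QY.last q of λ
          { (inj₁ (_ , _ , refl)) → contradiction (trans (sym eq) (≡ᵇ-refl L c)) λ ()
          ; (inj₂ (y , p , _)) → contradiction p (no-cells _ xs sh e 0<L (QY.shape≡ q)) } }
    ... | true with refl ← ≡ᵇ⇒≡ c L (subst T (sym eq) _) = record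
      { unique = [] ∷ []
      ; sound = λ { (here refl) → record
          { shape≡ = shape-empty
          ; ss = subst (λ c → All (λ x → All (Ordered x) c) c) (sym (empty-rows L (λ _ → 0) L 0)) []
          ; qy = All.tabulate λ p → contradiction p none
          ; entries = λ p → contradiction p none
          ; right = λ p → contradiction p none
          ; last = inj₁ (refl , refl , refl) } }
      ; complete = λ {T} q → here (trans (no-cells⇒empty L (λ _ → 0) T 0 (no-cells T xs sh e 0<L (QY.shape≡ q)))
          (cong (λ l → replicate l []) (trans (sym (length-map length T)) (trans (cong length (QY.shape≡ q)) (length-applyUpTo (column xs) L))))) }
      where
      none : ∀ {y} → ¬ (y ∈ cells (replicate L []))
      none p = contradiction (subst (_ ∈_) (empty-rows L (λ _ → 0) L 0) p) λ ()
      shape-empty : shape (replicate L []) ≡ conj xs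
      shape-empty = ‼-ext _ _ (trans (length-map length (replicate L [])) (trans (length-replicate L) (sym (length-applyUpTo (column xs) L))))
        λ i _ → trans (empty-shape L (λ _ → 0) L i) (sym (trans (conj-‼ xs i (proj₂ sh) (subst (_< L) (sym e) 0<L))
          (column-reject xs i λ j → ≤-trans (≤-reflexive (sum≡0⇒‼≡0 L xs j e)) z≤n)))
    qys-0 (suc m) xs c sh e 0<L = record { unique = [] ; sound = λ () ; complete = λ q → case QY.last q of λ
          { (inj₁ (_ , () , _))
          ; (inj₂ (y , p , _)) → contradiction p (no-cells _ xs sh e 0<L (QY.shape≡ q)) } }

    qys-lists : ∀ n m xs c → Shape L xs → sum xs ≡ n → n < L → Lists L (λ _ → 0) (QY n m xs c) (qys n m xs c)
    qys-lists zero    m       xs c sh e n<L = qys-0 m xs c sh e n<L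
    qys-lists (suc n) zero    xs c sh e n<L = record { unique = [] ; sound = λ () ; complete = λ q → case QY.last q of λ
          { (inj₁ (() , _))
          ; (inj₂ (y , p , _)) → contradiction (≤-trans (proj₁ (QY.entries q p)) (proj₂ (QY.entries q p))) λ () } }
    qys-lists (suc n) (suc m) xs c sh e n<L with removable c xs in rem
    ... | false = record { unique = [] ; sound = λ () ; complete = λ q → case QY-cases sh e n<L q of λ
          { (_ , _ , _ , _ , rem′ , _) → contradiction (trans (sym rem) rem′) λ () } }
    ... | true = record
      { unique = unique-map (λ _ _ → push-injective L (λ _ → 0))
          (unique-concat< (suc L) _ unique-before (λ {T} {i} {j} p q → same-index (sound-before i p) (sound-before j q)))
      ; sound = λ p → let (T′ , p′ , e′) = ∈-map⁻ _ p
                          (i , _ , p″) = ∈-concat<⁻ (suc L) _ p′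
                      in subst (QY (suc n) (suc m) xs c) (sym e′) (case sound-before i p″ of λ
                           { (inj₁ (i<c , q)) → QY-push-same sh s<L rem i<c q
                           ; (inj₂ (c≤i , q)) → QY-push-new sh s<L rem c≤i q })
      ; complete = λ q → case QY-cases sh e n<L q of λ
          { (m , T′ , i , refl , _ , refl , i≤L , which) → ∈-map⁺ _ (∈-concat<⁺ (suc L) _ i (s≤s i≤L) (complete-before i which)) } }
      where
      s<L : sum xs < L
      s<L = subst (_< L) (sym e) n<L
      n<L′ : n < L
      n<L′ = <-trans ≤-refl n<L
      open Corner {xs} {c} sh s<L rem using (dec-Shape; dec-sum)
      sum′ : sum (dec c xs) ≡ n
      sum′ = suc-injective (trans dec-sum e)
      lists : ∀ m i → Lists L (λ _ → 0) (QY n m (dec c xs) i) (qys n m (dec c xs) i)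
      lists m i = qys-lists n m (dec c xs) i dec-Shape sum′ n<L′
      f : ℕ → List Filling
      f = before (λ m → qys n m (dec c xs)) m c
      unique-before : ∀ i → Unique (f i)
      unique-before i with i <ᵇ c
      ... | true  = unique (lists (suc m) i)
      ... | false = unique (lists m i)
      Which : ℕ → Filling → Set
      Which i T = (i < c × QY n (suc m) (dec c xs) i T) ⊎ (c ≤ i × QY n m (dec c xs) i T)
      -- The column `i` can be recovered from the tableau, so the concatenated pieces are disjoint.
      same-index : ∀ {T i j} → Which i T → Which j T → i ≡ j
      same-index p q with label p | label q
        where
        label : ∀ {T i} → Which i T → ∃ λ m → QY n m (dec c xs) i T
        label (inj₁ (_ , p)) = suc m , p
        label (inj₂ (_ , p)) = m , p
      ... | _ , p′ | _ , q′ = proj₂ (QY-unique dec-Shape sum′ n<L′ p′ q′)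
      sound-before : ∀ i {T} → T ∈ f i → Which i T
      sound-before i p with i <ᵇ c in eq
      ... | true  = inj₁ (<ᵇ≡⇒< {i} {c} eq , sound (lists (suc m) i) p)
      ... | false = inj₂ ((≮⇒≥ λ q → contradiction (trans (sym eq) (<⇒<ᵇ≡ q)) λ ()) , sound (lists m i) p)
      complete-before : ∀ i {T} → Which i T → T ∈ f i
      complete-before i (inj₁ (i<c , q)) rewrite <⇒<ᵇ≡ i<c = complete (lists (suc m) i) q
      complete-before i (inj₂ (c≤i , q)) rewrite ≥⇒<ᵇ≡ c≤i = complete (lists m i) q

    qyts : ℕ → ℕ → List ℕ → List Filling
    qyts n m xs = concat< (suc L) (qys n m xs)

    length-qyts : ∀ n m xs → length (qyts n m xs) ≡ Σ< (suc L) (b L n m xs)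
    length-qyts n m xs = trans (length-concat< (suc L) (qys n m xs)) (Σ<-cong (suc L) λ i _ → length-qys n m xs i)

    record QYT (m : ℕ) (xs : List ℕ) (T : Filling) : Set where
      field
        shape≡  : shape T ≡ conj xs
        ss      : Semistandard T
        qy      : QuasiYamanouchi T
        entries : ∀ {y} → y ∈ cells T → 1 ≤ entry y × entry y ≤ m
        maximum : Any (λ y → entry y ≡ m) (cells T)

    -- A nonempty tableau has a rightmost instance of its maximum, so the lists for the single
    -- columns exhaust all of them.
    qyts-lists : ∀ n m xs → Shape L xs → sum xs ≡ suc n → suc n < L → Lists L (λ _ → 0) (QYT m xs) (qyts (suc n) m xs)
    qyts-lists n m xs sh e n<L = record
      { unique = unique-concat< (suc L) _ (λ i → unique (lists i))
          (λ {T} {i} {j} p q → proj₂ (QY-unique sh e n<L (sound (lists i) p) (sound (lists j) q)))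
      ; sound = λ p → let (i , _ , p′) = ∈-concat<⁻ (suc L) (qys (suc n) m xs) p
                          q = sound (lists i) p′ in record
          { shape≡ = QY.shape≡ q ; ss = QY.ss q ; qy = QY.qy q ; entries = QY.entries q
          ; maximum = case QY.last q of λ { (inj₁ (() , _)) ; (inj₂ (y , y∈ , e , _)) → lose y∈ e } }
      ; complete = λ {T} q → let (y , y∈ , e′) = find (QYT.maximum q)
                                 (z , z∈ , ez , max) = farthest (λ w → entry w ≟ m) (cells T) y∈ e′
                             in ∈-concat<⁺ (suc L) (qys (suc n) m xs) (col z) (m≤n⇒m≤1+n (reached q z∈)) (complete (lists (col z)) record
          { shape≡ = QYT.shape≡ q ; ss = QYT.ss q ; qy = QYT.qy q ; entries = QYT.entries q
          ; right = max ; last = inj₂ (z , z∈ , ez , refl) }) }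
      where
      lists : ∀ i → Lists L (λ _ → 0) (QY (suc n) m xs i) (qys (suc n) m xs i)
      lists i = qys-lists (suc n) m xs i sh e n<L
      reached : ∀ {T z} → QYT m xs T → z ∈ cells T → col z < L
      reached {T} {z} q p = <-≤-trans (subst (col z <_) (trans (cong (_‼ height z) (QYT.shape≡ q))
          (conj-‼ xs (height z) (proj₂ sh) (subst (_< L) (sym e) n<L))) (cell-bound T p))
        (≤-trans (length-filter (height z <?_) xs) (≤-reflexive (proj₁ sh)))

-- Comparison with the fillings of the definitions

module Fillings where

  open import Defs hiding (_+_; _*_; _^_; ∑; ∏; z)
  open import Data.Bool.Base using (true; false)
  import Data.Fin.Base as Fin
  open import Data.List.Base using (List; []; _∷_; _++_; length; map; filter; replicate; applyUpTo)
  import Data.List.Properties as List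
  open import Data.List.Membership.Propositional using (_∈_)
  open import Data.List.Membership.Propositional.Properties
    using (∈-map⁺; ∈-map⁻; ∈-filter⁺; ∈-filter⁻; ∈-cartesianProductWith⁺; ∈-cartesianProductWith⁻; ∈-applyUpTo⁺; ∈-applyUpTo⁻)
  open import Data.List.Relation.Binary.Permutation.Propositional.Properties using (↭-length)
  open import Data.List.Relation.Unary.All as All using (All; []; _∷_)
  import Data.List.Relation.Unary.All.Properties as All
  open import Data.List.Relation.Unary.AllPairs using ([]; _∷_)
  open import Data.List.Relation.Unary.Any using (Any; here)
  open import Data.List.Relation.Unary.Linked as Linked using (Linked; []; [-]; _∷_)
  open import Data.List.Relation.Unary.Unique.Propositional using (Unique)
  import Data.List.Relation.Unary.Unique.Propositional.Properties as Unique
  open import Data.Nat.Base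
  open import Data.Nat.ListAction using (sum)
  import Data.Nat.ListAction.Properties as ListAction
  open import Data.Nat.Properties
  open import Data.Product.Base using (_×_; _,_; proj₂; ∃)
  open import Data.Vec.Base as Vec using (Vec)
  import Data.Vec.Properties as Vec
  open import Function.Base using (_∘_)
  open import Relation.Binary.PropositionalEquality
  open import Relation.Nullary using (does)
  open import Relation.Nullary.Decidable using (_×-dec_)
  open import Relation.Unary using (Decidable)
  open Strips
  open Descents
  open Tableaux
  open QuasiYamanouchiTableaux

  -- The remaining fields are proofs of propositions with at most one proof.
  Partition-≡ : ∀ {n} {μ ν : Partition n} → parts μ ≡ parts ν → μ ≡ ν
  Partition-≡ {μ = record { positive = p ; sorted = s ; sum≡n = e }} {record { positive = p′ ; sorted = s′ ; sum≡n = e′ }} refl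
    with refl ← All.irrelevant ≤-irrelevant p p′
    with refl ← Linked.irrelevant ≤-irrelevant s s′
    with refl ← ≡-irrelevant e e′ = refl

  ∈-rowFillings⁺ : ∀ m R → All (λ x → 1 ≤ x × x ≤ m) R → R ∈ rowFillings m (length R)
  ∈-rowFillings⁺ m []          []                 = here refl
  ∈-rowFillings⁺ m (suc x ∷ R) ((_ , x<m) ∷ ps) =
    ∈-cartesianProductWith⁺ _∷_ (∈-applyUpTo⁺ suc x<m) (∈-rowFillings⁺ m R ps)

  ∈-rowFillings⁻ : ∀ m k {R} → R ∈ rowFillings m k → length R ≡ k × All (λ x → 1 ≤ x × x ≤ m) R
  ∈-rowFillings⁻ m zero (here refl) = refl , []
  ∈-rowFillings⁻ m (suc k) p
    with x , R , x∈ , R∈ , refl ← ∈-cartesianProductWith⁻ _∷_ (applyUpTo suc m) (rowFillings m k) p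
    with i , i<m , refl ← ∈-applyUpTo⁻ suc x∈
    with e , ps ← ∈-rowFillings⁻ m k R∈ = cong suc e , (s≤s z≤n , i<m) ∷ ps

  unique-rowFillings : ∀ m k → Unique (rowFillings m k)
  unique-rowFillings m zero    = [] ∷ []
  unique-rowFillings m (suc k) = Unique.cartesianProductWith⁺ _∷_ List.∷-injective
    (Unique.applyUpTo⁺₁ suc m λ i<j _ e → <⇒≢ i<j (suc-injective e)) (unique-rowFillings m k)

  ∈-fillings⁺ : ∀ m T → All (All (λ x → 1 ≤ x × x ≤ m)) T → T ∈ fillings m (shape T)
  ∈-fillings⁺ m []      []       = here refl
  ∈-fillings⁺ m (R ∷ T) (p ∷ ps) = ∈-cartesianProductWith⁺ _∷_ (∈-rowFillings⁺ m R p) (∈-fillings⁺ m T ps)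

  ∈-fillings⁻ : ∀ m ks {T} → T ∈ fillings m ks → shape T ≡ ks × All (All (λ x → 1 ≤ x × x ≤ m)) T
  ∈-fillings⁻ m []       (here refl) = refl , []
  ∈-fillings⁻ m (k ∷ ks) p
    with R , T , R∈ , T∈ , refl ← ∈-cartesianProductWith⁻ _∷_ (rowFillings m k) (fillings m ks) p
    with e , ps ← ∈-fillings⁻ m ks T∈ with e′ , qs ← ∈-rowFillings⁻ m k R∈ = cong₂ _∷_ e′ e , qs ∷ ps

  unique-fillings : ∀ m ks → Unique (fillings m ks)
  unique-fillings m []       = [] ∷ []
  unique-fillings m (k ∷ ks) = Unique.cartesianProductWith⁺ _∷_ List.∷-injective (unique-rowFillings m k) (unique-fillings m ks)

  module _ {P : ℕ → Set} where

    rowCells-All⁺ : ∀ r c R → All P R → All (P ∘ entry) (rowCells r c R)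
    rowCells-All⁺ r c []      []       = []
    rowCells-All⁺ r c (x ∷ R) (p ∷ ps) = p ∷ rowCells-All⁺ r (suc c) R ps

    rowCells-All⁻ : ∀ r c R → All (P ∘ entry) (rowCells r c R) → All P R
    rowCells-All⁻ r c []      []       = []
    rowCells-All⁻ r c (x ∷ R) (p ∷ ps) = p ∷ rowCells-All⁻ r (suc c) R ps

    cells-All⁺ : ∀ r T → All (All P) T → All (P ∘ entry) (cellsFrom r T)
    cells-All⁺ r []      []       = []
    cells-All⁺ r (R ∷ T) (p ∷ ps) = All.++⁺ (rowCells-All⁺ r 0 R p) (cells-All⁺ (suc r) T ps)

    cells-All⁻ : ∀ r T → All (P ∘ entry) (cellsFrom r T) → All (All P) T
    cells-All⁻ r []      []       = []
    cells-All⁻ r (R ∷ T) ps with p , qs ← All.++⁻ (rowCells r 0 R) ps =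
      rowCells-All⁻ r 0 R p ∷ cells-All⁻ (suc r) T qs

  record SSYT (m : ℕ) (ks : List ℕ) (T : Filling) : Set where
    field
      shape≡  : shape T ≡ ks
      ss      : Semistandard T
      entries : All (λ y → 1 ≤ entry y × entry y ≤ m) (cells T)

  ∈-ssyt⁺ : ∀ {n} m (μ : Partition n) {T} → SSYT m (parts μ) T → T ∈ ssyt m μ
  ∈-ssyt⁺ m μ {T} t = ∈-filter⁺ semistandard?
    (subst (λ ks → T ∈ fillings m ks) (SSYT.shape≡ t) (∈-fillings⁺ m T (cells-All⁻ 0 T (SSYT.entries t)))) (SSYT.ss t)

  ∈-ssyt⁻ : ∀ {n} m (μ : Partition n) {T} → T ∈ ssyt m μ → SSYT m (parts μ) T
  ∈-ssyt⁻ m μ {T} p with q , ss ← ∈-filter⁻ semistandard? {xs = fillings m (parts μ)} p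
                    with e , ps ← ∈-fillings⁻ m (parts μ) q =
    record { shape≡ = e ; ss = ss ; entries = cells-All⁺ 0 T ps }

  unique-ssyt : ∀ {n} m (μ : Partition n) → Unique (ssyt m μ)
  unique-ssyt m μ = Unique.filter⁺ semistandard? (unique-fillings m (parts μ))

  -- The tableaux enumerated by recursion have a fixed number of rows, empty ones included; those in
  -- `ssyt` have no empty rows.
  pad : ℕ → Filling → Filling
  pad j T = T ++ replicate j []

  cells-pad : ∀ j T → cells (pad j T) ≡ cells T
  cells-pad j T = go 0 T
    where
    go : ∀ r T → cellsFrom r (T ++ replicate j []) ≡ cellsFrom r T
    go r []      = empty-rows 0 (λ _ → 0) j r
    go r (R ∷ T) = cong (rowCells r 0 R ++_) (go (suc r) T)

  shape-pad : ∀ j T → shape (pad j T) ≡ shape T ++ replicate j 0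
  shape-pad j T = trans (List.map-++ length T _) (cong (shape T ++_) (List.map-replicate length j []))

  unpad : ∀ j ks T → shape T ≡ ks ++ replicate j 0 → ∃ λ T′ → T ≡ pad j T′ × shape T′ ≡ ks
  unpad j []       T e = [] , go j T e , refl
    where
    go : ∀ j T → shape T ≡ replicate j 0 → T ≡ replicate j []
    go zero    []       e = refl
    go (suc j) ([] ∷ T) e = cong ([] ∷_) (go j T (List.∷-injectiveʳ e))
  unpad j (k ∷ ks) (R ∷ T) e with refl , e′ ← List.∷-injective e with T′ , refl , refl ← unpad j ks T e′ =
    R ∷ T′ , refl , refl

  pad-injective : ∀ j {T T′} → pad j T ≡ pad j T′ → T ≡ T′
  pad-injective j {T} {T′} = List.++-cancelʳ (replicate j []) T T′

  -- Padding is injective, so matching the padded members of one enumeration with the other shows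
  -- that their lengths agree.
  length-pad : ∀ j {xs ys} → Unique xs → Unique ys → (∀ {T} → T ∈ xs → pad j T ∈ ys) →
               (∀ {T} → T ∈ ys → ∃ λ T′ → T ≡ pad j T′ × T′ ∈ xs) → length xs ≡ length ys
  length-pad j {xs} {ys} u v to from = trans (sym (List.length-map (pad j) xs))
    (↭-length (unique-↭ (Unique.map⁺ (pad-injective j) u) v
      (λ p → let (T , q , e) = ∈-map⁻ (pad j) p in subst (_∈ ys) (sym e) (to q))
      (λ p → let (T , e , q) = from p in subst (_∈ map (pad j) xs) (sym e) (∈-map⁺ (pad j) q))))

  padded : ℕ → List ℕ → List ℕ
  padded L ps = ps ++ replicate (L ∸ length ps) 0

  sum-zeros′ : ∀ j → sum (replicate j 0) ≡ 0
  sum-zeros′ zero    = refl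
  sum-zeros′ (suc j) = sum-zeros′ j

  zeros-‼ : ∀ j i → replicate j 0 ‼ i ≡ 0
  zeros-‼ zero    i       = refl
  zeros-‼ (suc j) zero    = refl
  zeros-‼ (suc j) (suc i) = zeros-‼ j i

  mono-padded : ∀ ps j → Linked _≥_ ps → Mono (ps ++ replicate j 0)
  mono-padded []           j []       i       = ≤-reflexive (trans (zeros-‼ j (suc i)) (sym (zeros-‼ j i))) 
  mono-padded (p ∷ [])     j [-]      zero    = ≤-trans (≤-reflexive (zeros-‼ j 0)) z≤n
  mono-padded (p ∷ [])     j [-]      (suc i) = mono-padded [] j [] i
  mono-padded (p ∷ q ∷ ps) j (p≥q ∷ l) zero    = p≥q
  mono-padded (p ∷ q ∷ ps) j (p≥q ∷ l) (suc i) = mono-padded (q ∷ ps) j l i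

  length≤sum : ∀ ps → All (0 <_) ps → length ps ≤ sum ps
  length≤sum []       []       = z≤n
  length≤sum (p ∷ ps) (q ∷ qs) = +-mono-≤ q (length≤sum ps qs)

  ℓ≤ : ∀ {n} (μ : Partition n) → ℓ μ ≤ n
  ℓ≤ μ = ≤-trans (length≤sum (parts μ) (positive μ)) (≤-reflexive (sum≡n μ))

  module _ {n : ℕ} (μ : Partition n) where

    -- One more row than cells: the last row is empty, as the commutation of strips requires.
    rows : List ℕ
    rows = padded (suc n) (parts μ)

    sum-rows : sum rows ≡ n
    sum-rows = trans (ListAction.sum-++ (parts μ) _)
      (trans (cong₂ _+_ (sum≡n μ) (sum-zeros′ (suc n ∸ ℓ μ))) (+-identityʳ n))

    Shape-rows : Shape (suc n) rows
    Shape-rows = trans (List.length-++ (parts μ)) (trans (cong (ℓ μ +_) (List.length-replicate (suc n ∸ ℓ μ)))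
      (m+[n∸m]≡n (m≤n⇒m≤1+n (ℓ≤ μ)))) , mono-padded (parts μ) _ (sorted μ)

  applyUpTo-padded : ∀ (f : ℕ → ℕ) K L → K ≤ L → (∀ i → K ≤ i → f i ≡ 0) →
                     applyUpTo f L ≡ applyUpTo f K ++ replicate (L ∸ K) 0
  applyUpTo-padded f zero    zero    K≤L e = refl
  applyUpTo-padded f zero    (suc L) K≤L e = cong₂ _∷_ (e 0 z≤n) (applyUpTo-padded (f ∘ suc) zero L z≤n λ i _ → e (suc i) z≤n)
  applyUpTo-padded f (suc K) (suc L) (s≤s K≤L) e = cong (f 0 ∷_) (applyUpTo-padded (f ∘ suc) K L K≤L λ i K≤i → e (suc i) (s≤s K≤i))

  column-padded : ∀ ps j i → column (ps ++ replicate j 0) i ≡ column ps i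
  column-padded ps j i = trans (cong length (List.filter-++ (i <?_) ps _))
    (trans (List.length-++ (filter (i <?_) ps)) (trans (cong (length (filter (i <?_) ps) +_)
      (column-reject (replicate j 0) i λ k → ≤-trans (≤-reflexive (zeros-‼ j k)) z≤n)) (+-identityʳ _)))

  largest≤sum : ∀ ps → largest ps ≤ sum ps
  largest≤sum []       = z≤n
  largest≤sum (p ∷ ps) = ⊔-lub (m≤m+n p _) (≤-trans (largest≤sum ps) (m≤n+m _ p))

  column-largest : ∀ ps i → largest ps ≤ i → column ps i ≡ 0
  column-largest ps i l≤i = cong length (List.filter-none (i <?_) (All.map (λ p≤l → ≤⇒≯ (≤-trans p≤l l≤i)) (≤largest ps)))

  applyUpTo-cong : ∀ {f g : ℕ → ℕ} → (∀ i → f i ≡ g i) → ∀ L → applyUpTo f L ≡ applyUpTo g L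
  applyUpTo-cong e zero    = refl
  applyUpTo-cong e (suc L) = cong₂ _∷_ (e 0) (applyUpTo-cong (e ∘ suc) L)

  conj-rows : ∀ {n} (μ : Partition n) →
              conj (suc n) (rows μ) ≡ parts (conjugate μ) ++ replicate (suc n ∸ largest (parts μ)) 0
  conj-rows {n} μ = trans (applyUpTo-cong (column-padded (parts μ) _) (suc n))
    (applyUpTo-padded (column (parts μ)) (largest (parts μ)) (suc n)
      (m≤n⇒m≤1+n (≤-trans (largest≤sum (parts μ)) (≤-reflexive (sum≡n μ)))) (column-largest (parts μ)))

  module _ {n : ℕ} (lam : Partition (suc n)) (m : ℕ) where

    private
      L = suc (suc n)
      j = L ∸ largest (parts lam)
      lists = qyts-lists L n m (rows lam) (Shape-rows lam) (sum-rows lam) ≤-refl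

    QYT₌-qyts : QYT₌ m (conjugate lam) ≡ length (qyts L (suc n) m (rows lam))
    QYT₌-qyts = length-pad j (Unique.filter⁺ good? (unique-ssyt m (conjugate lam))) (Lists.unique lists)
      (λ {T} p → let (q , qy , (le , mx)) = ∈-filter⁻ good? {xs = ssyt m (conjugate lam)} p
                     t = ∈-ssyt⁻ m (conjugate lam) q in Lists.complete lists (record
        { shape≡ = trans (shape-pad j T) (trans (cong (_++ replicate j 0) (SSYT.shape≡ t)) (sym (conj-rows lam)))
        ; ss = subst (λ c → All (λ x → All (Ordered x) c) c) (sym (cells-pad j T)) (SSYT.ss t)
        ; qy = subst QY′ (sym (cells-pad j T)) qy
        ; entries = λ {y} p → All.lookup (SSYT.entries t) (subst (y ∈_) (cells-pad j T) p)
        ; maximum = subst (Any (λ y → entry y ≡ m)) (sym (cells-pad j T)) mx }))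
      (λ {T} p → let q = Lists.sound lists p
                     (T′ , e , s) = unpad j (parts (conjugate lam)) T (trans (QYT.shape≡ q) (conj-rows lam))
                     c≡ : cells T ≡ cells T′
                     c≡ = trans (cong cells e) (cells-pad j T′)
                 in T′ , e , ∈-filter⁺ good? (∈-ssyt⁺ m (conjugate lam) (record
                   { shape≡ = s
                   ; ss = subst (λ c → All (λ x → All (Ordered x) c) c) c≡ (QYT.ss q)
                   ; entries = subst (All _) c≡ (All.tabulate (QYT.entries q)) }))
                   (subst QY′ c≡ (QYT.qy q) ,
                    subst (All (λ y → entry y ≤ m)) c≡ (All.tabulate (proj₂ ∘ QYT.entries q)) ,
                    subst (Any (λ y → entry y ≡ m)) c≡ (QYT.maximum q)))
      where
      good? : Decidable (λ T → QuasiYamanouchi T × HasMaximum m T)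
      good? T = quasiYamanouchi? T ×-dec hasMaximum? m T
      QY′ : List Cell → Set
      QY′ c = All (λ x → 1 < entry x → All (λ y → entry y ≡ entry x → col x ≤ col y) c →
                Any (λ y → suc (entry y) ≡ entry x × x WeaklyLeftOf y) c) c

  -- The Kostka number K_{λμ}; by definition `s lam μ` is its image in ℚ(α).
  kostka : ∀ {n} → Partition n → Partition n → ℕ
  kostka lam μ = coefficient (Vec.fromList (parts μ)) (map (weight (ℓ μ)) (ssyt (ℓ μ) lam))

  count-map : ∀ {A B : Set} {P : B → Set} (P? : Decidable P) (f : A → B) xs →
              count P? (map f xs) ≡ count (P? ∘ f) xs
  count-map P? f []       = refl
  count-map P? f (x ∷ xs) with does (P? (f x))
  ... | true  = cong suc (count-map P? f xs)
  ... | false = count-map P? f xs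

  tabulate-fromList : ∀ ps (f : ℕ → ℕ) → (∀ {i} → i < length ps → f i ≡ ps ‼ i) →
                      Vec.tabulate {n = length ps} (f ∘ Fin.toℕ) ≡ Vec.fromList ps
  tabulate-fromList []       f e = refl
  tabulate-fromList (p ∷ ps) f e = cong₂ Vec._∷_ (e (s≤s z≤n)) (tabulate-fromList ps (f ∘ suc) (e ∘ s≤s))

  fromList-tabulate : ∀ ps (f : ℕ → ℕ) → Vec.tabulate {n = length ps} (f ∘ Fin.toℕ) ≡ Vec.fromList ps →
                      ∀ {i} → i < length ps → f i ≡ ps ‼ i
  fromList-tabulate (p ∷ ps) f e {zero}  _         = Vec.∷-injectiveˡ e
  fromList-tabulate (p ∷ ps) f e {suc i} (s≤s i<l) = fromList-tabulate ps (f ∘ suc) (Vec.∷-injectiveʳ e) i<l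

  module _ {n : ℕ} (μ : Partition n) where

    private
      L = suc n
      μ‼ = λ i → parts μ ‼ i
      lists = tabs-lists L μ‼ (ℓ μ)

    has-rows? : ∀ lam → Decidable (λ T → shape T ≡ rows {n} lam)
    has-rows? lam T = List.≡-dec _≟_ (shape T) (rows lam)

    -- The weight vector prescribes exactly the contents that are built into `tabs`; what remains is
    -- to fix the shape.
    kostka-tabs : ∀ lam → kostka lam μ ≡ count (has-rows? lam) (tabs L μ‼ (ℓ μ))
    kostka-tabs lam = trans (count-map _≟μ (weight (ℓ μ)) (ssyt (ℓ μ) lam))
      (length-pad j (Unique.filter⁺ (_≟μ ∘ weight (ℓ μ)) (unique-ssyt (ℓ μ) lam)) (Unique.filter⁺ (has-rows? lam) (Lists.unique lists))
        (λ {T} p → let (q , w) = ∈-filter⁻ (_≟μ ∘ weight (ℓ μ)) {xs = ssyt (ℓ μ) lam} p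
                       t = ∈-ssyt⁻ (ℓ μ) lam q
                       shape≡ = trans (shape-pad j T) (cong (_++ replicate j 0) (SSYT.shape≡ t))
                   in ∈-filter⁺ (has-rows? lam) (Lists.complete lists (record
          { shapely = subst (Shape L) (sym shape≡) (Shape-rows lam)
          ; ss = subst (λ c → All (λ x → All (Ordered x) c) c) (sym (cells-pad j T)) (SSYT.ss t)
          ; entries = λ {y} p → All.lookup (SSYT.entries t) (subst (y ∈_) (cells-pad j T) p)
          ; contents = λ {i} i<N → trans (cong (count (λ y → entry y ≟ suc i)) (cells-pad j T))
              (fromList-tabulate (parts μ) (content T ∘ suc) w i<N) })) shape≡)
        (λ {T} p → let (q , shape≡) = ∈-filter⁻ (has-rows? lam) {xs = tabs L μ‼ (ℓ μ)} p
                       t = Lists.sound lists q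
                       (T′ , e , s) = unpad j (parts lam) T shape≡
                       c≡ : cells T ≡ cells T′
                       c≡ = trans (cong cells e) (cells-pad j T′)
                   in T′ , e , ∈-filter⁺ (_≟μ ∘ weight (ℓ μ)) (∈-ssyt⁺ (ℓ μ) lam (record
                     { shape≡ = s
                     ; ss = subst (λ c → All (λ x → All (Ordered x) c) c) c≡ (Tab.ss t)
                     ; entries = subst (All _) c≡ (All.tabulate (Tab.entries t)) }))
                     (tabulate-fromList (parts μ) (content T′ ∘ suc) λ {i} i<N →
                       trans (cong (count (λ y → entry y ≟ suc i)) (sym c≡)) (Tab.contents t i<N))))
      where
      j = L ∸ ℓ lam
      _≟μ : Decidable (λ v → v ≡ Vec.fromList (parts μ))
      v ≟μ = Vec.≡-dec _≟_ v (Vec.fromList (parts μ))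

-- Kostka numbers and the dual Cauchy identity

module Enumerate where

  open import Defs hiding (_+_; _*_; _^_; ∑; ∏; z)
  open import Data.Bool.Base using (true; false; if_then_else_)
  open import Data.List.Base using (List; []; _∷_; _++_; length; map; replicate)
  import Data.List.Properties as List
  open import Data.List.Membership.Propositional using (_∈_)
  open import Data.List.Relation.Unary.All as All using (All; []; _∷_)
  import Data.List.Relation.Unary.All.Properties as All
  open import Data.List.Relation.Unary.AllPairs using ([]; _∷_)
  open import Data.List.Relation.Unary.Any using (here; there)
  open import Data.List.Relation.Unary.Linked as Linked using (Linked; []; [-]; _∷_)
  open import Data.List.Relation.Unary.Unique.Propositional using (Unique)
  open import Data.Nat.Base
  open import Data.Nat.Combinatorics using (_C_)
  open import Data.Nat.ListAction using (sum; product)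
  open import Data.Nat.Properties
  open import Data.Product.Base using (_×_; _,_; proj₁; ∃)
  open import Function.Base using (_∘_)
  open import Relation.Binary.PropositionalEquality
  open import Relation.Nullary using (yes; no; contradiction; Dec; does)
  open import Relation.Nullary.Decidable using (_×-dec_)
  open Strips
  open Descents
  open Tableaux
  open QuasiYamanouchiTableaux
  open Fillings

  IsPartition : ℕ → List ℕ → Set
  IsPartition n ps = All (0 <_) ps × Linked _≥_ ps × sum ps ≡ n

  isPartition? : ∀ n ps → Dec (IsPartition n ps)
  isPartition? n ps = All.all? (0 <?_) ps ×-dec (Linked.linked? _≥?_ ps ×-dec sum ps ≟ n)

  keep : ∀ n → List (List ℕ) → List (Partition n)
  keep n [] = []
  keep n (ps ∷ pss) with isPartition? n ps
  ... | yes (p , s , e) = record { parts = ps ; positive = p ; sorted = s ; sum≡n = e } ∷ keep n pss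
  ... | no  _           = keep n pss

  ∈-keep⁻ : ∀ n pss {μ} → μ ∈ keep n pss → parts μ ∈ pss
  ∈-keep⁻ n (ps ∷ pss) p with isPartition? n ps
  ∈-keep⁻ n (ps ∷ pss) (here refl) | yes _ = here refl
  ∈-keep⁻ n (ps ∷ pss) (there p)   | yes _ = there (∈-keep⁻ n pss p)
  ∈-keep⁻ n (ps ∷ pss) p           | no  _ = there (∈-keep⁻ n pss p)

  ∈-keep⁺ : ∀ n pss μ → parts μ ∈ pss → μ ∈ keep n pss
  ∈-keep⁺ n (ps ∷ pss) μ p with isPartition? n ps
  ∈-keep⁺ n (ps ∷ pss) μ (here e)  | yes _ = here (Partition-≡ e)
  ∈-keep⁺ n (ps ∷ pss) μ (there p) | yes _ = there (∈-keep⁺ n pss μ p)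
  ∈-keep⁺ n (ps ∷ pss) μ (here refl) | no ¬p = contradiction (positive μ , sorted μ , sum≡n μ) ¬p
  ∈-keep⁺ n (ps ∷ pss) μ (there p) | no  _ = ∈-keep⁺ n pss μ p

  unique-keep : ∀ n {pss} → Unique pss → Unique (keep n pss)
  unique-keep n [] = []
  unique-keep n {ps ∷ pss} (ps∉ ∷ u) with isPartition? n ps
  ... | yes _ = All.tabulate (λ p e → All.lookup ps∉ (∈-keep⁻ n pss p) (cong parts e)) ∷ unique-keep n u
  ... | no  _ = unique-keep n u

  -- Found by a search through all lists of at most `n` entries between 1 and `n`; every partition
  -- of `n` is among them.
  partitions : ∀ n → List (Partition n)
  partitions n = keep n (concat< (suc n) (rowFillings n))

  ∈-partitions : ∀ {n} (μ : Partition n) → μ ∈ partitions n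
  ∈-partitions {n} μ = ∈-keep⁺ n _ μ (∈-concat<⁺ (suc n) (rowFillings n) (ℓ μ) (s≤s (ℓ≤ μ))
    (∈-rowFillings⁺ n (parts μ) (All.tabulate λ {x} p → All.lookup (positive μ) p , ≤-trans (∈⇒≤sum p) (≤-reflexive (sum≡n μ)))))
    where
    ∈⇒≤sum : ∀ {x ps} → x ∈ ps → x ≤ sum ps
    ∈⇒≤sum {ps = p ∷ ps} (here refl) = m≤m+n p _
    ∈⇒≤sum {ps = p ∷ ps} (there q)   = ≤-trans (∈⇒≤sum q) (m≤n+m _ p)

  unique-partitions : ∀ n → Unique (partitions n)
  unique-partitions n = unique-keep n (unique-concat< (suc n) (rowFillings n) (unique-rowFillings n)
    λ {R} {i} {j} p q → trans (sym (proj₁ (∈-rowFillings⁻ n i p))) (proj₁ (∈-rowFillings⁻ n j q)))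

  ∑P : ∀ n → (Partition n → ℕ) → ℕ
  ∑P n f = sum (map f (partitions n))

  sum-indicator : ∀ {A : Set} {P : A → Set} (P? : ∀ a → Dec (P a)) (f : A → ℕ) {xs a} → Unique xs → a ∈ xs → P a →
                  (∀ {b} → P b → a ≡ b) → sum (map (λ a → (if does (P? a) then 1 else 0) * f a) xs) ≡ f a
  sum-indicator {A} P? f {x ∷ xs} (x∉ ∷ u) (here refl) p only with P? x
  ... | no ¬p = contradiction p ¬p
  ... | yes _ = trans (cong₂ _+_ (+-identityʳ (f x)) (zeros xs x∉)) (+-identityʳ (f x))
    where
    zeros : ∀ xs → All (x ≢_) xs → sum (map (λ a → (if does (P? a) then 1 else 0) * f a) xs) ≡ 0
    zeros []       [] = refl
    zeros (y ∷ ys) (x≢y ∷ ne) with P? y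
    ... | yes q = contradiction (only q) x≢y
    ... | no  _ = zeros ys ne
  sum-indicator P? f {x ∷ xs} (x∉ ∷ u) (there a∈) p only with P? x
  ... | yes q = contradiction (sym (only q)) (All.lookup x∉ a∈)
  ... | no  _ = sum-indicator P? f u a∈ p only

  sum-map-+ : ∀ {A : Set} (f g : A → ℕ) xs → sum (map (λ a → f a + g a) xs) ≡ sum (map f xs) + sum (map g xs)
  sum-map-+ f g []       = refl
  sum-map-+ f g (x ∷ xs) = trans (cong (f x + g x +_) (sum-map-+ f g xs)) (interchange (f x) (g x) _ _)

  sum-map-cong : ∀ {A : Set} {f g : A → ℕ} xs → (∀ a → f a ≡ g a) → sum (map f xs) ≡ sum (map g xs)
  sum-map-cong xs e = cong sum (List.map-cong e xs)

  sum-map-0 : ∀ {A : Set} (xs : List A) → sum (map (λ _ → 0) xs) ≡ 0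
  sum-map-0 []       = refl
  sum-map-0 (x ∷ xs) = sum-map-0 xs

  -- In a weakly decreasing list nothing but zeros can follow a zero.
  trim : ∀ xs → Mono xs → ∃ λ ps → ∃ λ j → xs ≡ ps ++ replicate j 0 × All (0 <_) ps × Linked _≥_ ps
  trim []            mono = [] , 0 , refl , [] , []
  trim (zero ∷ xs)   mono = [] , suc (length xs) , cong (0 ∷_) (zeros xs λ i → n≤0⇒n≡0 (‼-≤-head 0 xs i mono)) , [] , []
    where
    zeros : ∀ xs → (∀ i → xs ‼ i ≡ 0) → xs ≡ replicate (length xs) 0
    zeros []       e = refl
    zeros (x ∷ xs) e = cong₂ _∷_ (e 0) (zeros xs (e ∘ suc))
  trim (suc x ∷ xs) mono with trim xs (mono ∘ suc)
  ... | []     , j , refl , _      , _ = suc x ∷ [] , j , refl , s≤s z≤n ∷ [] , [-]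
  ... | p ∷ ps , j , refl , q ∷ qs , l = suc x ∷ p ∷ ps , j , refl , s≤s z≤n ∷ q ∷ qs , mono 0 ∷ l

  rows-surjective : ∀ {n xs} → Shape (suc n) xs → sum xs ≡ n → ∃ λ (lam : Partition n) → xs ≡ rows lam
  rows-surjective {n} {xs} (len , mono) e with ps , j , refl , p , l ← trim xs mono =
    record { parts = ps ; positive = p ; sorted = l ; sum≡n = trans (sym (trans (ListAction.sum-++ ps (replicate j 0))
      (trans (cong (sum ps +_) (sum-zeros′ j)) (+-identityʳ _)))) e } ,
    cong (λ j → ps ++ replicate j 0) (sym (trans (cong (_∸ length ps) (trans (sym len)
      (trans (List.length-++ ps) (cong (length ps +_) (List.length-replicate j))))) (m+n∸m≡n (length ps) j)))
    where import Data.Nat.ListAction.Properties as ListAction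

  rows-injective : ∀ {n} {lam lam′ : Partition n} → rows lam ≡ rows lam′ → lam ≡ lam′
  rows-injective {n} {lam} {lam′} e = Partition-≡ (go (parts lam) (parts lam′) (positive lam) (positive lam′) _ _ e)
    where
    go : ∀ ps qs → All (0 <_) ps → All (0 <_) qs → ∀ i j → ps ++ replicate i 0 ≡ qs ++ replicate j 0 → ps ≡ qs
    go []       []       _ _ i j e = refl
    go []       (q ∷ qs) _ (0<q ∷ _) (suc i) j e = contradiction (List.∷-injectiveˡ e) (<⇒≢ 0<q)
    go (p ∷ ps) []       (0<p ∷ _) _ i (suc j) e = contradiction (sym (List.∷-injectiveˡ e)) (<⇒≢ 0<p)
    go (p ∷ ps) (q ∷ qs) (_ ∷ a) (_ ∷ b) i j e =
      cong₂ _∷_ (List.∷-injectiveˡ e) (go ps qs a b i j (List.∷-injectiveʳ e))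

  prefix-sum-Σ : ∀ L μ N → prefix-sum L μ N ≡ Σ< N μ
  prefix-sum-Σ L μ zero    = refl
  prefix-sum-Σ L μ (suc N) = cong (_+ μ N) (prefix-sum-Σ L μ N)

  Σ<-‼ : ∀ ps → Σ< (length ps) (ps ‼_) ≡ sum ps
  Σ<-‼ []       = refl
  Σ<-‼ (p ∷ ps) = trans (Σ<-head (length ps) (λ i → (p ∷ ps) ‼ i)) (cong (p +_) (Σ<-‼ ps))

  binomials-head : ∀ L μ M N → binomials L μ M (suc N) ≡ (M C μ 0) * binomials L (μ ∘ suc) M N
  binomials-head L μ M zero    = refl
  binomials-head L μ M (suc N) = trans (cong ((M C μ (suc N)) *_) (binomials-head L μ M N)) (x∙yz≈y∙xz (M C μ (suc N)) (M C μ 0) _)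
    where
    x∙yz≈y∙xz : ∀ x y z → x * (y * z) ≡ y * (x * z)
    x∙yz≈y∙xz x y z = trans (sym (*-assoc x y z)) (trans (cong (_* z) (*-comm x y)) (*-assoc y x z))

  binomials-product : ∀ L M ps → binomials L (ps ‼_) M (length ps) ≡ product (map (M C_) ps)
  binomials-product L M []       = refl
  binomials-product L M (p ∷ ps) = trans (binomials-head L (λ i → (p ∷ ps) ‼ i) M (length ps)) (cong ((M C p) *_) (binomials-product L M ps))

  module _ {n : ℕ} (μ : Partition n) where

    private
      L = suc n
      μ‼ = λ i → parts μ ‼ i

    -- Sorting the tableaux of content μ by their shape produces the Kostka numbers as
    -- multiplicities.
    kostka-total : ∀ (G : List ℕ → ℕ) → ∑P n (λ lam → kostka lam μ * G (rows lam)) ≡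
                   total L μ‼ G (tabs L μ‼ (ℓ μ))
    kostka-total G = trans (sum-map-cong (partitions n) λ lam → cong (_* G (rows lam)) (kostka-tabs μ lam))
      (regroup (tabs L μ‼ (ℓ μ)) λ {T} p → rows-surjective (Tab.shapely (Lists.sound (tabs-lists L μ‼ (ℓ μ)) p))
        (trans (proj₁ (tabs-size L μ‼ (ℓ μ) p)) (trans (prefix-sum-Σ L μ‼ (ℓ μ)) (trans (Σ<-‼ (parts μ)) (sum≡n μ)))))
      where
      regroup : ∀ Ts → (∀ {T} → T ∈ Ts → ∃ λ (lam : Partition n) → shape T ≡ rows lam) →
                ∑P n (λ lam → count (has-rows? μ lam) Ts * G (rows lam)) ≡ total L μ‼ G Ts
      regroup []       _ = sum-map-0 (partitions n)
      regroup (T ∷ Ts) f with lam₀ , e ← f (here refl) = begin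
        ∑P n (λ lam → count (has-rows? μ lam) (T ∷ Ts) * G (rows lam))
          ≡⟨ sum-map-cong (partitions n) split ⟩
        ∑P n (λ lam → indicator lam * G (rows lam) + count (has-rows? μ lam) Ts * G (rows lam))
          ≡⟨ sum-map-+ _ _ (partitions n) ⟩
        ∑P n (λ lam → indicator lam * G (rows lam)) + ∑P n (λ lam → count (has-rows? μ lam) Ts * G (rows lam))
          ≡⟨ cong₂ _+_ (trans (sum-indicator (λ lam → has-rows? μ lam T) (G ∘ rows) (unique-partitions n) (∈-partitions lam₀) e
               (λ e′ → rows-injective (trans (sym e) e′))) (cong G (sym e))) (regroup Ts (f ∘ there)) ⟩
        G (shape T) + total L μ‼ G Ts ∎
        where
        open ≡-Reasoning
        indicator : Partition n → ℕ
        indicator lam = if does (has-rows? μ lam T) then 1 else 0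
        split : ∀ lam → count (has-rows? μ lam) (T ∷ Ts) * G (rows lam) ≡
                        indicator lam * G (rows lam) + count (has-rows? μ lam) Ts * G (rows lam)
        split lam with does (has-rows? μ lam T)
        ... | true  = cong (_+ count (has-rows? μ lam) Ts * G (rows lam)) (sym (+-identityʳ _))
        ... | false = refl

  -- ⟨e_n[NX], s_λ⟩: the specialisation s_{λ'}(1^N).
  specialised : ∀ {n} → Partition n → ℕ → ℕ
  specialised {n} lam N = Σ< n (λ k → QYT₌ (suc k) (conjugate lam) * ((N + n ∸ suc k) C n))

  -- Summed over the row of the last cell, `b` counts the quasi-Yamanouchi tableaux of the conjugate
  -- shape with a given maximum.
  S-specialised : ∀ {n} .{{_ : NonZero n}} (lam : Partition n) N → S (suc n) N (rows lam) 0 ≡ specialised lam N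
  S-specialised {suc n} lam N = begin
    S L N xs 0
      ≡⟨ S-labelled L N (suc n) xs (Shape-rows lam) (sum-rows lam) ⟩
    Σ< (suc L) (λ c → Σ< L (λ m → b L (suc n) m xs c * ((N + suc n ∸ m) C suc n)))
      ≡⟨ Σ<-swap (suc L) L _ ⟩
    Σ< L (λ m → Σ< (suc L) (λ c → b L (suc n) m xs c * ((N + suc n ∸ m) C suc n)))
      ≡⟨ Σ<-cong L (λ m _ → Σ<-*ʳ (suc L) _ ((N + suc n ∸ m) C suc n)) ⟩
    Σ< L (λ m → Σ< (suc L) (b L (suc n) m xs) * ((N + suc n ∸ m) C suc n))
      ≡⟨ Σ<-head (suc n) _ ⟩
    -- A nonempty tableau has maximum at least 1, so the term `m = 0` vanishes.
    Σ< (suc L) (λ _ → 0) * ((N + suc n) C suc n)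
      + Σ< (suc n) (λ k → Σ< (suc L) (b L (suc n) (suc k) xs) * ((N + suc n ∸ suc k) C suc n))
      ≡⟨ cong₂ _+_ (cong (_* ((N + suc n) C suc n)) (Σ<-0 (suc L)))
           (Σ<-cong (suc n) λ k _ → cong (_* ((N + suc n ∸ suc k) C suc n))
             (sym (trans (QYT₌-qyts lam (suc k)) (length-qyts L (suc n) (suc k) xs)))) ⟩
    specialised lam N ∎
    where
    open ≡-Reasoning
    L = suc (suc n)
    xs = rows lam

  -- The coefficient of the monomial with exponents μ in ∏ᵢ (1 + xᵢ)^N = Σ_λ s_λ s_{λ′}(1^N).
  kostka-specialised : ∀ {n} .{{_ : NonZero n}} (μ : Partition n) N →
                       ∑P n (λ lam → kostka lam μ * specialised lam N) ≡ product (map (N C_) (parts μ))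
  kostka-specialised {n} μ N = begin
    ∑P n (λ lam → kostka lam μ * specialised lam N)
      ≡⟨ sum-map-cong (partitions n) (λ lam → cong (kostka lam μ *_) (S-specialised lam N)) ⟨
    ∑P n (λ lam → kostka lam μ * S L N (rows lam) 0)
      ≡⟨ kostka-total μ (λ xs → S L N xs 0) ⟩
    total L (parts μ ‼_) (λ xs → S L N xs 0) (tabs L (parts μ ‼_) (ℓ μ))
      ≡⟨ dual-cauchy L (parts μ ‼_) (s≤s z≤n) N (ℓ μ)
           (s≤s (≤-reflexive (trans (prefix-sum-Σ L (parts μ ‼_) (ℓ μ)) (trans (Σ<-‼ (parts μ)) (sum≡n μ))))) ⟩
    binomials L (parts μ ‼_) N (ℓ μ)
      ≡⟨ binomials-product L N (parts μ) ⟩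
    product (map (N C_) (parts μ)) ∎
    where
    open ≡-Reasoning
    L = suc n

-- Polynomials over ℚ and their signs

module PolyRing where

  open import Defs using (Poly; coeffₚ; _≈ₚ_; _+ₚ_; -ₚ_; _*ₚ_; NonZeroₚ; coeff-+; coeff-∷*; ZeroBelow; *-zeroBelow; 0∷*-zeroBelow; lowest; nonZero-at; *-nonZeroₚ)
  open import Algebra.Bundles using (CommutativeRing)
  open import Data.List.Base using ([]; _∷_; map)
  open import Data.Nat.Base as ℕ using (ℕ; zero; suc)
  import Data.Nat.Properties as ℕ
  open import Data.Product.Base using (_×_; _,_; ∃)
  open import Data.Rational.Base as ℚ using (ℚ; 0ℚ; 1ℚ)
  import Data.Rational.Properties as ℚ
  open import Data.Sum.Base using (_⊎_; inj₁; inj₂)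
  open import Level using (0ℓ)
  open import Relation.Binary.Definitions using (tri<; tri≈; tri>)
  open import Relation.Binary.PropositionalEquality
  open import Relation.Binary.Structures using (IsEquivalence)
  open import Relation.Nullary using (¬_; yes; no; contradiction)

  import Algebra.Properties.CommutativeSemigroup as CS
  open CS (CommutativeRing.+-commutativeSemigroup ℚ.+-*-commutativeRing) using (interchange; x∙yz≈y∙xz)

  ≈ₚ-isEquivalence : IsEquivalence _≈ₚ_
  ≈ₚ-isEquivalence = record { refl = λ i → refl ; sym = λ e i → sym (e i) ; trans = λ e f i → trans (e i) (f i) }

  open IsEquivalence ≈ₚ-isEquivalence public using () renaming (refl to ≈ₚ-refl; sym to ≈ₚ-sym; trans to ≈ₚ-trans)

  +ₚ-cong : ∀ {p p′ q q′} → p ≈ₚ p′ → q ≈ₚ q′ → p +ₚ q ≈ₚ p′ +ₚ q′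
  +ₚ-cong {p} {p′} {q} {q′} e f i = trans (coeff-+ p q i) (trans (cong₂ ℚ._+_ (e i) (f i)) (sym (coeff-+ p′ q′ i)))

  shift : Poly → ℕ → ℚ
  shift p zero    = 0ℚ
  shift p (suc i) = coeffₚ p i

  0∷≡shift : ∀ p i → coeffₚ (0ℚ ∷ p) i ≡ shift p i
  0∷≡shift p zero    = refl
  0∷≡shift p (suc i) = refl

  coeff-* : ∀ a p q i → coeffₚ ((a ∷ p) *ₚ q) i ≡ a ℚ.* coeffₚ q i ℚ.+ shift (p *ₚ q) i
  coeff-* a p q i = trans (coeff-∷* a p q i) (cong (a ℚ.* coeffₚ q i ℚ.+_) (0∷≡shift (p *ₚ q) i))

  shift-cong : ∀ {p q} → p ≈ₚ q → ∀ i → shift p i ≡ shift q i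
  shift-cong e zero    = refl
  shift-cong e (suc i) = e i

  shift-+ : ∀ p q i → shift (p +ₚ q) i ≡ shift p i ℚ.+ shift q i
  shift-+ p q zero    = sym (ℚ.+-identityˡ 0ℚ)
  shift-+ p q (suc i) = coeff-+ p q i

  *ₚ-congˡ : ∀ p {q q′} → q ≈ₚ q′ → p *ₚ q ≈ₚ p *ₚ q′
  *ₚ-congˡ []      e i = refl
  *ₚ-congˡ (a ∷ p) {q} {q′} e i = trans (coeff-* a p q i)
    (trans (cong₂ ℚ._+_ (cong (a ℚ.*_) (e i)) (shift-cong {p *ₚ q} {p *ₚ q′} (*ₚ-congˡ p e) i)) (sym (coeff-* a p q′ i)))

  *ₚ-zeroʳ : ∀ p → p *ₚ [] ≈ₚ []
  *ₚ-zeroʳ []      i = refl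
  *ₚ-zeroʳ (a ∷ p) i = trans (coeff-* a p [] i)
    (trans (cong₂ ℚ._+_ (ℚ.*-zeroʳ a) (trans (shift-cong {p *ₚ []} {[]} (*ₚ-zeroʳ p) i) (shift-[] i))) (ℚ.+-identityˡ 0ℚ))
    where
    shift-[] : ∀ i → shift [] i ≡ 0ℚ
    shift-[] zero    = refl
    shift-[] (suc i) = refl

  -- The product recurses on its left factor; commutativity needs the mirrored recursion on the
  -- right factor.
  *ₚ-∷ : ∀ p b q i → coeffₚ (p *ₚ (b ∷ q)) i ≡ b ℚ.* coeffₚ p i ℚ.+ shift (p *ₚ q) i
  *ₚ-∷ []      b q zero    = sym (trans (ℚ.+-identityʳ _) (ℚ.*-zeroʳ b))
  *ₚ-∷ []      b q (suc i) = sym (trans (ℚ.+-identityʳ _) (ℚ.*-zeroʳ b))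
  *ₚ-∷ (a ∷ p) b q zero    = trans (coeff-* a p (b ∷ q) 0) (cong (ℚ._+ 0ℚ) (ℚ.*-comm a b))
  *ₚ-∷ (a ∷ p) b q (suc i) = begin
    coeffₚ ((a ∷ p) *ₚ (b ∷ q)) (suc i)              ≡⟨ coeff-* a p (b ∷ q) (suc i) ⟩
    a ℚ.* coeffₚ q i ℚ.+ coeffₚ (p *ₚ (b ∷ q)) i     ≡⟨ cong (a ℚ.* coeffₚ q i ℚ.+_) (*ₚ-∷ p b q i) ⟩
    a ℚ.* coeffₚ q i ℚ.+ (b ℚ.* coeffₚ p i ℚ.+ shift (p *ₚ q) i)
      ≡⟨ x∙yz≈y∙xz (a ℚ.* coeffₚ q i) (b ℚ.* coeffₚ p i) _ ⟩
    b ℚ.* coeffₚ p i ℚ.+ (a ℚ.* coeffₚ q i ℚ.+ shift (p *ₚ q) i)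
      ≡⟨ cong (b ℚ.* coeffₚ p i ℚ.+_) (coeff-* a p q i) ⟨
    b ℚ.* coeffₚ p i ℚ.+ coeffₚ ((a ∷ p) *ₚ q) i     ∎
    where open ≡-Reasoning

  *ₚ-comm : ∀ p q → p *ₚ q ≈ₚ q *ₚ p
  *ₚ-comm []      q i = sym (*ₚ-zeroʳ q i)
  *ₚ-comm (a ∷ p) q i = trans (coeff-* a p q i)
    (trans (cong (a ℚ.* coeffₚ q i ℚ.+_) (shift-cong {p *ₚ q} {q *ₚ p} (*ₚ-comm p q) i)) (sym (*ₚ-∷ q a p i)))

  *ₚ-cong : ∀ {p p′ q q′} → p ≈ₚ p′ → q ≈ₚ q′ → p *ₚ q ≈ₚ p′ *ₚ q′
  *ₚ-cong {p} {p′} {q} {q′} e f i =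
    trans (*ₚ-congˡ p f i) (trans (*ₚ-comm p q′ i) (trans (*ₚ-congˡ q′ e i) (*ₚ-comm q′ p′ i)))

  *ₚ-distribˡ : ∀ p q r → p *ₚ (q +ₚ r) ≈ₚ p *ₚ q +ₚ p *ₚ r
  *ₚ-distribˡ []      q r i = refl
  *ₚ-distribˡ (a ∷ p) q r i = begin
    coeffₚ ((a ∷ p) *ₚ (q +ₚ r)) i
      ≡⟨ coeff-* a p (q +ₚ r) i ⟩
    a ℚ.* coeffₚ (q +ₚ r) i ℚ.+ shift (p *ₚ (q +ₚ r)) i
      ≡⟨ cong₂ ℚ._+_ (trans (cong (a ℚ.*_) (coeff-+ q r i)) (ℚ.*-distribˡ-+ a _ _))
           (trans (shift-cong {p *ₚ (q +ₚ r)} {p *ₚ q +ₚ p *ₚ r} (*ₚ-distribˡ p q r) i) (shift-+ (p *ₚ q) (p *ₚ r) i)) ⟩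
    (a ℚ.* coeffₚ q i ℚ.+ a ℚ.* coeffₚ r i) ℚ.+ (shift (p *ₚ q) i ℚ.+ shift (p *ₚ r) i)
      ≡⟨ interchange (a ℚ.* coeffₚ q i) _ _ _ ⟩
    (a ℚ.* coeffₚ q i ℚ.+ shift (p *ₚ q) i) ℚ.+ (a ℚ.* coeffₚ r i ℚ.+ shift (p *ₚ r) i)
      ≡⟨ cong₂ ℚ._+_ (coeff-* a p q i) (coeff-* a p r i) ⟨
    coeffₚ ((a ∷ p) *ₚ q) i ℚ.+ coeffₚ ((a ∷ p) *ₚ r) i
      ≡⟨ coeff-+ ((a ∷ p) *ₚ q) ((a ∷ p) *ₚ r) i ⟨
    coeffₚ ((a ∷ p) *ₚ q +ₚ (a ∷ p) *ₚ r) i ∎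
    where open ≡-Reasoning

  *ₚ-distribʳ : ∀ r p q → (p +ₚ q) *ₚ r ≈ₚ p *ₚ r +ₚ q *ₚ r
  *ₚ-distribʳ r p q i = trans (*ₚ-comm (p +ₚ q) r i) (trans (*ₚ-distribˡ r p q i)
    (+ₚ-cong {r *ₚ p} {p *ₚ r} {r *ₚ q} {q *ₚ r} (*ₚ-comm r p) (*ₚ-comm r q) i))

  scale-*ₚ : ∀ a q r i → coeffₚ (map (a ℚ.*_) q *ₚ r) i ≡ a ℚ.* coeffₚ (q *ₚ r) i
  scale-*ₚ a []      r i = sym (ℚ.*-zeroʳ a)
  scale-*ₚ a (b ∷ q) r i = begin
    coeffₚ ((a ℚ.* b ∷ map (a ℚ.*_) q) *ₚ r) i
      ≡⟨ coeff-* (a ℚ.* b) (map (a ℚ.*_) q) r i ⟩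
    a ℚ.* b ℚ.* coeffₚ r i ℚ.+ shift (map (a ℚ.*_) q *ₚ r) i
      ≡⟨ cong₂ ℚ._+_ (ℚ.*-assoc a b _) (lemma i) ⟩
    a ℚ.* (b ℚ.* coeffₚ r i) ℚ.+ a ℚ.* shift (q *ₚ r) i
      ≡⟨ ℚ.*-distribˡ-+ a _ _ ⟨
    a ℚ.* (b ℚ.* coeffₚ r i ℚ.+ shift (q *ₚ r) i)
      ≡⟨ cong (a ℚ.*_) (coeff-* b q r i) ⟨
    a ℚ.* coeffₚ ((b ∷ q) *ₚ r) i ∎
    where
    open ≡-Reasoning
    lemma : ∀ i → shift (map (a ℚ.*_) q *ₚ r) i ≡ a ℚ.* shift (q *ₚ r) i
    lemma zero    = sym (ℚ.*-zeroʳ a)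
    lemma (suc i) = scale-*ₚ a q r i

  0∷-*ₚ : ∀ p q i → coeffₚ ((0ℚ ∷ p) *ₚ q) i ≡ shift (p *ₚ q) i
  0∷-*ₚ p q i = trans (coeff-* 0ℚ p q i) (trans (cong (ℚ._+ shift (p *ₚ q) i) (ℚ.*-zeroˡ (coeffₚ q i))) (ℚ.+-identityˡ _))

  *ₚ-assoc : ∀ p q r → (p *ₚ q) *ₚ r ≈ₚ p *ₚ (q *ₚ r)
  *ₚ-assoc []      q r i = refl
  *ₚ-assoc (a ∷ p) q r i = begin
    coeffₚ ((map (a ℚ.*_) q +ₚ (0ℚ ∷ p *ₚ q)) *ₚ r) i
      ≡⟨ *ₚ-distribʳ r (map (a ℚ.*_) q) (0ℚ ∷ p *ₚ q) i ⟩
    coeffₚ (map (a ℚ.*_) q *ₚ r +ₚ (0ℚ ∷ p *ₚ q) *ₚ r) i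
      ≡⟨ coeff-+ (map (a ℚ.*_) q *ₚ r) _ i ⟩
    coeffₚ (map (a ℚ.*_) q *ₚ r) i ℚ.+ coeffₚ ((0ℚ ∷ p *ₚ q) *ₚ r) i
      ≡⟨ cong₂ ℚ._+_ (scale-*ₚ a q r i) (trans (0∷-*ₚ (p *ₚ q) r i) (shift-cong {(p *ₚ q) *ₚ r} {p *ₚ (q *ₚ r)} (*ₚ-assoc p q r) i)) ⟩
    a ℚ.* coeffₚ (q *ₚ r) i ℚ.+ shift (p *ₚ (q *ₚ r)) i
      ≡⟨ coeff-* a p (q *ₚ r) i ⟨
    coeffₚ ((a ∷ p) *ₚ (q *ₚ r)) i ∎
    where open ≡-Reasoning

  *ₚ-identityˡ : ∀ p → (1ℚ ∷ []) *ₚ p ≈ₚ p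
  *ₚ-identityˡ p i = trans (coeff-* 1ℚ [] p i) (trans (cong₂ ℚ._+_ (ℚ.*-identityˡ (coeffₚ p i)) (zero-shift i)) (ℚ.+-identityʳ (coeffₚ p i)))
    where
    zero-shift : ∀ i → shift [] i ≡ 0ℚ
    zero-shift zero    = refl
    zero-shift (suc i) = refl

  coeff-neg : ∀ p i → coeffₚ (-ₚ p) i ≡ ℚ.- coeffₚ p i
  coeff-neg []      i       = refl
  coeff-neg (a ∷ p) zero    = refl
  coeff-neg (a ∷ p) (suc i) = coeff-neg p i

  polyRing : CommutativeRing 0ℓ 0ℓ
  polyRing = record
    { Carrier = Poly ; _≈_ = _≈ₚ_ ; _+_ = _+ₚ_ ; _*_ = _*ₚ_ ; -_ = -ₚ_ ; 0# = [] ; 1# = 1ℚ ∷ []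
    ; isCommutativeRing = record
      { isRing = record
        { +-isAbelianGroup = record
          { isGroup = record
            { isMonoid = record
              { isSemigroup = record
                { isMagma = record { isEquivalence = ≈ₚ-isEquivalence ; ∙-cong = λ {p} {p′} {q} {q′} → +ₚ-cong {p} {p′} {q} {q′} }
                ; assoc = λ p q r i → trans (coeff-+ (p +ₚ q) r i) (trans (cong (ℚ._+ coeffₚ r i) (coeff-+ p q i))
                    (trans (ℚ.+-assoc (coeffₚ p i) _ _) (sym (trans (coeff-+ p (q +ₚ r) i) (cong (coeffₚ p i ℚ.+_) (coeff-+ q r i)))))) }
              ; identity = (λ p i → refl) , λ p i → trans (coeff-+ p [] i) (ℚ.+-identityʳ _) }
            ; inverse = (λ p i → trans (coeff-+ (-ₚ p) p i) (trans (cong (ℚ._+ coeffₚ p i) (coeff-neg p i)) (ℚ.+-inverseˡ (coeffₚ p i)))) ,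
                        (λ p i → trans (coeff-+ p (-ₚ p) i) (trans (cong (coeffₚ p i ℚ.+_) (coeff-neg p i)) (ℚ.+-inverseʳ (coeffₚ p i))))
            ; ⁻¹-cong = λ {p} {q} e i → trans (coeff-neg p i) (trans (cong ℚ.-_ (e i)) (sym (coeff-neg q i))) }
          ; comm = λ p q i → trans (coeff-+ p q i) (trans (ℚ.+-comm (coeffₚ p i) _) (sym (coeff-+ q p i))) }
        ; *-cong = λ {p} {p′} {q} {q′} → *ₚ-cong {p} {p′} {q} {q′}
        ; *-assoc = *ₚ-assoc
        ; *-identity = *ₚ-identityˡ , λ p i → trans (*ₚ-comm p (1ℚ ∷ []) i) (*ₚ-identityˡ p i)
        ; distrib = *ₚ-distribˡ , *ₚ-distribʳ }
      ; *-comm = *ₚ-comm } }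

  ¬nonZero⇒≈0 : ∀ {p} → ¬ NonZeroₚ p → p ≈ₚ []
  ¬nonZero⇒≈0 {p} ¬nz i with coeffₚ p i ℚ.≟ 0ℚ
  ... | yes e = e
  ... | no  e = contradiction (nonZero-at p i e) ¬nz

  nonZero⇒≉0 : ∀ {p} → NonZeroₚ p → ¬ (p ≈ₚ [])
  nonZero⇒≉0 nz e with j , c≢0 , _ ← lowest nz = c≢0 (e j)

  *ₚ-cancel-0 : ∀ {d x} → NonZeroₚ d → d *ₚ x ≈ₚ [] → x ≈ₚ []
  *ₚ-cancel-0 {d} {x} d≢0 e = ¬nonZero⇒≈0 λ x≢0 → nonZero⇒≉0 (*-nonZeroₚ d≢0 x≢0) e

  -- Positivity for the order in which the indeterminate is infinitesimal.
  Posₚ : Poly → Set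
  Posₚ p = ∃ λ j → 0ℚ ℚ.< coeffₚ p j × ZeroBelow j p

  Posₚ-resp : ∀ {p q} → p ≈ₚ q → Posₚ p → Posₚ q
  Posₚ-resp e (j , pos , zb) = j , subst (0ℚ ℚ.<_) (e j) pos , λ {i} i<j → trans (sym (e i)) (zb i<j)

  Posₚ-+ : ∀ p q → Posₚ p → Posₚ q → Posₚ (p +ₚ q)
  Posₚ-+ p q (i , pos , zb) (j , pos′ , zb′) with ℕ.<-cmp i j
  ... | tri< i<j _ _ = i ,
    subst (0ℚ ℚ.<_) (sym (trans (coeff-+ p q i) (trans (cong (coeffₚ p i ℚ.+_) (zb′ i<j)) (ℚ.+-identityʳ _)))) pos ,
    λ {k} k<i → trans (coeff-+ p q k) (cong₂ ℚ._+_ (zb k<i) (zb′ (ℕ.<-trans k<i i<j)))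
  ... | tri≈ _ refl _ = i ,
    subst (0ℚ ℚ.<_) (sym (coeff-+ p q i)) (ℚ.+-mono-< pos pos′) ,
    λ {k} k<i → trans (coeff-+ p q k) (cong₂ ℚ._+_ (zb k<i) (zb′ k<i))
  ... | tri> _ _ j<i = j ,
    subst (0ℚ ℚ.<_) (sym (trans (coeff-+ p q j) (trans (cong (ℚ._+ coeffₚ q j) (zb j<i)) (ℚ.+-identityˡ _)))) pos′ ,
    λ {k} k<j → trans (coeff-+ p q k) (cong₂ ℚ._+_ (zb (ℕ.<-trans k<j j<i)) (zb′ k<j))

  -- Below the sum of the two bounds every product of coefficients has a vanishing factor, and at
  -- that sum a single product is left. Positivity of lowest coefficients is therefore
  -- multiplicative.
  *ₚ-lowest : ∀ p q i j → ZeroBelow i p → ZeroBelow j q →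
              coeffₚ (p *ₚ q) (i ℕ.+ j) ≡ coeffₚ p i ℚ.* coeffₚ q j × ZeroBelow (i ℕ.+ j) (p *ₚ q)
  *ₚ-lowest []      q i j zp zq = sym (ℚ.*-zeroˡ (coeffₚ q j)) , λ _ → refl
  *ₚ-lowest (a ∷ p) q zero j zp zq =
    trans (coeff-∷* a p q j) (trans (cong (a ℚ.* coeffₚ q j ℚ.+_) (0∷*-zeroBelow p q zq ℕ.≤-refl)) (ℚ.+-identityʳ _)) ,
    *-zeroBelow (a ∷ p) q zq
  *ₚ-lowest (a ∷ p) q (suc i) j zp zq with e , zb ← *ₚ-lowest p q i j (λ k<i → zp (ℕ.s≤s k<i)) zq =
    trans (drop (suc i ℕ.+ j)) e , λ { {zero} _ → drop 0 ; {suc k} (ℕ.s≤s k<) → trans (drop (suc k)) (zb k<) }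
    where
    drop : ∀ k → coeffₚ ((a ∷ p) *ₚ q) k ≡ shift (p *ₚ q) k
    drop k = trans (coeff-* a p q k) (trans (cong (λ a → a ℚ.* coeffₚ q k ℚ.+ shift (p *ₚ q) k) (zp (ℕ.s≤s ℕ.z≤n)))
      (trans (cong (ℚ._+ shift (p *ₚ q) k) (ℚ.*-zeroˡ (coeffₚ q k))) (ℚ.+-identityˡ _)))

  *-pos : ∀ {a b} → 0ℚ ℚ.< a → 0ℚ ℚ.< b → 0ℚ ℚ.< a ℚ.* b
  *-pos {a} {b} 0<a 0<b = subst (ℚ._< a ℚ.* b) (ℚ.*-zeroʳ a) (ℚ.*-monoʳ-<-pos a 0<b)
    where instance
      _ = ℚ.positive 0<a

  Posₚ-* : ∀ p q → Posₚ p → Posₚ q → Posₚ (p *ₚ q)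
  Posₚ-* p q (i , pos , zb) (j , pos′ , zb′) with e , z ← *ₚ-lowest p q i j zb zb′ =
    i ℕ.+ j , subst (0ℚ ℚ.<_) (sym e) (*-pos pos pos′) , z

  Posₚ⊎ : ∀ p → NonZeroₚ p → Posₚ p ⊎ Posₚ (-ₚ p)
  Posₚ⊎ p nz with j , c≢0 , zb ← lowest nz with ℚ.<-cmp 0ℚ (coeffₚ p j)
  ... | tri< 0<c _ _ = inj₁ (j , 0<c , zb)
  ... | tri≈ _ 0≡c _ = contradiction (sym 0≡c) c≢0
  ... | tri> _ _ c<0 = inj₂ (j , subst (0ℚ ℚ.<_) (sym (coeff-neg p j)) (ℚ.neg-antimono-< c<0) ,
    λ {i} i<j → trans (coeff-neg p i) (cong ℚ.-_ (zb i<j)))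

  Posₚ⇒nonZero : ∀ {p} → Posₚ p → NonZeroₚ p
  Posₚ⇒nonZero {p} (j , pos , _) = nonZero-at p j λ e → ℚ.<⇒≢ pos (sym e)

-- Identities between cross-multiplied fractions

module CrossMul where

  open import Algebra.Bundles using (CommutativeRing)
  import Algebra.Properties.Ring as RingProperties
  import Algebra.Solver.Ring.NaturalCoefficients.Default as Solver
  open import Level using (0ℓ)

  -- n/d and m/e are fractions.
  module Cross (R : CommutativeRing 0ℓ 0ℓ) where
    open CommutativeRing R
    open RingProperties ring using (-‿distribˡ-*; -‿+-comm)
    open Solver commutativeSemiring
    open import Relation.Binary.Reasoning.Setoid setoid

    cross-+ : ∀ n₁ d₁ n₂ d₂ m₁ e₁ m₂ e₂ → n₁ * e₁ ≈ m₁ * d₁ → n₂ * e₂ ≈ m₂ * d₂ →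
              (n₁ * d₂ + n₂ * d₁) * (e₁ * e₂) ≈ (m₁ * e₂ + m₂ * e₁) * (d₁ * d₂)
    cross-+ n₁ d₁ n₂ d₂ m₁ e₁ m₂ e₂ p q = begin
      (n₁ * d₂ + n₂ * d₁) * (e₁ * e₂)
        ≈⟨ solve 6 (λ n₁ d₁ n₂ d₂ e₁ e₂ → (n₁ :* d₂ :+ n₂ :* d₁) :* (e₁ :* e₂) := (n₁ :* e₁) :* (d₂ :* e₂) :+ (n₂ :* e₂) :* (d₁ :* e₁)) refl n₁ d₁ n₂ d₂ e₁ e₂ ⟩
      (n₁ * e₁) * (d₂ * e₂) + (n₂ * e₂) * (d₁ * e₁)
        ≈⟨ +-cong (*-congʳ p) (*-congʳ q) ⟩
      (m₁ * d₁) * (d₂ * e₂) + (m₂ * d₂) * (d₁ * e₁)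
        ≈⟨ solve 6 (λ m₁ d₁ m₂ d₂ e₁ e₂ → (m₁ :* d₁) :* (d₂ :* e₂) :+ (m₂ :* d₂) :* (d₁ :* e₁) := (m₁ :* e₂ :+ m₂ :* e₁) :* (d₁ :* d₂)) refl m₁ d₁ m₂ d₂ e₁ e₂ ⟩
      (m₁ * e₂ + m₂ * e₁) * (d₁ * d₂) ∎

    cross-* : ∀ n₁ d₁ n₂ d₂ m₁ e₁ m₂ e₂ → n₁ * e₁ ≈ m₁ * d₁ → n₂ * e₂ ≈ m₂ * d₂ →
              (n₁ * n₂) * (e₁ * e₂) ≈ (m₁ * m₂) * (d₁ * d₂)
    cross-* n₁ d₁ n₂ d₂ m₁ e₁ m₂ e₂ p q = begin
      (n₁ * n₂) * (e₁ * e₂) ≈⟨ solve 4 (λ n₁ n₂ e₁ e₂ → (n₁ :* n₂) :* (e₁ :* e₂) := (n₁ :* e₁) :* (n₂ :* e₂)) refl n₁ n₂ e₁ e₂ ⟩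
      (n₁ * e₁) * (n₂ * e₂) ≈⟨ *-cong p q ⟩
      (m₁ * d₁) * (m₂ * d₂) ≈⟨ solve 4 (λ m₁ m₂ d₁ d₂ → (m₁ :* d₁) :* (m₂ :* d₂) := (m₁ :* m₂) :* (d₁ :* d₂)) refl m₁ m₂ d₁ d₂ ⟩
      (m₁ * m₂) * (d₁ * d₂) ∎

    cross-neg : ∀ n d m e → n * e ≈ m * d → - n * e ≈ - m * d
    cross-neg n d m e p = trans (sym (-‿distribˡ-* n e)) (trans (-‿cong p) (-‿distribˡ-* m d))

    -- Transitivity of equality of fractions, up to the middle denominator `d₂`: cancelling it takes
    -- the absence of zero divisors, which is a property of the polynomial ring and not of all
    -- commutative rings.
    cross-trans : ∀ n₁ d₁ n₂ d₂ n₃ d₃ → n₁ * d₂ ≈ n₂ * d₁ → n₂ * d₃ ≈ n₃ * d₂ →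
                  d₂ * (n₁ * d₃ + - (n₃ * d₁)) ≈ 0#
    cross-trans n₁ d₁ n₂ d₂ n₃ d₃ p q = begin
      d₂ * (n₁ * d₃ + - (n₃ * d₁))              ≈⟨ distribˡ d₂ _ _ ⟩
      d₂ * (n₁ * d₃) + d₂ * - (n₃ * d₁)         ≈⟨ +-cong eq (sym (RingProperties.-‿distribʳ-* ring d₂ (n₃ * d₁))) ⟩
      d₂ * (n₃ * d₁) + - (d₂ * (n₃ * d₁))       ≈⟨ -‿inverseʳ _ ⟩
      0#                                         ∎
      where
      eq : d₂ * (n₁ * d₃) ≈ d₂ * (n₃ * d₁)
      eq = begin
        d₂ * (n₁ * d₃)   ≈⟨ solve 3 (λ n₁ d₂ d₃ → d₂ :* (n₁ :* d₃) := (n₁ :* d₂) :* d₃) refl n₁ d₂ d₃ ⟩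
        (n₁ * d₂) * d₃   ≈⟨ *-congʳ p ⟩
        (n₂ * d₁) * d₃   ≈⟨ solve 3 (λ n₂ d₁ d₃ → (n₂ :* d₁) :* d₃ := (n₂ :* d₃) :* d₁) refl n₂ d₁ d₃ ⟩
        (n₂ * d₃) * d₁   ≈⟨ *-congʳ q ⟩
        (n₃ * d₂) * d₁   ≈⟨ solve 3 (λ n₃ d₁ d₂ → (n₃ :* d₂) :* d₁ := d₂ :* (n₃ :* d₁)) refl n₃ d₁ d₂ ⟩
        d₂ * (n₃ * d₁)   ∎

    +-assoc-cross : ∀ n₁ d₁ n₂ d₂ n₃ d₃ →
      ((n₁ * d₂ + n₂ * d₁) * d₃ + n₃ * (d₁ * d₂)) * (d₁ * (d₂ * d₃)) ≈
      (n₁ * (d₂ * d₃) + (n₂ * d₃ + n₃ * d₂) * d₁) * ((d₁ * d₂) * d₃)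
    +-assoc-cross = solve 6 (λ n₁ d₁ n₂ d₂ n₃ d₃ →
      ((n₁ :* d₂ :+ n₂ :* d₁) :* d₃ :+ n₃ :* (d₁ :* d₂)) :* (d₁ :* (d₂ :* d₃)) :=
      (n₁ :* (d₂ :* d₃) :+ (n₂ :* d₃ :+ n₃ :* d₂) :* d₁) :* ((d₁ :* d₂) :* d₃)) refl

    +-comm-cross : ∀ n₁ d₁ n₂ d₂ → (n₁ * d₂ + n₂ * d₁) * (d₂ * d₁) ≈ (n₂ * d₁ + n₁ * d₂) * (d₁ * d₂)
    +-comm-cross = solve 4 (λ n₁ d₁ n₂ d₂ →
      (n₁ :* d₂ :+ n₂ :* d₁) :* (d₂ :* d₁) := (n₂ :* d₁ :+ n₁ :* d₂) :* (d₁ :* d₂)) refl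

    +-identity-cross : ∀ z n d → z ≈ 0# → (z * d + n * 1#) * d ≈ n * (1# * d)
    +-identity-cross z n d e = begin
      (z * d + n * 1#) * d  ≈⟨ *-congʳ (+-congʳ (trans (*-congʳ e) (zeroˡ d))) ⟩
      (0# + n * 1#) * d     ≈⟨ *-congʳ (trans (+-identityˡ _) (*-identityʳ n)) ⟩
      n * d                 ≈⟨ *-congˡ (*-identityˡ d) ⟨
      n * (1# * d)          ∎

    inverse-cross : ∀ z n d → z ≈ 0# → (- n * d + n * d) * 1# ≈ z * (d * d)
    inverse-cross z n d e = begin
      (- n * d + n * d) * 1#  ≈⟨ *-identityʳ _ ⟩
      - n * d + n * d         ≈⟨ distribʳ d (- n) n ⟨
      (- n + n) * d           ≈⟨ *-congʳ (-‿inverseˡ n) ⟩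
      0# * d                  ≈⟨ zeroˡ d ⟩
      0#                      ≈⟨ zeroˡ (d * d) ⟨
      0# * (d * d)            ≈⟨ *-congʳ e ⟨
      z * (d * d)             ∎

    *-assoc-cross : ∀ n₁ d₁ n₂ d₂ n₃ d₃ → ((n₁ * n₂) * n₃) * (d₁ * (d₂ * d₃)) ≈ (n₁ * (n₂ * n₃)) * ((d₁ * d₂) * d₃)
    *-assoc-cross = solve 6 (λ n₁ d₁ n₂ d₂ n₃ d₃ →
      ((n₁ :* n₂) :* n₃) :* (d₁ :* (d₂ :* d₃)) := (n₁ :* (n₂ :* n₃)) :* ((d₁ :* d₂) :* d₃)) refl

    *-comm-cross : ∀ n₁ d₁ n₂ d₂ → (n₁ * n₂) * (d₂ * d₁) ≈ (n₂ * n₁) * (d₁ * d₂)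
    *-comm-cross = solve 4 (λ n₁ d₁ n₂ d₂ → (n₁ :* n₂) :* (d₂ :* d₁) := (n₂ :* n₁) :* (d₁ :* d₂)) refl

    *-identity-cross : ∀ n d → (1# * n) * d ≈ n * (1# * d)
    *-identity-cross n d = trans (*-congʳ (*-identityˡ n)) (sym (*-congˡ (*-identityˡ d)))

    distrib-cross : ∀ n₁ d₁ n₂ d₂ n₃ d₃ →
      (n₁ * (n₂ * d₃ + n₃ * d₂)) * ((d₁ * d₂) * (d₁ * d₃)) ≈
      ((n₁ * n₂) * (d₁ * d₃) + (n₁ * n₃) * (d₁ * d₂)) * (d₁ * (d₂ * d₃))
    distrib-cross = solve 6 (λ n₁ d₁ n₂ d₂ n₃ d₃ →
      (n₁ :* (n₂ :* d₃ :+ n₃ :* d₂)) :* ((d₁ :* d₂) :* (d₁ :* d₃)) :=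
      ((n₁ :* n₂) :* (d₁ :* d₃) :+ (n₁ :* n₃) :* (d₁ :* d₂)) :* (d₁ :* (d₂ :* d₃))) refl

    minus-0 : ∀ x y → x + - y ≈ 0# → x ≈ y
    minus-0 x y e = begin
      x              ≈⟨ +-identityʳ x ⟨
      x + 0#         ≈⟨ +-congˡ (-‿inverseˡ y) ⟨
      x + (- y + y)  ≈⟨ +-assoc x (- y) y ⟨
      x + - y + y    ≈⟨ +-congʳ e ⟩
      0# + y         ≈⟨ +-identityˡ y ⟩
      y              ∎

    nonzero-cross : ∀ n d z → z ≈ 0# → n ≈ 0# → n * 1# ≈ z * d
    nonzero-cross n d z e e′ = trans (*-identityʳ n) (trans e′ (sym (trans (*-congʳ e) (zeroˡ d))))

    ι-+-cross : ∀ p q → (p + q) * (1# * 1#) ≈ (p * 1# + q * 1#) * 1#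
    ι-+-cross = solve 2 (λ p q → (p :+ q) :* (con 1 :* con 1) := (p :* con 1 :+ q :* con 1) :* con 1) refl

    ι-*-cross : ∀ p q → (p * q) * (1# * 1#) ≈ (p * q) * 1#
    ι-*-cross = solve 2 (λ p q → (p :* q) :* (con 1 :* con 1) := (p :* q) :* con 1) refl

    pos-+-cross : ∀ n d m e → (n * d) * (e * e) + (m * e) * (d * d) ≈ (n * e + m * d) * (d * e)
    pos-+-cross = solve 4 (λ n d m e → (n :* d) :* (e :* e) :+ (m :* e) :* (d :* d) := (n :* e :+ m :* d) :* (d :* e)) refl

    pos-*-cross : ∀ n d m e → (n * d) * (m * e) ≈ (n * m) * (d * e)
    pos-*-cross = solve 4 (λ n d m e → (n :* d) :* (m :* e) := (n :* m) :* (d :* e)) refl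

    pos-neg-cross : ∀ n d → - (n * d) ≈ - n * d
    pos-neg-cross = -‿distribˡ-*

-- The ordered field ℚ(α)

module FracField where

  open import Defs
  open import Algebra.Bundles using (CommutativeRing)
  import Algebra.Properties.Ring as RingProperties
  open import Data.List.Base using ([]; _∷_)
  open import Data.Nat.Base as ℕ using (ℕ; zero; suc)
  open import Data.Product.Base using (_,_)
  open import Data.Rational.Base as ℚ using (ℚ; 0ℚ; 1ℚ)
  import Data.Rational.Properties as ℚ
  open import Data.Sum.Base using (_⊎_; inj₁; inj₂)
  open import Level using (0ℓ)
  open import Relation.Binary.PropositionalEquality as ≡ using (_≡_)
  open import Relation.Nullary using (¬_; yes; no; contradiction; Dec)
  open CrossMul
  open PolyRing

  module C = Cross polyRing
  module P = CommutativeRing polyRing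

  0∷≈[] : 0ℚ ∷ [] ≈ₚ []
  0∷≈[] zero    = ≡.refl
  0∷≈[] (suc i) = ≡.refl

  abstract
    ≈-trans : ∀ {f g h} → f ≈ g → g ≈ h → f ≈ h
    ≈-trans {f} {g} {h} p q = C.minus-0 (num f *ₚ den h) (num h *ₚ den f)
      (*ₚ-cancel-0 {den g} (den≢0 g) (C.cross-trans (num f) (den f) (num g) (den g) (num h) (den h) p q))

    +-cong : ∀ {f f′ g g′} → f ≈ f′ → g ≈ g′ → f + g ≈ f′ + g′
    +-cong {f} {f′} {g} {g′} = C.cross-+ (num f) (den f) (num g) (den g) (num f′) (den f′) (num g′) (den g′)

    *-cong : ∀ {f f′ g g′} → f ≈ f′ → g ≈ g′ → f * g ≈ f′ * g′
    *-cong {f} {f′} {g} {g′} = C.cross-* (num f) (den f) (num g) (den g) (num f′) (den f′) (num g′) (den g′)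

    neg-cong : ∀ {f g} → f ≈ g → - f ≈ - g
    neg-cong {f} {g} = C.cross-neg (num f) (den f) (num g) (den g)

    +-assoc : ∀ f g h → (f + g) + h ≈ f + (g + h)
    +-assoc f g h = C.+-assoc-cross (num f) (den f) (num g) (den g) (num h) (den h)

    +-comm : ∀ f g → f + g ≈ g + f
    +-comm f g = C.+-comm-cross (num f) (den f) (num g) (den g)

    +-identityˡ : ∀ f → 0# + f ≈ f
    +-identityˡ f = C.+-identity-cross (0ℚ ∷ []) (num f) (den f) 0∷≈[]

    inverseˡ : ∀ f → - f + f ≈ 0#
    inverseˡ f = C.inverse-cross (0ℚ ∷ []) (num f) (den f) 0∷≈[]

    *-assoc : ∀ f g h → (f * g) * h ≈ f * (g * h)
    *-assoc f g h = C.*-assoc-cross (num f) (den f) (num g) (den g) (num h) (den h)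

    *-comm : ∀ f g → f * g ≈ g * f
    *-comm f g = C.*-comm-cross (num f) (den f) (num g) (den g)

    *-identityˡ : ∀ f → 1# * f ≈ f
    *-identityˡ f = C.*-identity-cross (num f) (den f)

    distribˡ : ∀ f g h → f * (g + h) ≈ f * g + f * h
    distribˡ f g h = C.distrib-cross (num f) (den f) (num g) (den g) (num h) (den h)

  ≈-refl : ∀ {f} → f ≈ f
  ≈-refl i = ≡.refl

  ≈-sym : ∀ {f g} → f ≈ g → g ≈ f
  ≈-sym p i = ≡.sym (p i)

  K : CommutativeRing 0ℓ 0ℓ
  K = record
    { Carrier = ℚ⟨α⟩ ; _≈_ = _≈_ ; _+_ = _+_ ; _*_ = _*_ ; -_ = -_ ; 0# = 0# ; 1# = 1#
    ; isCommutativeRing = record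
      { isRing = record
        { +-isAbelianGroup = record
          { isGroup = record
            { isMonoid = record
              { isSemigroup = record
                { isMagma = record
                  { isEquivalence = record
                    { refl = λ {f} → ≈-refl {f}
                    ; sym = λ {f} {g} → ≈-sym {f} {g}
                    ; trans = λ {f} {g} {h} → ≈-trans {f} {g} {h} }
                  ; ∙-cong = λ {f} {f′} {g} {g′} → +-cong {f} {f′} {g} {g′} }
                ; assoc = +-assoc }
              ; identity = +-identityˡ , λ f → ≈-trans {f + 0#} {0# + f} {f} (+-comm f 0#) (+-identityˡ f) }
            ; inverse = inverseˡ , λ f → ≈-trans {f + - f} { - f + f} {0#} (+-comm f (- f)) (inverseˡ f)
            ; ⁻¹-cong = λ {f} {g} → neg-cong {f} {g} }
          ; comm = +-comm }
        ; *-cong = λ {f} {f′} {g} {g′} → *-cong {f} {f′} {g} {g′}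
        ; *-assoc = *-assoc
        ; *-identity = *-identityˡ , λ f → ≈-trans {f * 1#} {1# * f} {f} (*-comm f 1#) (*-identityˡ f)
        ; distrib = distribˡ , λ f g h → ≈-trans {(g + h) * f} {f * (g + h)} {g * f + h * f} (*-comm (g + h) f)
            (≈-trans {f * (g + h)} {f * g + f * h} {g * f + h * f} (distribˡ f g h)
              (+-cong {f * g} {g * f} {f * h} {h * f} (*-comm f g) (*-comm f h))) }
      ; *-comm = *-comm } }

  num≈0⇒≈0 : ∀ {f} → num f ≈ₚ [] → f ≈ 0#
  num≈0⇒≈0 {f} e = C.nonzero-cross (num f) (den f) (0ℚ ∷ []) 0∷≈[] e

  ≈0⇒num≈0 : ∀ {f} → f ≈ 0# → num f ≈ₚ []
  ≈0⇒num≈0 {f} e = P.trans {num f} {num f *ₚ (1ℚ ∷ [])} {[]} (P.sym {num f *ₚ (1ℚ ∷ [])} {num f} (P.*-identityʳ (num f)))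
    (P.trans {num f *ₚ (1ℚ ∷ [])} {(0ℚ ∷ []) *ₚ den f} {[]} e (P.trans {(0ℚ ∷ []) *ₚ den f} {[] *ₚ den f} {[]}
      (P.*-congʳ {den f} {0ℚ ∷ []} {[]} 0∷≈[]) (P.zeroˡ (den f))))

  ≈0? : ∀ f → Dec (f ≈ 0#)
  ≈0? f with nonZeroₚ? (num f)
  ... | yes nz = no λ e → nonZero⇒≉0 nz (≈0⇒num≈0 {f} e)
  ... | no ¬nz = yes (num≈0⇒≈0 {f} (¬nonZero⇒≈0 ¬nz))

  inverseʳ : ∀ f → ¬ (f ≈ 0#) → f * f ⁻¹ ≈ 1#
  inverseʳ f f≉0 with nonZeroₚ? (num f)
  ... | no ¬nz = contradiction (num≈0⇒≈0 {f} (¬nonZero⇒≈0 ¬nz)) f≉0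
  ... | yes nz = P.trans {(num f *ₚ den f) *ₚ (1ℚ ∷ [])} {num f *ₚ den f} {(1ℚ ∷ []) *ₚ (den f *ₚ num f)}
    (P.*-identityʳ (num f *ₚ den f)) (P.trans {num f *ₚ den f} {den f *ₚ num f} {(1ℚ ∷ []) *ₚ (den f *ₚ num f)}
      (P.*-comm (num f) (den f)) (P.sym {(1ℚ ∷ []) *ₚ (den f *ₚ num f)} {den f *ₚ num f} (P.*-identityˡ (den f *ₚ num f))))

  ι : Poly → ℚ⟨α⟩
  ι p = frac p (1ℚ ∷ []) 1≢0

  ι-cong : ∀ p q → p ≈ₚ q → ι p ≈ ι q
  ι-cong p q e = P.*-congʳ {1ℚ ∷ []} {p} {q} e

  ι-injective : ∀ p q → ι p ≈ ι q → p ≈ₚ q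
  ι-injective p q e = P.trans {p} {p *ₚ (1ℚ ∷ [])} {q} (P.sym {p *ₚ (1ℚ ∷ [])} {p} (P.*-identityʳ p))
    (P.trans {p *ₚ (1ℚ ∷ [])} {q *ₚ (1ℚ ∷ [])} {q} e (P.*-identityʳ q))

  ι-+ : ∀ p q → ι (p +ₚ q) ≈ ι p + ι q
  ι-+ = C.ι-+-cross

  ι-* : ∀ p q → ι (p *ₚ q) ≈ ι p * ι q
  ι-* = C.ι-*-cross

  const-+ : ∀ a b → const (a ℚ.+ b) ≈ const a + const b
  const-+ a b = ι-+ (a ∷ []) (b ∷ [])

  const-* : ∀ a b → const (a ℚ.* b) ≈ const a * const b
  const-* a b = ≈-trans {const (a ℚ.* b)} {ι ((a ∷ []) *ₚ (b ∷ []))} {const a * const b}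
    (ι-cong (a ℚ.* b ∷ []) ((a ∷ []) *ₚ (b ∷ [])) λ { zero → ≡.sym (ℚ.+-identityʳ (a ℚ.* b)) ; (suc i) → ≡.refl })
    (ι-* (a ∷ []) (b ∷ []))

  -- The sign of n/d is that of n d, which avoids normalising the denominator to be positive.
  Pos : ℚ⟨α⟩ → Set
  Pos f = Posₚ (num f *ₚ den f)

  Posₚ-sq : ∀ p → NonZeroₚ p → Posₚ (p *ₚ p)
  Posₚ-sq p nz with Posₚ⊎ p nz
  ... | inj₁ pos = Posₚ-* p p pos pos
  ... | inj₂ pos = Posₚ-resp {(-ₚ p) *ₚ (-ₚ p)} {p *ₚ p} (RingProperties.-‿distribˡ-* P.ring p (-ₚ p) |> λ e →
        P.trans {(-ₚ p) *ₚ (-ₚ p)} { -ₚ (p *ₚ (-ₚ p))} {p *ₚ p} (P.sym { -ₚ (p *ₚ (-ₚ p))} {(-ₚ p) *ₚ (-ₚ p)} e)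
          (P.trans { -ₚ (p *ₚ (-ₚ p))} { -ₚ (-ₚ (p *ₚ p))} {p *ₚ p}
            (P.-‿cong {p *ₚ (-ₚ p)} { -ₚ (p *ₚ p)} (P.sym { -ₚ (p *ₚ p)} {p *ₚ (-ₚ p)} (RingProperties.-‿distribʳ-* P.ring p p)))
            (RingProperties.-‿involutive P.ring (p *ₚ p)))) (Posₚ-* (-ₚ p) (-ₚ p) pos pos)
    where
    infixl 1 _|>_
    _|>_ : ∀ {A B : Set} → A → (A → B) → B
    x |> f = f x

  Pos-+ : ∀ f g → Pos f → Pos g → Pos (f + g)
  Pos-+ f g p q = Posₚ-resp
    {(num f *ₚ den f) *ₚ (den g *ₚ den g) +ₚ (num g *ₚ den g) *ₚ (den f *ₚ den f)}
    {(num f *ₚ den g +ₚ num g *ₚ den f) *ₚ (den f *ₚ den g)}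
    (C.pos-+-cross (num f) (den f) (num g) (den g))
    (Posₚ-+ ((num f *ₚ den f) *ₚ (den g *ₚ den g)) ((num g *ₚ den g) *ₚ (den f *ₚ den f))
      (Posₚ-* (num f *ₚ den f) (den g *ₚ den g) p (Posₚ-sq (den g) (den≢0 g)))
      (Posₚ-* (num g *ₚ den g) (den f *ₚ den f) q (Posₚ-sq (den f) (den≢0 f))))

  Pos-* : ∀ f g → Pos f → Pos g → Pos (f * g)
  Pos-* f g p q = Posₚ-resp {(num f *ₚ den f) *ₚ (num g *ₚ den g)} {(num f *ₚ num g) *ₚ (den f *ₚ den g)}
    (C.pos-*-cross (num f) (den f) (num g) (den g)) (Posₚ-* (num f *ₚ den f) (num g *ₚ den g) p q)

  Pos⇒≉0 : ∀ f → Pos f → ¬ (f ≈ 0#)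
  Pos⇒≉0 f p e = nonZero⇒≉0 (Posₚ⇒nonZero {num f *ₚ den f} p)
    (P.trans {num f *ₚ den f} {[] *ₚ den f} {[]} (P.*-congʳ {den f} {num f} {[]} (≈0⇒num≈0 {f} e)) (P.zeroˡ (den f)))

  Pos⊎ : ∀ f → ¬ (f ≈ 0#) → Pos f ⊎ Pos (- f)
  Pos⊎ f f≉0 with nonZeroₚ? (num f)
  ... | no ¬nz = contradiction (num≈0⇒≈0 {f} (¬nonZero⇒≈0 ¬nz)) f≉0
  ... | yes nz with Posₚ⊎ (num f *ₚ den f) (*-nonZeroₚ nz (den≢0 f))
  ... | inj₁ p = inj₁ p
  ... | inj₂ p = inj₂ (Posₚ-resp { -ₚ (num f *ₚ den f)} {(-ₚ num f) *ₚ den f} (C.pos-neg-cross (num f) (den f)) p)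

  -- If `g` were not positive, `- g` would be, and then so would `f + - g`, which is 0.
  Pos-resp : ∀ f g → f ≈ g → Pos f → Pos g
  Pos-resp f g e p with Pos⊎ g (λ e′ → Pos⇒≉0 f p (≈-trans {f} {g} {0#} e e′))
  ... | inj₁ q = q
  ... | inj₂ q = contradiction (≈-trans {f + - g} {g + - g} {0#} (+-cong {f} {g} { - g} { - g} e (≈-refl { - g}))
      (CommutativeRing.-‿inverseʳ K g)) (Pos⇒≉0 (f + - g) (Pos-+ f (- g) p q))

  Pos-sq : ∀ f → ¬ (f ≈ 0#) → Pos (f * f)
  Pos-sq f f≉0 with Pos⊎ f f≉0
  ... | inj₁ p = Pos-* f f p p
  ... | inj₂ p = Pos-resp (- f * - f) (f * f)
    (≈-trans { - f * - f} { - (f * - f)} {f * f}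
      (≈-sym { - (f * - f)} { - f * - f} (RingProperties.-‿distribˡ-* (CommutativeRing.ring K) f (- f)))
      (≈-trans { - (f * - f)} { - (- (f * f))} {f * f}
        (neg-cong {f * - f} { - (f * f)} (≈-sym { - (f * f)} {f * - f} (RingProperties.-‿distribʳ-* (CommutativeRing.ring K) f f)))
        (RingProperties.-‿involutive (CommutativeRing.ring K) (f * f))))
    (Pos-* (- f) (- f) p p)

  Pos-const : ∀ a → 0ℚ ℚ.< a → Pos (const a)
  Pos-const a 0<a = 0 , ≡.subst (0ℚ ℚ.<_) (≡.sym (≡.trans (ℚ.+-identityʳ (a ℚ.* 1ℚ)) (ℚ.*-identityʳ a))) 0<a , λ ()

  Pos-α : Pos α
  Pos-α = 1 , ℚ.*<* (ℤ.+<+ (ℕ.s≤s ℕ.z≤n)) , λ { {zero} _ → ≡.refl ; {suc i} (ℕ.s≤s ()) }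
    where import Data.Integer.Base as ℤ

-- Integers in ℚ and identities for binomial coefficients

module Scalars where

  open import Data.Integer.Base as ℤ using (ℤ; +_)
  import Data.Integer.Properties as ℤ
  open import Data.Nat.Base as ℕ using (ℕ; zero; suc; _!)
  open import Data.Nat.Combinatorics using (_C_; nCk+nC[k+1]≡[n+1]C[k+1]; k>n⇒nCk≡0; nC1≡n)
  import Data.Nat.Properties as ℕ
  open import Data.Nat.Tactic.RingSolver using (solve-∀)
  open import Data.Rational.Base as ℚ using (ℚ; 0ℚ)
  import Data.Rational.Properties as ℚ
  open import Data.Rational.Unnormalised.Base as ℚᵘ using (ℚᵘ; mkℚᵘ; *≡*)
  import Data.Rational.Unnormalised.Properties as ℚᵘ
  open import Relation.Binary.PropositionalEquality

  ℤ→ℚ : ℤ → ℚ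
  ℤ→ℚ i = i ℚ./ 1

  ℕ→ℚ : ℕ → ℚ
  ℕ→ℚ k = ℤ→ℚ (+ k)

  abstract
    toℚᵘ-ℤ : ∀ i → ℚ.toℚᵘ (ℤ→ℚ i) ℚᵘ.≃ mkℚᵘ i 0
    toℚᵘ-ℤ i = ℚ.toℚᵘ-fromℚᵘ (mkℚᵘ i 0)

    ℤ→ℚ-+ : ∀ i j → ℤ→ℚ (i ℤ.+ j) ≡ ℤ→ℚ i ℚ.+ ℤ→ℚ j
    ℤ→ℚ-+ i j = ℚ.toℚᵘ-injective (ℚᵘ.≃-trans (toℚᵘ-ℤ (i ℤ.+ j)) (ℚᵘ.≃-sym
      (ℚᵘ.≃-trans (ℚ.toℚᵘ-homo-+ (ℤ→ℚ i) (ℤ→ℚ j)) (ℚᵘ.≃-trans (ℚᵘ.+-cong (toℚᵘ-ℤ i) (toℚᵘ-ℤ j))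
        (*≡* (cong (ℤ._* + 1) (cong₂ ℤ._+_ (ℤ.*-identityʳ i) (ℤ.*-identityʳ j))))))))

    ℤ→ℚ-* : ∀ i j → ℤ→ℚ (i ℤ.* j) ≡ ℤ→ℚ i ℚ.* ℤ→ℚ j
    ℤ→ℚ-* i j = ℚ.toℚᵘ-injective (ℚᵘ.≃-trans (toℚᵘ-ℤ (i ℤ.* j)) (ℚᵘ.≃-sym
      (ℚᵘ.≃-trans (ℚ.toℚᵘ-homo-* (ℤ→ℚ i) (ℤ→ℚ j)) (ℚᵘ.*-cong (toℚᵘ-ℤ i) (toℚᵘ-ℤ j)))))

    ℤ→ℚ-injective : ∀ {i j} → ℤ→ℚ i ≡ ℤ→ℚ j → i ≡ j
    ℤ→ℚ-injective {i} {j} e with *≡* p ← ℚᵘ.≃-trans (ℚᵘ.≃-sym (toℚᵘ-ℤ i)) (ℚᵘ.≃-trans (ℚᵘ.≃-reflexive (cong ℚ.toℚᵘ e)) (toℚᵘ-ℤ j)) =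
      trans (sym (ℤ.*-identityʳ i)) (trans p (ℤ.*-identityʳ j))

    ℤ→ℚ-neg : ∀ i → ℤ→ℚ (ℤ.- i) ≡ ℚ.- ℤ→ℚ i
    ℤ→ℚ-neg i = begin
      ℤ→ℚ (ℤ.- i)                                       ≡⟨ ℚ.+-identityʳ _ ⟨
      ℤ→ℚ (ℤ.- i) ℚ.+ 0ℚ                                ≡⟨ cong (ℤ→ℚ (ℤ.- i) ℚ.+_) (ℚ.+-inverseʳ (ℤ→ℚ i)) ⟨
      ℤ→ℚ (ℤ.- i) ℚ.+ (ℤ→ℚ i ℚ.+ (ℚ.- ℤ→ℚ i))           ≡⟨ ℚ.+-assoc (ℤ→ℚ (ℤ.- i)) (ℤ→ℚ i) _ ⟨
      (ℤ→ℚ (ℤ.- i) ℚ.+ ℤ→ℚ i) ℚ.+ (ℚ.- ℤ→ℚ i)           ≡⟨ cong (ℚ._+ (ℚ.- ℤ→ℚ i)) (trans (sym (ℤ→ℚ-+ (ℤ.- i) i)) (cong ℤ→ℚ (ℤ.+-inverseˡ i))) ⟩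
      0ℚ ℚ.+ (ℚ.- ℤ→ℚ i)                                ≡⟨ ℚ.+-identityˡ _ ⟩
      ℚ.- ℤ→ℚ i                                         ∎
      where open ≡-Reasoning

    ℕ→ℚ-+ : ∀ m n → ℕ→ℚ (m ℕ.+ n) ≡ ℕ→ℚ m ℚ.+ ℕ→ℚ n
    ℕ→ℚ-+ m n = ℤ→ℚ-+ (+ m) (+ n)

    ℕ→ℚ-* : ∀ m n → ℕ→ℚ (m ℕ.* n) ≡ ℕ→ℚ m ℚ.* ℕ→ℚ n
    ℕ→ℚ-* m n = trans (cong ℤ→ℚ (ℤ.pos-* m n)) (ℤ→ℚ-* (+ m) (+ n))

    ℕ→ℚ-pos : ∀ k → 0ℚ ℚ.< ℕ→ℚ (suc k)
    ℕ→ℚ-pos k = ℚ.positive⁻¹ (ℕ→ℚ (suc k)) {{ℚ.normalize-pos (suc k) 1}}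

    ℕ→ℚ-injective : ∀ {m n} → ℕ→ℚ m ≡ ℕ→ℚ n → m ≡ n
    ℕ→ℚ-injective e = ℤ.+-injective (ℤ→ℚ-injective e)

  ℕ→ℚ-suc≢0 : ∀ k → ℕ→ℚ (suc k) ≢ 0ℚ
  ℕ→ℚ-suc≢0 k e = ℚ.<⇒≢ (ℕ→ℚ-pos k) (sym e)

  ℤ→ℚ-⊖ : ∀ m n → ℤ→ℚ (m ℤ.⊖ n) ≡ ℕ→ℚ m ℚ.+ (ℚ.- ℕ→ℚ n)
  ℤ→ℚ-⊖ m n = trans (cong ℤ→ℚ (sym (ℤ.m-n≡m⊖n m n)))
    (trans (ℤ→ℚ-+ (+ m) (ℤ.- (+ n))) (cong (ℕ→ℚ m ℚ.+_) (ℤ→ℚ-neg (+ n))))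

  absorb : ∀ n k → suc k ℕ.* (suc n C suc k) ≡ suc n ℕ.* (n C k)
  absorb zero    zero    = refl
  absorb zero    (suc k) = trans (cong (suc (suc k) ℕ.*_) (k>n⇒nCk≡0 {1} {suc (suc k)} (ℕ.s≤s (ℕ.s≤s ℕ.z≤n)))) (ℕ.*-zeroʳ (suc (suc k)))
  absorb (suc n) zero    = trans (ℕ.*-identityˡ _) (trans (nC1≡n (suc (suc n))) (sym (ℕ.*-identityʳ (suc (suc n)))))
  absorb (suc n) (suc k) = begin
    suc (suc k) ℕ.* (suc (suc n) C suc (suc k))
      ≡⟨ cong (suc (suc k) ℕ.*_) (nCk+nC[k+1]≡[n+1]C[k+1] (suc n) (suc k)) ⟨
    suc (suc k) ℕ.* (c ℕ.+ (suc n C suc (suc k)))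
      ≡⟨ expand (suc k) c (suc n C suc (suc k)) ⟩
    c ℕ.+ (suc k ℕ.* c ℕ.+ suc (suc k) ℕ.* (suc n C suc (suc k)))
      ≡⟨ cong (c ℕ.+_) (cong₂ ℕ._+_ (absorb n k) (absorb n (suc k))) ⟩
    c ℕ.+ (suc n ℕ.* (n C k) ℕ.+ suc n ℕ.* (n C suc k))
      ≡⟨ cong (c ℕ.+_) (trans (sym (ℕ.*-distribˡ-+ (suc n) (n C k) (n C suc k))) (cong (suc n ℕ.*_) (nCk+nC[k+1]≡[n+1]C[k+1] n k))) ⟩
    suc (suc n) ℕ.* c ∎
    where
    open ≡-Reasoning
    c = suc n C suc k
    expand : ∀ k c d → suc k ℕ.* (c ℕ.+ d) ≡ c ℕ.+ (k ℕ.* c ℕ.+ suc k ℕ.* d)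
    expand = solve-∀

  -- This is (m + 1) C(N, m + 1) = (N - m) C(N, m) freed of the subtraction.
  shift-binomial : ∀ N m → suc m ℕ.* (N C suc m) ℕ.+ m ℕ.* (N C m) ≡ N ℕ.* (N C m)
  shift-binomial N m = ℕ.+-cancelʳ-≡ (N C m) _ _ (begin
    suc m ℕ.* (N C suc m) ℕ.+ m ℕ.* (N C m) ℕ.+ (N C m)
      ≡⟨ collect m (N C suc m) (N C m) ⟩
    suc m ℕ.* ((N C m) ℕ.+ (N C suc m))
      ≡⟨ cong (suc m ℕ.*_) (nCk+nC[k+1]≡[n+1]C[k+1] N m) ⟩
    suc m ℕ.* (suc N C suc m)
      ≡⟨ absorb N m ⟩
    suc N ℕ.* (N C m)
      ≡⟨ ℕ.+-comm (N C m) (N ℕ.* (N C m)) ⟩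
    N ℕ.* (N C m) ℕ.+ (N C m) ∎)
    where
    open ≡-Reasoning
    collect : ∀ m c d → suc m ℕ.* c ℕ.+ m ℕ.* d ℕ.+ d ≡ suc m ℕ.* (d ℕ.+ c)
    collect = solve-∀

  -- The rising factorial M (M + 1) ⋯ (M + n - 1), the form that binomials take at negative
  -- arguments, up to sign and n!.
  rising : ℕ → ℕ → ℕ
  rising M zero    = 1
  rising M (suc n) = M ℕ.* rising (suc M) n

  rising-binomial : ∀ M n → rising (suc M) n ≡ n ! ℕ.* ((M ℕ.+ n) C n)
  rising-binomial M zero    = refl
  rising-binomial M (suc n) = begin
    suc M ℕ.* rising (suc (suc M)) n
      ≡⟨ cong (suc M ℕ.*_) (trans (rising-binomial (suc M) n) (cong (λ t → n ! ℕ.* (t C n)) (sym (ℕ.+-suc M n)))) ⟩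
    suc M ℕ.* (n ! ℕ.* (N C n))
      ≡⟨ x∙yz≈y∙xz (suc M) (n !) (N C n) ⟩
    n ! ℕ.* (suc M ℕ.* (N C n))
      ≡⟨ cong (n ! ℕ.*_) (sym step) ⟩
    n ! ℕ.* (suc n ℕ.* (N C suc n))
      ≡⟨ xy∙z (n !) (suc n) (N C suc n) ⟩
    suc n ! ℕ.* (N C suc n) ∎
    where
    open ≡-Reasoning
    N = M ℕ.+ suc n
    x∙yz≈y∙xz : ∀ x y z → x ℕ.* (y ℕ.* z) ≡ y ℕ.* (x ℕ.* z)
    x∙yz≈y∙xz = solve-∀
    xy∙z : ∀ x y z → x ℕ.* (y ℕ.* z) ≡ y ℕ.* x ℕ.* z
    xy∙z = solve-∀
    step : suc n ℕ.* (N C suc n) ≡ suc M ℕ.* (N C n)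
    step = ℕ.+-cancelʳ-≡ (n ℕ.* (N C n)) _ _ (trans (shift-binomial N n)
      (trans (cong (ℕ._* (N C n)) (ℕ.+-suc M n)) (ℕ.*-distribʳ-+ (N C n) (suc M) n)))

-- Specialising α and comparing polynomials

module Specialise where

  open import Defs using (Poly; _≈ₚ_; _+ₚ_; _*ₚ_; ℚ⟨α⟩; const; α; ℚ-noZeroDivisors)
  import Defs as D
  open import Algebra.Bundles using (CommutativeRing; CommutativeSemiring)
  import Algebra.Definitions.RawSemiring as RawSemiringDefinitions
  import Algebra.Solver.Ring.NaturalCoefficients.Default as Solver
  open import Data.Fin.Base using (Fin; zero; suc)
  open import Data.List.Base using ([]; _∷_; map; length)
  open import Data.Nat.Base as ℕ using (ℕ; zero; suc)
  import Data.Nat.Properties as ℕ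
  open import Data.Rational.Base as ℚ using (ℚ; 0ℚ; 1ℚ)
  import Data.Rational.Properties as ℚ
  open import Level using (0ℓ)
  open import Relation.Binary.PropositionalEquality as ≡ using (_≡_; _≢_)
  open import Relation.Nullary using (yes; no; contradiction)
  open PolyRing
  open FracField using (≈-trans; ≈-refl; ≈-sym; ι; ι-cong; ι-injective; ι-+; ι-*; module P; module C)

  -- Specialisation of α to an element β of a ℚ-algebra.
  module Specialisation (R : CommutativeRing 0ℓ 0ℓ) (c : ℚ → CommutativeRing.Carrier R)
    (c-0 : CommutativeRing._≈_ R (c 0ℚ) (CommutativeRing.0# R))
    (c-1 : CommutativeRing._≈_ R (c 1ℚ) (CommutativeRing.1# R))
    (c-+ : ∀ a b → CommutativeRing._≈_ R (c (a ℚ.+ b)) (CommutativeRing._+_ R (c a) (c b)))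
    (c-* : ∀ a b → CommutativeRing._≈_ R (c (a ℚ.* b)) (CommutativeRing._*_ R (c a) (c b)))
    (β : CommutativeRing.Carrier R) where

    open CommutativeRing R hiding (zero)
    open Solver commutativeSemiring
    open import Relation.Binary.Reasoning.Setoid setoid
    open RawSemiringDefinitions (CommutativeSemiring.rawSemiring commutativeSemiring) using (_^_) renaming (sum to ∑; product to ∏)

    ev : Poly → Carrier
    ev []      = 0#
    ev (a ∷ p) = c a + β * ev p

    ev-≈[] : ∀ p → p ≈ₚ [] → ev p ≈ 0#
    ev-≈[] []      e = refl
    ev-≈[] (a ∷ p) e = begin
      c a + β * ev p  ≈⟨ +-cong (trans (reflexive (≡.cong c (e 0))) c-0) (*-congˡ (ev-≈[] p (λ i → e (suc i)))) ⟩
      0# + β * 0#     ≈⟨ trans (+-identityˡ _) (zeroʳ β) ⟩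
      0#              ∎

    ev-cong : ∀ p q → p ≈ₚ q → ev p ≈ ev q
    ev-cong []      q       e = sym (ev-≈[] q (≈ₚ-sym {[]} {q} e))
    ev-cong (a ∷ p) []      e = ev-≈[] (a ∷ p) e
    ev-cong (a ∷ p) (b ∷ q) e = +-cong (reflexive (≡.cong c (e 0))) (*-congˡ (ev-cong p q (λ i → e (suc i))))

    ev-+ : ∀ p q → ev (p +ₚ q) ≈ ev p + ev q
    ev-+ []      q       = sym (+-identityˡ _)
    ev-+ (a ∷ p) []      = sym (+-identityʳ _)
    ev-+ (a ∷ p) (b ∷ q) = trans (+-cong (c-+ a b) (*-congˡ (ev-+ p q)))
      (solve 5 (λ a b β p q → (a :+ b) :+ β :* (p :+ q) := (a :+ β :* p) :+ (b :+ β :* q)) refl (c a) (c b) β (ev p) (ev q))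

    ev-scale : ∀ a q → ev (map (a ℚ.*_) q) ≈ c a * ev q
    ev-scale a []      = sym (zeroʳ _)
    ev-scale a (b ∷ q) = trans (+-cong (c-* a b) (*-congˡ (ev-scale a q)))
      (solve 4 (λ a b β q → a :* b :+ β :* (a :* q) := a :* (b :+ β :* q)) refl (c a) (c b) β (ev q))

    ev-* : ∀ p q → ev (p *ₚ q) ≈ ev p * ev q
    ev-* []      q = sym (zeroˡ _)
    ev-* (a ∷ p) q = begin
      ev (map (a ℚ.*_) q +ₚ (0ℚ ∷ p *ₚ q))    ≈⟨ ev-+ (map (a ℚ.*_) q) (0ℚ ∷ p *ₚ q) ⟩
      ev (map (a ℚ.*_) q) + (c 0ℚ + β * ev (p *ₚ q))
        ≈⟨ +-cong (ev-scale a q) (trans (+-congʳ c-0) (trans (+-identityˡ _) (*-congˡ (ev-* p q)))) ⟩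
      c a * ev q + β * (ev p * ev q)
        ≈⟨ solve 4 (λ a β p q → a :* q :+ β :* (p :* q) := (a :+ β :* p) :* q) refl (c a) β (ev p) (ev q) ⟩
      ev (a ∷ p) * ev q                        ∎

    infix 3 _⇝_
    -- A relation rather than a function: a fraction is evaluated at β only through a polynomial
    -- equal to it, and the value does not depend on which one is taken.
    record _⇝_ (f : ℚ⟨α⟩) (g : Carrier) : Set where
      constructor via
      field
        rep   : Poly
        from≈ : f D.≈ ι rep
        to≈   : ev rep ≈ g

    ⇝-unique : ∀ {f g g′} → f ⇝ g → f ⇝ g′ → g ≈ g′
    ⇝-unique {f} (via p e v) (via q e′ v′) = trans (sym v) (trans (ev-cong p q
      (ι-injective p q (≈-trans {ι p} {f} {ι q} (≈-sym {f} {ι p} e) e′))) v′)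

    ⇝-respˡ : ∀ {f f′ g} → f′ D.≈ f → f ⇝ g → f′ ⇝ g
    ⇝-respˡ {f} {f′} e′ (via p e v) = via p (≈-trans {f′} {f} {ι p} e′ e) v

    ⇝-respʳ : ∀ {f g g′} → g ≈ g′ → f ⇝ g → f ⇝ g′
    ⇝-respʳ e′ (via p e v) = via p e (trans v e′)

    ⇝-const : ∀ a → const a ⇝ c a
    ⇝-const a = via (a ∷ []) (≈-refl {const a}) (trans (+-congˡ (zeroʳ β)) (+-identityʳ _))

    ⇝-α : α ⇝ β
    ⇝-α = via (0ℚ ∷ 1ℚ ∷ []) (≈-refl {α}) (begin
      c 0ℚ + β * (c 1ℚ + β * 0#)  ≈⟨ +-cong c-0 (*-congˡ (+-cong c-1 (zeroʳ β))) ⟩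
      0# + β * (1# + 0#)           ≈⟨ solve 1 (λ β → con 0 :+ β :* (con 1 :+ con 0) := β) refl β ⟩
      β                            ∎)

    ⇝-+ : ∀ {f g f′ g′} → f ⇝ g → f′ ⇝ g′ → f D.+ f′ ⇝ g + g′
    ⇝-+ {f} {g} {f′} {g′} (via p e v) (via q e′ v′) = via (p +ₚ q)
      (≈-trans {f D.+ f′} {ι p D.+ ι q} {ι (p +ₚ q)} (FracField.+-cong {f} {ι p} {f′} {ι q} e e′)
        (≈-sym {ι (p +ₚ q)} {ι p D.+ ι q} (ι-+ p q)))
      (trans (ev-+ p q) (+-cong v v′))

    ⇝-* : ∀ {f g f′ g′} → f ⇝ g → f′ ⇝ g′ → f D.* f′ ⇝ g * g′
    ⇝-* {f} {g} {f′} {g′} (via p e v) (via q e′ v′) = via (p *ₚ q)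
      (≈-trans {f D.* f′} {ι p D.* ι q} {ι (p *ₚ q)} (FracField.*-cong {f} {ι p} {f′} {ι q} e e′)
        (≈-sym {ι (p *ₚ q)} {ι p D.* ι q} (ι-* p q)))
      (trans (ev-* p q) (*-cong v v′))

    ⇝-0 : D.0# ⇝ 0#
    ⇝-0 = ⇝-respʳ c-0 (⇝-const 0ℚ)

    ⇝-1 : D.1# ⇝ 1#
    ⇝-1 = ⇝-respʳ c-1 (⇝-const 1ℚ)

    ⇝-∏ : ∀ {n} {f : Fin n → ℚ⟨α⟩} {g : Fin n → Carrier} → (∀ i → f i ⇝ g i) → D.∏ f ⇝ ∏ g
    ⇝-∏ {zero}  r = ⇝-1
    ⇝-∏ {suc n} r = ⇝-* (r zero) (⇝-∏ λ i → r (suc i))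

    ⇝-∑ : ∀ {n} {f : Fin n → ℚ⟨α⟩} {g : Fin n → Carrier} → (∀ i → f i ⇝ g i) → D.∑ f ⇝ ∑ g
    ⇝-∑ {zero}  r = ⇝-0
    ⇝-∑ {suc n} r = ⇝-+ (r zero) (⇝-∑ λ i → r (suc i))

  module Division (R : CommutativeRing 0ℓ 0ℓ) where
    open CommutativeRing R hiding (zero)
    open Solver commutativeSemiring

    -- One Horner step of the division by X - r: P is the value of the tail at r, and Q the value of
    -- the tail's quotient at r + t.
    divide : ∀ a r t P Q → a + (r + t) * (P + t * Q) ≈ (a + r * P) + t * (P + (r + t) * Q)
    divide = solve 5 (λ a r t P Q → a :+ (r :+ t) :* (P :+ t :* Q) := (a :+ r :* P) :+ t :* (P :+ (r :+ t) :* Q)) refl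

    divide-last : ∀ a r t → a + (r + t) * 0# ≈ (a + r * 0#) + t * 0#
    divide-last = solve 3 (λ a r t → a :+ (r :+ t) :* con 0 := (a :+ r :* con 0) :+ t :* con 0) refl

    recombine : ∀ x r → r + (x + - r) ≈ x
    recombine x r = trans (+-comm r _) (trans (+-assoc x (- r) r) (trans (+-congˡ (-‿inverseˡ r)) (+-identityʳ x)))

  module At (x : ℚ) = Specialisation ℚ.+-*-commutativeRing (λ a → a) ≡.refl ≡.refl (λ _ _ → ≡.refl) (λ _ _ → ≡.refl) x

  module Div = Division ℚ.+-*-commutativeRing

  -- The quotient of synthetic division by X − r.
  quotient : ℚ → Poly → Poly
  quotient r []          = []
  quotient r (a ∷ [])    = []
  quotient r (a ∷ b ∷ p) = At.ev r (b ∷ p) ∷ quotient r (b ∷ p)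

  ev-quotient : ∀ r t p → At.ev (r ℚ.+ t) p ≡ At.ev r p ℚ.+ t ℚ.* At.ev (r ℚ.+ t) (quotient r p)
  ev-quotient r t []          = ≡.sym (≡.trans (ℚ.+-identityˡ _) (ℚ.*-zeroʳ t))
  ev-quotient r t (a ∷ [])    = Div.divide-last a r t
  ev-quotient r t (a ∷ b ∷ p) = ≡.trans
    (≡.cong (λ v → a ℚ.+ (r ℚ.+ t) ℚ.* v) (ev-quotient r t (b ∷ p)))
    (Div.divide a r t (At.ev r (b ∷ p)) (At.ev (r ℚ.+ t) (quotient r (b ∷ p))))

  quotient≈[] : ∀ r p → At.ev r p ≡ 0ℚ → quotient r p ≈ₚ [] → p ≈ₚ []
  quotient≈[] r []       e q i = ≡.refl
  quotient≈[] r (a ∷ []) e q zero    = ≡.trans (≡.sym (≡.trans (≡.cong (a ℚ.+_) (ℚ.*-zeroʳ r)) (ℚ.+-identityʳ a))) e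
  quotient≈[] r (a ∷ []) e q (suc i) = ≡.refl
  quotient≈[] r (a ∷ b ∷ p) e q (suc i) = quotient≈[] r (b ∷ p) (q 0) (λ i → q (suc i)) i
  quotient≈[] r (a ∷ b ∷ p) e q zero = ≡.trans (≡.sym (≡.trans (≡.cong (λ v → a ℚ.+ r ℚ.* v) (q 0))
    (≡.trans (≡.cong (a ℚ.+_) (ℚ.*-zeroʳ r)) (ℚ.+-identityʳ a)))) e

  length-quotient : ∀ r p d → length p ℕ.≤ suc d → length (quotient r p) ℕ.≤ d
  length-quotient r []          d       l = ℕ.z≤n
  length-quotient r (a ∷ [])    d       l = ℕ.z≤n
  length-quotient r (a ∷ b ∷ p) (suc d) (ℕ.s≤s l) = ℕ.s≤s (length-quotient r (b ∷ p) d l)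

  -- Dividing by X - `x 0` lowers the length and leaves the other points as roots, because they
  -- differ from `x 0` and ℚ has no zero divisors.
  vanishing : ∀ d p (x : ℕ → ℚ) → length p ℕ.≤ d → (∀ {i j} → x i ≡ x j → i ≡ j) →
              (∀ j → At.ev (x j) p ≡ 0ℚ) → p ≈ₚ []
  vanishing d       []      x l inj z = λ i → ≡.refl
  vanishing (suc d) (a ∷ p) x l inj z = quotient≈[] (x 0) (a ∷ p) (z 0)
    (vanishing d (quotient (x 0) (a ∷ p)) (λ j → x (suc j)) (length-quotient (x 0) (a ∷ p) d l)
      (λ e → ℕ.suc-injective (inj e)) root)
    where
    q = quotient (x 0) (a ∷ p)
    root : ∀ j → At.ev (x (suc j)) q ≡ 0ℚ
    root j with At.ev (x (suc j)) q ℚ.≟ 0ℚ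
    ... | yes e = e
    ... | no  ne = contradiction product≡0 (ℚ-noZeroDivisors t (At.ev (x (suc j)) q) t≢0 ne)
      where
      t = x (suc j) ℚ.+ (ℚ.- x 0)
      t≢0 : t ≢ 0ℚ
      t≢0 e with () ← inj {suc j} {0} (≡.trans (≡.sym (Div.recombine (x (suc j)) (x 0)))
        (≡.trans (≡.cong (x 0 ℚ.+_) e) (ℚ.+-identityʳ (x 0))))
      product≡0 : t ℚ.* At.ev (x (suc j)) q ≡ 0ℚ
      product≡0 = begin
        t ℚ.* At.ev (x (suc j)) q
          ≡⟨ ℚ.+-identityˡ _ ⟨
        0ℚ ℚ.+ t ℚ.* At.ev (x (suc j)) q
          ≡⟨ ≡.cong₂ (λ u v → u ℚ.+ t ℚ.* At.ev v q) (z 0) (Div.recombine (x (suc j)) (x 0)) ⟨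
        At.ev (x 0) (a ∷ p) ℚ.+ t ℚ.* At.ev (x 0 ℚ.+ t) q
          ≡⟨ ev-quotient (x 0) t (a ∷ p) ⟨
        At.ev (x 0 ℚ.+ t) (a ∷ p)
          ≡⟨ ≡.cong (λ v → At.ev v (a ∷ p)) (Div.recombine (x (suc j)) (x 0)) ⟩
        At.ev (x (suc j)) (a ∷ p)
          ≡⟨ z (suc j) ⟩
        0ℚ ∎
        where open ≡.≡-Reasoning

  -- The polynomials supplied at the first point represent the two fractions at every point, so
  -- their difference vanishes at infinitely many points.
  agree : ∀ {f g} (x : ℕ → ℚ) (v : ℕ → ℚ) → (∀ {i j} → x i ≡ x j → i ≡ j) →
          (∀ j → At._⇝_ (x j) f (v j)) → (∀ j → At._⇝_ (x j) g (v j)) → f D.≈ g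
  agree {f} {g} x v inj rf rg with rf 0 | rg 0
  ... | At.via p e _ | At.via q e′ _ = ≈-trans {f} {ι p} {g} e (≈-trans {ι p} {ι q} {g} (ι-cong p q p≈q) (≈-sym {g} {ι q} e′))
    where
    values : ∀ j → At.ev (x j) p ≡ At.ev (x j) q
    values j = ≡.trans (At.⇝-unique (x j) {f} {At.ev (x j) p} {v j} (At.via p e ≡.refl) (rf j))
      (At.⇝-unique (x j) {g} {v j} {At.ev (x j) q} (rg j) (At.via q e′ ≡.refl))
    difference : p +ₚ (D.-ₚ q) ≈ₚ []
    difference = vanishing (length (p +ₚ (D.-ₚ q))) (p +ₚ (D.-ₚ q)) x ℕ.≤-refl inj λ j →
      ≡.trans (At.ev-+ (x j) p (D.-ₚ q)) (≡.trans (≡.cong (ℚ._+ At.ev (x j) (D.-ₚ q)) (values j))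
        (≡.trans (≡.sym (At.ev-+ (x j) q (D.-ₚ q))) (At.ev-≈[] (x j) (q +ₚ (D.-ₚ q)) (P.-‿inverseʳ q))))
    p≈q : p ≈ₚ q
    p≈q = C.minus-0 p q difference

-- Finite sums over lists

module Sums where

  open import Algebra.Bundles using (CommutativeRing)
  import Algebra.Properties.CommutativeSemigroup as CS
  open import Data.List.Base using (List; []; _∷_; map; filter)
  open import Data.List.Membership.Propositional using (_∈_)
  open import Data.List.Relation.Binary.Permutation.Propositional using (_↭_; refl; prep; swap; trans)
  open import Data.List.Relation.Unary.All as All using (All; []; _∷_)
  open import Data.List.Relation.Unary.AllPairs using ([]; _∷_)
  open import Data.List.Relation.Unary.Any using (here; there)
  open import Data.List.Relation.Unary.Unique.Propositional using (Unique)
  open import Function.Base using (_∘_)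
  open import Level using (0ℓ)
  import Relation.Binary.PropositionalEquality as ≡
  open ≡ using (_≡_; _≢_)
  open import Relation.Nullary using (¬_; yes; no)
  open import Relation.Unary using (Decidable)

  module ListSum (R : CommutativeRing 0ℓ 0ℓ) where
    open CommutativeRing R hiding (refl; trans; zero)
    module ≈ = CommutativeRing R
    open CS +-commutativeSemigroup using (interchange; x∙yz≈y∙xz)
    open import Relation.Binary.Reasoning.Setoid setoid

    private variable
      A B : Set

    ∑ : (A → Carrier) → List A → Carrier
    ∑ f []       = 0#
    ∑ f (x ∷ xs) = f x + ∑ f xs

    ∑-cong-∈ : ∀ {f g : A → Carrier} xs → (∀ {x} → x ∈ xs → f x ≈ g x) → ∑ f xs ≈ ∑ g xs
    ∑-cong-∈ []       e = ≈.refl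
    ∑-cong-∈ (x ∷ xs) e = +-cong (e (here ≡.refl)) (∑-cong-∈ xs (e ∘ there))

    ∑-cong : ∀ {f g : A → Carrier} xs → (∀ x → f x ≈ g x) → ∑ f xs ≈ ∑ g xs
    ∑-cong xs e = ∑-cong-∈ xs λ {x} _ → e x

    ∑-0 : ∀ (xs : List A) → ∑ (λ _ → 0#) xs ≈ 0#
    ∑-0 []       = ≈.refl
    ∑-0 (x ∷ xs) = ≈.trans (+-identityˡ _) (∑-0 xs)

    ∑-zero : ∀ {f : A → Carrier} xs → (∀ {x} → x ∈ xs → f x ≈ 0#) → ∑ f xs ≈ 0#
    ∑-zero xs e = ≈.trans (∑-cong-∈ xs e) (∑-0 xs)

    ∑-+ : ∀ (f g : A → Carrier) xs → ∑ (λ x → f x + g x) xs ≈ ∑ f xs + ∑ g xs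
    ∑-+ f g []       = sym (+-identityˡ _)
    ∑-+ f g (x ∷ xs) = ≈.trans (+-congˡ (∑-+ f g xs)) (interchange (f x) (g x) _ _)

    ∑-*ˡ : ∀ c (f : A → Carrier) xs → ∑ (λ x → c * f x) xs ≈ c * ∑ f xs
    ∑-*ˡ c f []       = sym (zeroʳ c)
    ∑-*ˡ c f (x ∷ xs) = ≈.trans (+-congˡ (∑-*ˡ c f xs)) (sym (distribˡ c _ _))

    ∑-*ʳ : ∀ c (f : A → Carrier) xs → ∑ (λ x → f x * c) xs ≈ ∑ f xs * c
    ∑-*ʳ c f xs = ≈.trans (∑-cong xs λ x → *-comm (f x) c) (≈.trans (∑-*ˡ c f xs) (*-comm c _))

    ∑-swap : ∀ (f : A → B → Carrier) xs ys → ∑ (λ x → ∑ (f x) ys) xs ≈ ∑ (λ y → ∑ (λ x → f x y) xs) ys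
    ∑-swap f []       ys = sym (∑-0 ys)
    ∑-swap f (x ∷ xs) ys = ≈.trans (+-congˡ (∑-swap f xs ys)) (sym (∑-+ (f x) _ ys))

    ∑-map : ∀ (f : B → Carrier) (g : A → B) xs → ∑ f (map g xs) ≡ ∑ (f ∘ g) xs
    ∑-map f g []       = ≡.refl
    ∑-map f g (x ∷ xs) = ≡.cong (f (g x) +_) (∑-map f g xs)

    ∑-↭ : ∀ (f : A → Carrier) {xs ys} → xs ↭ ys → ∑ f xs ≈ ∑ f ys
    ∑-↭ f refl         = ≈.refl
    ∑-↭ f (prep x p)   = +-congˡ (∑-↭ f p)
    ∑-↭ f (swap x y p) = ≈.trans (+-congˡ (+-congˡ (∑-↭ f p))) (x∙yz≈y∙xz (f x) (f y) _)
    ∑-↭ f (trans p q)  = ≈.trans (∑-↭ f p) (∑-↭ f q)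

    ∑-filter : ∀ {P : A → Set} (P? : Decidable P) (f : A → Carrier) xs →
               (∀ {x} → x ∈ xs → ¬ P x → f x ≈ 0#) → ∑ f xs ≈ ∑ f (filter P? xs)
    ∑-filter P? f []       e = ≈.refl
    ∑-filter P? f (x ∷ xs) e with P? x
    ... | yes _ = +-congˡ (∑-filter P? f xs (e ∘ there))
    ... | no ¬p = ≈.trans (+-cong (e (here ≡.refl) ¬p) (∑-filter P? f xs (e ∘ there))) (+-identityˡ _)

    ∑-single : ∀ (f : A → Carrier) {xs a} → Unique xs → a ∈ xs →
               (∀ {x} → x ∈ xs → a ≢ x → f x ≈ 0#) → ∑ f xs ≈ f a
    ∑-single f {x ∷ xs} (x∉ ∷ u) (here ≡.refl) e =
      ≈.trans (+-congˡ (∑-zero xs λ y∈ → e (there y∈) (All.lookup x∉ y∈))) (+-identityʳ _)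
    ∑-single f {x ∷ xs} (x∉ ∷ u) (there a∈) e =
      ≈.trans (+-cong (e (here ≡.refl) (λ a≡x → All.lookup x∉ a∈ (≡.sym a≡x))) (∑-single f u a∈ (e ∘ there))) (+-identityˡ _)

-- Inserting a part into a partition

module Insert where

  open import Defs using (Partition; parts; positive; sorted; sum≡n; count; z)
  open import Data.List.Base using (List; []; _∷_; length; map; filter; applyUpTo)
  import Data.List.Properties as List
  open import Data.List.Membership.Propositional using (_∈_)
  open import Data.List.Membership.Propositional.Properties using (∈-map⁺; ∈-map⁻; ∈-filter⁺; ∈-filter⁻)
  open import Data.List.Membership.DecPropositional using () renaming (_∈?_ to _∈[_]?_)
  open import Data.List.Relation.Binary.Permutation.Propositional using (_↭_; ↭-refl; ↭-trans; prep; swap)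
  open import Data.List.Relation.Unary.All as All using (All; []; _∷_)
  open import Data.List.Relation.Unary.Any using (here; there; any?)
  open import Data.List.Relation.Unary.Linked as Linked using (Linked; []; [-]; _∷_)
  open import Data.List.Relation.Unary.Unique.Propositional using (Unique)
  import Data.List.Relation.Unary.Unique.Propositional.Properties as Unique
  open import Data.Nat.Base
  open import Data.Nat.ListAction using (sum; product)
  open import Data.Nat.Properties
  open import Data.Nat.Tactic.RingSolver using (solve-∀)
  open import Data.Product.Base using (_,_)
  open import Function.Base using (_∘_)
  open import Relation.Binary.PropositionalEquality
  open import Relation.Nullary using (yes; no; contradiction; Dec)
  open Tableaux using (unique-↭; unique-map)
  open Fillings using (Partition-≡)
  open Enumerate using (partitions; ∈-partitions; unique-partitions)

  insert delete : ℕ → List ℕ → List ℕ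
  insert r [] = r ∷ []
  insert r (x ∷ xs) with x ≤? r
  ... | yes _ = r ∷ x ∷ xs
  ... | no  _ = x ∷ insert r xs
  delete r [] = []
  delete r (x ∷ xs) with x ≟ r
  ... | yes _ = xs
  ... | no  _ = x ∷ delete r xs

  delete-insert : ∀ r xs → delete r (insert r xs) ≡ xs
  delete-insert r [] with r ≟ r
  ... | yes _ = refl
  ... | no  p = contradiction refl p
  delete-insert r (x ∷ xs) with x ≤? r
  ... | yes _ with r ≟ r
  ...   | yes _ = refl
  ...   | no  p = contradiction refl p
  delete-insert r (x ∷ xs) | no x≰r with x ≟ r
  ...   | yes refl = contradiction ≤-refl x≰r
  ...   | no  _    = cong (x ∷_) (delete-insert r xs)

  head-max : ∀ {x xs y} → Linked _≥_ (x ∷ xs) → y ∈ x ∷ xs → y ≤ x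
  head-max l (here refl) = ≤-refl
  head-max (x≥ ∷ l) (there p) = ≤-trans (head-max l p) x≥

  insert-delete : ∀ r xs → Linked _≥_ xs → r ∈ xs → insert r (delete r xs) ≡ xs
  insert-delete r (x ∷ xs) l r∈ with x ≟ r
  insert-delete r (x ∷ [])     l r∈ | yes refl = refl
  insert-delete r (x ∷ y ∷ xs) (x≥y ∷ l) r∈ | yes refl with y ≤? x
  ... | yes _  = refl
  ... | no y≰x = contradiction x≥y y≰x
  insert-delete r (x ∷ xs) l (here refl) | no p = contradiction refl p
  insert-delete r (x ∷ xs) l (there r∈)  | no p with x ≤? r
  ... | yes x≤r = contradiction (≤-antisym x≤r (head-max l (there r∈))) p
  ... | no  _   = cong (x ∷_) (insert-delete r xs (Linked.tail l) r∈)

  insert-↭ : ∀ r xs → insert r xs ↭ r ∷ xs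
  insert-↭ r [] = ↭-refl
  insert-↭ r (x ∷ xs) with x ≤? r
  ... | yes _ = ↭-refl
  ... | no  _ = ↭-trans (prep x (insert-↭ r xs)) (swap x r ↭-refl)

  ∈-insert : ∀ r xs → r ∈ insert r xs
  ∈-insert r [] = here refl
  ∈-insert r (x ∷ xs) with x ≤? r
  ... | yes _ = here refl
  ... | no  _ = there (∈-insert r xs)

  insert-sorted : ∀ r xs → Linked _≥_ xs → Linked _≥_ (insert r xs)
  insert-sorted r [] l = [-]
  insert-sorted r (x ∷ xs) l with x ≤? r
  ... | yes x≤r = x≤r ∷ l
  insert-sorted r (x ∷ [])     l         | no x≰r = ≰⇒≥ x≰r ∷ [-]
  insert-sorted r (x ∷ y ∷ xs) (x≥y ∷ l) | no x≰r with y ≤? r | insert-sorted r (y ∷ xs) l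
  ... | yes _ | l′ = ≰⇒≥ x≰r ∷ l′
  ... | no  _ | l′ = x≥y ∷ l′

  delete-sorted : ∀ r xs → Linked _≥_ xs → Linked _≥_ (delete r xs)
  delete-sorted r [] l = []
  delete-sorted r (x ∷ xs) l with x ≟ r
  ... | yes _ = Linked.tail l
  delete-sorted r (x ∷ [])         l | no _ = [-]
  delete-sorted r (x ∷ y ∷ xs)     (x≥y ∷ l) | no _ with y ≟ r | delete-sorted r (y ∷ xs) l
  delete-sorted r (x ∷ y ∷ [])     (x≥y ∷ l) | no _ | yes _ | l′ = [-]
  delete-sorted r (x ∷ y ∷ w ∷ xs) (x≥y ∷ (y≥w ∷ l)) | no _ | yes _ | l′ = ≤-trans y≥w x≥y ∷ l′
  ... | no  _ | l′ = x≥y ∷ l′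

  insert-All : ∀ {P : ℕ → Set} r xs → P r → All P xs → All P (insert r xs)
  insert-All r [] p [] = p ∷ []
  insert-All r (x ∷ xs) p (q ∷ qs) with x ≤? r
  ... | yes _ = p ∷ q ∷ qs
  ... | no  _ = q ∷ insert-All r xs p qs

  delete-All : ∀ {P : ℕ → Set} r xs → All P xs → All P (delete r xs)
  delete-All r [] [] = []
  delete-All r (x ∷ xs) (q ∷ qs) with x ≟ r
  ... | yes _ = qs
  ... | no  _ = q ∷ delete-All r xs qs

  sum-insert : ∀ r xs → sum (insert r xs) ≡ r + sum xs
  sum-insert r [] = refl
  sum-insert r (x ∷ xs) with x ≤? r
  ... | yes _ = refl
  ... | no  _ = trans (cong (x +_) (sum-insert r xs)) (x+y+z x r (sum xs))
    where
    x+y+z : ∀ x y z → x + (y + z) ≡ y + (x + z)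
    x+y+z = solve-∀

  sum-delete : ∀ r xs → r ∈ xs → r + sum (delete r xs) ≡ sum xs
  sum-delete r (x ∷ xs) r∈ with x ≟ r
  ... | yes refl = refl
  sum-delete r (x ∷ xs) (here refl) | no p = contradiction refl p
  sum-delete r (x ∷ xs) (there r∈)  | no p = trans (x+y+z r x (sum (delete r xs))) (cong (x +_) (sum-delete r xs r∈))
    where
    x+y+z : ∀ x y z → x + (y + z) ≡ y + (x + z)
    x+y+z = solve-∀

  length-insert : ∀ r xs → length (insert r xs) ≡ suc (length xs)
  length-insert r [] = refl
  length-insert r (x ∷ xs) with x ≤? r
  ... | yes _ = refl
  ... | no  _ = cong suc (length-insert r xs)

  mult : ℕ → List ℕ → ℕ
  mult i = count (_≟ i)

  mult-∷-≡ : ∀ i xs → mult i (i ∷ xs) ≡ suc (mult i xs)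
  mult-∷-≡ i xs = cong length (List.filter-accept (_≟ i) {i} {xs} refl)

  mult-∷-≢ : ∀ i x xs → x ≢ i → mult i (x ∷ xs) ≡ mult i xs
  mult-∷-≢ i x xs p = cong length (List.filter-reject (_≟ i) {x} {xs} p)

  mult-insert-≡ : ∀ r xs → mult r (insert r xs) ≡ suc (mult r xs)
  mult-insert-≡ r [] = mult-∷-≡ r []
  mult-insert-≡ r (x ∷ xs) with x ≤? r
  ... | yes _   = mult-∷-≡ r (x ∷ xs)
  ... | no  x≰r = trans (mult-∷-≢ r x (insert r xs) λ { refl → x≰r ≤-refl })
    (trans (mult-insert-≡ r xs) (cong suc (sym (mult-∷-≢ r x xs λ { refl → x≰r ≤-refl }))))

  mult-insert-≢ : ∀ i r xs → r ≢ i → mult i (insert r xs) ≡ mult i xs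
  mult-insert-≢ i r [] p = mult-∷-≢ i r [] p
  mult-insert-≢ i r (x ∷ xs) p with x ≤? r
  ... | yes _ = mult-∷-≢ i r (x ∷ xs) p
  ... | no  _ with x ≟ i
  ...   | yes refl = trans (mult-∷-≡ x (insert r xs)) (trans (cong suc (mult-insert-≢ x r xs p)) (sym (mult-∷-≡ x xs)))
  ...   | no  q    = trans (mult-∷-≢ i x (insert r xs) q) (trans (mult-insert-≢ i r xs p) (sym (mult-∷-≢ i x xs q)))

  mult-0 : ∀ i xs → All (_< i) xs → mult i xs ≡ 0
  mult-0 i xs a = cong length (List.filter-none (_≟ i) (All.map <⇒≢ a))

  mult⇒∈ : ∀ i xs → mult i xs ≢ 0 → i ∈ xs
  mult⇒∈ i [] p = contradiction refl p
  mult⇒∈ i (x ∷ xs) p with x ≟ i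
  ... | yes refl = here refl
  ... | no  q    = there (mult⇒∈ i xs (p ∘ trans (mult-∷-≢ i x xs q)))

  factor : ℕ → List ℕ → ℕ
  factor i xs = suc i ^ mult (suc i) xs * mult (suc i) xs !

  -- This is `z` on lists of parts, with the range of the product as a parameter: inserting a part
  -- changes the size and thereby the range.
  zee : ℕ → List ℕ → ℕ
  zee n xs = product (applyUpTo (λ i → factor i xs) n)

  product-cong : ∀ {f g : ℕ → ℕ} n → (∀ i → i < n → f i ≡ g i) → product (applyUpTo f n) ≡ product (applyUpTo g n)
  product-cong zero    e = refl
  product-cong (suc n) e = cong₂ _*_ (e 0 (s≤s z≤n)) (product-cong n λ i i<n → e (suc i) (s≤s i<n))

  product-update : ∀ {f g : ℕ → ℕ} n r c → r < n → g r ≡ c * f r → (∀ i → i ≢ r → g i ≡ f i) →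
                   product (applyUpTo g n) ≡ c * product (applyUpTo f n)
  product-update {f} {g} (suc n) zero c _ e ne = trans (cong₂ _*_ e (product-cong n λ i _ → ne (suc i) λ ()))
    (*-assoc c (f 0) _)
  product-update {f} {g} (suc n) (suc r) c (s≤s r<n) e ne = trans
    (cong₂ _*_ (ne 0 λ ()) (product-update n r c r<n e λ i i≢r → ne (suc i) (i≢r ∘ suc-injective)))
    (x∙yz≈y∙xz (f 0) c _)
    where
    x∙yz≈y∙xz : ∀ x y z → x * (y * z) ≡ y * (x * z)
    x∙yz≈y∙xz = solve-∀

  -- Only the factor of the inserted part changes: its power gains one `suc r` and its factorial
  -- gains the new multiplicity.
  zee-insert : ∀ n r xs → r < n → zee n (insert (suc r) xs) ≡ suc r * suc (mult (suc r) xs) * zee n xs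
  zee-insert n r xs r<n = product-update n r (suc r * suc m) r<n
    (trans (cong (λ k → suc r ^ k * k !) (mult-insert-≡ (suc r) xs)) (rearrange (suc r) (suc r ^ m) (suc m) (m !)))
    λ i i≢r → cong (λ k → suc i ^ k * k !) (mult-insert-≢ (suc i) (suc r) xs (i≢r ∘ suc-injective ∘ sym))
    where
    m = mult (suc r) xs
    rearrange : ∀ a b c d → a * b * (c * d) ≡ a * c * (b * d)
    rearrange = solve-∀

  product-ones : ∀ {f : ℕ → ℕ} n → (∀ i → f i ≡ 1) → product (applyUpTo f n) ≡ 1
  product-ones zero    e = refl
  product-ones (suc n) e = cong₂ _*_ (e 0) (product-ones n (e ∘ suc))

  product-extend : ∀ {f : ℕ → ℕ} m n → m ≤ n → (∀ i → m ≤ i → f i ≡ 1) →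
                   product (applyUpTo f n) ≡ product (applyUpTo f m)
  product-extend zero    n       _         e = product-ones n λ i → e i z≤n
  product-extend {f} (suc m) (suc n) (s≤s m≤n) e = cong (f 0 *_) (product-extend m n m≤n λ i m≤i → e (suc i) (s≤s m≤i))

  zee-extend : ∀ m n xs → m ≤ n → All (_≤ m) xs → zee n xs ≡ zee m xs
  zee-extend m n xs m≤n a = product-extend m n m≤n λ i m≤i →
    cong (λ k → suc i ^ k * k !) (mult-0 (suc i) xs (All.map (λ x≤m → s≤s (≤-trans x≤m m≤i)) a))

  zee-pos : ∀ n xs → 0 < zee n xs
  zee-pos n xs = go n (λ i → factor i xs) λ i → *-mono-≤ (m^n>0 (suc i) (mult (suc i) xs)) (1≤n! (mult (suc i) xs))
    where
    go : ∀ n (f : ℕ → ℕ) → (∀ i → 0 < f i) → 0 < product (applyUpTo f n)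
    go zero    f pos = s≤s z≤n
    go (suc n) f pos = *-mono-≤ (pos 0) (go n (f ∘ suc) (pos ∘ suc))

  ≤sum : ∀ xs → All (_≤ sum xs) xs
  ≤sum []       = []
  ≤sum (x ∷ xs) = m≤m+n x _ ∷ All.map (λ p → ≤-trans p (m≤n+m _ x)) (≤sum xs)

  insertP : ∀ {m n} r → r + m ≡ n → 0 < r → Partition m → Partition n
  insertP r e 0<r ν = record
    { parts = insert r (parts ν) ; positive = insert-All r _ 0<r (positive ν)
    ; sorted = insert-sorted r _ (sorted ν)
    ; sum≡n = trans (sum-insert r (parts ν)) (trans (cong (r +_) (sum≡n ν)) e) }

  -- The multiplicity is the one after insertion, so that the factor cancels against the weight r
  -- m_r in Newton's identity.
  z-insertP : ∀ {m n} r (e : suc r + m ≡ n) (ν : Partition m) →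
              z (insertP (suc r) e (s≤s z≤n) ν) ≡ suc r * mult (suc r) (insert (suc r) (parts ν)) * z ν
  z-insertP {m} {n} r e ν = trans (zee-insert n r (parts ν) (subst (r <_) e (m≤m+n (suc r) m)))
    (cong₂ (λ k w → suc r * k * w) (sym (mult-insert-≡ (suc r) (parts ν)))
      (zee-extend m n (parts ν) (subst (m ≤_) e (m≤n+m m (suc r))) (All.map (λ p → ≤-trans p (≤-reflexive (sum≡n ν))) (≤sum (parts ν)))))

  has? : ∀ {n} r (ν : Partition n) → Dec (r ∈ parts ν)
  has? r ν = any? (r ≟_) (parts ν)

  -- Inserting `r` and deleting `r` are inverse to each other.
  insertP-↭ : ∀ {m n} r (e : r + m ≡ n) (0<r : 0 < r) →
              filter (has? r) (partitions n) ↭ map (insertP r e 0<r) (partitions m)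
  insertP-↭ {m} {n} r e 0<r = unique-↭ (Unique.filter⁺ (has? r) (unique-partitions n))
    (unique-map (λ _ _ e′ → Partition-≡ (trans (sym (delete-insert r _)) (trans (cong (delete r ∘ parts) e′) (delete-insert r _)))) (unique-partitions m))
    (λ {ν} p → let (_ , r∈) = ∈-filter⁻ (has? r) {xs = partitions n} p in
      subst (_∈ map (insertP r e 0<r) (partitions m)) (Partition-≡ (insert-delete r (parts ν) (sorted ν) r∈))
        (∈-map⁺ (insertP r e 0<r) (∈-partitions (removed ν r∈))))
    (λ p → let (ν , _ , e′) = ∈-map⁻ (insertP r e 0<r) p in subst (_∈ filter (has? r) (partitions n)) (sym e′)
      (∈-filter⁺ (has? r) (∈-partitions (insertP r e 0<r ν)) (∈-insert r (parts ν))))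
    where
    removed : ∀ (ν : Partition n) → r ∈ parts ν → Partition m
    removed ν r∈ = record
      { parts = delete r (parts ν) ; positive = delete-All r _ (positive ν) ; sorted = delete-sorted r _ (sorted ν)
      ; sum≡n = +-cancelˡ-≡ r _ _ (trans (sum-delete r (parts ν) r∈) (trans (sum≡n ν) (sym e))) }

  weighted : ℕ → List ℕ → ℕ
  weighted n xs = sum (map (λ r → r * mult r xs) (applyUpTo suc n))

  -- Each part adds its size to the term of that size. The formula n = Σ r m_r is what makes
  -- Newton's identity reduce h_n to smaller degrees.
  sum-mult : ∀ n xs → All (0 <_) xs → All (_≤ n) xs → weighted n xs ≡ sum xs
  sum-mult n []       []       []       = zeros (applyUpTo suc n)
    where
    zeros : ∀ rs → sum (map (λ r → r * 0) rs) ≡ 0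
    zeros []       = refl
    zeros (r ∷ rs) = cong₂ _+_ (*-zeroʳ r) (zeros rs)
  sum-mult n (suc x ∷ xs) (_ ∷ ps) (x<n ∷ qs) = begin
    sum (map (λ r → r * mult r (suc x ∷ xs)) (applyUpTo suc n))
      ≡⟨ cong sum (List.map-applyUpTo suc (λ r → r * mult r (suc x ∷ xs)) n) ⟩
    sum (applyUpTo (λ i → suc i * mult (suc i) (suc x ∷ xs)) n)
      ≡⟨ update n x x<n (λ i → suc i * mult (suc i) (suc x ∷ xs)) (λ i → suc i * mult (suc i) xs)
           (trans (cong (suc x *_) (mult-∷-≡ (suc x) xs)) (*-suc (suc x) (mult (suc x) xs)))
           (λ i i≢x → cong (suc i *_) (mult-∷-≢ (suc i) (suc x) xs (i≢x ∘ suc-injective ∘ sym))) ⟩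
    suc x + sum (applyUpTo (λ i → suc i * mult (suc i) xs) n)
      ≡⟨ cong (λ s → suc x + sum s) (List.map-applyUpTo suc (λ r → r * mult r xs) n) ⟨
    suc x + weighted n xs
      ≡⟨ cong (suc x +_) (sum-mult n xs ps qs) ⟩
    suc x + sum xs ∎
    where
    open ≡-Reasoning
    sum-cong : ∀ {f g : ℕ → ℕ} n → (∀ i → f i ≡ g i) → sum (applyUpTo f n) ≡ sum (applyUpTo g n)
    sum-cong zero    e = refl
    sum-cong (suc n) e = cong₂ _+_ (e 0) (sum-cong n (e ∘ suc))
    update : ∀ n r → r < n → (g f : ℕ → ℕ) → ∀ {c} → g r ≡ c + f r → (∀ i → i ≢ r → g i ≡ f i) →
             sum (applyUpTo g n) ≡ c + sum (applyUpTo f n)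
    update (suc n) zero    _         g f {c} e ne = trans (cong₂ _+_ e (sum-cong n λ i → ne (suc i) λ ())) (+-assoc c (f 0) _)
    update (suc n) (suc r) (s≤s r<n) g f {c} e ne = trans
      (cong₂ _+_ (ne 0 λ ()) (update n r r<n (g ∘ suc) (f ∘ suc) e λ i i≢r → ne (suc i) (i≢r ∘ suc-injective)))
      (x+y+z (f 0) c _)
      where
      x+y+z : ∀ x y z → x + (y + z) ≡ y + (x + z)
      x+y+z = solve-∀

-- Monomial coefficients of products of power sums

module PowerSums where

  open import Defs using (Monomials; coefficient; powerSum; _⊛_; count; Partition; parts; positive; sorted; ℓ)
  open import Data.Bool.Base using (true; false; if_then_else_; T)
  open import Data.Empty using (⊥-elim)
  open import Data.Fin.Base as Fin using (Fin)
  import Data.Fin.Properties as Fin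
  open import Data.List.Base using (List; []; _∷_; length; map; filter; foldr; allFin; cartesianProductWith)
  import Data.List.Properties as List
  open import Data.List.Membership.Propositional using (_∈_)
  open import Data.List.Relation.Binary.Permutation.Propositional using (_↭_; ↭-refl; ↭-trans; ↭-sym; prep; swap; ↭-reflexive)
  open import Data.List.Relation.Binary.Permutation.Propositional.Properties using (drop-∷; ∈-resp-↭; ↭-empty-inv)
  open import Data.List.Relation.Unary.All as All using (All; []; _∷_)
  open import Data.List.Relation.Unary.Any using (here; there)
  open import Data.List.Relation.Unary.Linked as Linked using (Linked; []; _∷_)
  open import Data.Nat.Base
  open import Data.Nat.ListAction using (sum)
  open import Data.Nat.Properties
  open import Data.Product.Base using (_×_; _,_; ∃)
  open import Data.Vec.Base as Vec using (Vec; []; _∷_; lookup; updateAt; replicate; zipWith; tabulate; fromList)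
  import Data.Vec.Properties as Vec
  open import Function.Base using (_∘_; id)
  open import Relation.Binary.PropositionalEquality
  open import Relation.Nullary using (yes; no; contradiction; does)
  open import Relation.Unary using (Decidable)
  open Fillings using (count-map)
  open Insert using (head-max)

  expand : ∀ N → List ℕ → Monomials N
  expand N = foldr (λ r F → powerSum r N ⊛ F) (replicate N 0 ∷ [])

  powerCoeff : ∀ {N} → List ℕ → Vec ℕ N → ℕ
  powerCoeff {N} rs v = coefficient v (expand N rs)

  -- The subtraction is truncated, hence the guards `r ≤ᵇ lookup v i` in the formulas for
  -- coefficients.
  lower : ∀ {N} → ℕ → Fin N → Vec ℕ N → Vec ℕ N
  lower r i v = updateAt v i (_∸ r)

  count-⇔ : ∀ {A : Set} {P Q : A → Set} (P? : Decidable P) (Q? : Decidable Q) xs →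
            (∀ x → P x → Q x) → (∀ x → Q x → P x) → count P? xs ≡ count Q? xs
  count-⇔ P? Q? []       f g = refl
  count-⇔ P? Q? (x ∷ xs) f g with P? x | Q? x
  ... | yes _ | yes _ = cong suc (count-⇔ P? Q? xs f g)
  ... | no  _ | no  _ = count-⇔ P? Q? xs f g
  ... | yes p | no ¬q = contradiction (f x p) ¬q
  ... | no ¬p | yes q = contradiction (g x q) ¬p

  unit : ∀ {N} → ℕ → Fin N → Vec ℕ N
  unit r i = tabulate (λ j → if does (i Fin.≟ j) then r else 0)

  add-zeros : ∀ {N} (b : Vec ℕ N) → zipWith _+_ (tabulate (λ _ → 0)) b ≡ b
  add-zeros []      = refl
  add-zeros (x ∷ b) = cong (x ∷_) (add-zeros b)

  add-unit : ∀ {N} r (i : Fin N) b → zipWith _+_ (unit r i) b ≡ updateAt b i (r +_)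
  add-unit r Fin.zero    (x ∷ b) = cong (r + x ∷_) (add-zeros b)
  add-unit r (Fin.suc i) (x ∷ b) = cong (x ∷_) (add-unit r i b)

  raise-lower : ∀ {N} r (i : Fin N) v → r ≤ lookup v i → updateAt (lower r i v) i (r +_) ≡ v
  raise-lower r Fin.zero    (x ∷ v) p = cong (_∷ v) (m+[n∸m]≡n p)
  raise-lower r (Fin.suc i) (x ∷ v) p = cong (x ∷_) (raise-lower r i v p)

  lower-raise : ∀ {N} r (i : Fin N) v → lower r i (updateAt v i (r +_)) ≡ v
  lower-raise r Fin.zero    (x ∷ v) = cong (_∷ v) (m+n∸m≡n r x)
  lower-raise r (Fin.suc i) (x ∷ v) = cong (x ∷_) (lower-raise r i v)

  coefficient-unit : ∀ {N} r (i : Fin N) v F → coefficient v (map (zipWith _+_ (unit r i)) F) ≡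
                     (if r ≤ᵇ lookup v i then coefficient (lower r i v) F else 0)
  coefficient-unit r i v F with r ≤ᵇ lookup v i in e
  ... | true  = trans (count-map _ (zipWith _+_ (unit r i)) F) (count-⇔ _ (λ b → Vec.≡-dec _≟_ b (lower r i v)) F
    (λ b e′ → trans (sym (lower-raise r i b)) (cong (lower r i) (trans (sym (add-unit r i b)) e′)))
    (λ b e′ → trans (add-unit r i b) (trans (cong (λ b → updateAt b i (r +_)) e′) (raise-lower r i v (≤ᵇ⇒≤ r _ (subst T (sym e) _))))))
  ... | false = trans (count-map _ (zipWith _+_ (unit r i)) F)
    (cong length (List.filter-none _ (All.tabulate {xs = F} λ {b} _ e′ → subst T e (≤⇒≤ᵇ (subst (r ≤_)
      (trans (sym (Vec.lookup∘updateAt i b)) (cong (λ v → lookup v i) (trans (sym (add-unit r i b)) e′))) (m≤m+n r _))))))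

  -- The first power sum contributes the r-th power of one variable, and the other factors have to
  -- supply the remaining exponents.
  powerCoeff-∷ : ∀ {N} r rs (v : Vec ℕ N) → powerCoeff (r ∷ rs) v ≡
                 sum (map (λ i → if r ≤ᵇ lookup v i then powerCoeff rs (lower r i v) else 0) (allFin N))
  powerCoeff-∷ {N} r rs v = go (allFin N)
    where
    F = expand N rs
    go : ∀ is → coefficient v (cartesianProductWith (zipWith _+_) (map (unit r) is) F) ≡
         sum (map (λ i → if r ≤ᵇ lookup v i then coefficient (lower r i v) F else 0) is)
    go []       = refl
    go (i ∷ is) = trans (cong length (List.filter-++ _ (map (zipWith _+_ (unit r i)) F) _))
      (trans (List.length-++ (filter _ (map (zipWith _+_ (unit r i)) F)))
        (cong₂ _+_ (coefficient-unit r i v F) (go is)))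

  powerCoeff-[] : ∀ {N} (v : Vec ℕ N) → powerCoeff [] v ≢ 0 → v ≡ replicate N 0
  powerCoeff-[] {N} v p with Vec.≡-dec _≟_ (replicate N 0) v
  ... | yes e = sym e
  ... | no  _ = contradiction refl p

  powerCoeff-zeros : ∀ N → powerCoeff [] (replicate N 0) ≡ 1
  powerCoeff-zeros N = cong length (List.filter-accept (λ b → Vec.≡-dec _≟_ b (replicate N 0)) {replicate N 0} {[]} refl)

  sum≢0 : ∀ {A : Set} (f : A → ℕ) xs → sum (map f xs) ≢ 0 → ∃ λ x → f x ≢ 0
  sum≢0 f []       p = contradiction refl p
  sum≢0 f (x ∷ xs) p with f x in e
  ... | zero  = sum≢0 f xs p
  ... | suc _ = x , λ e′ → contradiction (trans (sym e′) e) λ ()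

  term≤sum : ∀ {A : Set} (f : A → ℕ) {x} xs → x ∈ xs → f x ≤ sum (map f xs)
  term≤sum f (x ∷ xs) (here refl) = m≤m+n (f x) _
  term≤sum f (y ∷ xs) (there p)   = ≤-trans (term≤sum f xs p) (m≤n+m _ (f y))

  sum-mono : ∀ {A : Set} {f g : A → ℕ} xs → (∀ x → f x ≤ g x) → sum (map f xs) ≤ sum (map g xs)
  sum-mono []       e = z≤n
  sum-mono (x ∷ xs) e = +-mono-≤ (e x) (sum-mono xs e)

  nonzeros : ∀ {N} → Vec ℕ N → List ℕ
  nonzeros []          = []
  nonzeros (zero ∷ v)  = nonzeros v
  nonzeros (suc x ∷ v) = suc x ∷ nonzeros v

  nonzeros-replicate : ∀ N → nonzeros (replicate N 0) ≡ []
  nonzeros-replicate zero    = refl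
  nonzeros-replicate (suc N) = nonzeros-replicate N

  nonzeros-fromList : ∀ ps → All (0 <_) ps → nonzeros (fromList ps) ≡ ps
  nonzeros-fromList []           []       = refl
  nonzeros-fromList (suc p ∷ ps) (_ ∷ qs) = cong (suc p ∷_) (nonzeros-fromList ps qs)

  -- Lowering by `r` makes an entry disappear only if that entry equals `r`.
  nonzeros-lower : ∀ {N} r (i : Fin N) v → 0 < r → r ≤ lookup v i →
    length (nonzeros v) ≤ suc (length (nonzeros (lower r i v))) ×
    (length (nonzeros (lower r i v)) < length (nonzeros v) → nonzeros v ↭ r ∷ nonzeros (lower r i v))
  nonzeros-lower (suc r) Fin.zero (suc x ∷ v) _ p with x ∸ r in e
  ... | zero  = ≤-refl , λ _ → ↭-reflexive (cong (_∷ nonzeros v) (cong suc (≤-antisym (m∸n≡0⇒m≤n e) (s≤s⁻¹ p))))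
  ... | suc _ = m≤n⇒m≤1+n ≤-refl , λ q → contradiction q (<-irrefl refl)
  nonzeros-lower r (Fin.suc i) (zero ∷ v)  0<r p = nonzeros-lower r i v 0<r p
  nonzeros-lower r (Fin.suc i) (suc x ∷ v) 0<r p with l , f ← nonzeros-lower r i v 0<r p =
    s≤s l , λ q → ↭-trans (prep (suc x) (f (s≤s⁻¹ q))) (swap (suc x) r ↭-refl)

  -- Every part is absorbed by one variable, so the nonzero exponents are sums over disjoint groups
  -- of parts; if there are as many exponents as parts, all groups are singletons.
  powerCoeff-support : ∀ {N} rs (v : Vec ℕ N) → All (0 <_) rs → powerCoeff rs v ≢ 0 →
    length (nonzeros v) ≤ length rs × (length (nonzeros v) ≡ length rs → nonzeros v ↭ rs)
  powerCoeff-support {N} [] v [] p with refl ← powerCoeff-[] v p =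
    ≤-reflexive (cong length (nonzeros-replicate N)) , λ _ → ↭-reflexive (nonzeros-replicate N)
  powerCoeff-support {N} (r ∷ rs) v (0<r ∷ ps) p
    with i , q ← sum≢0 (λ i → if r ≤ᵇ lookup v i then powerCoeff rs (lower r i v) else 0) (allFin N) (p ∘ trans (powerCoeff-∷ r rs v))
    with r ≤ᵇ lookup v i in e
  ... | false = contradiction refl q
  ... | true with l , f ← powerCoeff-support rs (lower r i v) ps q
             with l′ , f′ ← nonzeros-lower r i v 0<r (≤ᵇ⇒≤ r _ (subst T (sym e) _)) =
    ≤-trans l′ (s≤s l) , λ e′ → let lt = ≤-<-trans l (≤-reflexive (sym e′)) in
      ↭-trans (f′ lt) (prep r (f (≤-antisym l (s≤s⁻¹ (subst (_≤ suc (length (nonzeros (lower r i v)))) e′ l′)))))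

  sorted-↭ : ∀ xs ys → Linked _≥_ xs → Linked _≥_ ys → xs ↭ ys → xs ≡ ys
  sorted-↭ [] ys lx ly p = sym (↭-empty-inv (↭-sym p))
  sorted-↭ (x ∷ xs) [] lx ly p with () ← ↭-empty-inv p
  sorted-↭ (x ∷ xs) (y ∷ ys) lx ly p
    with refl ← ≤-antisym (head-max ly (∈-resp-↭ p (here refl))) (head-max lx (∈-resp-↭ (↭-sym p) (here refl))) =
    cong (x ∷_) (sorted-↭ xs ys (Linked.tail lx) (Linked.tail ly) (drop-∷ p))

  partCoeff : ∀ {m n} → Partition m → Partition n → ℕ
  partCoeff ν μ = powerCoeff (parts ν) (fromList (parts μ))

  -- The power sums are triangular in the monomial basis with respect to the number of parts; by
  -- this triangularity m_μ is expressed through power sums.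
  partCoeff-support : ∀ {n} (ν μ : Partition n) → partCoeff ν μ ≢ 0 → ℓ μ ≤ ℓ ν × (ℓ μ ≡ ℓ ν → parts μ ≡ parts ν)
  partCoeff-support ν μ p with l , f ← powerCoeff-support (parts ν) (fromList (parts μ)) (positive ν) p =
    subst (λ ps → length ps ≤ ℓ ν) nz l , λ e → sorted-↭ (parts μ) (parts ν) (sorted μ) (sorted ν)
      (subst (_↭ parts ν) nz (f (trans (cong length nz) e)))
    where
    nz = nonzeros-fromList (parts μ) (positive μ)

  allFin-suc : ∀ N → allFin (suc N) ≡ Fin.zero ∷ map Fin.suc (allFin N)
  allFin-suc N = cong (Fin.zero ∷_) (sym (List.map-tabulate id Fin.suc))

  -- All terms that use only the old variables are still present when a variable with exponent 0 is
  -- added.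
  powerCoeff-0∷ : ∀ {N} rs (v : Vec ℕ N) → powerCoeff rs v ≤ powerCoeff rs (0 ∷ v)
  powerCoeff-0∷ {N} [] v with powerCoeff [] v ≟ 0
  ... | yes e = ≤-trans (≤-reflexive e) z≤n
  ... | no  p with refl ← powerCoeff-[] v p = ≤-reflexive (trans (powerCoeff-zeros N) (sym (powerCoeff-zeros (suc N))))
  powerCoeff-0∷ {N} (r ∷ rs) v = begin
    powerCoeff (r ∷ rs) v                  ≡⟨ powerCoeff-∷ r rs v ⟩
    sum (map f (allFin N))                 ≤⟨ sum-mono (allFin N) le ⟩
    sum (map (g ∘ Fin.suc) (allFin N))     ≤⟨ m≤n+m _ (g Fin.zero) ⟩
    g Fin.zero + sum (map (g ∘ Fin.suc) (allFin N))
      ≡⟨ cong (λ xs → g Fin.zero + sum xs) (List.map-∘ (allFin N)) ⟩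
    sum (map g (Fin.zero ∷ map Fin.suc (allFin N)))
      ≡⟨ cong (sum ∘ map g) (allFin-suc N) ⟨
    sum (map g (allFin (suc N)))           ≡⟨ powerCoeff-∷ r rs (0 ∷ v) ⟨
    powerCoeff (r ∷ rs) (0 ∷ v)            ∎
    where
    open ≤-Reasoning
    f : Fin N → ℕ
    f i = if r ≤ᵇ lookup v i then powerCoeff rs (lower r i v) else 0
    g : Fin (suc N) → ℕ
    g i = if r ≤ᵇ lookup (0 ∷ v) i then powerCoeff rs (lower r i (0 ∷ v)) else 0
    le : ∀ i → f i ≤ g (Fin.suc i)
    le i with r ≤ᵇ lookup v i
    ... | true  = powerCoeff-0∷ rs (lower r i v)
    ... | false = z≤n

  -- One contribution comes from giving every part its own variable.
  powerCoeff-self : ∀ rs → 0 < powerCoeff rs (fromList rs)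
  powerCoeff-self []       = s≤s z≤n
  powerCoeff-self (r ∷ rs) = begin-strict
    0                                        <⟨ powerCoeff-self rs ⟩
    powerCoeff rs (fromList rs)              ≤⟨ powerCoeff-0∷ rs (fromList rs) ⟩
    powerCoeff rs (0 ∷ fromList rs)          ≡⟨ cong (λ x → powerCoeff rs (x ∷ fromList rs)) (n∸n≡0 r) ⟨
    powerCoeff rs (r ∸ r ∷ fromList rs)      ≡⟨ cong (if_then powerCoeff rs (r ∸ r ∷ fromList rs) else 0) r≤r ⟨
    f Fin.zero                               ≤⟨ term≤sum f (allFin (suc (length rs))) (here refl) ⟩
    sum (map f (allFin (suc (length rs))))   ≡⟨ powerCoeff-∷ r rs (fromList (r ∷ rs)) ⟨
    powerCoeff (r ∷ rs) (fromList (r ∷ rs))  ∎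
    where
    open ≤-Reasoning
    f : Fin (suc (length rs)) → ℕ
    f i = if r ≤ᵇ lookup (r ∷ fromList rs) i then powerCoeff rs (lower r i (r ∷ fromList rs)) else 0
    r≤r : (r ≤ᵇ r) ≡ true
    r≤r with r ≤ᵇ r in e
    ... | true  = refl
    ... | false = ⊥-elim (subst T e (≤⇒≤ᵇ {r} ≤-refl))

  -- In one variable each power sum is a single power, so the product is the monomial of degree n.
  powerCoeff-row : ∀ rs n → sum rs ≡ n → powerCoeff rs (n ∷ []) ≡ 1
  powerCoeff-row []       n refl = refl
  powerCoeff-row (r ∷ rs) n refl = trans (powerCoeff-∷ r rs (r + sum rs ∷ [])) (trans (+-identityʳ _)
    (trans (cong (if_then powerCoeff rs (r + sum rs ∸ r ∷ []) else 0) r≤)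
      (trans (cong (λ x → powerCoeff rs (x ∷ [])) (m+n∸m≡n r (sum rs))) (powerCoeff-row rs (sum rs) refl))))
    where
    r≤ : (r ≤ᵇ r + sum rs) ≡ true
    r≤ with r ≤ᵇ r + sum rs in e
    ... | true  = refl
    ... | false = ⊥-elim (subst T e (≤⇒≤ᵇ (m≤m+n r (sum rs))))

-- Newton's identity for h_n[aX]

module Newton where

  open import Defs using (Partition; parts; positive; sorted; sum≡n; ℓ; z)
  open import Algebra.Bundles using (CommutativeRing)
  import Algebra.Definitions.RawSemiring as RawSemiringDefinitions
  open import Algebra.Bundles using (CommutativeSemiring)
  import Algebra.Solver.Ring.NaturalCoefficients.Default as Solver
  open import Data.Bool.Base using (Bool; true; false; if_then_else_; T)
  open import Data.Empty using (⊥-elim)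
  open import Data.Fin.Base as Fin using (Fin)
  import Data.Fin.Properties as Fin
  open import Data.List.Base using (List; []; _∷_; map; filter; allFin; applyUpTo)
  import Data.List.Properties as List
  open import Data.List.Membership.Propositional using (_∈_)
  open import Data.List.Membership.Propositional.Properties using (∈-applyUpTo⁻)
  open import Data.List.Relation.Binary.Permutation.Propositional using (_↭_; refl; prep; swap; trans)
  open import Data.List.Relation.Unary.All as All using (All; []; _∷_)
  open import Data.List.Relation.Unary.Any using (here; there)
  open import Data.Nat.Base as ℕ using (ℕ; zero; suc; _≤_; _<_; z≤n; s≤s; _∸_; _≤ᵇ_)
  open import Data.Nat.Induction using (<-rec)
  open import Data.Nat.ListAction using (sum)
  import Data.Nat.Properties as ℕ
  open import Data.Product.Base using (_×_; _,_; ∃)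
  open import Data.Vec.Base as Vec using (Vec; []; _∷_; lookup)
  import Data.Vec.Properties as Vec
  open import Function.Base using (_∘_)
  open import Level using (0ℓ)
  open import Relation.Binary.PropositionalEquality as ≡ using (_≡_)
  open import Relation.Nullary using (¬_; yes; no; contradiction; Dec)
  open Sums
  open Insert
  open PowerSums
  open Enumerate using (partitions; ∈-partitions; unique-partitions)

  -- Collects what the argument about Jack functions uses of ℚ(α); characteristic 0 enters as
  -- positivity of the nonzero naturals.
  record OrderedField : Set₁ where
    field
      ring : CommutativeRing 0ℓ 0ℓ
    open CommutativeRing ring hiding (ring; zero) public
    field
      _⁻¹      : Carrier → Carrier
      inverseʳ : ∀ x → ¬ (x ≈ 0#) → x * x ⁻¹ ≈ 1#
      ≈0?      : ∀ x → Dec (x ≈ 0#)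
      nat      : ℕ → Carrier
      nat-0    : nat 0 ≈ 0#
      nat-1    : nat 1 ≈ 1#
      nat-+    : ∀ m n → nat (m ℕ.+ n) ≈ nat m + nat n
      nat-*    : ∀ m n → nat (m ℕ.* n) ≈ nat m * nat n
      Pos      : Carrier → Set
      Pos-resp : ∀ {x y} → x ≈ y → Pos x → Pos y
      Pos-+    : ∀ {x y} → Pos x → Pos y → Pos (x + y)
      Pos-*    : ∀ {x y} → Pos x → Pos y → Pos (x * y)
      Pos-sq   : ∀ {x} → ¬ (x ≈ 0#) → Pos (x * x)
      Pos⇒≉0   : ∀ {x} → Pos x → ¬ (x ≈ 0#)
      nat-pos  : ∀ k → Pos (nat (suc k))

  module FieldLemmas (𝔽 : OrderedField) where
    open OrderedField 𝔽 public
    open Solver commutativeSemiring public using (solve; con; _:+_; _:*_; _:=_)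
    module ≈ = CommutativeRing ring
    open RawSemiringDefinitions (CommutativeSemiring.rawSemiring commutativeSemiring) public using (_^_)
    open ListSum ring public hiding (module ≈)
    open import Relation.Binary.Reasoning.Setoid setoid public

    nat≉0 : ∀ {k} → 0 < k → ¬ (nat k ≈ 0#)
    nat≉0 {suc k} _ = Pos⇒≉0 (nat-pos k)

    cancelˡ : ∀ {x y w} → ¬ (x ≈ 0#) → x * y ≈ x * w → y ≈ w
    cancelˡ {x} {y} {w} x≉0 e = begin
      y               ≈⟨ undo y ⟨
      x ⁻¹ * (x * y)  ≈⟨ *-congˡ e ⟩
      x ⁻¹ * (x * w)  ≈⟨ undo w ⟩
      w               ∎
      where
      undo : ∀ y → x ⁻¹ * (x * y) ≈ y
      undo y = begin
        x ⁻¹ * (x * y)  ≈⟨ solve 3 (λ i x y → i :* (x :* y) := (x :* i) :* y) ≈.refl (x ⁻¹) x y ⟩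
        x * x ⁻¹ * y    ≈⟨ *-congʳ (inverseʳ x x≉0) ⟩
        1# * y          ≈⟨ *-identityˡ y ⟩
        y               ∎

    noZeroDivisors : ∀ {x y} → ¬ (x ≈ 0#) → x * y ≈ 0# → y ≈ 0#
    noZeroDivisors x≉0 e = cancelˡ x≉0 (≈.trans e (sym (zeroʳ _)))

    *-⁻¹ : ∀ {x y} → ¬ (x ≈ 0#) → ¬ (y ≈ 0#) → x * (x * y) ⁻¹ ≈ y ⁻¹
    *-⁻¹ {x} {y} x≉0 y≉0 = cancelˡ y≉0 (begin
      y * (x * (x * y) ⁻¹)  ≈⟨ solve 3 (λ x y i → y :* (x :* i) := (x :* y) :* i) ≈.refl x y ((x * y) ⁻¹) ⟩
      x * y * (x * y) ⁻¹    ≈⟨ inverseʳ (x * y) (λ e → y≉0 (noZeroDivisors x≉0 e)) ⟩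
      1#                    ≈⟨ inverseʳ y y≉0 ⟨
      y * y ⁻¹              ∎)

    ⁻¹-cong : ∀ {x y} → ¬ (x ≈ 0#) → x ≈ y → x ⁻¹ ≈ y ⁻¹
    ⁻¹-cong {x} {y} x≉0 e = cancelˡ x≉0 (begin
      x * x ⁻¹   ≈⟨ inverseʳ x x≉0 ⟩
      1#         ≈⟨ inverseʳ y (λ e′ → x≉0 (≈.trans e e′)) ⟨
      y * y ⁻¹   ≈⟨ *-congʳ e ⟨
      x * y ⁻¹   ∎)

    nat-sum : ∀ {A : Set} (f : A → ℕ) xs → nat (sum (map f xs)) ≈ ∑ (nat ∘ f) xs
    nat-sum f []       = nat-0
    nat-sum f (x ∷ xs) = ≈.trans (nat-+ (f x) _) (+-congˡ (nat-sum f xs))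

    when : Bool → Carrier → Carrier
    when b x = if b then x else 0#

    when-cong : ∀ b {x y} → (b ≡ true → x ≈ y) → when b x ≈ when b y
    when-cong true  e = e ≡.refl
    when-cong false e = ≈.refl

    *-when : ∀ c b x → c * when b x ≈ when b (c * x)
    *-when c true  x = ≈.refl
    *-when c false x = zeroʳ c

    when-∑ : ∀ {A : Set} b (f : A → Carrier) xs → when b (∑ f xs) ≈ ∑ (λ x → when b (f x)) xs
    when-∑ true  f xs = ≈.refl
    when-∑ false f xs = sym (∑-0 xs)

  ≤ᵇ-true : ∀ {m n} → m ≤ n → (m ≤ᵇ n) ≡ true
  ≤ᵇ-true {m} {n} p with m ≤ᵇ n in e
  ... | true  = ≡.refl
  ... | false = ⊥-elim (≡.subst T e (ℕ.≤⇒≤ᵇ p))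

  ≤ᵇ⇒≤ : ∀ {m n} → (m ≤ᵇ n) ≡ true → m ≤ n
  ≤ᵇ⇒≤ {m} {n} e = ℕ.≤ᵇ⇒≤ m n (≡.subst T (≡.sym e) _)

  module NewtonIdentity (𝔽 : OrderedField) (a : OrderedField.Carrier 𝔽) where
    open FieldLemmas 𝔽

    coeff : ∀ {N} → List ℕ → Vec ℕ N → Carrier
    coeff rs v = nat (powerCoeff rs v)

    coeff-∷ : ∀ {N} r rs (v : Vec ℕ N) →
              coeff (r ∷ rs) v ≈ ∑ (λ i → when (r ≤ᵇ lookup v i) (coeff rs (lower r i v))) (allFin N)
    coeff-∷ {N} r rs v = begin
      nat (powerCoeff (r ∷ rs) v)   ≈⟨ reflexive (≡.cong nat (powerCoeff-∷ r rs v)) ⟩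
      nat (sum (map (λ i → if r ≤ᵇ lookup v i then powerCoeff rs (lower r i v) else 0) (allFin N)))
        ≈⟨ nat-sum (λ i → if r ≤ᵇ lookup v i then powerCoeff rs (lower r i v) else 0) (allFin N) ⟩
      ∑ (λ i → nat (if r ≤ᵇ lookup v i then powerCoeff rs (lower r i v) else 0)) (allFin N)
        ≈⟨ ∑-cong (allFin N) nat-if ⟩
      ∑ (λ i → when (r ≤ᵇ lookup v i) (coeff rs (lower r i v))) (allFin N) ∎
      where
      nat-if : ∀ i → nat (if r ≤ᵇ lookup v i then powerCoeff rs (lower r i v) else 0) ≈
                     when (r ≤ᵇ lookup v i) (coeff rs (lower r i v))
      nat-if i with r ≤ᵇ lookup v i
      ... | true  = ≈.refl
      ... | false = nat-0

    -- Distinct variables do not interfere, and for a single variable both orders demand an exponent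
    -- of at least r + s.
    lower-swap : ∀ {N} r s (i j : Fin N) v (G : Vec ℕ N → Carrier) →
      when (r ≤ᵇ lookup v i) (when (s ≤ᵇ lookup (lower r i v) j) (G (lower s j (lower r i v)))) ≈
      when (s ≤ᵇ lookup v j) (when (r ≤ᵇ lookup (lower s j v) i) (G (lower r i (lower s j v))))
    lower-swap r s i j v G with i Fin.≟ j
    ... | no i≢j rewrite Vec.lookup∘updateAt′ j i {_∸ r} (i≢j ∘ ≡.sym) v | Vec.lookup∘updateAt′ i j {_∸ s} i≢j v
                       | Vec.updateAt-commutes i j {_∸ r} {_∸ s} i≢j v
      with r ≤ᵇ lookup v i | s ≤ᵇ lookup v j
    ...   | true  | true  = ≈.refl
    ...   | true  | false = ≈.refl
    ...   | false | true  = ≈.refl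
    ...   | false | false = ≈.refl
    lower-swap r s i j v G | yes ≡.refl
      rewrite Vec.lookup∘updateAt i {_∸ r} v | Vec.lookup∘updateAt i {_∸ s} v
      with r ℕ.+ s ℕ.≤? lookup v i
    ... | yes p rewrite ≤ᵇ-true (ℕ.≤-trans (ℕ.m≤m+n r s) p) | ≤ᵇ-true (ℕ.≤-trans (ℕ.m≤n+m s r) p)
                      | ≤ᵇ-true {s} {lookup v i ∸ r} (ℕ.m+n≤o⇒m≤o∸n s (≡.subst (_≤ lookup v i) (ℕ.+-comm r s) p))
                      | ≤ᵇ-true {r} {lookup v i ∸ s} (ℕ.m+n≤o⇒m≤o∸n r p) =
      reflexive (≡.cong G (≡.trans (Vec.updateAt-updateAt i v) (≡.trans
        (Vec.updateAt-cong i (λ x → ≡.trans (ℕ.∸-+-assoc x r s) (≡.trans (≡.cong (x ∸_) (ℕ.+-comm r s)) (≡.sym (ℕ.∸-+-assoc x s r)))) v)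
        (≡.sym (Vec.updateAt-updateAt i v)))))
    ... | no ¬p = ≈.trans (vanish r s (¬p)) (sym (vanish s r (¬p ∘ ≡.subst (_≤ lookup v i) (ℕ.+-comm s r))))
      where
      vanish : ∀ r s {x : Carrier} → ¬ (r ℕ.+ s ≤ lookup v i) → when (r ≤ᵇ lookup v i) (when (s ≤ᵇ lookup v i ∸ r) x) ≈ 0#
      vanish r s ¬p with r ≤ᵇ lookup v i in e
      ... | false = ≈.refl
      ... | true with s ≤ᵇ lookup v i ∸ r in e′
      ...   | false = ≈.refl
      ...   | true  = contradiction (≡.subst (r ℕ.+ s ≤_) (ℕ.m+[n∸m]≡n (≤ᵇ⇒≤ {r} e)) (ℕ.+-monoʳ-≤ r (≤ᵇ⇒≤ {s} e′))) ¬p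

    coeff-swap : ∀ {N} r s rs (v : Vec ℕ N) → coeff (r ∷ s ∷ rs) v ≈ coeff (s ∷ r ∷ rs) v
    coeff-swap {N} r s rs v = begin
      coeff (r ∷ s ∷ rs) v     ≈⟨ twice r s ⟩
      ∑ (λ i → ∑ (λ j → when (r ≤ᵇ lookup v i) (when (s ≤ᵇ lookup (lower r i v) j) (coeff rs (lower s j (lower r i v))))) (allFin N)) (allFin N)
        ≈⟨ ∑-swap _ (allFin N) (allFin N) ⟩
      ∑ (λ j → ∑ (λ i → when (r ≤ᵇ lookup v i) (when (s ≤ᵇ lookup (lower r i v) j) (coeff rs (lower s j (lower r i v))))) (allFin N)) (allFin N)
        ≈⟨ ∑-cong (allFin N) (λ j → ∑-cong (allFin N) λ i → lower-swap r s i j v (coeff rs)) ⟩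
      ∑ (λ j → ∑ (λ i → when (s ≤ᵇ lookup v j) (when (r ≤ᵇ lookup (lower s j v) i) (coeff rs (lower r i (lower s j v))))) (allFin N)) (allFin N)
        ≈⟨ twice s r ⟨
      coeff (s ∷ r ∷ rs) v     ∎
      where
      twice : ∀ r s → coeff (r ∷ s ∷ rs) v ≈
        ∑ (λ i → ∑ (λ j → when (r ≤ᵇ lookup v i) (when (s ≤ᵇ lookup (lower r i v) j) (coeff rs (lower s j (lower r i v))))) (allFin N)) (allFin N)
      twice r s = ≈.trans (coeff-∷ r (s ∷ rs) v) (∑-cong (allFin N) λ i →
        ≈.trans (when-cong (r ≤ᵇ lookup v i) λ _ → coeff-∷ s rs (lower r i v)) (when-∑ (r ≤ᵇ lookup v i) _ (allFin N)))

    coeff-↭ : ∀ {N rs ss} (v : Vec ℕ N) → rs ↭ ss → coeff rs v ≈ coeff ss v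
    coeff-↭ v refl = ≈.refl
    coeff-↭ {N} v (prep {xs = rs} {ys = ss} r p) = ≈.trans (coeff-∷ r rs v) (≈.trans
      (∑-cong (allFin N) λ i → when-cong (r ≤ᵇ lookup v i) λ _ → coeff-↭ (lower r i v) p) (sym (coeff-∷ r ss v)))
    coeff-↭ {N} v (swap {xs = rs} {ys = ss} r s p) = ≈.trans (coeff-swap r s rs v) (≈.trans (coeff-∷ s (r ∷ rs) v) (≈.trans
      (∑-cong (allFin N) λ i → when-cong (s ≤ᵇ lookup v i) λ _ → ≈.trans (coeff-∷ r rs (lower s i v)) (≈.trans
        (∑-cong (allFin N) λ j → when-cong (r ≤ᵇ lookup (lower s i v) j) λ _ → coeff-↭ (lower r j (lower s i v)) p)
        (sym (coeff-∷ r ss (lower s i v))))) (sym (coeff-∷ s (r ∷ ss) v))))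
    coeff-↭ v (trans p q) = ≈.trans (coeff-↭ v p) (coeff-↭ v q)

    term : ∀ {N n} → Partition n → Vec ℕ N → Carrier
    term ν v = (a ^ ℓ ν * nat (z ν) ⁻¹) * coeff (parts ν) v

    -- The coefficients of h_n[aX] = Σ_ν a^{ℓ(ν)} z_ν⁻¹ p_ν.
    Q : ∀ {N} → ℕ → Vec ℕ N → Carrier
    Q n v = ∑ (λ ν → term ν v) (partitions n)

    -- The coefficient at `v` of the product of p_r with the function whose coefficients are `G r`.
    lowered : ∀ {N} → Vec ℕ N → (ℕ → Vec ℕ N → Carrier) → ℕ → Carrier
    lowered {N} v G r = ∑ (λ i → when (r ≤ᵇ lookup v i) (G r (lower r i v))) (allFin N)

    -- The weight r m_r cancels against the factors that the additional part r brings to z; what is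
    -- left of that part is a factor `a` and a factor p_r.
    term-insert : ∀ {N m n} r (e : suc r ℕ.+ m ≡ n) (ν : Partition m) (v : Vec ℕ N) →
      nat (suc r ℕ.* mult (suc r) (insert (suc r) (parts ν))) * term (insertP (suc r) e (s≤s z≤n) ν) v ≈
      a * lowered v (λ _ → term ν) (suc r)
    term-insert {N} {m} {n} r e ν v = begin
      nat w * ((a ^ ℓ ν⁺ * nat (z ν⁺) ⁻¹) * coeff (parts ν⁺) v)
        ≈⟨ *-congˡ (*-cong (*-cong (reflexive (≡.cong (a ^_) (length-insert (suc r) (parts ν))))
             (⁻¹-cong (nat≉0 (zee-pos n (parts ν⁺))) (≈.trans (reflexive (≡.cong nat (z-insertP r e ν))) (nat-* w (z ν)))))
             (coeff-↭ v (insert-↭ (suc r) (parts ν)))) ⟩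
      nat w * (((a * a ^ ℓ ν) * (nat w * nat (z ν)) ⁻¹) * coeff (suc r ∷ parts ν) v)
        ≈⟨ solve 5 (λ w a A I C → w :* (((a :* A) :* I) :* C) := a :* ((A :* (w :* I)) :* C)) ≈.refl
             (nat w) a (a ^ ℓ ν) ((nat w * nat (z ν)) ⁻¹) (coeff (suc r ∷ parts ν) v) ⟩
      a * ((a ^ ℓ ν * (nat w * (nat w * nat (z ν)) ⁻¹)) * coeff (suc r ∷ parts ν) v)
        ≈⟨ *-congˡ (*-cong (*-congˡ (*-⁻¹ (nat≉0 w>0) (nat≉0 (zee-pos m (parts ν))))) (coeff-∷ (suc r) (parts ν) v)) ⟩
      a * ((a ^ ℓ ν * nat (z ν) ⁻¹) * lowered v (λ _ → coeff (parts ν)) (suc r))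
        ≈⟨ *-congˡ (≈.trans (sym (∑-*ˡ _ _ (allFin N))) (∑-cong (allFin N) λ i → *-when _ (suc r ≤ᵇ lookup v i) _)) ⟩
      a * lowered v (λ _ → term ν) (suc r) ∎
      where
      ν⁺ = insertP (suc r) e (s≤s z≤n) ν
      w = suc r ℕ.* mult (suc r) (insert (suc r) (parts ν))
      w>0 : 0 < w
      w>0 = ≡.subst (λ k → 0 < suc r ℕ.* k) (≡.sym (mult-insert-≡ (suc r) (parts ν))) (s≤s z≤n)

    -- Writing n as Σ r m_r(ν) and taking one part r off ν gives n h_n[aX] = a Σ_r p_r h_{n-r}[aX].
    Q-newton : ∀ {N} n (v : Vec ℕ N) → nat n * Q n v ≈ a * ∑ (lowered v (λ r → Q (n ∸ r))) (applyUpTo suc n)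
    Q-newton {N} n v = begin
      nat n * ∑ (λ ν → term ν v) (partitions n)
        ≈⟨ ∑-*ˡ (nat n) (λ ν → term ν v) (partitions n) ⟨
      ∑ (λ ν → nat n * term ν v) (partitions n)
        ≈⟨ ∑-cong (partitions n) (λ ν → ≈.trans (*-congʳ (nat-n ν)) (sym (∑-*ʳ (term ν v) _ rs))) ⟩
      ∑ (λ ν → ∑ (λ r → nat (r ℕ.* mult r (parts ν)) * term ν v) rs) (partitions n)
        ≈⟨ ∑-swap _ (partitions n) rs ⟩
      ∑ (λ r → ∑ (λ ν → nat (r ℕ.* mult r (parts ν)) * term ν v) (partitions n)) rs
        ≈⟨ ∑-cong-∈ rs (λ r∈ → let (i , i<n , r≡) = ∈-applyUpTo⁻ suc r∈ in
             ≡.subst (λ r → ∑ (λ ν → nat (r ℕ.* mult r (parts ν)) * term ν v) (partitions n) ≈ a * lowered v (λ r → Q (n ∸ r)) r)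
               (≡.sym r≡) (part i i<n)) ⟩
      ∑ (λ r → a * lowered v (λ r → Q (n ∸ r)) r) rs
        ≈⟨ ∑-*ˡ a _ rs ⟩
      a * ∑ (lowered v (λ r → Q (n ∸ r))) rs ∎
      where
      rs = applyUpTo suc n
      nat-n : ∀ (ν : Partition n) → nat n ≈ ∑ (λ r → nat (r ℕ.* mult r (parts ν))) rs
      nat-n ν = ≈.trans (reflexive (≡.cong nat (≡.sym (≡.trans
          (sum-mult n (parts ν) (positive ν) (All.map (λ p → ℕ.≤-trans p (ℕ.≤-reflexive (sum≡n ν))) (≤sum (parts ν)))) (sum≡n ν)))))
        (nat-sum (λ r → r ℕ.* mult r (parts ν)) rs)
      part : ∀ i → i < n → ∑ (λ ν → nat (suc i ℕ.* mult (suc i) (parts ν)) * term ν v) (partitions n) ≈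
                           a * lowered v (λ r → Q (n ∸ r)) (suc i)
      part i i<n = begin
        ∑ φ (partitions n)
          -- Partitions without the part `suc i` have multiplicity 0 and drop out; the others arise
          -- from insertion.
          ≈⟨ ∑-filter (has? (suc i)) φ (partitions n) (λ {ν} _ r∉ → ≈.trans
               (*-congʳ (≈.trans (reflexive (≡.cong nat (≡.trans (≡.cong (suc i ℕ.*_) (mult≡0 ν r∉)) (ℕ.*-zeroʳ (suc i))))) nat-0)) (zeroˡ _)) ⟩
        ∑ φ (filter (has? (suc i)) (partitions n))
          ≈⟨ ∑-↭ φ (insertP-↭ (suc i) e (s≤s z≤n)) ⟩
        ∑ φ (map (insertP (suc i) e (s≤s z≤n)) (partitions m))
          ≈⟨ reflexive (∑-map φ (insertP (suc i) e (s≤s z≤n)) (partitions m)) ⟩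
        ∑ (λ ν → φ (insertP (suc i) e (s≤s z≤n) ν)) (partitions m)
          ≈⟨ ∑-cong (partitions m) (λ ν → term-insert i e ν v) ⟩
        ∑ (λ ν → a * lowered v (λ _ → term ν) (suc i)) (partitions m)
          ≈⟨ ∑-*ˡ a _ (partitions m) ⟩
        a * ∑ (λ ν → lowered v (λ _ → term ν) (suc i)) (partitions m)
          ≈⟨ *-congˡ (≈.trans (∑-swap _ (partitions m) (allFin N)) (∑-cong (allFin N) λ j →
               sym (when-∑ (suc i ≤ᵇ lookup v j) (λ ν → term ν (lower (suc i) j v)) (partitions m)))) ⟩
        a * lowered v (λ r → Q (n ∸ r)) (suc i) ∎
        where
        m = n ∸ suc i
        e : suc i ℕ.+ m ≡ n
        e = ℕ.m+[n∸m]≡n i<n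
        φ : Partition n → Carrier
        φ ν = nat (suc i ℕ.* mult (suc i) (parts ν)) * term ν v
        mult≡0 : ∀ (ν : Partition n) → ¬ (suc i ∈ parts ν) → mult (suc i) (parts ν) ≡ 0
        mult≡0 ν r∉ with mult (suc i) (parts ν) ℕ.≟ 0
        ... | yes e′ = e′
        ... | no ne  = contradiction (mult⇒∈ (suc i) (parts ν) ne) r∉

    -- The binomial coefficient of a + m − 1 over m.
    h : ℕ → Carrier
    h zero    = 1#
    h (suc m) = h m * ((a + nat m) * nat (suc m) ⁻¹)

    H : ∀ {N} → Vec ℕ N → Carrier
    H []      = 1#
    H (x ∷ v) = h x * H v

    -- Comes from (x + 1) h(x + 1) = (a + x) h(x). The sum runs to a bound `n` independent of x, so
    -- that the sums for several variables can be added.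
    h-newton : ∀ n x → x ≤ n → nat x * h x ≈ a * ∑ (λ r → when (r ≤ᵇ x) (h (x ∸ r))) (applyUpTo suc n)
    h-newton n zero x≤n = begin
      nat 0 * 1#   ≈⟨ ≈.trans (*-identityʳ _) nat-0 ⟩
      0#           ≈⟨ zeroʳ a ⟨
      a * 0#       ≈⟨ *-congˡ (∑-zero (applyUpTo suc n) (λ r∈ → none r∈)) ⟨
      a * ∑ (λ r → when (r ≤ᵇ 0) (h (0 ∸ r))) (applyUpTo suc n) ∎
      where
      none : ∀ {r} → r ∈ applyUpTo suc n → when (r ≤ᵇ 0) (h (0 ∸ r)) ≈ 0#
      none r∈ with _ , _ , ≡.refl ← ∈-applyUpTo⁻ suc r∈ = ≈.refl
    h-newton (suc n) (suc x) (s≤s x≤n) = begin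
      nat (suc x) * (h x * ((a + nat x) * nat (suc x) ⁻¹))
        ≈⟨ solve 5 (λ s h a x i → s :* (h :* ((a :+ x) :* i)) := (s :* i) :* (a :* h :+ x :* h)) ≈.refl
             (nat (suc x)) (h x) a (nat x) (nat (suc x) ⁻¹) ⟩
      (nat (suc x) * nat (suc x) ⁻¹) * (a * h x + nat x * h x)
        ≈⟨ ≈.trans (*-congʳ (inverseʳ (nat (suc x)) (nat≉0 (s≤s z≤n)))) (*-identityˡ _) ⟩
      a * h x + nat x * h x
        ≈⟨ +-congˡ (h-newton n x x≤n) ⟩
      a * h x + a * ∑ (λ r → when (r ≤ᵇ x) (h (x ∸ r))) (applyUpTo suc n)
        ≈⟨ distribˡ a _ _ ⟨
      a * (h x + ∑ (λ r → when (r ≤ᵇ x) (h (x ∸ r))) (applyUpTo suc n))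
        ≈⟨ *-congˡ (+-congˡ (shifted suc (λ i → ≡.refl) (applyUpTo suc n) λ r∈ → ∈-applyUpTo⁻ suc r∈)) ⟩
      a * (h x + ∑ (λ r → when (r ≤ᵇ suc x) (h (suc x ∸ r))) (map suc (applyUpTo suc n)))
        ≈⟨ *-congˡ (+-congˡ (reflexive (≡.cong (∑ _) (List.map-applyUpTo suc suc n)))) ⟩
      a * ∑ (λ r → when (r ≤ᵇ suc x) (h (suc x ∸ r))) (applyUpTo suc (suc n)) ∎
      where
      shifted : ∀ (f : ℕ → ℕ) → (∀ i → f i ≡ suc i) → ∀ rs → (∀ {r} → r ∈ rs → ∃ λ i → i < n × r ≡ suc i) →
                ∑ (λ r → when (r ≤ᵇ x) (h (x ∸ r))) rs ≈ ∑ (λ r → when (r ≤ᵇ suc x) (h (suc x ∸ r))) (map suc rs)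
      shifted f e []       s = ≈.refl
      shifted f e (r ∷ rs) s with _ , _ , ≡.refl ← s (here ≡.refl) = +-congˡ (shifted f e rs (s ∘ there))

    -- A Leibniz rule: the identity for each single variable is multiplied by the factors of the
    -- other variables.
    H-newton : ∀ {N} n (v : Vec ℕ N) → Vec.sum v ≤ n →
               nat (Vec.sum v) * H v ≈ a * ∑ (lowered v (λ _ → H)) (applyUpTo suc n)
    H-newton n [] s≤n = begin
      nat 0 * 1#                          ≈⟨ ≈.trans (*-identityʳ _) nat-0 ⟩
      0#                                  ≈⟨ zeroʳ a ⟨
      a * 0#                              ≈⟨ *-congˡ (∑-0 (applyUpTo suc n)) ⟨
      a * ∑ (λ _ → 0#) (applyUpTo suc n)  ∎
    H-newton {suc N} n (x ∷ v) s≤n = begin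
      nat (x ℕ.+ Vec.sum v) * (h x * H v)
        ≈⟨ *-congʳ (nat-+ x (Vec.sum v)) ⟩
      (nat x + nat (Vec.sum v)) * (h x * H v)
        ≈⟨ solve 4 (λ x s h H → (x :+ s) :* (h :* H) := (x :* h) :* H :+ h :* (s :* H)) ≈.refl (nat x) (nat (Vec.sum v)) (h x) (H v) ⟩
      (nat x * h x) * H v + h x * (nat (Vec.sum v) * H v)
        ≈⟨ +-cong (*-congʳ (h-newton n x (ℕ.≤-trans (ℕ.m≤m+n x _) s≤n))) (*-congˡ (H-newton n v (ℕ.≤-trans (ℕ.m≤n+m _ x) s≤n))) ⟩
      (a * ∑ f rs) * H v + h x * (a * ∑ g rs)
        ≈⟨ solve 5 (λ a f H h g → (a :* f) :* H :+ h :* (a :* g) := a :* (f :* H :+ h :* g)) ≈.refl a (∑ f rs) (H v) (h x) (∑ g rs) ⟩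
      a * (∑ f rs * H v + h x * ∑ g rs)
        ≈⟨ *-congˡ (≈.trans (+-cong (sym (∑-*ʳ (H v) f rs)) (sym (∑-*ˡ (h x) g rs))) (sym (∑-+ _ _ rs))) ⟩
      a * ∑ (λ r → f r * H v + h x * g r) rs
        ≈⟨ *-congˡ (∑-cong rs split) ⟨
      a * ∑ (lowered (x ∷ v) (λ _ → H)) rs ∎
      where
      rs = applyUpTo suc n
      f g : ℕ → Carrier
      f r = when (r ≤ᵇ x) (h (x ∸ r))
      g = lowered v (λ _ → H)
      split : ∀ r → lowered (x ∷ v) (λ _ → H) r ≈ f r * H v + h x * g r
      split r = begin
        ∑ G (allFin (suc N))
          ≈⟨ reflexive (≡.cong (∑ G) (allFin-suc N)) ⟩
        G Fin.zero + ∑ G (map Fin.suc (allFin N))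
          ≈⟨ +-cong (first (r ≤ᵇ x)) (≈.trans (reflexive (∑-map G Fin.suc (allFin N))) (≈.trans
               (∑-cong (allFin N) λ i → sym (*-when (h x) (r ≤ᵇ lookup v i) _)) (∑-*ˡ (h x) _ (allFin N)))) ⟩
        f r * H v + h x * g r ∎
        where
        G : Fin (suc N) → Carrier
        G i = when (r ≤ᵇ lookup (x ∷ v) i) (H (lower r i (x ∷ v)))
        first : ∀ b → when b (h (x ∸ r) * H v) ≈ when b (h (x ∸ r)) * H v
        first true  = ≈.refl
        first false = sym (zeroˡ _)

    sum-lower : ∀ {N} r (i : Fin N) v → r ≤ lookup v i → Vec.sum (lower r i v) ≡ Vec.sum v ∸ r
    sum-lower r Fin.zero    (x ∷ v) p = ≡.sym (ℕ.+-∸-comm (Vec.sum v) p)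
    sum-lower r (Fin.suc i) (x ∷ v) p = ≡.trans (≡.cong (x ℕ.+_) (sum-lower r i v p))
      (≡.sym (ℕ.+-∸-assoc x (ℕ.≤-trans p (lookup≤sum i v))))
      where
      lookup≤sum : ∀ {N} (i : Fin N) v → lookup v i ≤ Vec.sum v
      lookup≤sum Fin.zero    (x ∷ v) = ℕ.m≤m+n x _
      lookup≤sum (Fin.suc i) (x ∷ v) = ℕ.≤-trans (lookup≤sum i v) (ℕ.m≤n+m _ x)

    H-zeros : ∀ {N} (v : Vec ℕ N) → Vec.sum v ≡ 0 → v ≡ Vec.replicate N 0 × H v ≈ 1#
    H-zeros []         e = ≡.refl , ≈.refl
    H-zeros (zero ∷ v) e with e′ , p ← H-zeros v e = ≡.cong (0 ∷_) e′ , ≈.trans (*-identityˡ _) p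

    nothing : Partition 0
    nothing = record { parts = [] ; positive = [] ; sorted = Data.List.Relation.Unary.Linked.[] ; sum≡n = ≡.refl }
      where import Data.List.Relation.Unary.Linked

    Q-0 : ∀ {N} (v : Vec ℕ N) → Vec.sum v ≡ 0 → Q 0 v ≈ H v
    Q-0 {N} v e with v≡ , H≈1 ← H-zeros v e = begin
      Q 0 v
        ≈⟨ ∑-single (λ ν → term ν v) (unique-partitions 0) (∈-partitions nothing) (λ {ν} _ ne → contradiction (only ν) ne) ⟩
      (1# * nat 1 ⁻¹) * nat (powerCoeff [] v)
        ≈⟨ *-cong (≈.trans (*-identityˡ _) (⁻¹-cong (nat≉0 (s≤s z≤n)) nat-1))
             (≈.trans (reflexive (≡.cong nat (≡.trans (≡.cong (powerCoeff []) v≡) (powerCoeff-zeros N)))) nat-1) ⟩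
      1# ⁻¹ * 1#   ≈⟨ ≈.trans (*-comm _ _) (inverseʳ 1# (λ e → nat≉0 {1} (s≤s z≤n) (≈.trans nat-1 e))) ⟩
      1#           ≈⟨ H≈1 ⟨
      H v          ∎
      where
      only : ∀ ν → nothing ≡ ν
      only ν = Fillings.Partition-≡ (go (parts ν) (positive ν) (sum≡n ν))
        where
        go : ∀ ps → All (0 <_) ps → sum ps ≡ 0 → [] ≡ ps
        go []           _ _ = ≡.refl
        go (suc p ∷ ps) _ ()
        go (zero ∷ ps)  (() ∷ _) _

    -- Both sides satisfy Newton's recursion, which determines them because every n ≥ 1 is
    -- invertible.
    Q≈H : ∀ n {N} (v : Vec ℕ N) → Vec.sum v ≡ n → Q n v ≈ H v
    Q≈H = <-rec (λ n → ∀ {N} (v : Vec ℕ N) → Vec.sum v ≡ n → Q n v ≈ H v) step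
      where
      step : ∀ n → (∀ {m} → m < n → ∀ {N} (v : Vec ℕ N) → Vec.sum v ≡ m → Q m v ≈ H v) →
             ∀ {N} (v : Vec ℕ N) → Vec.sum v ≡ n → Q n v ≈ H v
      step zero    rec v e = Q-0 v e
      step (suc n) rec {N} v e = cancelˡ (nat≉0 {suc n} (s≤s z≤n)) (begin
        nat (suc n) * Q (suc n) v
          ≈⟨ Q-newton (suc n) v ⟩
        a * ∑ (lowered v (λ r → Q (suc n ∸ r))) (applyUpTo suc (suc n))
          ≈⟨ *-congˡ (∑-cong-∈ (applyUpTo suc (suc n)) λ {r} r∈ → ∑-cong (allFin N) λ i → when-cong (r ≤ᵇ lookup v i) λ r≤ →
               smaller r∈ i (≤ᵇ⇒≤ {r} r≤)) ⟩
        a * ∑ (lowered v (λ _ → H)) (applyUpTo suc (suc n))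
          ≈⟨ H-newton (suc n) v (ℕ.≤-reflexive e) ⟨
        nat (Vec.sum v) * H v
          ≈⟨ *-congʳ (reflexive (≡.cong nat e)) ⟩
        nat (suc n) * H v ∎)
        where
        smaller : ∀ {r} → r ∈ applyUpTo suc (suc n) → ∀ i → r ≤ lookup v i → Q (suc n ∸ r) (lower r i v) ≈ H (lower r i v)
        smaller r∈ i r≤ with j , _ , ≡.refl ← ∈-applyUpTo⁻ suc r∈ =
          rec (s≤s (ℕ.m∸n≤m n j)) (lower (suc j) i v) (≡.trans (sum-lower (suc j) i v r≤) (≡.cong (_∸ suc j) e))

-- Orthogonality and the one-row Jack function

module Jack where

  open import Defs using (Partition; parts; positive; sum≡n; ℓ; _⊴_; row; ones)
  open import Data.List.Base using (List; []; _∷_; take)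
  import Data.List.Properties as List
  open import Data.List.Membership.Propositional using (_∈_)
  open import Data.List.Relation.Unary.All as All using (All; []; _∷_)
  open import Data.List.Relation.Unary.Any using (here; there)
  open import Data.Nat.Base as ℕ using (ℕ; zero; suc; _≤_; _<_; z≤n; NonZero)
  open import Data.Nat.Induction using (<-rec)
  open import Data.Nat.ListAction using (sum)
  import Data.Nat.Properties as ℕ
  open import Data.Product.Base using (_×_; _,_; proj₁; proj₂; ∃)
  open import Data.Sum.Base using (_⊎_; inj₁; inj₂)
  open import Function.Base using (_∘_)
  open import Relation.Binary.PropositionalEquality as ≡ using (_≡_; _≢_)
  open import Relation.Nullary using (¬_; yes; no; contradiction; Dec)
  open Fillings using (Partition-≡; ℓ≤)
  open Descents using (Σ<)
  open Enumerate using (partitions; ∈-partitions; unique-partitions)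
  open PowerSums
  open Newton

  _≟P_ : ∀ {n} (μ ν : Partition n) → Dec (μ ≡ ν)
  μ ≟P ν with List.≡-dec ℕ._≟_ (parts μ) (parts ν)
  ... | yes e = yes (Partition-≡ e)
  ... | no  p = no (p ∘ ≡.cong parts)

  Σ<-mono : ∀ n {f g : ℕ → ℕ} → (∀ i → f i ≤ g i) → Σ< n f ≤ Σ< n g
  Σ<-mono zero    e = z≤n
  Σ<-mono (suc n) e = ℕ.+-mono-≤ (Σ<-mono n e) (e n)

  Σ<-mono-≡ : ∀ n {f g : ℕ → ℕ} → (∀ i → f i ≤ g i) → Σ< n f ≡ Σ< n g → ∀ i → i < n → f i ≡ g i
  Σ<-mono-≡ (suc n) {f} {g} e eq i i<n with ℕ.m≤n⇒m<n∨m≡n (ℕ.s≤s⁻¹ i<n)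
  ... | inj₁ i<n′ = Σ<-mono-≡ n e (ℕ.≤-antisym (Σ<-mono n e)
    (ℕ.+-cancelʳ-≤ (g n) _ _ (ℕ.≤-trans (ℕ.≤-reflexive (≡.sym eq)) (ℕ.+-monoʳ-≤ (Σ< n f) (e n))))) i i<n′
  ... | inj₂ ≡.refl = ℕ.≤-antisym (e i)
    (ℕ.+-cancelˡ-≤ (Σ< i g) _ _ (ℕ.≤-trans (ℕ.≤-reflexive (≡.sym eq)) (ℕ.+-monoˡ-≤ (f i) (Σ<-mono i e))))

  take-sums-injective : ∀ xs ys → All (0 <_) xs → All (0 <_) ys →
                        (∀ k → sum (take k xs) ≡ sum (take k ys)) → xs ≡ ys
  take-sums-injective []       []       _ _ e = ≡.refl
  take-sums-injective []       (y ∷ ys) _ (0<y ∷ _) e =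
    contradiction (≡.trans (e 1) (ℕ.+-identityʳ y)) (ℕ.<⇒≢ 0<y)
  take-sums-injective (x ∷ xs) []       (0<x ∷ _) _ e =
    contradiction (≡.sym (≡.trans (≡.sym (ℕ.+-identityʳ x)) (e 1))) (ℕ.<⇒≢ 0<x)
  take-sums-injective (x ∷ xs) (y ∷ ys) (_ ∷ p) (_ ∷ q) e
    with ≡.refl ← ≡.trans (≡.sym (ℕ.+-identityʳ x)) (≡.trans (e 1) (ℕ.+-identityʳ y)) =
    ≡.cong (x ∷_) (take-sums-injective xs ys p q λ k → ℕ.+-cancelˡ-≡ x _ _ (e (suc k)))

  -- Replaces the partial order of dominance by a natural number on which to do induction: the sum
  -- of all the partial sums that dominance compares.
  rank : ∀ {n} → Partition n → ℕ
  rank {n} μ = Σ< (suc n) (λ k → sum (take k (parts μ)))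

  ⊴⇒rank≤ : ∀ {n} (ν μ : Partition n) → ν ⊴ μ → rank ν ≤ rank μ
  ⊴⇒rank≤ {n} ν μ = Σ<-mono (suc n)

  -- Partial sums that are comparable termwise and have equal totals agree termwise; from the n-th
  -- on they are all n, and together they determine the parts.
  ⊴-rank-≡ : ∀ {n} (ν μ : Partition n) → ν ⊴ μ → rank ν ≡ rank μ → ν ≡ μ
  ⊴-rank-≡ {n} ν μ dom e = Partition-≡ (take-sums-injective (parts ν) (parts μ) (positive ν) (positive μ) go)
    where
    full : ∀ (κ : Partition n) k → n ≤ k → sum (take k (parts κ)) ≡ n
    full κ k n≤k = ≡.trans (≡.cong sum (List.take-all k (parts κ) (ℕ.≤-trans (ℓ≤ κ) n≤k))) (sum≡n κ)
    go : ∀ k → sum (take k (parts ν)) ≡ sum (take k (parts μ))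
    go k with k ℕ.<? suc n
    ... | yes k<n = Σ<-mono-≡ (suc n) dom e k k<n
    ... | no  k≮n = ≡.trans (full ν k (ℕ.<⇒≤ (ℕ.≮⇒≥ k≮n))) (≡.sym (full μ k (ℕ.<⇒≤ (ℕ.≮⇒≥ k≮n))))

  ⊴-row : ∀ n .{{_ : NonZero n}} (μ : Partition n) → μ ⊴ row n
  ⊴-row n μ zero    = z≤n
  ⊴-row n μ (suc k) = ℕ.≤-trans (take-sum (suc k) (parts μ)) (ℕ.≤-trans (ℕ.≤-reflexive (sum≡n μ)) (ℕ.m≤m+n n _))
    where
    take-sum : ∀ k xs → sum (take k xs) ≤ sum xs
    take-sum zero    xs       = z≤n
    take-sum (suc k) []       = z≤n
    take-sum (suc k) (x ∷ xs) = ℕ.+-monoʳ-≤ x (take-sum k xs)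

  record Form (𝔽 : OrderedField) (n : ℕ) : Set where
    open OrderedField 𝔽
    field
      form      : (Partition n → Carrier) → (Partition n → Carrier) → Carrier
      form-cong : ∀ {f f′ g g′} → (∀ μ → f μ ≈ f′ μ) → (∀ μ → g μ ≈ g′ μ) → form f g ≈ form f′ g′
      form-+ˡ   : ∀ f f′ g → form (λ μ → f μ + f′ μ) g ≈ form f g + form f′ g
      form-+ʳ   : ∀ f g g′ → form f (λ μ → g μ + g′ μ) ≈ form f g + form f g′
      form-*ˡ   : ∀ c f g → form (λ μ → c * f μ) g ≈ c * form f g
      form-*ʳ   : ∀ c f g → form f (λ μ → c * g μ) ≈ c * form f g

  module Orthogonal (𝔽 : OrderedField) {n : ℕ} (F : Form 𝔽 n) where
    open FieldLemmas 𝔽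
    open Form F

    V : Set
    V = Partition n → Carrier

    Ps : List (Partition n)
    Ps = partitions n

    form-0ˡ : ∀ {f} g → (∀ μ → f μ ≈ 0#) → form f g ≈ 0#
    form-0ˡ {f} g e = ≈.trans (form-cong {f} {λ μ → 0# * f μ} (λ μ → ≈.trans (e μ) (sym (zeroˡ _))) λ _ → ≈.refl)
      (≈.trans (form-*ˡ 0# f g) (zeroˡ _))

    form-0ʳ : ∀ f {g} → (∀ μ → g μ ≈ 0#) → form f g ≈ 0#
    form-0ʳ f {g} e = ≈.trans (form-cong {g = g} {λ μ → 0# * g μ} (λ _ → ≈.refl) (λ μ → ≈.trans (e μ) (sym (zeroˡ _))))
      (≈.trans (form-*ʳ 0# f g) (zeroˡ _))

    form-∑ˡ : ∀ {A : Set} (c : A → Carrier) (F : A → V) g xs →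
              form (λ μ → ∑ (λ x → c x * F x μ) xs) g ≈ ∑ (λ x → c x * form (F x) g) xs
    form-∑ˡ c F g []       = form-0ˡ g λ _ → ≈.refl
    form-∑ˡ c F g (x ∷ xs) = ≈.trans (form-+ˡ (λ μ → c x * F x μ) _ g) (+-cong (form-*ˡ (c x) (F x) g) (form-∑ˡ c F g xs))

    form-∑ʳ : ∀ {A : Set} (c : A → Carrier) f (G : A → V) xs →
              form f (λ μ → ∑ (λ x → c x * G x μ) xs) ≈ ∑ (λ x → c x * form f (G x)) xs
    form-∑ʳ c f G []       = form-0ʳ f λ _ → ≈.refl
    form-∑ʳ c f G (x ∷ xs) = ≈.trans (form-+ʳ f (λ μ → c x * G x μ) _) (+-cong (form-*ʳ (c x) f (G x)) (form-∑ʳ c f G xs))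

    ∑-at : ∀ (f : Partition n → Carrier) μ → (∀ ν → μ ≢ ν → f ν ≈ 0#) → ∑ f Ps ≈ f μ
    ∑-at f μ e = ∑-single f (unique-partitions n) (∈-partitions μ) λ {ν} _ → e ν

    m : Partition n → V
    m μ ν with μ ≟P ν
    ... | yes _ = 1#
    ... | no  _ = 0#

    m-same : ∀ μ → m μ μ ≈ 1#
    m-same μ with μ ≟P μ
    ... | yes _ = ≈.refl
    ... | no  p = contradiction ≡.refl p

    m-other : ∀ {μ ν} → μ ≢ ν → m μ ν ≈ 0#
    m-other {μ} {ν} p with μ ≟P ν
    ... | yes e = contradiction e p
    ... | no  _ = ≈.refl

    m-expansion : ∀ (f : V) ν → f ν ≈ ∑ (λ μ → f μ * m μ ν) Ps
    m-expansion f ν = sym (≈.trans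
      (∑-at (λ μ → f μ * m μ ν) ν (λ μ p → ≈.trans (*-congˡ (m-other (p ∘ ≡.sym))) (zeroʳ _)))
      (≈.trans (*-congˡ (m-same ν)) (*-identityʳ _)))

    p : Partition n → V
    p ν μ = nat (partCoeff ν μ)

    record Spanned (f : V) : Set where
      constructor spanned
      field
        coords : V
        combination : ∀ μ → f μ ≈ ∑ (λ ν → coords ν * p ν μ) Ps

    Spanned-0 : ∀ {f} → (∀ μ → f μ ≈ 0#) → Spanned f
    Spanned-0 e = spanned (λ _ → 0#) λ μ → ≈.trans (e μ) (sym (∑-zero Ps λ _ → zeroˡ _))

    Spanned-+ : ∀ {f g} → Spanned f → Spanned g → Spanned (λ μ → f μ + g μ)
    Spanned-+ (spanned c e) (spanned c′ e′) = spanned (λ ν → c ν + c′ ν) λ μ → ≈.trans (+-cong (e μ) (e′ μ))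
      (≈.trans (sym (∑-+ _ _ Ps)) (∑-cong Ps λ ν → sym (distribʳ (p ν μ) (c ν) (c′ ν))))

    Spanned-* : ∀ {f} k → Spanned f → Spanned (λ μ → k * f μ)
    Spanned-* k (spanned c e) = spanned (λ ν → k * c ν) λ μ → ≈.trans (*-congˡ (e μ))
      (≈.trans (sym (∑-*ˡ k _ Ps)) (∑-cong Ps λ ν → sym (*-assoc k (c ν) (p ν μ))))

    Spanned-∑ : ∀ {A : Set} (F : A → V) xs → (∀ x → Spanned (F x)) → Spanned (λ μ → ∑ (λ x → F x μ) xs)
    Spanned-∑ F []       s = Spanned-0 λ _ → ≈.refl
    Spanned-∑ F (x ∷ xs) s = Spanned-+ (s x) (Spanned-∑ F xs s)

    Spanned-resp : ∀ {f g} → (∀ μ → g μ ≈ f μ) → Spanned f → Spanned g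
    Spanned-resp e (spanned c e′) = spanned c λ μ → ≈.trans (e μ) (e′ μ)

    Spanned-p : ∀ ν → Spanned (p ν)
    Spanned-p ν = spanned (m ν) λ μ → sym (≈.trans
      (∑-at (λ κ → m ν κ * p κ μ) ν (λ κ q → ≈.trans (*-congʳ (m-other q)) (zeroˡ _)))
      (≈.trans (*-congʳ (m-same ν)) (*-identityˡ _)))

    -- Induction on the number of parts: p_μ is a nonzero multiple of m_μ plus a combination of m_ν
    -- with fewer parts.
    Spanned-m : ∀ μ → Spanned (m μ)
    Spanned-m μ = <-rec (λ k → ∀ μ → ℓ μ ≡ k → Spanned (m μ)) step (ℓ μ) μ ≡.refl
      where
      step : ∀ k → (∀ {j} → j < k → ∀ μ → ℓ μ ≡ j → Spanned (m μ)) → ∀ μ → ℓ μ ≡ k → Spanned (m μ)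
      step k rec μ ≡.refl = Spanned-resp solved (Spanned-* (R ⁻¹) (Spanned-+ (Spanned-p μ)
        (Spanned-* (- 1#) (Spanned-∑ (λ ν κ → c ν * m ν κ) Ps lowerTerm))))
        where
        R : Carrier
        R = nat (partCoeff μ μ)
        R≉0 : ¬ (R ≈ 0#)
        R≉0 = nat≉0 (powerCoeff-self (parts μ))
        c : Partition n → Carrier
        c ν with μ ≟P ν
        ... | yes _ = 0#
        ... | no  _ = p μ ν
        lowerTerm : ∀ ν → Spanned (λ κ → c ν * m ν κ)
        lowerTerm ν with μ ≟P ν
        ... | yes _ = Spanned-0 λ κ → zeroˡ _
        ... | no μ≢ν with partCoeff μ ν ℕ.≟ 0
        ...   | yes e = Spanned-0 λ κ → ≈.trans (*-congʳ (≈.trans (reflexive (≡.cong nat e)) nat-0)) (zeroˡ _)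
        ...   | no ne with le , eq ← partCoeff-support μ ν ne =
          Spanned-* (p μ ν) (rec (ℕ.≤∧≢⇒< le λ e → μ≢ν (Partition-≡ (≡.sym (eq e)))) ν ≡.refl)
        split : ∀ κ → p μ κ ≈ R * m μ κ + ∑ (λ ν → c ν * m ν κ) Ps
        split κ = begin
          p μ κ
            ≈⟨ m-expansion (p μ) κ ⟩
          ∑ (λ ν → p μ ν * m ν κ) Ps
            ≈⟨ ∑-cong Ps pieces ⟩
          ∑ (λ ν → m μ ν * (p μ ν * m ν κ) + c ν * m ν κ) Ps
            ≈⟨ ∑-+ _ _ Ps ⟩
          ∑ (λ ν → m μ ν * (p μ ν * m ν κ)) Ps + ∑ (λ ν → c ν * m ν κ) Ps
            ≈⟨ +-congʳ (≈.trans (∑-at (λ ν → m μ ν * (p μ ν * m ν κ)) μ (λ ν q → ≈.trans (*-congʳ (m-other q)) (zeroˡ _)))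
                 (≈.trans (*-congʳ (m-same μ)) (*-identityˡ _))) ⟩
          R * m μ κ + ∑ (λ ν → c ν * m ν κ) Ps ∎
          where
          pieces : ∀ ν → p μ ν * m ν κ ≈ m μ ν * (p μ ν * m ν κ) + c ν * m ν κ
          pieces ν with μ ≟P ν
          ... | yes _ = sym (≈.trans (+-cong (*-identityˡ _) (zeroˡ _)) (+-identityʳ _))
          ... | no  _ = sym (≈.trans (+-congʳ (zeroˡ _)) (+-identityˡ _))
        solved : ∀ κ → m μ κ ≈ R ⁻¹ * (p μ κ + - 1# * ∑ (λ ν → c ν * m ν κ) Ps)
        solved κ = cancelˡ R≉0 (begin
          R * m μ κ
            ≈⟨ +-identityʳ _ ⟨
          R * m μ κ + 0#
            ≈⟨ +-congˡ (≈.trans (sym (zeroˡ r)) (*-congʳ (sym (-‿inverseʳ 1#)))) ⟩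
          R * m μ κ + (1# + - 1#) * r
            ≈⟨ solve 4 (λ x r o n → x :+ (o :+ n) :* r := (x :+ o :* r) :+ n :* r) ≈.refl (R * m μ κ) r 1# (- 1#) ⟩
          R * m μ κ + 1# * r + - 1# * r
            ≈⟨ +-congʳ (≈.trans (+-congˡ (*-identityˡ r)) (sym (split κ))) ⟩
          p μ κ + - 1# * r
            ≈⟨ *-identityˡ _ ⟨
          1# * (p μ κ + - 1# * r)
            ≈⟨ *-congʳ (inverseʳ R R≉0) ⟨
          R * R ⁻¹ * (p μ κ + - 1# * r)
            ≈⟨ *-assoc R (R ⁻¹) _ ⟩
          R * (R ⁻¹ * (p μ κ + - 1# * r)) ∎)
          where r = ∑ (λ ν → c ν * m ν κ) Ps

    abstract
      Spanned-all : ∀ f → Spanned f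
      Spanned-all f = Spanned-resp (m-expansion f) (Spanned-∑ (λ μ κ → f μ * m μ κ) Ps λ μ → Spanned-* (f μ) (Spanned-m μ))

    module _ (w : Partition n → Carrier) (w-pos : ∀ ν → Pos (w ν))
             (form-pp : ∀ ν → form (p ν) (p ν) ≈ w ν)
             (form-pq : ∀ {μ ν} → μ ≢ ν → form (p μ) (p ν) ≈ 0#) where

      -- By orthogonality of the power sums, pairing with p_ν isolates the coordinate at ν.
      form-p : ∀ {f} (s : Spanned f) ν → form (p ν) f ≈ Spanned.coords s ν * w ν
      form-p {f} (spanned c e) ν = begin
        form (p ν) f                                    ≈⟨ form-cong (λ _ → ≈.refl) e ⟩
        form (p ν) (λ μ → ∑ (λ κ → c κ * p κ μ) Ps)     ≈⟨ form-∑ʳ c (p ν) p Ps ⟩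
        ∑ (λ κ → c κ * form (p ν) (p κ)) Ps
          ≈⟨ ∑-at (λ κ → c κ * form (p ν) (p κ)) ν (λ κ q → ≈.trans (*-congˡ (form-pq q)) (zeroʳ _)) ⟩
        c ν * form (p ν) (p ν)                          ≈⟨ *-congˡ (form-pp ν) ⟩
        c ν * w ν                                       ∎

      NonNegative : Carrier → Set
      NonNegative x = Pos x ⊎ x ≈ 0#

      +-NonNegative : ∀ {x y} → NonNegative x → NonNegative y → NonNegative (x + y)
      +-NonNegative (inj₁ px) (inj₁ py) = inj₁ (Pos-+ px py)
      +-NonNegative (inj₁ px) (inj₂ y≈0) = inj₁ (Pos-resp (sym (≈.trans (+-congˡ y≈0) (+-identityʳ _))) px)
      +-NonNegative (inj₂ x≈0) (inj₁ py) = inj₁ (Pos-resp (sym (≈.trans (+-congʳ x≈0) (+-identityˡ _))) py)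
      +-NonNegative (inj₂ x≈0) (inj₂ y≈0) = inj₂ (≈.trans (+-cong x≈0 y≈0) (+-identityˡ _))

      +≈0⇒≈0 : ∀ {x y} → NonNegative x → NonNegative y → x + y ≈ 0# → x ≈ 0# × y ≈ 0#
      +≈0⇒≈0 (inj₂ x≈0) ny e = x≈0 , ≈.trans (sym (+-identityˡ _)) (≈.trans (+-congʳ (sym x≈0)) e)
      +≈0⇒≈0 (inj₁ px) (inj₁ py) e = contradiction e (Pos⇒≉0 (Pos-+ px py))
      +≈0⇒≈0 (inj₁ px) (inj₂ y≈0) e = ≈.trans (sym (+-identityʳ _)) (≈.trans (+-congˡ (sym y≈0)) e) , y≈0

      ∑-NonNegative : ∀ {A : Set} {f : A → Carrier} xs → (∀ x → NonNegative (f x)) → NonNegative (∑ f xs)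
      ∑-NonNegative []       nn = inj₂ ≈.refl
      ∑-NonNegative (x ∷ xs) nn = +-NonNegative (nn x) (∑-NonNegative xs nn)

      ∑≈0⇒≈0 : ∀ {A : Set} {f : A → Carrier} xs → (∀ x → NonNegative (f x)) → ∑ f xs ≈ 0# → ∀ {x} → x ∈ xs → f x ≈ 0#
      ∑≈0⇒≈0 (x ∷ xs) nn e (here ≡.refl) = proj₁ (+≈0⇒≈0 (nn x) (∑-NonNegative xs nn) e)
      ∑≈0⇒≈0 (x ∷ xs) nn e (there y∈)    = ∑≈0⇒≈0 xs nn (proj₂ (+≈0⇒≈0 (nn x) (∑-NonNegative xs nn) e)) y∈

      -- In power-sum coordinates the form is Σ c_ν² w_ν with positive weights, and a sum of
      -- nonnegative terms vanishes only termwise.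
      definite : ∀ f → form f f ≈ 0# → ∀ μ → f μ ≈ 0#
      definite f e μ = ≈.trans (f≈ μ) (∑-zero Ps λ {ν} _ → ≈.trans (*-congʳ (c≈0 ν)) (zeroˡ _))
        where
        s : Spanned f
        s = Spanned-all f
        open Spanned s renaming (coords to c; combination to f≈)
        norm : form f f ≈ ∑ (λ ν → c ν * (c ν * w ν)) Ps
        norm = ≈.trans (form-cong f≈ λ _ → ≈.refl) (≈.trans (form-∑ˡ c p f Ps) (∑-cong Ps λ ν → *-congˡ (form-p s ν)))
        nn : ∀ ν → NonNegative (c ν * (c ν * w ν))
        nn ν with ≈0? (c ν)
        ... | yes z = inj₂ (≈.trans (*-congʳ z) (zeroˡ _))
        ... | no nz = inj₁ (Pos-resp (*-assoc (c ν) (c ν) (w ν)) (Pos-* (Pos-sq nz) (w-pos ν)))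
        c≈0 : ∀ ν → c ν ≈ 0#
        c≈0 ν with ≈0? (c ν)
        ... | yes z = z
        ... | no nz = contradiction (noZeroDivisors nz (noZeroDivisors nz (∑≈0⇒≈0 Ps nn (≈.trans (sym norm) e) (∈-partitions ν))))
                        (Pos⇒≉0 (w-pos ν))

      module _ (J : Partition n → V)
               (orthogonal : ∀ {μ ν} → μ ≢ ν → form (J μ) (J ν) ≈ 0#)
               (triangular : ∀ μ ν → ¬ (ν ⊴ μ) → J μ ν ≈ 0#)
               (nonzero : ∀ μ → ¬ (J μ (ones n) ≈ 0#)) where

        -- By induction on the rank, m_μ lies in the span of the J_λ of at most its rank:
        -- otherwise J_μ would lie in the span of lower J_λ and be orthogonal to itself.
        m-orthogonal : ∀ μ (g : V) → (∀ κ → rank κ ≤ rank μ → form (J κ) g ≈ 0#) → form (m μ) g ≈ 0#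
        m-orthogonal μ = <-rec (λ k → ∀ μ → rank μ ≡ k → ∀ g → (∀ κ → rank κ ≤ rank μ → form (J κ) g ≈ 0#) → form (m μ) g ≈ 0#)
                           step (rank μ) μ ≡.refl
          where
          step : ∀ k → (∀ {j} → j < k → ∀ μ → rank μ ≡ j → ∀ g → (∀ κ → rank κ ≤ rank μ → form (J κ) g ≈ 0#) → form (m μ) g ≈ 0#) →
                 ∀ μ → rank μ ≡ k → ∀ g → (∀ κ → rank κ ≤ rank μ → form (J κ) g ≈ 0#) → form (m μ) g ≈ 0#
          step k rec μ ≡.refl g perp = noZeroDivisors diagonal (≈.trans (sym (leading g below)) (perp μ ℕ.≤-refl))
            where
            -- Apart from the term of m_μ itself, triangularity leaves only terms of smaller rank,
            -- which are orthogonal to `g`.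
            leading : ∀ g → (∀ ν → rank ν < rank μ → form (m ν) g ≈ 0#) → form (J μ) g ≈ J μ μ * form (m μ) g
            leading g low = begin
              form (J μ) g                                 ≈⟨ form-cong (m-expansion (J μ)) (λ _ → ≈.refl) ⟩
              form (λ κ → ∑ (λ ν → J μ ν * m ν κ) Ps) g    ≈⟨ form-∑ˡ (J μ) m g Ps ⟩
              ∑ (λ ν → J μ ν * form (m ν) g) Ps            ≈⟨ ∑-at (λ ν → J μ ν * form (m ν) g) μ others ⟩
              J μ μ * form (m μ) g                         ∎
              where
              others : ∀ ν → μ ≢ ν → J μ ν * form (m ν) g ≈ 0#
              others ν μ≢ν with rank ν ℕ.<? rank μ
              ... | yes lt = ≈.trans (*-congˡ (low ν lt)) (zeroʳ _)
              ... | no ¬lt = ≈.trans (*-congʳ (triangular μ ν λ dom →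
                      μ≢ν (≡.sym (⊴-rank-≡ ν μ dom (ℕ.≤-antisym (⊴⇒rank≤ ν μ dom) (ℕ.≮⇒≥ ¬lt)))))) (zeroˡ _)
            below : ∀ ν → rank ν < rank μ → form (m ν) g ≈ 0#
            below ν lt = rec lt ν ≡.refl g λ κ le → perp κ (ℕ.≤-trans le (ℕ.<⇒≤ lt))
            diagonal : ¬ (J μ μ ≈ 0#)
            diagonal e = nonzero μ (definite (J μ) (≈.trans
              (leading (J μ) λ ν lt → rec lt ν ≡.refl (J μ) λ κ le → orthogonal λ { ≡.refl → ℕ.<⇒≱ lt le })
              (≈.trans (*-congʳ e) (zeroˡ _))) (ones n))

        -- J_(n) is orthogonal to every m_μ except m_(n), and m_(n) has coefficient 1 in each p_ν.
        -- Hence all pairings of p_ν with J_(n) are equal to κ, and division by the norms gives the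
        -- coordinates.
        row-expansion : .{{_ : NonZero n}} → ∃ λ κ → ∀ μ → J (row n) μ ≈ κ * ∑ (λ ν → w ν ⁻¹ * p ν μ) Ps
        row-expansion = κ , λ μ → begin
          J (row n) μ                          ≈⟨ J≈ μ ⟩
          ∑ (λ ν → c ν * p ν μ) Ps             ≈⟨ ∑-cong Ps (λ ν → *-congʳ (c≈ ν)) ⟩
          ∑ (λ ν → (κ * w ν ⁻¹) * p ν μ) Ps    ≈⟨ ∑-cong Ps (λ ν → *-assoc κ (w ν ⁻¹) (p ν μ)) ⟩
          ∑ (λ ν → κ * (w ν ⁻¹ * p ν μ)) Ps    ≈⟨ ∑-*ˡ κ _ Ps ⟩
          κ * ∑ (λ ν → w ν ⁻¹ * p ν μ) Ps      ∎
          where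
          κ : Carrier
          κ = form (m (row n)) (J (row n))
          s : Spanned (J (row n))
          s = Spanned-all (J (row n))
          open Spanned s renaming (coords to c; combination to J≈)
          others : ∀ μ → row n ≢ μ → form (m μ) (J (row n)) ≈ 0#
          others μ row≢μ = m-orthogonal μ (J (row n)) λ κ le → orthogonal λ { ≡.refl →
            row≢μ (≡.sym (⊴-rank-≡ μ (row n) (⊴-row n μ) (ℕ.≤-antisym (⊴⇒rank≤ μ (row n) (⊴-row n μ)) le))) }
          p-J : ∀ ν → form (p ν) (J (row n)) ≈ κ
          p-J ν = begin
            form (p ν) (J (row n))
              ≈⟨ form-cong (m-expansion (p ν)) (λ _ → ≈.refl) ⟩
            form (λ κ → ∑ (λ μ → p ν μ * m μ κ) Ps) (J (row n))
              ≈⟨ form-∑ˡ (p ν) m (J (row n)) Ps ⟩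
            ∑ (λ μ → p ν μ * form (m μ) (J (row n))) Ps
              ≈⟨ ∑-at _ (row n) (λ μ q → ≈.trans (*-congˡ (others μ q)) (zeroʳ _)) ⟩
            p ν (row n) * κ
              ≈⟨ *-congʳ (≈.trans (reflexive (≡.cong nat (powerCoeff-row (parts ν) n (sum≡n ν)))) nat-1) ⟩
            1# * κ
              ≈⟨ *-identityˡ κ ⟩
            κ ∎
          c≈ : ∀ ν → c ν ≈ κ * w ν ⁻¹
          c≈ ν = cancelˡ (Pos⇒≉0 (w-pos ν)) (begin
            w ν * c ν           ≈⟨ *-comm (w ν) (c ν) ⟩
            c ν * w ν           ≈⟨ form-p s ν ⟨
            form (p ν) (J (row n)) ≈⟨ p-J ν ⟩
            κ                   ≈⟨ *-identityʳ κ ⟨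
            κ * 1#              ≈⟨ *-congˡ (inverseʳ (w ν) (Pos⇒≉0 (w-pos ν))) ⟨
            κ * (w ν * w ν ⁻¹)  ≈⟨ solve 3 (λ k w i → k :* (w :* i) := w :* (k :* i)) ≈.refl κ (w ν) (w ν ⁻¹) ⟩
            w ν * (κ * w ν ⁻¹)  ∎)

-- Substituting 1/α

module Inversion where

  open import Defs using (Poly; coeffₚ; _≈ₚ_; _+ₚ_; _*ₚ_; NonZeroₚ; ℚ⟨α⟩; num; den; den≢0; const; α; evalₚ; _[1/α]; fromℕ)
  import Defs as D
  open import Algebra.Bundles using (CommutativeRing)
  open import Data.List.Base using (List; []; _∷_; _++_; length)
  import Data.List.Properties as List
  open import Data.List.Relation.Unary.Any using (Any; here; there)
  import Data.List.Relation.Unary.Any.Properties as Any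
  open import Data.Nat.Base as ℕ using (ℕ; zero; suc)
  import Data.Nat.Properties as ℕ
  open import Data.Rational.Base as ℚ using (ℚ; 0ℚ; 1ℚ)
  import Data.Rational.Properties as ℚ
  open import Data.Vec.Base as Vec using (Vec; []; _∷_)
  open import Relation.Binary.PropositionalEquality as ≡ using (_≡_)
  open import Relation.Nullary using (¬_)
  open PolyRing
  open FracField using (≈-trans; ≈-refl; ≈-sym; ι; ι-cong; ι-injective; ι-+; ι-*; module P; K; const-+; const-*)
  open Scalars
  open Specialise
  open Newton

  ≈-reflexive : ∀ {f g} → f ≡ g → f D.≈ g
  ≈-reflexive {f} ≡.refl = ≈-refl {f}

  𝕂 : OrderedField
  𝕂 = record
    { ring = K
    ; _⁻¹ = D._⁻¹
    ; inverseʳ = FracField.inverseʳ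
    ; ≈0? = FracField.≈0?
    ; nat = fromℕ
    ; nat-0 = ≈-refl {D.0#}
    ; nat-1 = ≈-refl {D.1#}
    ; nat-+ = λ m n → ≈-trans {fromℕ (m ℕ.+ n)} {const (ℕ→ℚ m ℚ.+ ℕ→ℚ n)} {fromℕ m D.+ fromℕ n}
        (≈-reflexive (≡.cong const (ℕ→ℚ-+ m n))) (const-+ (ℕ→ℚ m) (ℕ→ℚ n))
    ; nat-* = λ m n → ≈-trans {fromℕ (m ℕ.* n)} {const (ℕ→ℚ m ℚ.* ℕ→ℚ n)} {fromℕ m D.* fromℕ n}
        (≈-reflexive (≡.cong const (ℕ→ℚ-* m n))) (const-* (ℕ→ℚ m) (ℕ→ℚ n))
    ; Pos = FracField.Pos
    ; Pos-resp = λ {f} {g} → FracField.Pos-resp f g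
    ; Pos-+ = λ {f} {g} → FracField.Pos-+ f g
    ; Pos-* = λ {f} {g} → FracField.Pos-* f g
    ; Pos-sq = λ {f} → FracField.Pos-sq f
    ; Pos⇒≉0 = λ {f} → FracField.Pos⇒≉0 f
    ; nat-pos = λ k → FracField.Pos-const (ℕ→ℚ (suc k)) (ℕ→ℚ-pos k)
    }

  module Reciprocal (𝔽 : OrderedField) where
    open FieldLemmas 𝔽
    module N x = NewtonIdentity 𝔽 x

    -- g x m is xᵐ h_m[1/x], written without the inverse.
    g : Carrier → ℕ → Carrier
    g x zero    = 1#
    g x (suc m) = g x m * ((1# + nat m * x) * nat (suc m) ⁻¹)

    G : ∀ {N} → Carrier → Vec ℕ N → Carrier
    G x []      = 1#
    G x (m ∷ v) = g x m * G x v

    ^-+ : ∀ x m n → x ^ (m ℕ.+ n) ≈ x ^ m * x ^ n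
    ^-+ x zero    n = sym (*-identityˡ _)
    ^-+ x (suc m) n = ≈.trans (*-congˡ (^-+ x m n)) (sym (*-assoc x _ _))

    module _ {x y : Carrier} (xy≈1 : x * y ≈ 1#) where

      ^-inverse : ∀ n → x ^ n * y ^ n ≈ 1#
      ^-inverse zero    = *-identityˡ 1#
      ^-inverse (suc n) = begin
        x * x ^ n * (y * y ^ n)    ≈⟨ solve 4 (λ x X y Y → (x :* X) :* (y :* Y) := (x :* y) :* (X :* Y)) ≈.refl x (x ^ n) y (y ^ n) ⟩
        x * y * (x ^ n * y ^ n)    ≈⟨ *-cong xy≈1 (^-inverse n) ⟩
        1# * 1#                    ≈⟨ *-identityˡ 1# ⟩
        1#                         ∎

      -- Each of the m factors y + k absorbs one x and becomes 1 + k x.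
      h⇒g : ∀ m → x ^ m * N.h y m ≈ g x m
      h⇒g zero    = *-identityˡ 1#
      h⇒g (suc m) = begin
        x * x ^ m * (N.h y m * ((y + nat m) * i))
          ≈⟨ solve 6 (λ x X h y k i → (x :* X) :* (h :* ((y :+ k) :* i)) := (X :* h) :* ((x :* y :+ k :* x) :* i)) ≈.refl
               x (x ^ m) (N.h y m) y (nat m) i ⟩
        (x ^ m * N.h y m) * ((x * y + nat m * x) * i)
          ≈⟨ *-cong (h⇒g m) (*-congʳ (+-congʳ xy≈1)) ⟩
        g x (suc m) ∎
        where i = nat (suc m) ⁻¹

      g⇒h : ∀ m → x ^ m * g y m ≈ N.h x m
      g⇒h zero    = *-identityˡ 1#
      g⇒h (suc m) = begin
        x * x ^ m * (g y m * ((1# + nat m * y) * i))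
          ≈⟨ solve 6 (λ x X h y k i → (x :* X) :* (h :* ((con 1 :+ k :* y) :* i)) := (X :* h) :* ((x :+ k :* (x :* y)) :* i)) ≈.refl
               x (x ^ m) (g y m) y (nat m) i ⟩
        (x ^ m * g y m) * ((x + nat m * (x * y)) * i)
          ≈⟨ *-cong (g⇒h m) (*-congʳ (+-congˡ (≈.trans (*-congˡ xy≈1) (*-identityʳ _)))) ⟩
        N.h x (suc m) ∎
        where i = nat (suc m) ⁻¹

      private
        regroup : ∀ X Y h H → X * Y * (h * H) ≈ (X * h) * (Y * H)
        regroup = solve 4 (λ X Y h H → (X :* Y) :* (h :* H) := (X :* h) :* (Y :* H)) ≈.refl

      H⇒G : ∀ {N} (v : Vec ℕ N) → x ^ Vec.sum v * N.H y v ≈ G x v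
      H⇒G []      = *-identityˡ 1#
      H⇒G (m ∷ v) = ≈.trans (*-congʳ (^-+ x m (Vec.sum v))) (≈.trans (regroup (x ^ m) (x ^ Vec.sum v) (N.h y m) (N.H y v))
        (*-cong (h⇒g m) (H⇒G v)))

      G⇒H : ∀ {N} (v : Vec ℕ N) → x ^ Vec.sum v * G y v ≈ N.H x v
      G⇒H []      = *-identityˡ 1#
      G⇒H (m ∷ v) = ≈.trans (*-congʳ (^-+ x m (Vec.sum v))) (≈.trans (regroup (x ^ m) (x ^ Vec.sum v) (g y m) (G y v))
        (*-cong (g⇒h m) (G⇒H v)))

  -- The polynomial X^d p(1/X), where d is the length of the list. The constant term 0 arises
  -- because d exceeds the degree.
  reversed : Poly → Poly
  reversed []      = 0ℚ ∷ []
  reversed (a ∷ p) = reversed p ++ a ∷ []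

  length-reversed : ∀ p → length (reversed p) ≡ suc (length p)
  length-reversed []      = ≡.refl
  length-reversed (a ∷ p) = ≡.trans (List.length-++ (reversed p))
    (≡.trans (ℕ.+-comm (length (reversed p)) 1) (≡.cong suc (length-reversed p)))

  reversed-nonZero : ∀ {p} → NonZeroₚ p → NonZeroₚ (reversed p)
  reversed-nonZero {a ∷ p} (here a≢0) = Any.++⁺ʳ (reversed p) (here a≢0)
  reversed-nonZero {a ∷ p} (there nz) = Any.++⁺ˡ (reversed-nonZero nz)

  module Reversal (𝔽 : OrderedField) (c : ℚ → OrderedField.Carrier 𝔽) where
    open FieldLemmas 𝔽

    module _ (c-0 : c 0ℚ ≈ 0#) {x y : Carrier} (xy≈1 : x * y ≈ 1#) (at-x at-y : Poly → Carrier)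
      (x-[] : at-x [] ≈ 0#) (x-∷ : ∀ a q → at-x (a ∷ q) ≈ c a + x * at-x q)
      (y-[] : at-y [] ≈ 0#) (y-∷ : ∀ a q → at-y (a ∷ q) ≈ c a + y * at-y q) where

      at-x-∷ʳ : ∀ q a → at-x (q ++ a ∷ []) ≈ at-x q + c a * x ^ length q
      at-x-∷ʳ [] a = begin
        at-x (a ∷ [])            ≈⟨ x-∷ a [] ⟩
        c a + x * at-x []        ≈⟨ +-congˡ (*-congˡ x-[]) ⟩
        c a + x * 0#             ≈⟨ solve 2 (λ a x → a :+ x :* con 0 := con 0 :+ a :* con 1) ≈.refl (c a) x ⟩
        0# + c a * 1#            ≈⟨ +-congʳ x-[] ⟨
        at-x [] + c a * 1#       ∎
      at-x-∷ʳ (b ∷ q) a = begin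
        at-x (b ∷ q ++ a ∷ [])                        ≈⟨ x-∷ b (q ++ a ∷ []) ⟩
        c b + x * at-x (q ++ a ∷ [])                  ≈⟨ +-congˡ (*-congˡ (at-x-∷ʳ q a)) ⟩
        c b + x * (at-x q + c a * x ^ length q)       ≈⟨ solve 5 (λ b x q a X → b :+ x :* (q :+ a :* X) := (b :+ x :* q) :+ a :* (x :* X))
                                                           ≈.refl (c b) x (at-x q) (c a) (x ^ length q) ⟩
        c b + x * at-x q + c a * (x * x ^ length q)   ≈⟨ +-congʳ (x-∷ b q) ⟨
        at-x (b ∷ q) + c a * x ^ length (b ∷ q)       ∎

      -- Stated for two maps that obey Horner's rule at x and at y: at α this is the embedding of
      -- polynomials into fractions, at 1/α it is evaluation.
      at-reversed : ∀ p → at-x (reversed p) ≈ x ^ length p * at-y p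
      at-reversed [] = begin
        at-x (0ℚ ∷ [])           ≈⟨ x-∷ 0ℚ [] ⟩
        c 0ℚ + x * at-x []       ≈⟨ +-cong c-0 (*-congˡ x-[]) ⟩
        0# + x * 0#              ≈⟨ ≈.trans (+-identityˡ _) (zeroʳ x) ⟩
        0#                       ≈⟨ ≈.trans (*-congˡ y-[]) (zeroʳ 1#) ⟨
        1# * at-y []             ∎
      at-reversed (a ∷ p) = begin
        at-x (reversed p ++ a ∷ [])
          ≈⟨ at-x-∷ʳ (reversed p) a ⟩
        at-x (reversed p) + c a * x ^ length (reversed p)
          ≈⟨ +-cong (at-reversed p) (*-congˡ (reflexive (≡.cong (x ^_) (length-reversed p)))) ⟩
        X * at-y p + c a * (x * X)
          ≈⟨ +-congʳ (≈.trans (sym (*-identityˡ _)) (*-congʳ (sym xy≈1))) ⟩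
        x * y * (X * at-y p) + c a * (x * X)
          ≈⟨ solve 5 (λ x y X p a → x :* y :* (X :* p) :+ a :* (x :* X) := (x :* X) :* (a :+ y :* p)) ≈.refl x y X (at-y p) (c a) ⟩
        (x * X) * (c a + y * at-y p)
          ≈⟨ *-congˡ (y-∷ a p) ⟨
        x ^ length (a ∷ p) * at-y (a ∷ p) ∎
        where X = x ^ length p

  module Quotient (𝔽 : OrderedField) where
    open FieldLemmas 𝔽

    divided : ∀ n d P → ¬ (d ≈ 0#) → n ≈ P * d → n * d ⁻¹ ≈ P
    divided n d P d≉0 e = begin
      n * d ⁻¹          ≈⟨ *-congʳ e ⟩
      P * d * d ⁻¹      ≈⟨ *-assoc P d _ ⟩
      P * (d * d ⁻¹)    ≈⟨ *-congˡ (inverseʳ d d≉0) ⟩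
      P * 1#            ≈⟨ *-identityʳ P ⟩
      P                 ∎

    unit-inverse : ∀ {x y} → ¬ (x ≈ 0#) → x * y ≈ 1# → x ⁻¹ ≈ y
    unit-inverse x≉0 e = cancelˡ x≉0 (≈.trans (inverseʳ _ x≉0) (sym e))

  β : ℚ⟨α⟩
  β = α D.⁻¹

  abstract
    αβ≈1 : α D.* β D.≈ D.1#
    αβ≈1 = FracField.inverseʳ α (FracField.Pos⇒≉0 α FracField.Pos-α)

  module Inv = Specialisation K const (≈-refl {D.0#}) (≈-refl {D.1#}) const-+ const-* β

  ι-∷ : ∀ a q → ι (a ∷ q) D.≈ const a D.+ α D.* ι q
  ι-∷ a q = ≈-trans {ι (a ∷ q)} {ι ((a ∷ []) +ₚ X *ₚ q)} {const a D.+ α D.* ι q} (ι-cong (a ∷ q) ((a ∷ []) +ₚ X *ₚ q) coeffs)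
    (≈-trans {ι ((a ∷ []) +ₚ X *ₚ q)} {ι (a ∷ []) D.+ ι (X *ₚ q)} {const a D.+ α D.* ι q} (ι-+ (a ∷ []) (X *ₚ q))
      (FracField.+-cong {const a} {const a} {ι (X *ₚ q)} {α D.* ι q} (≈-refl {const a}) (ι-* X q)))
    where
    X : Poly
    X = 0ℚ ∷ 1ℚ ∷ []
    coeffs : a ∷ q ≈ₚ (a ∷ []) +ₚ X *ₚ q
    coeffs i = ≡.trans (split i) (≡.trans (≡.cong (coeffₚ (a ∷ []) i ℚ.+_) (≡.sym (≡.trans (0∷-*ₚ (1ℚ ∷ []) q i)
      (shift-cong {(1ℚ ∷ []) *ₚ q} {q} (*ₚ-identityˡ q) i)))) (≡.sym (D.coeff-+ (a ∷ []) (X *ₚ q) i)))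
      where
      split : ∀ i → coeffₚ (a ∷ q) i ≡ coeffₚ (a ∷ []) i ℚ.+ shift q i
      split zero    = ≡.sym (ℚ.+-identityʳ a)
      split (suc i) = ≡.sym (ℚ.+-identityˡ _)

  ι-[] : ι [] D.≈ D.0#
  ι-[] = ι-cong [] (0ℚ ∷ []) (≈ₚ-sym {0ℚ ∷ []} {[]} FracField.0∷≈[])

  ι-reversed : ∀ p → ι (reversed p) D.≈ α D.^ length p D.* Inv.ev p
  ι-reversed = Reversal.at-reversed 𝕂 const (≈-refl {D.0#}) {α} {β} αβ≈1 ι Inv.ev
    ι-[] ι-∷ (≈-refl {D.0#}) (λ a q → ≈-refl {Inv.ev (a ∷ q)})

  -- The reversed polynomial is p(1/α) times a power of α, so a value 0 at 1/α would force all
  -- coefficients to vanish.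
  ev-nonZero : ∀ {p} → NonZeroₚ p → ¬ (Inv.ev p D.≈ D.0#)
  ev-nonZero {p} nz e = nonZero⇒≉0 (reversed-nonZero nz) (ι-injective (reversed p) [] (≈-trans {ι (reversed p)} {α D.^ length p D.* Inv.ev p} {ι []}
    (ι-reversed p) (≈-trans {α D.^ length p D.* Inv.ev p} {α D.^ length p D.* D.0#} {ι []}
      (FracField.*-cong {α D.^ length p} {α D.^ length p} {Inv.ev p} {D.0#} (≈-refl {α D.^ length p}) e)
      (≈-trans {α D.^ length p D.* D.0#} {D.0#} {ι []} (CommutativeRing.zeroʳ K (α D.^ length p)) (≈-sym {ι []} {D.0#} ι-[])))))

  evalₚ≡ev : ∀ p → evalₚ p β ≡ Inv.ev p
  evalₚ≡ev []      = ≡.refl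
  evalₚ≡ev (a ∷ p) = ≡.cong (λ v → const a D.+ β D.* v) (evalₚ≡ev p)

  -- The substitution acts on numerator and denominator separately. For a fraction equal to a
  -- polynomial, the value of the denominator is a nonzero common factor and cancels.
  ⇝-[1/α] : ∀ {f g} → Inv._⇝_ f g → f [1/α] D.≈ g
  ⇝-[1/α] {f} {g} (Inv.via P e v) = ≡.subst₂ (λ n d → n D.* d D.⁻¹ D.≈ g) (≡.sym (evalₚ≡ev (num f))) (≡.sym (evalₚ≡ev (den f)))
    (≈-trans {Inv.ev (num f) D.* Inv.ev (den f) D.⁻¹} {Inv.ev P} {g}
      (Quotient.divided 𝕂 (Inv.ev (num f)) (Inv.ev (den f)) (Inv.ev P) (ev-nonZero (den≢0 f))
        (≈-trans {Inv.ev (num f)} {Inv.ev (P *ₚ den f)} {Inv.ev P D.* Inv.ev (den f)}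
          (Inv.ev-cong (num f) (P *ₚ den f) (≈ₚ-trans {num f} {num f *ₚ (1ℚ ∷ [])} {P *ₚ den f}
            (≈ₚ-sym {num f *ₚ (1ℚ ∷ [])} {num f} (CommutativeRing.*-identityʳ polyRing (num f))) e))
          (Inv.ev-* P (den f)))) v)

-- Values at negative integers and linear independence

module Values where

  open import Defs using (ℚ⟨α⟩; const; α; fromℕ; fromℤ; binomial; ℚ-noZeroDivisors)
  import Defs as D
  open import Algebra.Bundles using (CommutativeRing; CommutativeSemiring)
  import Algebra.Definitions.RawSemiring as RawSemiringDefinitions
  import Algebra.Properties.Ring as RingProperties
  import Algebra.Solver.Ring.NaturalCoefficients.Default as Solver
  open import Data.Fin.Base as Fin using (Fin; zero; suc; toℕ)
  import Data.Fin.Properties as Fin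
  open import Data.Integer.Base as ℤ using (_⊖_)
  open import Data.List.Base using ([]; _∷_; map)
  open import Data.Nat.Base as ℕ using (ℕ; zero; suc; z≤n; s≤s; _!; _∸_)
  open import Data.Nat.Combinatorics using (_C_)
  open import Data.Nat.Induction using (<-rec)
  open import Data.Nat.ListAction using (product)
  import Data.Nat.Properties as ℕ
  open import Data.Rational.Base as ℚ using (ℚ; 0ℚ; 1ℚ)
  import Data.Rational.Properties as ℚ
  open import Data.Vec.Base as Vec using (Vec; []; _∷_; fromList)
  open import Level using (0ℓ)
  open import Relation.Binary.Definitions using (tri<; tri≈; tri>)
  open import Relation.Binary.PropositionalEquality as ≡ using (_≡_; _≢_)
  open import Relation.Nullary using (¬_; contradiction)
  open FracField using (≈-trans; ≈-sym; const-*)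
  open Scalars
  open Specialise
  open Newton
  open Inversion
  open RawSemiringDefinitions (CommutativeSemiring.rawSemiring (CommutativeRing.commutativeSemiring ℚ.+-*-commutativeRing))
    using () renaming (sum to ∑; product to ∏)

  -- Made total by treating 0 like 1; it is applied to positive numbers only.
  recip : ℕ → ℚ
  recip k = ℚ.1/ ℕ→ℚ (suc (ℕ.pred k))
    where instance
      _ : ℚ.NonZero (ℕ→ℚ (suc (ℕ.pred k)))
      _ = ℚ.≢-nonZero (ℕ→ℚ-suc≢0 (ℕ.pred k))

  abstract
    recip-inverse : ∀ k → 0 ℕ.< k → ℕ→ℚ k ℚ.* recip k ≡ 1ℚ
    recip-inverse (suc k) _ = ℚ.*-inverseʳ (ℕ→ℚ (suc k))
      where instance
        _ : ℚ.NonZero (ℕ→ℚ (suc k))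
        _ = ℚ.≢-nonZero (ℕ→ℚ-suc≢0 k)

    fromℕ≉0 : ∀ k → 0 ℕ.< k → ¬ (fromℕ k D.≈ D.0#)
    fromℕ≉0 (suc k) _ = OrderedField.Pos⇒≉0 𝕂 {fromℕ (suc k)} (OrderedField.nat-pos 𝕂 k)

    fromℕ⁻¹ : ∀ k → 0 ℕ.< k → fromℕ k D.⁻¹ D.≈ const (recip k)
    fromℕ⁻¹ k 0<k = Quotient.unit-inverse 𝕂 {fromℕ k} {const (recip k)} (fromℕ≉0 k 0<k)
      (≈-trans {fromℕ k D.* const (recip k)} {const (ℕ→ℚ k ℚ.* recip k)} {D.1#}
        (≈-sym {const (ℕ→ℚ k ℚ.* recip k)} {fromℕ k D.* const (recip k)} (const-* (ℕ→ℚ k) (recip k)))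
        (≈-reflexive (≡.cong const (recip-inverse k 0<k))))

  module Signs (R : CommutativeRing 0ℓ 0ℓ) where
    open CommutativeRing R hiding (zero)
    open RingProperties ring using (-‿distribˡ-*; -‿+-comm; -1*x≈-x)
    open Solver commutativeSemiring
    open import Relation.Binary.Reasoning.Setoid setoid

    -- One factor (-n + m)/(m + 1) turns C(n, m) into -C(n, m + 1): `c` and `c′` stand for these
    -- coefficients, `s` for m + 1 and `r` for its inverse.
    sign-step : ∀ E c c′ s r n m → s * c′ + m * c ≈ n * c → s * r ≈ 1# →
                (E * c) * ((- n + m) * r) ≈ (- 1# * E) * c′
    sign-step E c c′ s r n m e e′ = begin
      (E * c) * ((- n + m) * r)
        ≈⟨ solve 5 (λ E c n m r → (E :* c) :* ((n :+ m) :* r) := (E :* r) :* (n :* c :+ m :* c)) refl E c (- n) m r ⟩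
      (E * r) * (- n * c + m * c)
        ≈⟨ *-congˡ (+-congʳ (trans (sym (-‿distribˡ-* n c)) (trans (-‿cong (sym e)) (sym (-‿+-comm (s * c′) (m * c)))))) ⟩
      (E * r) * (- (s * c′) + - (m * c) + m * c)
        ≈⟨ *-congˡ (trans (+-assoc _ _ _) (trans (+-congˡ (-‿inverseˡ (m * c))) (+-identityʳ _))) ⟩
      (E * r) * - (s * c′)
        ≈⟨ *-congˡ (-1*x≈-x (s * c′)) ⟨
      (E * r) * (- 1# * (s * c′))
        ≈⟨ solve 5 (λ E r o s c → (E :* r) :* (o :* (s :* c)) := (s :* r) :* ((o :* E) :* c)) refl E r (- 1#) s c′ ⟩
      (s * r) * ((- 1# * E) * c′)
        ≈⟨ trans (*-congʳ e′) (*-identityˡ _) ⟩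
      (- 1# * E) * c′ ∎

    difference : ∀ M k i → - (M + k) + (k + - i) ≈ - 1# * (M + i)
    difference M k i = begin
      - (M + k) + (k + - i)        ≈⟨ +-congʳ (-‿+-comm M k) ⟨
      - M + - k + (k + - i)        ≈⟨ trans (+-assoc _ _ _) (+-congˡ (trans (sym (+-assoc _ _ _)) (trans (+-congʳ (-‿inverseˡ k)) (+-identityˡ _)))) ⟩
      - M + - i                    ≈⟨ -‿+-comm M i ⟩
      - (M + i)                    ≈⟨ -1*x≈-x (M + i) ⟨
      - 1# * (M + i)               ∎

    interchange : ∀ a b c d → (a * b) * (c * d) ≈ (a * c) * (b * d)
    interchange = solve 4 (λ a b c d → (a :* b) :* (c :* d) := (a :* c) :* (b :* d)) refl

    unscale : ∀ E f c r → f * r ≈ 1# → (E * (f * c)) * r ≈ E * c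
    unscale E f c r e = trans (solve 4 (λ E f c r → (E :* (f :* c)) :* r := (f :* r) :* (E :* c)) refl E f c r)
      (trans (*-congʳ e) (*-identityˡ _))

  module ℚSigns = Signs ℚ.+-*-commutativeRing

  ε : ℕ → ℚ
  ε zero    = 1ℚ
  ε (suc n) = (ℚ.- 1ℚ) ℚ.* ε n

  ε-+ : ∀ m n → ε (m ℕ.+ n) ≡ ε m ℚ.* ε n
  ε-+ zero    n = ≡.sym (ℚ.*-identityˡ (ε n))
  ε-+ (suc m) n = ≡.trans (≡.cong ((ℚ.- 1ℚ) ℚ.*_) (ε-+ m n)) (≡.sym (ℚ.*-assoc (ℚ.- 1ℚ) (ε m) (ε n)))

  module AtPoint (x : ℚ) where
    open At x

    hq : ℕ → ℚ
    hq zero    = 1ℚ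
    hq (suc m) = hq m ℚ.* ((x ℚ.+ ℕ→ℚ m) ℚ.* recip (suc m))

    Hq : ∀ {N} → Vec ℕ N → ℚ
    Hq []      = 1ℚ
    Hq (m ∷ v) = hq m ℚ.* Hq v

    ⇝-fromℕ : ∀ k → fromℕ k ⇝ ℕ→ℚ k
    ⇝-fromℕ k = ⇝-const (ℕ→ℚ k)

    ⇝-fromℕ⁻¹ : ∀ k → 0 ℕ.< k → fromℕ k D.⁻¹ ⇝ recip k
    ⇝-fromℕ⁻¹ k 0<k = ⇝-respˡ {const (recip k)} {fromℕ k D.⁻¹} (fromℕ⁻¹ k 0<k) (⇝-const (recip k))

    ⇝-h : ∀ m → Reciprocal.N.h 𝕂 α m ⇝ hq m
    ⇝-h zero    = ⇝-1
    ⇝-h (suc m) = ⇝-* {Reciprocal.N.h 𝕂 α m} {hq m} {(α D.+ fromℕ m) D.* i} (⇝-h m)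
      (⇝-* {α D.+ fromℕ m} {x ℚ.+ ℕ→ℚ m} {i} (⇝-+ {α} {x} {fromℕ m} ⇝-α (⇝-fromℕ m)) (⇝-fromℕ⁻¹ (suc m) (s≤s z≤n)))
      where i = fromℕ (suc m) D.⁻¹

    ⇝-H : ∀ {N} (v : Vec ℕ N) → Reciprocal.N.H 𝕂 α v ⇝ Hq v
    ⇝-H []      = ⇝-1
    ⇝-H (m ∷ v) = ⇝-* {Reciprocal.N.h 𝕂 α m} {hq m} {Reciprocal.N.H 𝕂 α v} (⇝-h m) (⇝-H v)

    binomialValue : ℕ → ℕ → ℚ
    binomialValue k n = ∏ {n} (λ i → x ℚ.+ ℤ→ℚ (k ⊖ toℕ i)) ℚ.* recip (n !)

    ⇝-binomial : ∀ k n → binomial k n ⇝ binomialValue k n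
    ⇝-binomial k n = ⇝-* {D.∏ {n} factor} {∏ {n} value} {fromℕ (n !) D.⁻¹}
      (⇝-∏ {n} {factor} {value} λ i → ⇝-+ {α} {x} {fromℤ (k ⊖ toℕ i)} ⇝-α (⇝-const (ℤ→ℚ (k ⊖ toℕ i)))) (⇝-fromℕ⁻¹ (n !) (ℕ.1≤n! n))
      where
      factor : Fin n → ℚ⟨α⟩
      factor i = α D.+ fromℤ (k ⊖ toℕ i)
      value : Fin n → ℚ
      value i = x ℚ.+ ℤ→ℚ (k ⊖ toℕ i)

  ⇝-g : ∀ m → Inv._⇝_ (Reciprocal.g 𝕂 α m) (Reciprocal.g 𝕂 β m)
  ⇝-g zero    = Inv.⇝-1
  ⇝-g (suc m) = Inv.⇝-* {R.g α m} {R.g β m} {(D.1# D.+ fromℕ m D.* α) D.* i} {(D.1# D.+ fromℕ m D.* β) D.* i} (⇝-g m)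
    (Inv.⇝-* {D.1# D.+ fromℕ m D.* α} {D.1# D.+ fromℕ m D.* β} {i} {i}
      (Inv.⇝-+ {D.1#} {D.1#} {fromℕ m D.* α} {fromℕ m D.* β} Inv.⇝-1
        (Inv.⇝-* {fromℕ m} {fromℕ m} {α} {β} (Inv.⇝-const (ℕ→ℚ m)) Inv.⇝-α))
      (Inv.⇝-respˡ {const r} {i} {i} (fromℕ⁻¹ (suc m) (s≤s z≤n))
        (Inv.⇝-respʳ {const r} {const r} {i} (≈-sym {i} {const r} (fromℕ⁻¹ (suc m) (s≤s z≤n))) (Inv.⇝-const r))))
    where
    module R = Reciprocal 𝕂
    i = fromℕ (suc m) D.⁻¹
    r = recip (suc m)

  ⇝-G : ∀ {N} (v : Vec ℕ N) → Inv._⇝_ (Reciprocal.G 𝕂 α v) (Reciprocal.G 𝕂 β v)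
  ⇝-G []      = Inv.⇝-1
  ⇝-G (m ∷ v) = Inv.⇝-* {Reciprocal.g 𝕂 α m} {Reciprocal.g 𝕂 β m} {Reciprocal.G 𝕂 α v} {Reciprocal.G 𝕂 β v} (⇝-g m) (⇝-G v)

  module Negative (N : ℕ) where
    open AtPoint (ℚ.- ℕ→ℚ N)

    -- Upper negation, C(-N + m - 1, m) = (-1)ᵐ C(N, m), one factor at a time.
    hq-value : ∀ m → hq m ≡ ε m ℚ.* ℕ→ℚ (N C m)
    hq-value zero    = ≡.refl
    hq-value (suc m) = ≡.trans (≡.cong (ℚ._* (((ℚ.- ℕ→ℚ N) ℚ.+ ℕ→ℚ m) ℚ.* recip (suc m))) (hq-value m))
      (ℚSigns.sign-step (ε m) (ℕ→ℚ (N C m)) (ℕ→ℚ (N C suc m)) (ℕ→ℚ (suc m)) (recip (suc m)) (ℕ→ℚ N) (ℕ→ℚ m)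
        (≡.trans (≡.cong₂ ℚ._+_ (≡.sym (ℕ→ℚ-* (suc m) (N C suc m))) (≡.sym (ℕ→ℚ-* m (N C m))))
          (≡.trans (≡.sym (ℕ→ℚ-+ (suc m ℕ.* (N C suc m)) (m ℕ.* (N C m))))
            (≡.trans (≡.cong ℕ→ℚ (shift-binomial N m)) (ℕ→ℚ-* N (N C m)))))
        (recip-inverse (suc m) (s≤s z≤n)))

    Hq-value : ∀ ps → Hq (fromList ps) ≡ ε (Data.Nat.ListAction.sum ps) ℚ.* ℕ→ℚ (product (map (N C_) ps))
    Hq-value []       = ≡.refl
    Hq-value (p ∷ ps) = ≡.trans (≡.cong₂ ℚ._*_ (hq-value p) (Hq-value ps))
      (≡.trans (ℚSigns.interchange (ε p) (ℕ→ℚ (N C p)) _ _)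
        (≡.cong₂ ℚ._*_ (≡.sym (ε-+ p _)) (≡.sym (ℕ→ℚ-* (N C p) _))))

    ∏-rising : ∀ n M {f : Fin n → ℚ} → (∀ i → f i ≡ (ℚ.- 1ℚ) ℚ.* ℕ→ℚ (M ℕ.+ toℕ i)) → ∏ f ≡ ε n ℚ.* ℕ→ℚ (rising M n)
    ∏-rising zero    M e = ≡.refl
    ∏-rising (suc n) M {f} e = ≡.trans (≡.cong₂ ℚ._*_ (≡.trans (e zero) (≡.cong (λ t → (ℚ.- 1ℚ) ℚ.* ℕ→ℚ t) (ℕ.+-identityʳ M)))
        (∏-rising n (suc M) λ i → ≡.trans (e (suc i)) (≡.cong (λ t → (ℚ.- 1ℚ) ℚ.* ℕ→ℚ t) (ℕ.+-suc M (toℕ i)))))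
      (≡.trans (ℚSigns.interchange (ℚ.- 1ℚ) (ℕ→ℚ M) (ε n) (ℕ→ℚ (rising (suc M) n)))
        (≡.cong (ε (suc n) ℚ.*_) (≡.sym (ℕ→ℚ-* M (rising (suc M) n)))))

    -- With M = N - k - 1, the factor -N + k - i is -(M + 1 + i), so up to sign the product is a
    -- rising factorial. The bound `k < N` makes the truncated difference exact.
    binomial-value : ∀ k n → k ℕ.< N → binomialValue k n ≡ ε n ℚ.* ℕ→ℚ ((N ℕ.+ n ∸ suc k) C n)
    binomial-value k n k<N = begin
      ∏ {n} (λ i → (ℚ.- ℕ→ℚ N) ℚ.+ ℤ→ℚ (k ⊖ toℕ i)) ℚ.* recip (n !)
        ≡⟨ ≡.cong (ℚ._* recip (n !)) (∏-rising n (suc M) factor) ⟩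
      (ε n ℚ.* ℕ→ℚ (rising (suc M) n)) ℚ.* recip (n !)
        ≡⟨ ≡.cong (λ t → (ε n ℚ.* t) ℚ.* recip (n !)) (≡.trans (≡.cong ℕ→ℚ (rising-binomial M n)) (ℕ→ℚ-* (n !) ((M ℕ.+ n) C n))) ⟩
      (ε n ℚ.* (ℕ→ℚ (n !) ℚ.* ℕ→ℚ ((M ℕ.+ n) C n))) ℚ.* recip (n !)
        ≡⟨ ℚSigns.unscale (ε n) (ℕ→ℚ (n !)) (ℕ→ℚ ((M ℕ.+ n) C n)) (recip (n !)) (recip-inverse (n !) (ℕ.1≤n! n)) ⟩
      ε n ℚ.* ℕ→ℚ ((M ℕ.+ n) C n)
        ≡⟨ ≡.cong (λ t → ε n ℚ.* ℕ→ℚ (t C n)) (≡.sym (ℕ.+-∸-comm n k<N)) ⟩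
      ε n ℚ.* ℕ→ℚ ((N ℕ.+ n ∸ suc k) C n) ∎
      where
      open ≡.≡-Reasoning
      M = N ∸ suc k
      N≡ : N ≡ suc M ℕ.+ k
      N≡ = ≡.trans (≡.sym (ℕ.m∸n+n≡m k<N)) (ℕ.+-suc M k)
      factor : ∀ i → (ℚ.- ℕ→ℚ N) ℚ.+ ℤ→ℚ (k ⊖ toℕ i) ≡ (ℚ.- 1ℚ) ℚ.* ℕ→ℚ (suc M ℕ.+ toℕ {n} i)
      factor i = ≡.trans (≡.cong₂ (λ u v → (ℚ.- u) ℚ.+ v) (≡.trans (≡.cong ℕ→ℚ N≡) (ℕ→ℚ-+ (suc M) k)) (ℤ→ℚ-⊖ k (toℕ i)))
        (≡.trans (ℚSigns.difference (ℕ→ℚ (suc M)) (ℕ→ℚ k) (ℕ→ℚ (toℕ i)))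
          (≡.cong ((ℚ.- 1ℚ) ℚ.*_) (≡.sym (ℕ→ℚ-+ (suc M) (toℕ i)))))

  ∏-zero : ∀ {n} (f : Fin n → ℚ) i → f i ≡ 0ℚ → ∏ f ≡ 0ℚ
  ∏-zero f zero    e = ≡.trans (≡.cong (ℚ._* ∏ (λ i → f (suc i))) e) (ℚ.*-zeroˡ (∏ (λ i → f (suc i))))
  ∏-zero f (suc i) e = ≡.trans (≡.cong (f zero ℚ.*_) (∏-zero (λ i → f (suc i)) i e)) (ℚ.*-zeroʳ (f zero))

  ∏-nonzero : ∀ {n} (f : Fin n → ℚ) → (∀ i → f i ≢ 0ℚ) → ∏ f ≢ 0ℚ
  ∏-nonzero {zero}  f ne ()
  ∏-nonzero {suc n} f ne = ℚ-noZeroDivisors (f zero) (∏ (λ i → f (suc i))) (ne zero) (∏-nonzero (λ i → f (suc i)) (λ i → ne (suc i)))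

  ∑Fin-cong : ∀ {n} {f g : Fin n → ℚ} → (∀ i → f i ≡ g i) → ∑ f ≡ ∑ g
  ∑Fin-cong {zero}  e = ≡.refl
  ∑Fin-cong {suc n} e = ≡.cong₂ ℚ._+_ (e zero) (∑Fin-cong λ i → e (suc i))

  ∑-differ-at : ∀ {n} {f g : Fin n → ℚ} k → (∀ i → i ≢ k → f i ≡ g i) → ∑ f ≡ ∑ g → f k ≡ g k
  ∑-differ-at {f = f} {g} zero e eq = ℚ-+-cancelʳ (∑ (λ i → f (suc i))) (f zero) (g zero)
    (≡.trans eq (≡.cong (g zero ℚ.+_) (≡.sym (∑Fin-cong λ i → e (suc i) λ ()))))
    where
    ℚ-+-cancelʳ : ∀ c a b → a ℚ.+ c ≡ b ℚ.+ c → a ≡ b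
    ℚ-+-cancelʳ c a b e = RingProperties.+-cancelʳ (CommutativeRing.ring ℚ.+-*-commutativeRing) c a b e
  ∑-differ-at {f = f} {g} (suc k) e eq = ∑-differ-at k (λ i i≢k → e (suc i) (λ p → i≢k (Fin.suc-injective p)))
    (RingProperties.+-cancelˡ (CommutativeRing.ring ℚ.+-*-commutativeRing) (f zero) _ _
      (≡.trans eq (≡.cong (ℚ._+ ∑ (λ i → g (suc i))) (≡.sym (e zero λ ())))))

  sum-⊖ : ∀ m k i → ℕ→ℚ m ℚ.+ ℤ→ℚ (k ⊖ i) ≡ ℤ→ℚ ((m ℕ.+ k) ⊖ i)
  sum-⊖ m k i = ≡.trans (≡.cong (ℕ→ℚ m ℚ.+_) (ℤ→ℚ-⊖ k i)) (≡.trans (≡.sym (ℚ.+-assoc (ℕ→ℚ m) (ℕ→ℚ k) (ℚ.- ℕ→ℚ i)))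
    (≡.trans (≡.cong (ℚ._+ (ℚ.- ℕ→ℚ i)) (≡.sym (ℕ→ℚ-+ m k))) (≡.sym (ℤ→ℚ-⊖ (m ℕ.+ k) i))))

  ⊖-zero : ∀ m i → m ≡ i → ℤ→ℚ (m ⊖ i) ≡ 0ℚ
  ⊖-zero m .m ≡.refl = ≡.trans (ℤ→ℚ-⊖ m m) (ℚ.+-inverseʳ (ℕ→ℚ m))

  ⊖-nonzero : ∀ m i → i ℕ.< m → ℤ→ℚ (m ⊖ i) ≢ 0ℚ
  ⊖-nonzero m i i<m e = ℕ.<⇒≢ i<m (≡.sym (ℕ→ℚ-injective (≡.trans (≡.sym (ℚ.+-identityʳ (ℕ→ℚ m)))
    (≡.trans (≡.cong (ℕ→ℚ m ℚ.+_) (≡.sym (ℚ.+-inverseˡ (ℕ→ℚ i)))) (≡.trans (≡.sym (ℚ.+-assoc (ℕ→ℚ m) (ℚ.- ℕ→ℚ i) (ℕ→ℚ i)))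
    (≡.trans (≡.cong (ℚ._+ ℕ→ℚ i) (≡.trans (≡.sym (ℤ→ℚ-⊖ m i)) e)) (ℚ.+-identityˡ (ℕ→ℚ i))))))))

  -- At α = n − k the polynomials with index below k vanish and the one with index k does not.
  independent : ∀ {n} (a a′ : Fin n → ℚ) →
    (∀ x → ∑ (λ k → a k ℚ.* AtPoint.binomialValue x (toℕ k) n) ≡ ∑ (λ k → a′ k ℚ.* AtPoint.binomialValue x (toℕ k) n)) →
    ∀ k → a k ≡ a′ k
  independent {n} a a′ e k = <-rec (λ d → ∀ k → n ∸ toℕ k ≡ d → a k ≡ a′ k) step (n ∸ toℕ k) k ≡.refl
    where
    V : ℕ → Fin n → ℚ
    V m k = AtPoint.binomialValue (ℕ→ℚ m) (toℕ k) n
    -- The factor with index (n - k) + k′ is zero, and this index is below n because k′ < k.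
    vanishes : ∀ (k k′ : Fin n) → toℕ k′ ℕ.< toℕ k → V (n ∸ toℕ k) k′ ≡ 0ℚ
    vanishes k k′ k′<k = ≡.trans (≡.cong (ℚ._* recip (n !)) (∏-zero _ i
      (≡.trans (sum-⊖ m (toℕ k′) (toℕ i)) (⊖-zero (m ℕ.+ toℕ k′) (toℕ i) (≡.sym (Fin.toℕ-fromℕ< below)))))) (ℚ.*-zeroˡ (recip (n !)))
      where
      m = n ∸ toℕ k
      below : m ℕ.+ toℕ k′ ℕ.< n
      below = ≡.subst (m ℕ.+ toℕ k′ ℕ.<_) (ℕ.m∸n+n≡m (ℕ.<⇒≤ (Fin.toℕ<n k))) (ℕ.+-monoʳ-< m k′<k)
      i : Fin n
      i = Fin.fromℕ< below
    -- At α = n - k the factors are n - i with i < n.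
    survives : ∀ k → V (n ∸ toℕ k) k ≢ 0ℚ
    survives k = ℚ-noZeroDivisors _ (recip (n !)) (∏-nonzero _ λ i e → ⊖-nonzero n (toℕ i) (Fin.toℕ<n i)
        (≡.trans (≡.cong (λ t → ℤ→ℚ (t ⊖ toℕ i)) (≡.sym (ℕ.m∸n+n≡m (ℕ.<⇒≤ (Fin.toℕ<n k)))))
          (≡.trans (≡.sym (sum-⊖ (n ∸ toℕ k) (toℕ k) (toℕ i))) e)))
      λ r≡0 → contradiction (≡.trans (≡.sym (recip-inverse (n !) (ℕ.1≤n! n))) (≡.trans (≡.cong (ℕ→ℚ (n !) ℚ.*_) r≡0) (ℚ.*-zeroʳ (ℕ→ℚ (n !))))) λ ()
    step : ∀ d → (∀ {j} → j ℕ.< d → ∀ k → n ∸ toℕ k ≡ j → a k ≡ a′ k) → ∀ k → n ∸ toℕ k ≡ d → a k ≡ a′ k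
    step d rec k ≡.refl = cancel (∑-differ-at k others (e (ℕ→ℚ m)))
      where
      m = n ∸ toℕ k
      v = V m k
      -- Below k the polynomials vanish at this point; above k the coefficients already agree by the
      -- induction on n - k.
      others : ∀ i → i ≢ k → a i ℚ.* V m i ≡ a′ i ℚ.* V m i
      others i i≢k with ℕ.<-cmp (toℕ i) (toℕ k)
      ... | tri< i<k _ _ = ≡.trans (≡.trans (≡.cong (a i ℚ.*_) (vanishes k i i<k)) (ℚ.*-zeroʳ (a i)))
        (≡.sym (≡.trans (≡.cong (a′ i ℚ.*_) (vanishes k i i<k)) (ℚ.*-zeroʳ (a′ i))))
      ... | tri≈ _ i≡k _ = contradiction (Fin.toℕ-injective i≡k) i≢k
      ... | tri> _ _ k<i = ≡.cong (ℚ._* V m i) (rec (ℕ.∸-monoʳ-< k<i (ℕ.<⇒≤ (Fin.toℕ<n i))) i ≡.refl)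
      cancel : a k ℚ.* v ≡ a′ k ℚ.* v → a k ≡ a′ k
      cancel eq = begin
        a k                      ≡⟨ ℚ.*-identityʳ (a k) ⟨
        a k ℚ.* 1ℚ               ≡⟨ ≡.cong (a k ℚ.*_) (ℚ.*-inverseʳ v) ⟨
        a k ℚ.* (v ℚ.* ℚ.1/ v)   ≡⟨ ℚ.*-assoc (a k) v (ℚ.1/ v) ⟨
        a k ℚ.* v ℚ.* ℚ.1/ v     ≡⟨ ≡.cong (ℚ._* ℚ.1/ v) eq ⟩
        a′ k ℚ.* v ℚ.* ℚ.1/ v    ≡⟨ ℚ.*-assoc (a′ k) v (ℚ.1/ v) ⟩
        a′ k ℚ.* (v ℚ.* ℚ.1/ v)  ≡⟨ ≡.cong (a′ k ℚ.*_) (ℚ.*-inverseʳ v) ⟩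
        a′ k ℚ.* 1ℚ              ≡⟨ ℚ.*-identityʳ (a′ k) ⟩
        a′ k                     ∎
        where
        open ≡.≡-Reasoning
        instance
          _ : ℚ.NonZero v
          _ = ℚ.≢-nonZero (survives k)

-- Monomial coefficients of the one-row function

module JackRow where

  open import Defs using (ℚ⟨α⟩; α; fromℕ; Partition; parts; sum≡n; ℓ; z; row; ones; δ; sameParts?; Λ; BilinearForm; form; IsJackProduct; IsJackFamily; tilde; _[1/α])
  import Defs as D
  open import Algebra.Bundles using (CommutativeRing)
  open import Data.Fin.Base using (zero; suc)
  open import Data.List.Base using ([]; _∷_; applyUpTo)
  open import Data.Nat.Base as ℕ using (ℕ; zero; suc; z≤n; s≤s; _!; NonZero)
  open import Data.Nat.ListAction using (sum)
  import Data.Nat.Properties as ℕ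
  open import Data.Product.Base using (proj₁; proj₂; ∃)
  open import Data.Rational.Base as ℚ using (ℚ)
  open import Data.Vec.Base as Vec using (Vec; []; _∷_; fromList)
  open import Function.Base using (_∘_)
  open import Relation.Binary.PropositionalEquality as ≡ using (_≡_; _≢_)
  open import Relation.Nullary using (¬_; yes; no; contradiction)
  open Fillings using (Partition-≡)
  open Enumerate using (partitions; ∈-partitions; unique-partitions)
  open FracField using (≈-trans; ≈-refl; ≈-sym; K)
  open Insert using (zee-pos)
  open PowerSums using (partCoeff)
  open Scalars
  open Specialise
  open Sums
  open Newton
  open Jack
  open Inversion
  open Values

  sum-fromList : ∀ ps → Vec.sum (fromList ps) ≡ sum ps
  sum-fromList []       = ≡.refl
  sum-fromList (p ∷ ps) = ≡.cong (p ℕ.+_) (sum-fromList ps)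

  module RowCoefficients (𝔽 : OrderedField) {x y : OrderedField.Carrier 𝔽}
    (xy≈1 : OrderedField._≈_ 𝔽 (OrderedField._*_ 𝔽 x y) (OrderedField.1# 𝔽)) {n : ℕ} where
    open FieldLemmas 𝔽
    open Reciprocal 𝔽

    exponents : ∀ (μ : Partition n) → Vec ℕ (ℓ μ)
    exponents μ = fromList (parts μ)

    sum-exponents : ∀ μ → Vec.sum (exponents μ) ≡ n
    sum-exponents μ = ≡.trans (sum-fromList (parts μ)) (sum≡n μ)

    x^≉0 : ∀ k → ¬ (x ^ k ≈ 0#)
    x^≉0 k e = nat≉0 {1} (s≤s z≤n) (≈.trans nat-1 (≈.trans (sym (^-inverse xy≈1 k)) (≈.trans (*-congʳ e) (zeroˡ _))))

    -- The inverse norms are y to the power ℓ(ν) divided by z_ν, so the sum is the power-sum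
    -- expansion of h_n[yX].
    weights : ∀ μ → ∑ (λ ν → (nat (z ν) * x ^ ℓ ν) ⁻¹ * nat (partCoeff ν μ)) (partitions n) ≈ N.H y (exponents μ)
    weights μ = ≈.trans (∑-cong (partitions n) λ ν → *-congʳ (cancelˡ {nat (z ν) * x ^ ℓ ν} (w≉0 ν) (begin
        (nat (z ν) * x ^ ℓ ν) * (nat (z ν) * x ^ ℓ ν) ⁻¹
          ≈⟨ inverseʳ _ (w≉0 ν) ⟩
        1#
          ≈⟨ ≈.trans (*-cong (inverseʳ _ (z≉0 ν)) (^-inverse xy≈1 (ℓ ν))) (*-identityˡ 1#) ⟨
        (nat (z ν) * nat (z ν) ⁻¹) * (x ^ ℓ ν * y ^ ℓ ν)
          ≈⟨ solve 4 (λ z i X Y → (z :* i) :* (X :* Y) := (z :* X) :* (Y :* i)) ≈.refl (nat (z ν)) (nat (z ν) ⁻¹) (x ^ ℓ ν) (y ^ ℓ ν) ⟩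
        (nat (z ν) * x ^ ℓ ν) * (y ^ ℓ ν * nat (z ν) ⁻¹) ∎)))
      (N.Q≈H y n (exponents μ) (sum-exponents μ))
      where
      z≉0 : ∀ (ν : Partition n) → ¬ (nat (z ν) ≈ 0#)
      z≉0 ν = nat≉0 (zee-pos n (parts ν))
      w≉0 : ∀ ν → ¬ (nat (z ν) * x ^ ℓ ν ≈ 0#)
      w≉0 ν e = x^≉0 (ℓ ν) (noZeroDivisors (z≉0 ν) e)

    H-ones : N.H y (exponents (ones n)) ≈ y ^ n
    H-ones = go n
      where
      h-1 : N.h y 1 ≈ y
      h-1 = begin
        1# * ((y + nat 0) * nat 1 ⁻¹)  ≈⟨ ≈.trans (*-identityˡ _) (*-cong (≈.trans (+-congˡ nat-0) (+-identityʳ y)) (⁻¹-cong (nat≉0 {1} (s≤s z≤n)) nat-1)) ⟩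
        y * 1# ⁻¹                      ≈⟨ *-congˡ (≈.trans (sym (*-identityˡ _)) (inverseʳ 1# λ e → nat≉0 {1} (s≤s z≤n) (≈.trans nat-1 e))) ⟩
        y * 1#                         ≈⟨ *-identityʳ y ⟩
        y                              ∎
      go : ∀ n → N.H y (fromList (applyUpTo (λ _ → 1) n)) ≈ y ^ n
      go zero    = ≈.refl
      go (suc n) = *-cong h-1 (go n)

    -- The coefficient of m_{1ⁿ} in h_n[yX] is yⁿ, so the normalisation forces κ = n! xⁿ. This power
    -- of x then clears all inverses.
    normalised : ∀ (f : Partition n → Carrier) κ →
      (∀ μ → f μ ≈ κ * ∑ (λ ν → (nat (z ν) * x ^ ℓ ν) ⁻¹ * nat (partCoeff ν μ)) (partitions n)) →
      f (ones n) ≈ nat (n !) → ∀ μ → f μ ≈ nat (n !) * G x (exponents μ)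
    normalised f κ e norm μ = begin
      f μ                                             ≈⟨ ≈.trans (e μ) (*-congˡ (weights μ)) ⟩
      κ * N.H y (exponents μ)                         ≈⟨ *-congʳ κ≈ ⟩
      (nat (n !) * x ^ n) * N.H y (exponents μ)       ≈⟨ *-assoc _ _ _ ⟩
      nat (n !) * (x ^ n * N.H y (exponents μ))       ≈⟨ *-congˡ (*-congʳ (reflexive (≡.cong (x ^_) (≡.sym (sum-exponents μ))))) ⟩
      nat (n !) * (x ^ Vec.sum (exponents μ) * N.H y (exponents μ)) ≈⟨ *-congˡ (H⇒G xy≈1 (exponents μ)) ⟩
      nat (n !) * G x (exponents μ)                   ∎
      where
      κ≈ : κ ≈ nat (n !) * x ^ n
      κ≈ = begin
        κ                     ≈⟨ ≈.trans (*-congˡ (^-inverse xy≈1 n)) (*-identityʳ κ) ⟨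
        κ * (x ^ n * y ^ n)   ≈⟨ solve 3 (λ k X Y → k :* (X :* Y) := (k :* Y) :* X) ≈.refl κ (x ^ n) (y ^ n) ⟩
        (κ * y ^ n) * x ^ n   ≈⟨ *-congʳ (≈.trans (*-congˡ (sym (≈.trans (weights (ones n)) H-ones))) (≈.trans (sym (e (ones n))) norm)) ⟩
        nat (n !) * x ^ n     ∎

    -- Distributing the powers of x over the factors of `G y` turns each 1 + k y into x + k.
    inverted : ∀ μ c → x ^ n * (c * G y (exponents μ)) ≈ c * N.H x (exponents μ)
    inverted μ c = begin
      x ^ n * (c * G y (exponents μ))     ≈⟨ solve 3 (λ X c g → X :* (c :* g) := c :* (X :* g)) ≈.refl (x ^ n) c (G y (exponents μ)) ⟩
      c * (x ^ n * G y (exponents μ))     ≈⟨ *-congˡ (*-congʳ (reflexive (≡.cong (x ^_) (≡.sym (sum-exponents μ))))) ⟩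
      c * (x ^ Vec.sum (exponents μ) * G y (exponents μ)) ≈⟨ *-congˡ (G⇒H xy≈1 (exponents μ)) ⟩
      c * N.H x (exponents μ)             ∎

    Pos-weight : Pos x → ∀ (ν : Partition n) → Pos (nat (z ν) * x ^ ℓ ν)
    Pos-weight px ν = Pos-* (Pos-nat (zee-pos n (parts ν))) (Pos-^ (ℓ ν))
      where
      Pos-nat : ∀ {k} → 0 ℕ.< k → Pos (nat k)
      Pos-nat {suc k} _ = nat-pos k
      Pos-^ : ∀ k → Pos (x ^ k)
      Pos-^ zero    = Pos-resp nat-1 (nat-pos 0)
      Pos-^ (suc k) = Pos-* px (Pos-^ k)

    pick-out : ∀ (c d : Partition n → Carrier) lam → d lam ≈ 1# → (∀ ν → lam ≢ ν → d ν ≈ 0#) →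
               ∑ (λ ν → c ν * d ν) (partitions n) ≈ c lam
    pick-out c d lam e e′ = ≈.trans (∑-single (λ ν → c ν * d ν) (unique-partitions n) (∈-partitions lam)
        (λ {ν} _ p → ≈.trans (*-congˡ (e′ ν p)) (zeroʳ _)))
      (≈.trans (*-congˡ e) (*-identityʳ _))

  δ-same : ∀ {n} (μ : Partition n) → δ μ μ ≡ D.1#
  δ-same μ with sameParts? μ μ
  ... | yes _ = ≡.refl
  ... | no  p = contradiction ≡.refl p

  δ-other : ∀ {n} {μ ν : Partition n} → μ ≢ ν → δ μ ν ≡ D.0#
  δ-other {μ = μ} {ν} p with sameParts? μ ν
  ... | yes e = contradiction (Partition-≡ e) p
  ... | no  _ = ≡.refl

  module KR {n : ℕ} = RowCoefficients 𝕂 {α} {β} αβ≈1 {n}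

  formOf : BilinearForm → ∀ n → Form 𝕂 n
  formOf B n = record
    { form = form B {n} {n}
    ; form-cong = λ {f} {f′} {g} {g′} → BilinearForm.congr B {n} {n} {f} {f′} {g} {g′}
    ; form-+ˡ = BilinearForm.⊕-left B
    ; form-+ʳ = BilinearForm.⊕-right B
    ; form-*ˡ = BilinearForm.•-left B
    ; form-*ʳ = BilinearForm.•-right B
    }

  module 𝕂L = FieldLemmas 𝕂

  H : ∀ {n} → Partition n → ℚ⟨α⟩
  H μ = Reciprocal.N.H 𝕂 α (fromList (parts μ))

  module _ (n : ℕ) .{{_ : NonZero n}} (B : BilinearForm) (jack : IsJackProduct B)
           (J : ∀ {m} → Partition m → Λ m) (family : IsJackFamily B J) where

    private
      w : Partition n → ℚ⟨α⟩
      w ν = fromℕ (z ν) D.* α D.^ ℓ ν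

      pp : ∀ ν → form B {n} {n} (D.p ν) (D.p ν) D.≈ w ν
      pp ν = ≈-trans {form B (D.p ν) (D.p ν)} {δ ν ν D.* w ν} {w ν} (jack ν ν)
        (≡.subst (λ d → d D.* w ν D.≈ w ν) (≡.sym (δ-same ν)) (FracField.*-identityˡ (w ν)))

      pq : ∀ {μ ν} → μ ≢ ν → form B {n} {n} (D.p μ) (D.p ν) D.≈ D.0#
      pq {μ} {ν} p = ≈-trans {form B (D.p μ) (D.p ν)} {δ μ ν D.* w μ} {D.0#} (jack μ ν)
        (≡.subst (λ d → d D.* w μ D.≈ D.0#) (≡.sym (δ-other p)) (CommutativeRing.zeroˡ K (w μ)))

      expansion : ∃ λ κ → ∀ μ → J (row n) μ D.≈ κ D.* 𝕂L.∑ (λ ν → w ν D.⁻¹ D.* fromℕ (partCoeff ν μ)) (partitions n)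
      expansion = Orthogonal.row-expansion 𝕂 (formOf B n) w (KR.Pos-weight {n} FracField.Pos-α) pp (λ {μ} {ν} → pq {μ} {ν}) J
        (λ {μ} {ν} p → IsJackFamily.orthogonal family μ ν (p ∘ Partition-≡))
        (IsJackFamily.triangular family)
        (λ μ e → fromℕ≉0 (n !) (ℕ.1≤n! n) (≈-trans {fromℕ (n !)} {J μ (ones n)} {D.0#}
          (≈-sym {J μ (ones n)} {fromℕ (n !)} (IsJackFamily.normalized family μ)) e))

    -- The coefficients of J_(n) are n! `Gα`, polynomials in α, so the substitution of 1/α can be
    -- carried out factor by factor.
    tilde-row : ∀ μ → tilde J (row n) μ D.≈ fromℕ (n !) D.* H μ
    tilde-row μ = ≈-trans {α D.^ n D.* J (row n) μ [1/α]} {α D.^ n D.* (fromℕ (n !) D.* Gβ)} {fromℕ (n !) D.* H μ}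
      (FracField.*-cong {α D.^ n} {α D.^ n} {J (row n) μ [1/α]} {fromℕ (n !) D.* Gβ} (≈-refl {α D.^ n})
        (⇝-[1/α] {J (row n) μ} {fromℕ (n !) D.* Gβ} (Inv.⇝-respˡ {fromℕ (n !) D.* Gα} {J (row n) μ} {fromℕ (n !) D.* Gβ}
          (KR.normalised {n} (J (row n)) (proj₁ expansion) (proj₂ expansion) (IsJackFamily.normalized family (row n)) μ)
          (Inv.⇝-* {fromℕ (n !)} {fromℕ (n !)} {Gα} {Gβ} (Inv.⇝-const (ℕ→ℚ (n !))) (⇝-G (fromList (parts μ)))))))
      (KR.inverted {n} μ (fromℕ (n !)))
      where
      Gα = Reciprocal.G 𝕂 α (fromList (parts μ))
      Gβ = Reciprocal.G 𝕂 β (fromList (parts μ))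

-- Comparison with the Schur expansion

module Coefficients where

  open import Defs using (ℚ⟨α⟩; const; fromℕ; binomial; Partition; parts; sum≡n; row; Λ; s; BilinearForm; form; IsJackProduct; IsHallProduct; IsJackFamily; tilde; QYT₌; conjugate)
  import Defs as D
  open import Algebra.Bundles using (CommutativeRing; CommutativeSemiring)
  import Algebra.Definitions.RawSemiring as RawSemiringDefinitions
  import Algebra.Properties.Ring as RingProperties
  import Algebra.Solver.Ring.NaturalCoefficients.Default as Solver
  open import Data.Fin.Base using (Fin; zero; suc; toℕ)
  import Data.Fin.Properties as Fin
  import Data.Integer.Base as ℤ
  open import Data.List.Base using ([]; _∷_; map)
  open import Data.Nat.Base as ℕ using (ℕ; zero; suc; _!; _∸_; NonZero)
  open import Data.Nat.Combinatorics using (_C_)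
  open import Data.Nat.ListAction using (sum; product)
  import Data.Nat.Properties as ℕ
  open import Data.Rational.Base as ℚ using (ℚ)
  import Data.Rational.Properties as ℚ
  open import Data.Vec.Base using (fromList)
  open import Function.Base using (_∘_)
  open import Level using (0ℓ)
  open import Relation.Binary.PropositionalEquality as ≡ using (_≡_)
  open Fillings using (kostka)
  open Descents using (Σ<; Σ<-head)
  open Enumerate using (partitions; specialised; kostka-specialised; ∑P)
  open FracField using (≈-trans; ≈-refl)
  open Scalars
  open Specialise
  open Sums
  open Newton
  open Inversion
  open Values
  open Jack using (module Orthogonal)
  open JackRow
  open RawSemiringDefinitions (CommutativeSemiring.rawSemiring (CommutativeRing.commutativeSemiring ℚ.+-*-commutativeRing))
    using () renaming (sum to ∑)

  module ℚL = ListSum ℚ.+-*-commutativeRing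

  module Rearrange (R : CommutativeRing 0ℓ 0ℓ) where
    open CommutativeRing R
    open Solver commutativeSemiring

    collect : ∀ f y E c → (f * y) * (E * c) ≈ (E * f) * (y * c)
    collect = solve 4 (λ f y E c → (f :* y) :* (E :* c) := (E :* f) :* (y :* c)) refl

    collect′ : ∀ f E c → f * (E * c) ≈ (E * f) * c
    collect′ = solve 3 (λ f E c → f :* (E :* c) := (E :* f) :* c) refl

    swap-last : ∀ c S k → (c * S) * k ≈ c * (k * S)
    swap-last = solve 3 (λ c S k → (c :* S) :* k := c :* (k :* S)) refl

  module ℚR = Rearrange ℚ.+-*-commutativeRing

  ∑-Σ< : ∀ n c (f : ℕ → ℕ) → ∑ {n} (λ k → c ℚ.* ℕ→ℚ (f (toℕ k))) ≡ c ℚ.* ℕ→ℚ (Σ< n f)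
  ∑-Σ< zero    c f = ≡.sym (ℚ.*-zeroʳ c)
  ∑-Σ< (suc n) c f = ≡.trans (≡.cong (c ℚ.* ℕ→ℚ (f 0) ℚ.+_) (∑-Σ< n c (f ∘ suc)))
    (≡.trans (≡.sym (ℚ.*-distribˡ-+ c (ℕ→ℚ (f 0)) (ℕ→ℚ (Σ< n (f ∘ suc)))))
      (≡.cong (c ℚ.*_) (≡.trans (≡.sym (ℕ→ℚ-+ (f 0) (Σ< n (f ∘ suc)))) (≡.cong ℕ→ℚ (≡.sym (Σ<-head n f))))))

  ∑-sum : ∀ {A : Set} c (f : A → ℕ) xs → ℚL.∑ (λ a → c ℚ.* ℕ→ℚ (f a)) xs ≡ c ℚ.* ℕ→ℚ (sum (map f xs))
  ∑-sum c f []       = ≡.sym (ℚ.*-zeroʳ c)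
  ∑-sum c f (x ∷ xs) = ≡.trans (≡.cong (c ℚ.* ℕ→ℚ (f x) ℚ.+_) (∑-sum c f xs))
    (≡.trans (≡.sym (ℚ.*-distribˡ-+ c (ℕ→ℚ (f x)) (ℕ→ℚ (sum (map f xs)))))
      (≡.cong (c ℚ.*_) (≡.sym (ℕ→ℚ-+ (f x) (sum (map f xs))))))

  ⇝-list : ∀ x {A : Set} (f : A → ℚ⟨α⟩) (g : A → ℚ) xs → (∀ a → At._⇝_ x (f a) (g a)) → At._⇝_ x (𝕂L.∑ f xs) (ℚL.∑ g xs)
  ⇝-list x f g []       e = At.⇝-0 x
  ⇝-list x f g (a ∷ as) e = At.⇝-+ x {f a} {g a} {𝕂L.∑ f as} {ℚL.∑ g as} (e a) (⇝-list x f g as e)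

  module _ (n : ℕ) .{{_ : NonZero n}} where

    multiplicityOf : Partition n → ℕ → ℕ
    multiplicityOf lam k = QYT₌ (suc k) (conjugate lam)

    combination : (Fin n → ℚ) → ℚ⟨α⟩
    combination a = D.∑ {n} (λ k → const (a k) D.* binomial (toℕ k) n)

    combinationValue : ℚ → (Fin n → ℚ) → ℚ
    combinationValue x a = ∑ {n} (λ k → a k ℚ.* AtPoint.binomialValue x (toℕ k) n)

    ⇝-combination : ∀ x a → At._⇝_ x (combination a) (combinationValue x a)
    ⇝-combination x a = At.⇝-∑ x {n} {λ k → const (a k) D.* binomial (toℕ k) n} {λ k → a k ℚ.* AtPoint.binomialValue x (toℕ k) n}
      λ k → At.⇝-* x {const (a k)} {a k} {binomial (toℕ k) n} {AtPoint.binomialValue x (toℕ k) n}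
        (At.⇝-const x (a k)) (AtPoint.⇝-binomial x (toℕ k) n)

    schurCoefficients : Partition n → Fin n → ℚ
    schurCoefficients lam k = ℕ→ℚ (n ! ℕ.* multiplicityOf lam (toℕ k))

    c : Partition n → ℚ⟨α⟩
    c lam = combination (schurCoefficients lam)

    schurExpansion : Λ n
    schurExpansion μ = 𝕂L.∑ (λ lam → c lam D.* s lam μ) (partitions n)

    -- Each C(α + k, n) becomes (-1)ⁿ C(N + n - k - 1, n), so the sum over k is the descent formula
    -- for s_{λ′}(1^N). The bound on N covers every k < n.
    combinationValue-negative : ∀ N lam → n ℕ.≤ N → combinationValue (ℚ.- ℕ→ℚ N) (schurCoefficients lam) ≡
                                (ε n ℚ.* ℕ→ℚ (n !)) ℚ.* ℕ→ℚ (specialised lam N)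
    combinationValue-negative N lam n≤N = ≡.trans
      (∑Fin-cong λ k → ≡.trans
        (≡.cong₂ ℚ._*_ (ℕ→ℚ-* (n !) (multiplicityOf lam (toℕ k))) (Negative.binomial-value N (toℕ k) n (ℕ.<-≤-trans (Fin.toℕ<n k) n≤N)))
        (≡.trans (ℚR.collect (ℕ→ℚ (n !)) (ℕ→ℚ (multiplicityOf lam (toℕ k))) (ε n) (ℕ→ℚ ((N ℕ.+ n ∸ suc (toℕ k)) C n)))
          (≡.cong ((ε n ℚ.* ℕ→ℚ (n !)) ℚ.*_) (≡.sym (ℕ→ℚ-* (multiplicityOf lam (toℕ k)) ((N ℕ.+ n ∸ suc (toℕ k)) C n))))))
      (∑-Σ< n (ε n ℚ.* ℕ→ℚ (n !)) (λ k → multiplicityOf lam k ℕ.* ((N ℕ.+ n ∸ suc k) C n)))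

    -- The dual Cauchy identity; the sign is (-1)ⁿ on both sides because the parts of μ add up to n.
    expansionValue : ∀ N μ → n ℕ.≤ N →
      ℚL.∑ (λ lam → combinationValue (ℚ.- ℕ→ℚ N) (schurCoefficients lam) ℚ.* ℕ→ℚ (kostka lam μ)) (partitions n) ≡
      ℕ→ℚ (n !) ℚ.* AtPoint.Hq (ℚ.- ℕ→ℚ N) (fromList (parts μ))
    expansionValue N μ n≤N = begin
      ℚL.∑ (λ lam → combinationValue (ℚ.- ℕ→ℚ N) (schurCoefficients lam) ℚ.* ℕ→ℚ (kostka lam μ)) (partitions n)
        ≡⟨ ℚL.∑-cong (partitions n) (λ lam → ≡.trans (≡.cong (ℚ._* ℕ→ℚ (kostka lam μ)) (combinationValue-negative N lam n≤N))
             (≡.trans (ℚR.swap-last (ε n ℚ.* ℕ→ℚ (n !)) (ℕ→ℚ (specialised lam N)) (ℕ→ℚ (kostka lam μ)))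
               (≡.cong ((ε n ℚ.* ℕ→ℚ (n !)) ℚ.*_) (≡.sym (ℕ→ℚ-* (kostka lam μ) (specialised lam N)))))) ⟩
      ℚL.∑ (λ lam → (ε n ℚ.* ℕ→ℚ (n !)) ℚ.* ℕ→ℚ (kostka lam μ ℕ.* specialised lam N)) (partitions n)
        ≡⟨ ∑-sum (ε n ℚ.* ℕ→ℚ (n !)) (λ lam → kostka lam μ ℕ.* specialised lam N) (partitions n) ⟩
      (ε n ℚ.* ℕ→ℚ (n !)) ℚ.* ℕ→ℚ (∑P n (λ lam → kostka lam μ ℕ.* specialised lam N))
        ≡⟨ ≡.cong (λ t → (ε n ℚ.* ℕ→ℚ (n !)) ℚ.* ℕ→ℚ t) (kostka-specialised μ N) ⟩
      (ε n ℚ.* ℕ→ℚ (n !)) ℚ.* ℕ→ℚ (product (map (N C_) (parts μ)))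
        ≡⟨ ℚR.collect′ (ℕ→ℚ (n !)) (ε n) (ℕ→ℚ (product (map (N C_) (parts μ)))) ⟨
      ℕ→ℚ (n !) ℚ.* (ε n ℚ.* ℕ→ℚ (product (map (N C_) (parts μ))))
        ≡⟨ ≡.cong (ℕ→ℚ (n !) ℚ.*_) (≡.trans (Negative.Hq-value N (parts μ)) (≡.cong (λ t → ε t ℚ.* ℕ→ℚ (product (map (N C_) (parts μ)))) (sum≡n μ))) ⟨
      ℕ→ℚ (n !) ℚ.* AtPoint.Hq (ℚ.- ℕ→ℚ N) (fromList (parts μ)) ∎
      where open ≡.≡-Reasoning

    H-expansion : ∀ μ → fromℕ (n !) D.* H μ D.≈ schurExpansion μ
    H-expansion μ = agree {fromℕ (n !) D.* H μ} {schurExpansion μ} point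
      (λ j → ℕ→ℚ (n !) ℚ.* AtPoint.Hq (point j) (fromList (parts μ)))
      (λ e → ℕ.+-cancelˡ-≡ n _ _ (ℕ→ℚ-injective (≡.trans (≡.sym (RingProperties.-‿involutive ℚring _))
        (≡.trans (≡.cong ℚ.-_ e) (RingProperties.-‿involutive ℚring _)))))
      (λ j → At.⇝-* (point j) {fromℕ (n !)} {ℕ→ℚ (n !)} {H μ} {AtPoint.Hq (point j) (fromList (parts μ))}
        (At.⇝-const (point j) (ℕ→ℚ (n !))) (AtPoint.⇝-H (point j) (fromList (parts μ))))
      (λ j → At.⇝-respʳ (point j) {schurExpansion μ} (expansionValue (n ℕ.+ j) μ (ℕ.m≤m+n n j))
        (⇝-list (point j) (λ lam → c lam D.* s lam μ)
          (λ lam → combinationValue (point j) (schurCoefficients lam) ℚ.* ℕ→ℚ (kostka lam μ)) (partitions n)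
          λ lam → At.⇝-* (point j) {c lam} {combinationValue (point j) (schurCoefficients lam)} {s lam μ} {ℕ→ℚ (kostka lam μ)}
            (⇝-combination (point j) (schurCoefficients lam)) (At.⇝-const (point j) (ℕ→ℚ (kostka lam μ)))))
      where
      ℚring = CommutativeRing.ring ℚ.+-*-commutativeRing
      -- Starting from -n keeps N ≥ n at every point, as the evaluation of the binomials demands.
      point : ℕ → ℚ
      point j = ℚ.- ℕ→ℚ (n ℕ.+ j)

    -- The function agrees with its Schur expansion in every monomial coefficient, and
    -- orthonormality of the Schur functions picks out the coefficient at λ.
    schur-coefficient : (B : BilinearForm) → IsJackProduct B → (J : ∀ {m} → Partition m → Λ m) → IsJackFamily B J →
      (B′ : BilinearForm) → IsHallProduct B′ → ∀ lam → form B′ (tilde J (row n)) (s lam) D.≈ c lam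
    schur-coefficient B jack J family B′ hall lam =
      ≈-trans {form B′ (tilde J (row n)) (s lam)} {form B′ schurExpansion (s lam)} {c lam}
        (BilinearForm.congr B′ {n} {n} {tilde J (row n)} {schurExpansion} {s lam} {s lam}
          (λ μ → ≈-trans {tilde J (row n) μ} {fromℕ (n !) D.* H μ} {schurExpansion μ} (tilde-row n B jack J family μ) (H-expansion μ))
          (λ μ → ≈-refl {s lam μ}))
        (≈-trans {form B′ schurExpansion (s lam)} {𝕂L.∑ (λ ν → c ν D.* form B′ (s ν) (s lam)) (partitions n)} {c lam}
          (Orthogonal.form-∑ˡ 𝕂 (formOf B′ n) c s (s lam) (partitions n))
          (KR.pick-out {n} c (λ ν → form B′ (s ν) (s lam)) lam
            (≡.subst (form B′ (s lam) (s lam) D.≈_) (δ-same lam) (hall lam lam))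
            (λ ν p → ≡.subst (form B′ (s ν) (s lam) D.≈_) (δ-other (p ∘ ≡.sym)) (hall ν lam))))

    -- Both combinations are polynomials in α, so an equality in ℚ(α) may be evaluated at every
    -- rational number.
    coefficients-unique : ∀ (a a′ : Fin n → ℚ) → combination a D.≈ combination a′ → ∀ k → a k ≡ a′ k
    coefficients-unique a a′ e = independent a a′ λ x → At.⇝-unique x {combination a}
      (⇝-combination x a) (At.⇝-respˡ x {combination a′} {combination a} e (⇝-combination x a′))

    combination-cong : ∀ m (a a′ : Fin m → ℚ) (v : Fin m → ℚ⟨α⟩) → (∀ k → a k ≡ a′ k) →
                       D.∑ (λ k → const (a k) D.* v k) ≡ D.∑ (λ k → const (a′ k) D.* v k)
    combination-cong zero    a a′ v e = ≡.refl
    combination-cong (suc m) a a′ v e = ≡.cong₂ (λ x y → const x D.* v zero D.+ y) (e zero)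
      (combination-cong m (a ∘ suc) (a′ ∘ suc) (v ∘ suc) (e ∘ suc))

-- The coefficients in the binomial basis

open import Defs
open import Data.Fin.Base using (Fin; toℕ)
open import Data.Nat.Base as ℕ using (ℕ; suc; NonZero; _!)
open import Data.Rational.Base using (ℚ)
import Data.Integer.Base as ℤ
import Data.Rational.Base as ℚ
open import Function.Bundles using (_⇔_; mk⇔)
open import Relation.Binary.PropositionalEquality using (_≡_; sym; subst)
open FracField using (≈-trans; ≈-sym)
open Coefficients

theorem3p4 : (n : ℕ) .{{_ : NonZero n}} (lam : Partition n)
    (⟨,⟩α : BilinearForm) → IsJackProduct ⟨,⟩α →
    (⟨,⟩ : BilinearForm) → IsHallProduct ⟨,⟩ →
    (J : ∀ {m} → Partition m → Λ m) → IsJackFamily ⟨,⟩α J →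
    (a : Fin n → ℚ) →
    (form ⟨,⟩ (tilde J (row n)) (s lam) ≈ ∑ (λ k → const (a k) * binomial (toℕ k) n))
    ⇔ (∀ k → a k ≡ (ℤ.+ (n ! ℕ.* QYT₌ (suc (toℕ k)) (conjugate lam))) ℚ./ 1)
theorem3p4 n lam ⟨,⟩α jack ⟨,⟩ hall J family a = mk⇔
  -- Linear independence of the binomials makes any expansion coincide with the one already found.
  (λ e → coefficients-unique n a (schurCoefficients n lam)
    (≈-trans {combination n a} {form ⟨,⟩ (tilde J (row n)) (s lam)} {c n lam}
      (≈-sym {form ⟨,⟩ (tilde J (row n)) (s lam)} {combination n a} e) value))
  (λ e → subst (form ⟨,⟩ (tilde J (row n)) (s lam) ≈_)
    (sym (combination-cong n n a (schurCoefficients n lam) (λ k → binomial (toℕ k) n) e)) value)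
  where
  value = schur-coefficient n ⟨,⟩α jack J family ⟨,⟩ hall lam
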